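{- Let $\mathcal{P}$ be a finite classical polar space of rank $d$ over $\mathbb{F}_q$ with parameter $e$, and let $\mathcal{L}$ be a degree one Cameron-Liebler set of generators of $\mathcal{P}$ with parameter $x$. If $x\le q^{e-1}+1$, then either $\mathcal{L}$ is the union of $x$ point-pencils whose vertices are pairwise non-collinear, or $x=q^{e-1}+1$ and $\mathcal{L}$ is the set of generators of an embedded polar space of rank $d$ with parameter $e-1$.
   Context: The finite classical polar spaces of rank $d$ are $Q^+(2d-1,q)$, $H(2d-1,q)$ ($q$ a square), $W(2d-1,q)$, $Q(2d,q)$, $H(2d,q)$ ($q$ a square), $Q^-(2d+1,q)$; generators are totally isotropic subspaces of maximal projective dimension $d-1$. The parameter $e$ (every $(d-2)$-space lies in exactly $q^e+1$ generators) is $0,\tfrac12,1,1,\tfrac32,2$ respectively. With $A$ the real point-generator incidence matrix, a set $\mathcal{L}$ of generators with characteristic vector $\chi$ is a degree one Cameron-Liebler set if $\chi\in\mathrm{im}(A^T)$; its parameter is $x=|\mathcal{L}|/\prod_{k=0}^{d-2}(q^{e+k}+1)$. A point-pencil with vertex $P$ is the set of all generators through the point $P$. An embedded polar space of rank $d$ is a polar space contained in $\mathcal{P}$ (on a subspace/subform) whose generators are also generators of $\mathcal{P}$. -}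

module Defs where

open import Level using (0ℓ)
open import Data.Bool using (Bool; true; false; _∧_; if_then_else_)
open import Data.Nat as ℕ using (ℕ; zero; suc; _^_; NonZero)
open import Data.Nat.Properties using (m*n≢0; m^n≢0)
open import Data.Integer using (+_)
open import Data.Rational as ℚ using (ℚ; 0ℚ; 1ℚ)
open import Data.Fin using (Fin; zero; suc)
open import Data.Fin.Properties using (all?)
open import Data.Vec.Functional as VF using ()
open import Data.List using (List; []; _∷_; length; map; concatMap; foldr)
open import Data.Bool.ListAction using (any)
open import Data.List.Membership.Propositional using (_∈_)
open import Data.List.Relation.Unary.Any using (Any; here; there)
open import Data.List.Relation.Unary.AllPairs using (AllPairs)
open import Data.List.Relation.Unary.Unique.Propositional using (Unique)
open import Data.Product using (Σ; ∃; _×_; _,_; proj₁; proj₂)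
open import Relation.Binary.PropositionalEquality using (_≡_; _≢_; refl)
open import Relation.Binary.Definitions using (DecidableEquality)
open import Relation.Nullary using (¬_; Dec; yes; no)
open import Relation.Nullary.Decidable using (⌊_⌋)
open import Algebra.Core using (Op₁; Op₂)
open import Algebra.Structures using (IsCommutativeRing)
open import Function.Bundles using (_⇔_)

record FiniteField : Set₁ where
  infixl 6 _+_
  infixl 7 _*_
  field
    Carrier           : Set
    _+_ _*_           : Op₂ Carrier
    -_                : Op₁ Carrier
    0# 1#             : Carrier
    isCommutativeRing : IsCommutativeRing _≡_ _+_ _*_ -_ 0# 1#
    0≢1               : 0# ≢ 1#
    inverse           : ∀ x → x ≢ 0# → ∃ λ y → x * y ≡ 1#
    _≟_               : DecidableEquality Carrier
    elems             : List Carrier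
    complete          : ∀ x → x ∈ elems
    unique            : Unique elems

  q : ℕ
  q = length elems

private
  ∈⇒nonZero : ∀ {A : Set} {x : A} {xs : List A} → x ∈ xs → NonZero (length xs)
  ∈⇒nonZero (here _)  = _
  ∈⇒nonZero (there _) = _

q-nonZero : (F : FiniteField) → NonZero (FiniteField.q F)
q-nonZero F = ∈⇒nonZero (FiniteField.complete F (FiniteField.0# F))

data Kind : Set where
  Q⁺ Q₀ Q⁻ W H-even H-odd : Kind
  -- Q⁺(2d-1,q), Q(2d,q), Q⁻(2d+1,q), W(2d-1,q), H(2d-1,q), H(2d,q)

-- vector space dimension of the ambient space F_q^n
dim : Kind → ℕ → ℕ
dim Q⁺     d = 2 ℕ.* d
dim Q₀     d = suc (2 ℕ.* d)
dim Q⁻     d = suc (suc (2 ℕ.* d))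
dim W      d = 2 ℕ.* d
dim H-even d = 2 ℕ.* d
dim H-odd  d = suc (2 ℕ.* d)

twoE : Kind → ℕ
twoE Q⁺     = 0
twoE Q₀     = 2
twoE Q⁻     = 4
twoE W      = 2
twoE H-even = 1
twoE H-odd  = 3

data FormKind : Set where
  quadratic alternating hermitian : FormKind

formKind : Kind → FormKind
formKind Q⁺     = quadratic
formKind Q₀     = quadratic
formKind Q⁻     = quadratic
formKind W      = alternating
formKind H-even = hermitian
formKind H-odd  = hermitian

module _ (F : FiniteField) where
  open FiniteField F

  Vec : ℕ → Set
  Vec n = Fin n → Carrier

  _≈ᵥ_ : ∀ {n} → Vec n → Vec n → Set
  u ≈ᵥ v = ∀ j → u j ≡ v j

  zeroV : ∀ {n} → Vec n
  zeroV _ = 0#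

  ΣF : ∀ {n} → (Fin n → Carrier) → Carrier
  ΣF {zero}  f = 0#
  ΣF {suc n} f = f zero + ΣF (λ i → f (suc i))

  comb : ∀ {k n} → (Fin k → Vec n) → Vec k → Vec n
  comb M c j = ΣF (λ i → c i * M i j)

  Independent : ∀ {k n} → (Fin k → Vec n) → Set
  Independent M = ∀ c → comb M c ≈ᵥ zeroV → ∀ i → c i ≡ 0#

  _∈span_ : ∀ {k n} → Vec n → (Fin k → Vec n) → Set
  v ∈span M = ∃ λ c → v ≈ᵥ comb M c

  SameSpan : ∀ {k l n} → (Fin k → Vec n) → (Fin l → Vec n) → Set
  SameSpan M N = ∀ v → (v ∈span M) ⇔ (v ∈span N)

  record Involution : Set where
    field
      σ        : Carrier → Carrier
      σ-+      : ∀ a b → σ (a + b) ≡ σ a + σ b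
      σ-*      : ∀ a b → σ (a * b) ≡ σ a * σ b
      σ-σ      : ∀ a → σ (σ a) ≡ a
      σ-nontriv : ∃ λ a → σ a ≢ a

  record Hermitian (n : ℕ) : Set where
    field
      inv  : Involution
      h    : Fin n → Fin n → Carrier
      herm : ∀ i j → h j i ≡ Involution.σ inv (h i j)
      -- r = q^(1/2), the order of the fixed field; recorded for convenience
      r    : ℕ
      r²≡q : r ℕ.* r ≡ q

  Form : FormKind → ℕ → Set
  -- quadratic form Q(v) = Σ_{i,j} c_ij v_i v_j
  Form quadratic   n = Fin n → Fin n → Carrier
  Form alternating n = Σ (Fin n → Fin n → Carrier)
                         λ a → (∀ i → a i i ≡ 0#) × (∀ i j → a j i ≡ - a i j)
  Form hermitian   n = Hermitian n

  quadVal : ∀ {n} → (Fin n → Fin n → Carrier) → Vec n → Carrier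
  quadVal c v = ΣF (λ i → ΣF (λ j → c i j * (v i * v j)))

  bil : ∀ fk {n} → Form fk n → Vec n → Vec n → Carrier
  bil quadratic   c u v = quadVal c (λ j → u j + v j) + (- quadVal c u + - quadVal c v)
  bil alternating (a , _) u v = ΣF (λ i → ΣF (λ j → u i * (a i j * v j)))
  bil hermitian   H u v =
    ΣF (λ i → ΣF (λ j → u i * (Hermitian.h H i j * Involution.σ (Hermitian.inv H) (v j))))

  Singular : ∀ fk {n} → Form fk n → Vec n → Set
  Singular quadratic   c v = quadVal c v ≡ 0#
  Singular alternating f v = bil alternating f v v ≡ 0#
  Singular hermitian   f v = bil hermitian f v v ≡ 0#

  NonDegenerate : ∀ fk {n} → Form fk n → Set
  NonDegenerate fk f = ∀ u → Singular fk f u → (∀ v → bil fk f u v ≡ 0#) → u ≈ᵥ zeroV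

  TotallySingular : ∀ fk {k n} → Form fk n → (Fin k → Vec n) → Set
  TotallySingular quadratic   c M = ∀ x → quadVal c (comb M x) ≡ 0#
  TotallySingular alternating f M = ∀ x y → bil alternating f (comb M x) (comb M y) ≡ 0#
  TotallySingular hermitian   f M = ∀ x y → bil hermitian f (comb M x) (comb M y) ≡ 0#

  record ClassicalPolarSpace (d : ℕ) : Set where
    field
      kind    : Kind
      form    : Form (formKind kind) (dim kind d)
      nondeg  : NonDegenerate (formKind kind) form
      witt₁   : ∃ λ (M : Fin d → Vec (dim kind d)) →
                  Independent M × TotallySingular (formKind kind) form M
      witt₂   : ∀ (M : Fin (suc d) → Vec (dim kind d)) →
                  Independent M → ¬ TotallySingular (formKind kind) form M

  module _ {d : ℕ} (P : ClassicalPolarSpace d) where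
    open ClassicalPolarSpace P

    N : ℕ
    N = dim kind d

    -- points: nonzero singular vectors (representing projective points)
    IsPoint : Vec N → Set
    IsPoint v = (¬ v ≈ᵥ zeroV) × Singular (formKind kind) form v

    -- generators: totally singular subspaces of vector dimension d,
    -- given by a basis (the rows of M)
    IsGenerator : (Fin d → Vec N) → Set
    IsGenerator M = Independent M × TotallySingular (formKind kind) form M

    Collinear : Vec N → Vec N → Set
    Collinear u v = TotallySingular (formKind kind) form (VF._∷_ u (VF._∷_ v VF.[]))

    -- base b and unit u with  q = b ^ u  and  q ^ e = b ^ eB
    base : ℕ
    base with formKind kind | form
    ... | hermitian | H = Hermitian.r H
    ... | quadratic | _ = q
    ... | alternating | _ = q

    unit : ℕ
    unit with formKind kind
    ... | hermitian = 2
    ... | quadratic = 1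
    ... | alternating = 1

    eB : ℕ
    eB with formKind kind
    ... | hermitian = twoE kind
    ... | quadratic = ℕ._/_ (twoE kind) 2
    ... | alternating = ℕ._/_ (twoE kind) 2

    private
      r-nonZero : ∀ r → r ℕ.* r ≡ q → NonZero r
      r-nonZero zero    eq with q-nonZero F
      ... | nz rewrite Relation.Binary.PropositionalEquality.sym eq = nz
      r-nonZero (suc r) eq = _

    base-nonZero : NonZero base
    base-nonZero with formKind kind | form
    ... | hermitian | H = r-nonZero (Hermitian.r H) (Hermitian.r²≡q H)
    ... | quadratic | _ = q-nonZero F
    ... | alternating | _ = q-nonZero F

    qPowE+ : ℕ → ℕ
    qPowE+ k = base ^ (eB ℕ.+ unit ℕ.* k)

    prodFactors : ℕ → ℕ
    prodFactors zero    = 1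
    prodFactors (suc m) = prodFactors m ℕ.* suc (qPowE+ m)

    prodFactors-nonZero : ∀ m → NonZero (prodFactors m)
    prodFactors-nonZero zero    = _
    prodFactors-nonZero (suc m) =
      m*n≢0 (prodFactors m) (suc (qPowE+ m)) {{prodFactors-nonZero m}}

    genDenominator : ℕ
    genDenominator = prodFactors (d ℕ.∸ 1)

    qPowE-1 : ℚ
    qPowE-1 = ℚ._/_ (+ (base ^ eB)) (base ^ unit)
                {{m^n≢0 base unit {{base-nonZero}}}}

    IsGeneratorSet : List (Fin d → Vec N) → Set
    IsGeneratorSet L = (∀ M → M ∈ L → IsGenerator M)
                       × AllPairs (λ M M′ → ¬ SameSpan M M′) L

    _∈ₗ_ : (Fin d → Vec N) → List (Fin d → Vec N) → Set
    π ∈ₗ L = Any (SameSpan π) L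

    parameter : List (Fin d → Vec N) → ℚ
    parameter L = ℚ._/_ (+ length L) genDenominator
                    {{prodFactors-nonZero (d ℕ.∸ 1)}}

    -- Sums over the points of a subspace.  A projective point is
    -- represented canonically by its normalised vector (first nonzero
    -- coordinate equal to 1).

    allVecs : (k : ℕ) → List (Vec k)
    allVecs zero    = (λ ()) ∷ []
    allVecs (suc k) = concatMap (λ a → map (λ v → VF._∷_ a v) (allVecs k)) elems

    normalised : ∀ {n} → Vec n → Bool
    normalised {zero}  v = false
    normalised {suc n} v with v zero ≟ 0#
    ... | yes _ = normalised (λ i → v (suc i))
    ... | no  _ = ⌊ v zero ≟ 1# ⌋

    eqV? : ∀ {n} → Vec n → Vec n → Bool
    eqV? u v = ⌊ all? (λ j → u j ≟ v j) ⌋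

    inSpan? : ∀ {k} → Vec N → (Fin k → Vec N) → Bool
    inSpan? {k} v M = any (λ c → eqV? v (comb M c)) (allVecs k)

    sumℚ : List ℚ → ℚ
    sumℚ = foldr ℚ._+_ 0ℚ

    pointSum : (Vec N → ℚ) → (Fin d → Vec N) → ℚ
    pointSum w M =
      sumℚ (map (λ v → if normalised v ∧ inSpan? v M then w v else 0ℚ) (allVecs N))

    -- degree one Cameron-Liebler set: χ_L ∈ im(Aᵀ), i.e. there is a weight
    -- function w on points with Σ_{P ∈ π} w(P) = χ_L(π) for every generator π
    DegreeOneCL : List (Fin d → Vec N) → Set
    DegreeOneCL L = ∃ λ (w : Vec N → ℚ) → ∀ π → IsGenerator π →
                      (π ∈ₗ L → pointSum w π ≡ 1ℚ) × (¬ π ∈ₗ L → pointSum w π ≡ 0ℚ)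

  module _ {d : ℕ} (P : ClassicalPolarSpace d) where

    UnionOfPencils : List (Fin d → Vec (N P)) → ℕ → Set
    UnionOfPencils L k =
      ∃ λ (V : Fin k → Vec (N P)) →
        (∀ i → IsPoint P (V i)) ×
        (∀ i j → i ≢ j → ¬ Collinear P (V i) (V j)) ×
        (∀ π → IsGenerator P π → (_∈ₗ_ P π L) ⇔ (∃ λ i → V i ∈span π))

    record EmbeddedPolarSpace : Set where
      field
        E        : ClassicalPolarSpace d
        ι        : Fin (N E) → Vec (N P)
        ι-inj    : Independent ι
        points   : ∀ v → IsPoint E v → IsPoint P (comb ι v)
        gens     : ∀ G → IsGenerator E G → IsGenerator P (λ i → comb ι (G i))

    GeneratorsOf : EmbeddedPolarSpace → List (Fin d → Vec (N P)) → Set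
    GeneratorsOf Em L = ∀ π → IsGenerator P π →
      (_∈ₗ_ P π L) ⇔ (∃ λ G → IsGenerator E G × SameSpan (λ i → comb ι (G i)) π)
      where open EmbeddedPolarSpace Em

{-# OPTIONS --safe #-}
-- Let W be a rational weight on the points whose sum over every generator π is χ_L(π). Its total is the parameter x, and
-- x_P = q^(d-2) q^e W(P) + W(P^⊥) is the normalised number of members of L through the point P. For a generator π ∋ P outside
-- L, the members of L that meet π in a hyperplane not through P are counted by a positive multiple of x - x_P. Hence every
-- generator through a point with x_P > x belongs to L, and splitting off this point-pencil lowers x by one. Summing x_P over
-- the points of a member of L gives q x ≥ q^e + q as soon as none of them satisfies x_P > x. So pencils exhaust L unless
-- x = q^(e-1) + 1 and x_P = x on the set T of all points of members. In that case T contains the line joining any two of its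
-- collinear points, L consists of the generators inside T, and every hyperplane of a member lies in exactly x members. Two
-- opposite members span a subspace U; comparing these x members with the generators of a polar space of parameter e - 1 that
-- lives on U (for e = 2, on the span of U and one more point of T) shows that T is this polar space.

module Submission where

-- Counting is done with vectors, not projective points: a subspace is a Boolean predicate of size a
-- power of q, and identities are multiplied by powers of q instead of divided. Generators are never
-- enumerated. A sum over the generators that meet π in a hyperplane becomes a sum over the vectors
-- v outside π, each standing for the generator through v and K ∩ v⊥ with K = π. One maximal
-- subspace and the number of singular vectors on a line replace Witt's theorem.
--
-- The obstacle is the extremal case, where a form for T has to be built. It depends on e. For e < 1
-- two members through a hyperplane already give 2 ≤ x, which is too many. For e = 1 the form on U =
-- K + K′ is a + b ↦ B(a,b). In W(2d-1,q) its polar form is B only in characteristic 2, and closure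
-- of T under orthogonal sums forces that characteristic. For e = 3/2 the Hermitian form is
-- restricted to U. For e = 2 the space U is one dimension too small: the count on U falls short,
-- which yields the extra point of T; the quadratic form is then restricted to the larger span.

module RingSolver where

  open import Algebra.Bundles using (CommutativeRing; RawRing)
  open import Data.Product using (_×_; _,_)
  open import Data.Nat as ℕ using (ℕ; zero; suc)
  open import Data.Maybe using (Maybe; just; nothing)
  open import Relation.Nullary using (yes; no)
  open import Relation.Binary.PropositionalEquality
  open import Algebra.Structures using (IsCommutativeRing)
  open import Algebra.Solver.Ring.AlmostCommutativeRing using (fromCommutativeRing; _-Raw-AlmostCommutative⟶_)
  import Algebra.Solver.Ring as RS
  import Algebra.Properties.Ring as RP
  import Algebra.Properties.AbelianGroup as AG
  import Algebra.Properties.Semiring.Mult as SM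
  import Algebra.Properties.Semiring.Mult.TCOptimised as SMT

  -- Formal differences of natural numbers serve as coefficients, so that the solver can cancel.
  module ZSolver {A : Set} {_+_ _*_ : A → A → A} { -_ : A → A} {0# 1# : A}
                 (isCR : IsCommutativeRing _≡_ _+_ _*_ -_ 0# 1#) where

    R : CommutativeRing _ _
    R = record { isCommutativeRing = isCR }

    open CommutativeRing R using (ring; semiring; +-abelianGroup; +-identityʳ; +-identityˡ; +-assoc; +-comm; distribˡ; distribʳ; -‿inverseʳ)
    open RP ring using (-‿distribˡ-*; -‿distribʳ-*; -0#≈0#)
    open AG +-abelianGroup using (⁻¹-∙-comm; ⁻¹-involutive)
    open SM semiring using (×-homo-+; ×1-homo-*) renaming (_×_ to _×ᵘ_)
    open SMT semiring using (×ᵤ≈×) renaming (_×_ to _×ᵗ_)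
    open ≡-Reasoning

    -- Keeps one component zero, so that every integer has a single representative and normal forms
    -- can be compared by `refl`.
    reduce : ℕ → ℕ → ℕ × ℕ
    reduce (suc a) (suc b) = reduce a b
    reduce a       b       = a , b

    coeffs : RawRing _ _
    coeffs = record
      { Carrier = ℕ × ℕ ; _≈_ = _≡_
      ; _+_ = λ (a , b) (c , d) → reduce (a ℕ.+ c) (b ℕ.+ d)
      ; _*_ = λ (a , b) (c , d) → reduce (a ℕ.* c ℕ.+ b ℕ.* d) (a ℕ.* d ℕ.+ b ℕ.* c)
      ; -_ = λ (a , b) → b , a
      ; 0# = 0 , 0 ; 1# = 1 , 0 }

    -- The separate clause for `zero` and the optimised multiple make `(0 , 0)` and `(1 , 0)`
    -- evaluate to `0#` and `1#` definitionally, so `:0` and `:1` can stand for these constants in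
    -- goals.
    embed : ℕ × ℕ → A
    embed (a , zero)  = a ×ᵗ 1#
    embed (a , suc b) = (a ×ᵗ 1#) + (- (suc b ×ᵗ 1#))

    private
      u : ℕ → A
      u n = n ×ᵘ 1#

      embed-≡ : ∀ a b → embed (a , b) ≡ u a + (- u b)
      embed-≡ a zero = trans (sym (×ᵤ≈× a 1#)) (sym (trans (cong (u a +_) -0#≈0#) (+-identityʳ _)))
      embed-≡ a (suc b) = cong₂ (λ x y → x + (- y)) (sym (×ᵤ≈× a 1#)) (sym (×ᵤ≈× (suc b) 1#))

      swap-mid : ∀ a b c d → (a + b) + (c + d) ≡ (a + c) + (b + d)
      swap-mid a b c d = begin
        (a + b) + (c + d) ≡⟨ +-assoc a b _ ⟩
        a + (b + (c + d)) ≡⟨ cong (a +_) (sym (+-assoc b c d)) ⟩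
        a + ((b + c) + d) ≡⟨ cong (λ z → a + (z + d)) (+-comm b c) ⟩
        a + ((c + b) + d) ≡⟨ cong (a +_) (+-assoc c b d) ⟩
        a + (c + (b + d)) ≡⟨ sym (+-assoc a c _) ⟩
        (a + c) + (b + d) ∎

      cancel : ∀ p q r s → p + s ≡ r + q → p + (- q) ≡ r + (- s)
      cancel p q r s e = begin
        p + (- q)                        ≡⟨ sym (+-identityʳ _) ⟩
        (p + (- q)) + 0#                 ≡⟨ cong₂ _+_ refl (sym (-‿inverseʳ s)) ⟩
        (p + (- q)) + (s + (- s))        ≡⟨ swap-mid _ _ _ _ ⟩
        (p + s) + ((- q) + (- s))        ≡⟨ cong₂ _+_ e refl ⟩
        (r + q) + ((- q) + (- s))        ≡⟨ cong₂ _+_ refl (+-comm _ _) ⟩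
        (r + q) + ((- s) + (- q))        ≡⟨ swap-mid _ _ _ _ ⟩
        (r + (- s)) + (q + (- q))        ≡⟨ cong₂ _+_ refl (-‿inverseʳ q) ⟩
        (r + (- s)) + 0#                 ≡⟨ +-identityʳ _ ⟩
        r + (- s)                        ∎

      embed-reduce : ∀ a b → embed (reduce a b) ≡ u a + (- u b)
      embed-reduce (suc a) (suc b) = trans (embed-reduce a b) (cancel _ _ _ _
        (trans (cong₂ _+_ refl (+-comm 1# (u b))) (trans (sym (+-assoc (u a) (u b) 1#)) (trans (+-comm _ 1#) (sym (+-assoc 1# (u a) (u b)))))))
      embed-reduce zero    b       = embed-≡ zero b
      embed-reduce (suc a) zero    = embed-≡ (suc a) zero

      +-homo : ∀ x y → embed (RawRing._+_ coeffs x y) ≡ embed x + embed y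
      +-homo (a , b) (c , d) = begin
        embed (reduce (a ℕ.+ c) (b ℕ.+ d))     ≡⟨ embed-reduce (a ℕ.+ c) (b ℕ.+ d) ⟩
        u (a ℕ.+ c) + (- u (b ℕ.+ d))          ≡⟨ cong₂ (λ x y → x + (- y)) (×-homo-+ 1# a c) (×-homo-+ 1# b d) ⟩
        (u a + u c) + (- (u b + u d))          ≡⟨ cong ((u a + u c) +_) (sym (⁻¹-∙-comm (u b) (u d))) ⟩
        (u a + u c) + ((- u b) + (- u d))      ≡⟨ swap-mid _ _ _ _ ⟩
        (u a + (- u b)) + (u c + (- u d))      ≡⟨ sym (cong₂ _+_ (embed-≡ a b) (embed-≡ c d)) ⟩
        embed (a , b) + embed (c , d)          ∎

      expand : ∀ p q r s → (p + (- q)) * (r + (- s)) ≡ ((p * r) + (q * s)) + (- ((p * s) + (q * r)))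
      expand p q r s = begin
        (p + (- q)) * (r + (- s))                                    ≡⟨ distribʳ _ p (- q) ⟩
        (p * (r + (- s))) + ((- q) * (r + (- s)))                    ≡⟨ cong₂ _+_ (distribˡ p r (- s)) (distribˡ (- q) r (- s)) ⟩
        ((p * r) + (p * (- s))) + (((- q) * r) + ((- q) * (- s)))
          ≡⟨ cong₂ _+_ (cong ((p * r) +_) (sym (-‿distribʳ-* p s))) (cong₂ _+_ (sym (-‿distribˡ-* q r)) neg-neg) ⟩
        ((p * r) + (- (p * s))) + ((- (q * r)) + (q * s))            ≡⟨ cong₂ _+_ refl (+-comm _ _) ⟩
        ((p * r) + (- (p * s))) + ((q * s) + (- (q * r)))            ≡⟨ swap-mid _ _ _ _ ⟩
        ((p * r) + (q * s)) + ((- (p * s)) + (- (q * r)))            ≡⟨ cong₂ _+_ refl (⁻¹-∙-comm _ _) ⟩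
        ((p * r) + (q * s)) + (- ((p * s) + (q * r)))                ∎
        where
        neg-neg : (- q) * (- s) ≡ q * s
        neg-neg = trans (sym (-‿distribˡ-* q (- s))) (trans (cong -_ (sym (-‿distribʳ-* q s))) (⁻¹-involutive _))

      u-+* : ∀ a b c d → u (a ℕ.* b ℕ.+ c ℕ.* d) ≡ (u a * u b) + (u c * u d)
      u-+* a b c d = trans (×-homo-+ 1# (a ℕ.* b) (c ℕ.* d)) (cong₂ _+_ (×1-homo-* a b) (×1-homo-* c d))

      *-homo : ∀ x y → embed (RawRing._*_ coeffs x y) ≡ embed x * embed y
      *-homo (a , b) (c , d) = begin
        embed (reduce (a ℕ.* c ℕ.+ b ℕ.* d) (a ℕ.* d ℕ.+ b ℕ.* c))        ≡⟨ embed-reduce (a ℕ.* c ℕ.+ b ℕ.* d) (a ℕ.* d ℕ.+ b ℕ.* c) ⟩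
        u (a ℕ.* c ℕ.+ b ℕ.* d) + (- u (a ℕ.* d ℕ.+ b ℕ.* c))             ≡⟨ cong₂ (λ x y → x + (- y)) (u-+* a c b d) (u-+* a d b c) ⟩
        ((u a * u c) + (u b * u d)) + (- ((u a * u d) + (u b * u c)))      ≡⟨ sym (expand _ _ _ _) ⟩
        (u a + (- u b)) * (u c + (- u d))                                  ≡⟨ sym (cong₂ _*_ (embed-≡ a b) (embed-≡ c d)) ⟩
        embed (a , b) * embed (c , d)                                      ∎

      -‿homo : ∀ x → embed (RawRing.-_ coeffs x) ≡ - embed x
      -‿homo (a , b) = begin
        embed (b , a)            ≡⟨ embed-≡ b a ⟩
        u b + (- u a)            ≡⟨ cong (_+ (- u a)) (sym (⁻¹-involutive _)) ⟩
        (- (- u b)) + (- u a)    ≡⟨ +-comm _ _ ⟩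
        (- u a) + (- (- u b))    ≡⟨ ⁻¹-∙-comm _ _ ⟩
        - (u a + (- u b))        ≡⟨ cong -_ (sym (embed-≡ a b)) ⟩
        - embed (a , b)          ∎

      _coeff≟_ : ∀ x y → Maybe (embed x ≡ embed y)
      (a , b) coeff≟ (c , d) with (a ℕ.+ d) ℕ.≟ (c ℕ.+ b)
      ... | no  _ = nothing
      ... | yes e = just (trans (embed-≡ a b) (trans (cancel _ _ _ _
                      (trans (sym (×-homo-+ 1# a d)) (trans (cong u e) (×-homo-+ 1# c b)))) (sym (embed-≡ c d))))

      morphism : coeffs -Raw-AlmostCommutative⟶ fromCommutativeRing R
      morphism = record { ⟦_⟧ = embed ; +-homo = +-homo ; *-homo = *-homo ; -‿homo = -‿homo ; 0-homo = refl ; 1-homo = refl }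

    open RS coeffs (fromCommutativeRing R) morphism _coeff≟_ public

    :0 :1 : ∀ {n} → Polynomial n
    :0 = con (0 , 0)
    :1 = con (1 , 0)

-- Indicators, ordered-field arithmetic and finite sums over the rationals.

module Numbers where

  open import Data.Bool using (Bool; true; false; _∧_; _∨_; not) public
  import Data.Bool.Properties as BP
  open import Data.Nat as ℕ using (ℕ; zero; suc)
  import Data.Integer as ℤ
  open import Data.Rational hiding (truncate; ceiling; ∣_∣; _≟_)
  open import Data.Rational.Properties hiding (_≟_)
  open import Data.List using (List; []; _∷_; map; _++_; length)
  open import Data.List.Membership.Propositional using (_∈_)
  open import Data.List.Relation.Unary.Any using (Any; here; there; any?)
  import Data.List.Relation.Unary.All as All
  open import Data.List.Relation.Unary.Unique.Propositional using (Unique)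
  open import Data.List.Relation.Unary.AllPairs using (_∷_)
  open import Data.Product using (∃; _×_; _,_)
  open import Data.Sum using (_⊎_; inj₁; inj₂)
  open import Data.Empty using (⊥; ⊥-elim)
  open import Relation.Nullary using (¬_; yes; Dec; does)
  open import Relation.Nullary.Decidable using (dec-true; dec-false)
  open import Relation.Binary.PropositionalEquality hiding ([_])
  open import Relation.Binary.Definitions using (DecidableEquality)
  open RingSolver

  module QS = ZSolver +-*-isCommutativeRing
  open QS using (solve; _:=_; _:+_; _:*_; _:-_; :-_; :0; :1)

  bool-ext : ∀ {a b} → (a ≡ true → b ≡ true) → (b ≡ true → a ≡ true) → a ≡ b
  bool-ext {true}  {true}  f g = refl
  bool-ext {true}  {false} f g = sym (f refl)
  bool-ext {false} {true}  f g = g refl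
  bool-ext {false} {false} f g = refl

  ∧-true : ∀ {a b} → a ≡ true → b ≡ true → a ∧ b ≡ true
  ∧-true refl refl = refl

  ∧-trueˡ : ∀ {a b} → a ∧ b ≡ true → a ≡ true
  ∧-trueˡ {true} e = refl

  ∧-trueʳ : ∀ {a b} → a ∧ b ≡ true → b ≡ true
  ∧-trueʳ {true} e = e

  not-true : ∀ {a} → ¬ a ≡ true → not a ≡ true
  not-true {true}  f = ⊥-elim (f refl)
  not-true {false} f = refl

  true-not : ∀ {a} → not a ≡ true → ¬ a ≡ true
  true-not {false} e ()

  ¬true : ∀ {a} → ¬ a ≡ true → a ≡ false
  ¬true {true}  f = ⊥-elim (f refl)
  ¬true {false} f = refl

  false-¬true : ∀ {a} → a ≡ false → ¬ a ≡ true
  false-¬true refl ()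

  split : ∀ a → a ≡ true ⊎ ¬ a ≡ true
  split true  = inj₁ refl
  split false = inj₂ λ ()

  does-true : ∀ {P : Set} (d : Dec P) → P → does d ≡ true
  does-true d p = dec-true d p

  true-does : ∀ {P : Set} (d : Dec P) → does d ≡ true → P
  true-does (yes p) e = p

  [_] : Bool → ℚ
  [ true ]  = 1ℚ
  [ false ] = 0ℚ

  []-∧ : ∀ a b → [ a ∧ b ] ≡ [ a ] * [ b ]
  []-∧ true  b = sym (*-identityˡ [ b ])
  []-∧ false b = sym (*-zeroˡ [ b ])

  0≤1 : 0ℚ ≤ 1ℚ
  0≤1 = *≤* (ℤ.+≤+ ℕ.z≤n)

  0<1 : 0ℚ < 1ℚ
  0<1 = *<* (ℤ.+<+ (ℕ.s≤s ℕ.z≤n))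

  []≥0 : ∀ a → 0ℚ ≤ [ a ]
  []≥0 true  = 0≤1
  []≥0 false = ≤-refl

  []-mono : ∀ {a b} → (a ≡ true → b ≡ true) → [ a ] ≤ [ b ]
  []-mono {true}  {b} f rewrite f refl = ≤-refl
  []-mono {false} {b} f = []≥0 b

  []-guard : ∀ a {x y} → (a ≡ true → x ≡ y) → [ a ] * x ≡ [ a ] * y
  []-guard true  f = cong (1ℚ *_) (f refl)
  []-guard false {x} {y} f = trans (*-zeroˡ x) (sym (*-zeroˡ y))

  -- Ordered-field arithmetic

  mul≤ : ∀ {a b} c → 0ℚ ≤ c → a ≤ b → c * a ≤ c * b
  mul≤ c h = *-monoˡ-≤-nonNeg c {{nonNegative h}}

  cancel≤ : ∀ {a b} c → 0ℚ < c → c * a ≤ c * b → a ≤ b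
  cancel≤ c h = *-cancelˡ-≤-pos c {{positive h}}

  cancel≡ : ∀ {a b} c → 0ℚ < c → c * a ≡ c * b → a ≡ b
  cancel≡ c h e = ≤-antisym (cancel≤ c h (≤-reflexive e)) (cancel≤ c h (≤-reflexive (sym e)))

  mul>0 : ∀ {a b} → 0ℚ < a → 0ℚ < b → 0ℚ < a * b
  mul>0 {a} {b} h k = subst (_< a * b) (*-zeroʳ a) (*-monoʳ-<-pos a {{positive h}} k)

  add≥0 : ∀ {a b} → 0ℚ ≤ a → 0ℚ ≤ b → 0ℚ ≤ a + b
  add≥0 h k = +-mono-≤ h k

  mul≥0 : ∀ {a b} → 0ℚ ≤ a → 0ℚ ≤ b → 0ℚ ≤ a * b
  mul≥0 {a} {b} h k = subst (_≤ a * b) (*-zeroʳ a) (mul≤ a h k)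

  diff≥0 : ∀ {a b} → a ≤ b → 0ℚ ≤ b - a
  diff≥0 {a} {b} h = subst (_≤ b - a) (+-inverseʳ a) (+-monoˡ-≤ (- a) h)

  ≥0-diff : ∀ {a b} → 0ℚ ≤ b - a → a ≤ b
  ≥0-diff {a} {b} h = subst₂ _≤_ (+-identityˡ a) (solve 2 (λ a b → b :- a :+ a := b) refl a b) (+-monoˡ-≤ a h)

  ≤<-⊥ : ∀ {a b} → a ≤ b → b < a → ⊥
  ≤<-⊥ h k = <-irrefl refl (<-≤-trans k h)

  -- A recursive embedding on which induction works directly, without the normalisation hidden in
  -- `_/_`. The two are linked by `/-*`.
  ι : ℕ → ℚ
  ι zero    = 0ℚ
  ι (suc n) = 1ℚ + ι n

  ι-+ : ∀ m n → ι (m ℕ.+ n) ≡ ι m + ι n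
  ι-+ zero    n = sym (+-identityˡ (ι n))
  ι-+ (suc m) n = trans (cong (1ℚ +_) (ι-+ m n)) (sym (+-assoc 1ℚ (ι m) (ι n)))

  ι-* : ∀ m n → ι (m ℕ.* n) ≡ ι m * ι n
  ι-* zero    n = sym (*-zeroˡ (ι n))
  ι-* (suc m) n = trans (ι-+ n (m ℕ.* n)) (trans (cong (ι n +_) (ι-* m n))
    (solve 2 (λ a b → b :+ a :* b := (:1 :+ a) :* b) refl (ι m) (ι n)))

  ι≥0 : ∀ n → 0ℚ ≤ ι n
  ι≥0 zero    = ≤-refl
  ι≥0 (suc n) = add≥0 0≤1 (ι≥0 n)

  ι>0 : ∀ n → 0ℚ < ι (suc n)
  ι>0 n = <-≤-trans 0<1 (≤-trans (≤-reflexive (sym (+-identityʳ 1ℚ))) (+-monoʳ-≤ 1ℚ (ι≥0 n)))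

  ι-mono-< : ∀ {m n} → m ℕ.< n → ι m < ι n
  ι-mono-< {zero} {suc n} h = ι>0 n
  ι-mono-< {suc m} {suc n} (ℕ.s≤s h) = +-monoʳ-< 1ℚ (ι-mono-< h)

  ι-nz>0 : ∀ n → .{{ℕ.NonZero n}} → 0ℚ < ι n
  ι-nz>0 (suc n) = ι>0 n

  infixr 8 _^^_
  _^^_ : ℚ → ℕ → ℚ
  x ^^ zero  = 1ℚ
  x ^^ suc n = x * (x ^^ n)

  ^^-+ : ∀ x m n → x ^^ (m ℕ.+ n) ≡ x ^^ m * x ^^ n
  ^^-+ x zero    n = sym (*-identityˡ _)
  ^^-+ x (suc m) n = trans (cong (x *_) (^^-+ x m n)) (sym (*-assoc x _ _))

  ι-^ : ∀ m n → ι (m ℕ.^ n) ≡ ι m ^^ n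
  ι-^ m zero    = +-identityʳ 1ℚ
  ι-^ m (suc n) = trans (ι-* m (m ℕ.^ n)) (cong (ι m *_) (ι-^ m n))

  ^^>0 : ∀ {x} n → 0ℚ < x → 0ℚ < x ^^ n
  ^^>0 zero    h = 0<1
  ^^>0 (suc n) h = mul>0 h (^^>0 n h)

  -- Sums over lists

  ∑ᴸ : ∀ {A : Set} → List A → (A → ℚ) → ℚ
  ∑ᴸ []       f = 0ℚ
  ∑ᴸ (x ∷ xs) f = f x + ∑ᴸ xs f

  module _ {A : Set} where

    ∑ᴸ-cong : ∀ xs {f g : A → ℚ} → (∀ x → f x ≡ g x) → ∑ᴸ xs f ≡ ∑ᴸ xs g
    ∑ᴸ-cong []       h = refl
    ∑ᴸ-cong (x ∷ xs) h = cong₂ _+_ (h x) (∑ᴸ-cong xs h)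

    ∑ᴸ-cong∈ : ∀ xs {f g : A → ℚ} → (∀ x → x ∈ xs → f x ≡ g x) → ∑ᴸ xs f ≡ ∑ᴸ xs g
    ∑ᴸ-cong∈ []       h = refl
    ∑ᴸ-cong∈ (x ∷ xs) h = cong₂ _+_ (h x (here refl)) (∑ᴸ-cong∈ xs (λ y m → h y (there m)))

    ∑ᴸ-+ : ∀ xs (f g : A → ℚ) → ∑ᴸ xs (λ x → f x + g x) ≡ ∑ᴸ xs f + ∑ᴸ xs g
    ∑ᴸ-+ []       f g = refl
    ∑ᴸ-+ (x ∷ xs) f g = trans (cong (f x + g x +_) (∑ᴸ-+ xs f g))
      (solve 4 (λ a b c d → a :+ b :+ (c :+ d) := a :+ c :+ (b :+ d)) refl (f x) (g x) _ _)

    ∑ᴸ-* : ∀ xs c (f : A → ℚ) → ∑ᴸ xs (λ x → c * f x) ≡ c * ∑ᴸ xs f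
    ∑ᴸ-* []       c f = sym (*-zeroʳ c)
    ∑ᴸ-* (x ∷ xs) c f = trans (cong (c * f x +_) (∑ᴸ-* xs c f)) (sym (*-distribˡ-+ c (f x) _))

    ∑ᴸ-0 : ∀ (xs : List A) → ∑ᴸ xs (λ _ → 0ℚ) ≡ 0ℚ
    ∑ᴸ-0 []       = refl
    ∑ᴸ-0 (x ∷ xs) = trans (+-identityˡ _) (∑ᴸ-0 xs)

    ∑ᴸ-mono : ∀ xs {f g : A → ℚ} → (∀ x → f x ≤ g x) → ∑ᴸ xs f ≤ ∑ᴸ xs g
    ∑ᴸ-mono []       h = ≤-refl
    ∑ᴸ-mono (x ∷ xs) h = +-mono-≤ (h x) (∑ᴸ-mono xs h)

    ∑ᴸ-++ : ∀ xs ys (f : A → ℚ) → ∑ᴸ (xs ++ ys) f ≡ ∑ᴸ xs f + ∑ᴸ ys f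
    ∑ᴸ-++ []       ys f = sym (+-identityˡ _)
    ∑ᴸ-++ (x ∷ xs) ys f = trans (cong (f x +_) (∑ᴸ-++ xs ys f)) (sym (+-assoc (f x) _ _))

    ∑ᴸ-len : ∀ (xs : List A) → ∑ᴸ xs (λ _ → 1ℚ) ≡ ι (length xs)
    ∑ᴸ-len []       = refl
    ∑ᴸ-len (x ∷ xs) = cong (1ℚ +_) (∑ᴸ-len xs)

    ∑ᴸ-≥0 : ∀ xs {f : A → ℚ} → (∀ x → 0ℚ ≤ f x) → 0ℚ ≤ ∑ᴸ xs f
    ∑ᴸ-≥0 xs {f} h = subst (_≤ ∑ᴸ xs f) (∑ᴸ-0 xs) (∑ᴸ-mono xs h)

    ∑ᴸ-term : ∀ xs {f : A → ℚ} → (∀ x → 0ℚ ≤ f x) → ∀ {x} → x ∈ xs → f x ≤ ∑ᴸ xs f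
    ∑ᴸ-term (x ∷ xs) {f} h (here refl) =
      ≤-trans (≤-reflexive (sym (+-identityʳ (f x)))) (+-monoʳ-≤ (f x) (∑ᴸ-≥0 xs h))
    ∑ᴸ-term (x ∷ xs) {f} h {y} (there m) =
      ≤-trans (≤-reflexive (sym (+-identityˡ (f y)))) (+-mono-≤ (h x) (∑ᴸ-term xs h m))

  ∑ᴸ-map : ∀ {A B : Set} (g : A → B) xs (f : B → ℚ) → ∑ᴸ (map g xs) f ≡ ∑ᴸ xs (λ x → f (g x))
  ∑ᴸ-map g []       f = refl
  ∑ᴸ-map g (x ∷ xs) f = cong (f (g x) +_) (∑ᴸ-map g xs f)

  ∑ᴸ-swap : ∀ {A B : Set} xs ys (f : A → B → ℚ) →
            ∑ᴸ xs (λ x → ∑ᴸ ys (f x)) ≡ ∑ᴸ ys (λ y → ∑ᴸ xs (λ x → f x y))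
  ∑ᴸ-swap []       ys f = sym (∑ᴸ-0 ys)
  ∑ᴸ-swap (x ∷ xs) ys f = trans (cong (∑ᴸ ys (f x) +_) (∑ᴸ-swap xs ys f)) (sym (∑ᴸ-+ ys (f x) _))

  record Finite : Set₁ where
    field
      Carrier  : Set
      _≟_      : DecidableEquality Carrier
      elems    : List Carrier
      complete : ∀ x → x ∈ elems
      unique   : Unique elems

  module FiniteSums (X : Finite) where
    open Finite X renaming (Carrier to A)

    infixr 6 _==_
    _==_ : A → A → Bool
    x == y = does (x ≟ y)

    ==-refl : ∀ x → (x == x) ≡ true
    ==-refl x = does-true (x ≟ x) refl

    ==-true : ∀ {x y} → (x == y) ≡ true → x ≡ y
    ==-true {x} {y} = true-does (x ≟ y)

    ==-false : ∀ {x y} → x ≢ y → (x == y) ≡ false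
    ==-false {x} {y} n = dec-false (x ≟ y) n

    ∑ : (A → ℚ) → ℚ
    ∑ = ∑ᴸ elems

    -- Cardinalities are rational so that they can be subtracted, compared and cancelled without
    -- truncation.
    ⌈_⌉ : (A → Bool) → ℚ
    ⌈ P ⌉ = ∑ (λ x → [ P x ])

    ∑-cong : ∀ {f g : A → ℚ} → (∀ x → f x ≡ g x) → ∑ f ≡ ∑ g
    ∑-cong = ∑ᴸ-cong elems

    ∑-+ : ∀ f g → ∑ (λ x → f x + g x) ≡ ∑ f + ∑ g
    ∑-+ = ∑ᴸ-+ elems

    ∑-* : ∀ c f → ∑ (λ x → c * f x) ≡ c * ∑ f
    ∑-* = ∑ᴸ-* elems

    ∑-*ʳ : ∀ c f → ∑ (λ x → f x * c) ≡ ∑ f * c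
    ∑-*ʳ c f = trans (∑-cong (λ x → *-comm (f x) c)) (trans (∑-* c f) (*-comm c (∑ f)))

    ∑-neg : ∀ f → ∑ (λ x → - f x) ≡ - ∑ f
    ∑-neg f = trans (∑-cong (λ x → neg* (f x))) (trans (∑-* (- 1ℚ) f) (sym (neg* (∑ f))))
      where
      neg* : ∀ a → - a ≡ - 1ℚ * a
      neg* = solve 1 (λ a → :- a := (:- :1) :* a) refl

    ∑-- : ∀ f g → ∑ (λ x → f x - g x) ≡ ∑ f - ∑ g
    ∑-- f g = trans (∑-+ f (λ x → - g x)) (cong (∑ f +_) (∑-neg g))

    ∑-swapᴸ : ∀ {B : Set} (ys : List B) f → ∑ (λ x → ∑ᴸ ys (f x)) ≡ ∑ᴸ ys (λ y → ∑ (λ x → f x y))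
    ∑-swapᴸ = ∑ᴸ-swap elems

    ∑-swap : ∀ f → ∑ (λ x → ∑ (f x)) ≡ ∑ (λ y → ∑ (λ x → f x y))
    ∑-swap = ∑ᴸ-swap elems elems

    private
      ∑ᴸ-absent : ∀ xs {f : A → ℚ} {u} → All.All (u ≢_) xs → ∑ᴸ xs (λ x → [ x == u ] * f x) ≡ 0ℚ
      ∑ᴸ-absent []       _ = refl
      ∑ᴸ-absent (x ∷ xs) {f} {u} (n All.∷ ns) rewrite ==-false {x} {u} (λ e → n (sym e)) =
        trans (cong₂ _+_ (*-zeroˡ (f x)) (∑ᴸ-absent xs {f} ns)) refl

      ∑ᴸ-δ : ∀ xs (f : A → ℚ) {u} → u ∈ xs → Unique xs → ∑ᴸ xs (λ x → [ x == u ] * f x) ≡ f u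
      ∑ᴸ-δ (x ∷ xs) f {u} (here refl) (p ∷ ps) rewrite ==-refl u =
        trans (cong₂ _+_ (*-identityˡ (f u)) (∑ᴸ-absent xs {f} p)) (+-identityʳ (f u))
      ∑ᴸ-δ (x ∷ xs) f {u} (there m) (p ∷ ps) rewrite ==-false {x} {u} (All.lookup p m) =
        trans (cong₂ _+_ (*-zeroˡ (f x)) (∑ᴸ-δ xs f m ps)) (+-identityˡ (f u))

    ∑-δ : ∀ f u → ∑ (λ x → [ x == u ] * f x) ≡ f u
    ∑-δ f u = ∑ᴸ-δ elems f (complete u) unique

    ∑-δ1 : ∀ u → ⌈ (_== u) ⌉ ≡ 1ℚ
    ∑-δ1 u = trans (∑-cong (λ x → sym (*-identityʳ _))) (∑-δ (λ _ → 1ℚ) u)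

    ∣∣-unique : ∀ (P : A → Bool) u → P u ≡ true → (∀ x → P x ≡ true → x ≡ u) → ⌈ P ⌉ ≡ 1ℚ
    ∣∣-unique P u h k = trans (∑-cong (λ x → cong [_] (bool-ext
      (λ e → does-true (x ≟ u) (k x e)) (λ e → trans (cong P (==-true e)) h)))) (∑-δ1 u)

    -- Summation over the graph of φ: after the sums are swapped, each y has the single preimage ψ
    -- y.
    ∑-reindex : ∀ (φ ψ : A → A) → (∀ x → ψ (φ x) ≡ x) → (∀ x → φ (ψ x) ≡ x) → ∀ f → ∑ (λ x → f (φ x)) ≡ ∑ f
    ∑-reindex φ ψ h k f = begin
      ∑ (λ x → f (φ x))                              ≡⟨ ∑-cong (λ x → sym (∑-δ f (φ x))) ⟩
      ∑ (λ x → ∑ (λ y → [ y == φ x ] * f y))         ≡⟨ ∑-swap _ ⟩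
      ∑ (λ y → ∑ (λ x → [ y == φ x ] * f y))         ≡⟨ ∑-cong (λ y → ∑-*ʳ (f y) _) ⟩
      ∑ (λ y → ⌈ (λ x → y == φ x) ⌉ * f y)           ≡⟨ ∑-cong (λ y → cong (_* f y) (one y)) ⟩
      ∑ (λ y → 1ℚ * f y)                             ≡⟨ ∑-cong (λ y → *-identityˡ (f y)) ⟩
      ∑ f                                            ∎
      where
      open ≡-Reasoning
      one : ∀ y → ⌈ (λ x → y == φ x) ⌉ ≡ 1ℚ
      one y = ∣∣-unique _ (ψ y) (does-true (y ≟ φ (ψ y)) (sym (k y)))
        (λ x e → trans (sym (h x)) (cong ψ (sym (==-true e))))

    ∣∣-mono : ∀ {P Q : A → Bool} → (∀ x → P x ≡ true → Q x ≡ true) → ⌈ P ⌉ ≤ ⌈ Q ⌉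
    ∣∣-mono h = ∑ᴸ-mono elems (λ x → []-mono (h x))

    ∣∣-cong : ∀ {P Q : A → Bool} → (∀ x → P x ≡ Q x) → ⌈ P ⌉ ≡ ⌈ Q ⌉
    ∣∣-cong h = ∑-cong (λ x → cong [_] (h x))

    ∣∣-none : ∀ {P : A → Bool} → (∀ x → ¬ P x ≡ true) → ⌈ P ⌉ ≡ 0ℚ
    ∣∣-none h = trans (∑-cong (λ x → cong [_] (¬true (h x)))) (∑ᴸ-0 elems)

    ∣∣≥0 : ∀ P → 0ℚ ≤ ⌈ P ⌉
    ∣∣≥0 P = ∑ᴸ-≥0 elems (λ x → []≥0 (P x))

    ∣∣>0 : ∀ P u → P u ≡ true → 0ℚ < ⌈ P ⌉
    ∣∣>0 P u h = <-≤-trans 0<1 (subst (λ b → [ b ] ≤ ⌈ P ⌉) h (∑ᴸ-term elems (λ x → []≥0 (P x)) (complete u)))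

    opaque
      some : (A → Bool) → Bool
      some P = does (any? (λ x → P x BP.≟ true) elems)

      some-intro : ∀ P {x} → P x ≡ true → some P ≡ true
      some-intro P {x} h = does-true (any? _ elems) (go (complete x))
        where
        go : ∀ {xs} → x ∈ xs → Any (λ y → P y ≡ true) xs
        go (here refl) = here h
        go (there m)   = there (go m)

      some-elim : ∀ P → some P ≡ true → ∃ λ x → P x ≡ true
      some-elim P e = go (true-does (any? (λ x → P x BP.≟ true) elems) e)
        where
        go : ∀ {xs} → Any (λ y → P y ≡ true) xs → ∃ λ x → P x ≡ true
        go (here h)  = _ , h
        go (there m) = go m

    search : ∀ P → (∃ λ x → P x ≡ true) ⊎ (∀ x → ¬ P x ≡ true)
    search P with split (some P)
    ... | inj₁ e = inj₁ (some-elim P e)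
    ... | inj₂ n = inj₂ λ x h → n (some-intro P h)

    infix 4 _⊆_
    _⊆_ : (A → Bool) → (A → Bool) → Set
    P ⊆ Q = ∀ x → P x ≡ true → Q x ≡ true

    infix 5 _⊆ᵇ_
    opaque
      _⊆ᵇ_ : (A → Bool) → (A → Bool) → Bool
      P ⊆ᵇ Q = not (some (λ x → P x ∧ not (Q x)))

      ⊆ᵇ-intro : ∀ {P Q} → P ⊆ Q → (P ⊆ᵇ Q) ≡ true
      ⊆ᵇ-intro h = not-true λ e → let x , k = some-elim _ e in true-not (∧-trueʳ k) (h x (∧-trueˡ k))

      ⊆ᵇ-elim : ∀ {P Q} → (P ⊆ᵇ Q) ≡ true → P ⊆ Q
      ⊆ᵇ-elim {P} {Q} e x h with split (Q x)
      ... | inj₁ k = k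
      ... | inj₂ n = ⊥-elim (true-not e (some-intro _ {x} (∧-true h (not-true n))))

    ⊆-or : ∀ P Q → P ⊆ Q ⊎ (∃ λ x → P x ≡ true × ¬ Q x ≡ true)
    ⊆-or P Q with search (λ x → P x ∧ not (Q x))
    ... | inj₁ (x , h) = inj₂ (x , ∧-trueˡ h , true-not (∧-trueʳ {P x} h))
    ... | inj₂ n = inj₁ λ x h → case x h (split (Q x))
      where
      case : ∀ x → P x ≡ true → Q x ≡ true ⊎ ¬ Q x ≡ true → Q x ≡ true
      case x h (inj₁ k) = k
      case x h (inj₂ m) = ⊥-elim (n x (∧-true h (not-true m)))

    outside : ∀ {P Q} → ⌈ Q ⌉ < ⌈ P ⌉ → ∃ λ x → P x ≡ true × ¬ Q x ≡ true
    outside {P} {Q} h with ⊆-or P Q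
    ... | inj₁ s = ⊥-elim (≤<-⊥ (∣∣-mono s) h)
    ... | inj₂ r = r

    ∣∣-split : ∀ (P Q : A → Bool) → ⌈ P ⌉ ≡ ⌈ (λ x → P x ∧ Q x) ⌉ + ⌈ (λ x → P x ∧ not (Q x)) ⌉
    ∣∣-split P Q = trans (∑-cong (λ x → eq (P x) (Q x))) (∑-+ (λ x → [ P x ∧ Q x ]) (λ x → [ P x ∧ not (Q x) ]))
      where
      eq : ∀ a b → [ a ] ≡ [ a ∧ b ] + [ a ∧ not b ]
      eq true  true  = refl
      eq true  false = refl
      eq false b     = refl

    ∣∣-minus : ∀ {P Q} → Q ⊆ P → ⌈ (λ x → P x ∧ not (Q x)) ⌉ ≡ ⌈ P ⌉ - ⌈ Q ⌉
    ∣∣-minus {P} {Q} h = trans (sym (solve 2 (λ a b → a :+ b :- a := b) refl ⌈ Q ⌉ ⌈ P∖Q ⌉))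
      (cong (_- ⌈ Q ⌉) (sym (trans (∣∣-split P Q) (cong (_+ ⌈ P∖Q ⌉) (∣∣-cong {λ x → P x ∧ Q x} (λ x → bool-ext (∧-trueʳ {P x}) (λ k → ∧-true (h x k) k)))))))
      where
      P∖Q : A → Bool
      P∖Q x = P x ∧ not (Q x)

    -- The device that turns counts into equalities of subspaces and of point sets throughout.
    ⊆-full : ∀ {P Q} → P ⊆ Q → ⌈ Q ⌉ ≤ ⌈ P ⌉ → Q ⊆ P
    ⊆-full {P} {Q} h k with ⊆-or Q P
    ... | inj₁ s = s
    ... | inj₂ (u , a , b) = ⊥-elim (<-irrefl refl (<-≤-trans someP (≤-trans (≤-reflexive (∣∣-minus h)) nonpos)))
      where
      someP : 0ℚ < ⌈ (λ x → Q x ∧ not (P x)) ⌉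
      someP = ∣∣>0 (λ x → Q x ∧ not (P x)) u (∧-true a (not-true b))
      nonpos : ⌈ Q ⌉ - ⌈ P ⌉ ≤ 0ℚ
      nonpos = subst (⌈ Q ⌉ - ⌈ P ⌉ ≤_) (+-inverseʳ ⌈ P ⌉) (+-monoˡ-≤ (- ⌈ P ⌉) k)

-- Finite fields, finite vector spaces, and subspaces as Boolean predicates.

module LinearAlgebra where

  open import Defs using (FiniteField)
  open import Data.Nat as ℕ using (ℕ; zero; suc)
  open import Data.Rational using (ℚ; 0ℚ; 1ℚ; _<_; _+_; _*_; _-_; -_; 1/_; >-nonZero)
  open import Data.Rational.Properties using (*-inverseʳ; *-identityʳ; *-identityˡ; *-zeroˡ; *-comm; *-assoc; +-identityˡ; ≤-reflexive; ≤-trans; <-≤-trans; <-trans; +-inverseʳ; +-monoˡ-<)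
  open import Data.Vec as Vec using (Vec; []; _∷_; lookup; zipWith; replicate)
  open import Data.Fin using (Fin; zero; suc)
  open import Data.Product using (∃; _×_; _,_; proj₁)
  open import Data.Sum using (inj₁; inj₂)
  open import Data.Empty using (⊥-elim)
  open import Relation.Nullary using (¬_; yes; no)
  open import Relation.Binary.PropositionalEquality hiding ([_])
  open import Algebra.Structures using (IsCommutativeRing)
  open Numbers
  open RingSolver

  module Field (F : FiniteField) where
    open FiniteField F public using () renaming
      (Carrier to 𝔽; _+_ to infixl 6 _+ᶠ_; _*_ to infixl 7 _*ᶠ_; -_ to infix 8 -ᶠ_; 0# to 0ᶠ; 1# to 1ᶠ; _≟_ to infix 4 _≟ᶠ_)
    open FiniteField F using (inverse; 0≢1; isCommutativeRing; elems; complete; unique)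
    module FS = ZSolver isCommutativeRing
    open IsCommutativeRing isCommutativeRing public using () renaming
      (*-identityˡ to *ᶠ-identityˡ; *-identityʳ to *ᶠ-identityʳ; +-identityˡ to +ᶠ-identityˡ; +-identityʳ to +ᶠ-identityʳ;
       zeroˡ to *ᶠ-zeroˡ; zeroʳ to *ᶠ-zeroʳ; *-comm to *ᶠ-comm; *-assoc to *ᶠ-assoc; +-comm to +ᶠ-comm; -‿inverseʳ to -ᶠ-inverseʳ; -‿inverseˡ to -ᶠ-inverseˡ)
    open FS using (solve; _:=_; _:+_; _:*_; _:-_; :-_; :0; :1)

    scalars : Finite
    scalars = record { Carrier = 𝔽 ; _≟_ = _≟ᶠ_ ; elems = elems ; complete = complete ; unique = unique }

    module ΣF = FiniteSums scalars
    open ΣF public using () renaming (∑ to ∑ᶠ)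

    opaque
      q : ℚ
      q = ι (FiniteField.q F)

      q-def : q ≡ ι (FiniteField.q F)
      q-def = refl

    ∑ᶠ-const : ∀ c → ∑ᶠ (λ _ → c) ≡ q * c
    ∑ᶠ-const c = trans (ΣF.∑-cong (λ _ → sym (*-identityˡ c))) (trans (ΣF.∑-*ʳ c (λ _ → 1ℚ)) (cong (_* c) (trans (∑ᴸ-len elems) (sym q-def))))

    1≢0 : 1ᶠ ≢ 0ᶠ
    1≢0 e = 0≢1 (sym e)

    1<q : 1ℚ < q
    1<q = <-≤-trans (ι-mono-< {1} {2} (ℕ.s≤s (ℕ.s≤s ℕ.z≤n))) (≤-trans (≤-reflexive two) (≤-trans (ΣF.∣∣-mono {λ x → (x ΣF.== 0ᶠ) ∨ (x ΣF.== 1ᶠ)} {λ _ → true} (λ _ _ → refl)) (≤-reflexive (trans (∑ᴸ-len elems) (sym q-def)))))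
      where
      or : ∀ x → [ (x ΣF.== 0ᶠ) ∨ (x ΣF.== 1ᶠ) ] ≡ [ x ΣF.== 0ᶠ ] + [ x ΣF.== 1ᶠ ]
      or x with x ≟ᶠ 0ᶠ | x ≟ᶠ 1ᶠ
      ... | yes refl | yes e = ⊥-elim (0≢1 e)
      ... | yes _ | no _  = refl
      ... | no  _ | yes _ = refl
      ... | no  _ | no _  = refl
      two : ι 2 ≡ ΣF.⌈ (λ x → (x ΣF.== 0ᶠ) ∨ (x ΣF.== 1ᶠ)) ⌉
      two = sym (trans (ΣF.∑-cong or) (trans (ΣF.∑-+ _ _) (cong₂ _+_ (ΣF.∑-δ1 0ᶠ) (ΣF.∑-δ1 1ᶠ))))

    0<q : 0ℚ < q
    0<q = <-trans 0<1 1<q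

    0<q-1 : 0ℚ < q - 1ℚ
    0<q-1 = subst (_< q - 1ℚ) (+-inverseʳ 1ℚ) (+-monoˡ-< (- 1ℚ) 1<q)

    inv : ∀ x → x ≢ 0ᶠ → ∃ λ y → x *ᶠ y ≡ 1ᶠ
    inv = inverse

    integral : ∀ {x y} → x ≢ 0ᶠ → x *ᶠ y ≡ 0ᶠ → y ≡ 0ᶠ
    integral {x} {y} n e with inverse x n
    ... | z , p = trans (sym (*ᶠ-identityˡ y)) (trans (cong (_*ᶠ y) (sym p))
      (trans (solve 3 (λ x z y → x :* z :* y := z :* (x :* y)) refl x z y) (trans (cong (z *ᶠ_) e) (*ᶠ-zeroʳ z))))

    prod≢0 : ∀ {x y} → x ≢ 0ᶠ → y ≢ 0ᶠ → x *ᶠ y ≢ 0ᶠ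
    prod≢0 n m e = m (integral n e)

    neg≢0 : ∀ {x} → x ≢ 0ᶠ → -ᶠ x ≢ 0ᶠ
    neg≢0 {x} n e = n (trans (solve 1 (λ x → x := :- (:- x)) refl x) (trans (cong -ᶠ_ e) (solve 0 (:- :0 := :0) refl)))

    root : 𝔽 → (b : 𝔽) → b ≢ 0ᶠ → 𝔽
    root a b n = -ᶠ a *ᶠ proj₁ (inverse b n)

    root-eq : ∀ a b n → a +ᶠ root a b n *ᶠ b ≡ 0ᶠ
    root-eq a b n with inverse b n
    ... | z , p = trans (solve 3 (λ a b z → a :+ (:- a) :* z :* b := a :- a :* (b :* z)) refl a b z)
      (trans (cong (λ t → a +ᶠ -ᶠ (a *ᶠ t)) p) (solve 1 (λ a → a :- a :* :1 := :0) refl a))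

    root-unique : ∀ a b n c → a +ᶠ c *ᶠ b ≡ 0ᶠ → c ≡ root a b n
    root-unique a b n c e with inverse b n
    ... | z , p = trans (sym (*ᶠ-identityʳ c)) (trans (cong (c *ᶠ_) (sym p))
      (trans (solve 4 (λ a b z c → c :* (b :* z) := (a :+ c :* b) :* z :+ (:- a) :* z) refl a b z c)
      (trans (cong (λ t → t *ᶠ z +ᶠ -ᶠ a *ᶠ z) e) (solve 2 (λ a z → :0 :* z :+ (:- a) :* z := (:- a) :* z) refl a z))))

    -- An affine function of nonzero slope has exactly one zero; the counts along lines for bilinear
    -- and quadratic forms end here.
    one-root : ∀ a b → b ≢ 0ᶠ → ∑ᶠ (λ c → [ (a +ᶠ c *ᶠ b) ΣF.== 0ᶠ ]) ≡ 1ℚ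
    one-root a b n = ΣF.∣∣-unique _ (root a b n) (does-true (_ ≟ᶠ _) (root-eq a b n))
      (λ c e → root-unique a b n c (ΣF.==-true e))

    opaque
      q⁻¹ : ∃ λ r → q * r ≡ 1ℚ
      q⁻¹ = (1/ q) {{>-nonZero 0<q}} , *-inverseʳ q {{>-nonZero 0<q}}

  -- Equality of vectors has to be propositional and decidable, which functions on `Fin n` do not
  -- provide. The instance in `Coordinates` therefore uses the inductive vectors.
  record Space (F : FiniteField) : Set₁ where
    open FiniteField F using () renaming (Carrier to 𝔽; _+_ to _+ᶠ_; _*_ to _*ᶠ_; 0# to 0ᶠ; 1# to 1ᶠ)
    infixl 6 _⊕_
    infixr 7 _·_
    field
      vectors : Finite
    open Finite vectors public using () renaming (Carrier to V; _≟_ to _≟ᵛ_)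
    field
      _⊕_  : V → V → V
      0ᵛ   : V
      _·_  : 𝔽 → V → V
      ⊕-assoc     : ∀ u v w → (u ⊕ v) ⊕ w ≡ u ⊕ (v ⊕ w)
      ⊕-comm      : ∀ u v → u ⊕ v ≡ v ⊕ u
      ⊕-identityˡ : ∀ v → 0ᵛ ⊕ v ≡ v
      ·-⊕         : ∀ c u v → c · (u ⊕ v) ≡ c · u ⊕ c · v
      +-·         : ∀ a b v → (a +ᶠ b) · v ≡ a · v ⊕ b · v
      *-·         : ∀ a b v → (a *ᶠ b) · v ≡ a · (b · v)
      1-·         : ∀ v → 1ᶠ · v ≡ v
      0-·         : ∀ v → 0ᶠ · v ≡ 0ᵛ

  module Subspaces {F : FiniteField} (S : Space F) where
    open Field F public
    open Space S public
    open FiniteSums vectors public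
    open FS using (Polynomial; ⟦_⟧↓; correct; :0; :1; :-_; _:-_; _:+_; _:*_) renaming (⟦_⟧ to ⟦_⟧ᵖ)
    open ≡-Reasoning

    ∑-∑ᶠ : ∀ f → ∑ (λ v → ∑ᶠ (f v)) ≡ ∑ᶠ (λ c → ∑ (λ v → f v c))
    ∑-∑ᶠ = ∑-swapᴸ (FiniteField.elems F)

    infixl 6 _⊖_
    _⊖_ : V → V → V
    u ⊖ v = u ⊕ (-ᶠ 1ᶠ) · v

    -- A normaliser for linear combinations: an expression in m vectors is turned into its vector of coefficients.
    module VectorSolver where
      infixl 6 _:⊕_ _:⊖_
      infixr 7 _:·_
      data Expr (n m : ℕ) : Set where
        var  : Fin m → Expr n m
        _:⊕_ : Expr n m → Expr n m → Expr n m
        _:·_ : Polynomial n → Expr n m → Expr n m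
        :𝟎   : Expr n m

      _:⊖_ : ∀ {n m} → Expr n m → Expr n m → Expr n m
      a :⊖ b = a :⊕ (:- :1) :· b

      eval : ∀ {n m} → Expr n m → Vec 𝔽 n → Vec V m → V
      eval (var i)  ρ vs = lookup vs i
      eval (a :⊕ b) ρ vs = eval a ρ vs ⊕ eval b ρ vs
      eval (p :· a) ρ vs = ⟦ p ⟧ᵖ ρ · eval a ρ vs
      eval :𝟎       ρ vs = 0ᵛ

      unitᵛ : ∀ {n m} → Fin m → Vec (Polynomial n) m
      unitᵛ {m = suc m} zero    = :1 ∷ replicate m :0
      unitᵛ {m = suc m} (suc i) = :0 ∷ unitᵛ i

      coeffs : ∀ {n m} → Expr n m → Vec (Polynomial n) m
      coeffs (var i)  = unitᵛ i
      coeffs (a :⊕ b) = zipWith _:+_ (coeffs a) (coeffs b)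
      coeffs (p :· a) = Vec.map (p :*_) (coeffs a)
      coeffs :𝟎       = replicate _ :0

      lin : ∀ {n m} → Vec (Polynomial n) m → Vec 𝔽 n → Vec V m → V
      lin []       ρ []       = 0ᵛ
      lin (p ∷ ps) ρ (v ∷ vs) = ⟦ p ⟧ᵖ ρ · v ⊕ lin ps ρ vs

      ⊕-mid : ∀ a b c d → (a ⊕ b) ⊕ (c ⊕ d) ≡ (a ⊕ c) ⊕ (b ⊕ d)
      ⊕-mid a b c d = begin
        (a ⊕ b) ⊕ (c ⊕ d) ≡⟨ ⊕-assoc a b _ ⟩
        a ⊕ (b ⊕ (c ⊕ d)) ≡⟨ cong (a ⊕_) (sym (⊕-assoc b c d)) ⟩
        a ⊕ ((b ⊕ c) ⊕ d) ≡⟨ cong (λ z → a ⊕ (z ⊕ d)) (⊕-comm b c) ⟩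
        a ⊕ ((c ⊕ b) ⊕ d) ≡⟨ cong (a ⊕_) (⊕-assoc c b d) ⟩
        a ⊕ (c ⊕ (b ⊕ d)) ≡⟨ sym (⊕-assoc a c _) ⟩
        (a ⊕ c) ⊕ (b ⊕ d) ∎

      ·-0ᵛ : ∀ c → c · 0ᵛ ≡ 0ᵛ
      ·-0ᵛ c = trans (cong (c ·_) (sym (0-· 0ᵛ))) (trans (sym (*-· c 0ᶠ 0ᵛ)) (trans (cong (_· 0ᵛ) (*ᶠ-zeroʳ c)) (0-· 0ᵛ)))

      lin-0 : ∀ {n} m (ρ : Vec 𝔽 n) (vs : Vec V m) → lin (replicate m :0) ρ vs ≡ 0ᵛ
      lin-0 zero    ρ []       = refl
      lin-0 (suc m) ρ (v ∷ vs) = trans (cong₂ _⊕_ (0-· v) (lin-0 m ρ vs)) (⊕-identityˡ 0ᵛ)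

      lin-unit : ∀ {n m} (i : Fin m) (ρ : Vec 𝔽 n) vs → lin (unitᵛ i) ρ vs ≡ lookup vs i
      lin-unit zero ρ (v ∷ vs) = trans (cong₂ _⊕_ (1-· v) (lin-0 _ ρ vs)) (trans (⊕-comm v 0ᵛ) (⊕-identityˡ v))
      lin-unit (suc i) ρ (v ∷ vs) = trans (cong₂ _⊕_ (0-· v) (lin-unit i ρ vs)) (⊕-identityˡ _)

      lin-⊕ : ∀ {n m} (ps qs : Vec (Polynomial n) m) ρ vs → lin (zipWith _:+_ ps qs) ρ vs ≡ lin ps ρ vs ⊕ lin qs ρ vs
      lin-⊕ []       []        ρ []       = sym (⊕-identityˡ 0ᵛ)
      lin-⊕ (p ∷ ps) (p′ ∷ qs) ρ (v ∷ vs) = trans (cong₂ _⊕_ (+-· _ _ v) (lin-⊕ ps qs ρ vs)) (⊕-mid _ _ _ _)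

      lin-· : ∀ {n m} p (ps : Vec (Polynomial n) m) ρ vs → lin (Vec.map (p :*_) ps) ρ vs ≡ ⟦ p ⟧ᵖ ρ · lin ps ρ vs
      lin-· p []        ρ []       = sym (·-0ᵛ _)
      lin-· p (p′ ∷ ps) ρ (v ∷ vs) = trans (cong₂ _⊕_ (*-· _ _ v) (lin-· p ps ρ vs)) (sym (·-⊕ _ _ _))

      lin-coeffs : ∀ {n m} (e : Expr n m) ρ vs → eval e ρ vs ≡ lin (coeffs e) ρ vs
      lin-coeffs (var i)  ρ vs = sym (lin-unit i ρ vs)
      lin-coeffs (a :⊕ b) ρ vs = trans (cong₂ _⊕_ (lin-coeffs a ρ vs) (lin-coeffs b ρ vs)) (sym (lin-⊕ (coeffs a) (coeffs b) ρ vs))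
      lin-coeffs (p :· a) ρ vs = trans (cong (_ ·_) (lin-coeffs a ρ vs)) (sym (lin-· p (coeffs a) ρ vs))
      lin-coeffs :𝟎       ρ vs = sym (lin-0 _ ρ vs)

      lin-normal : ∀ {n m} (ps qs : Vec (Polynomial n) m) ρ vs →
                   Vec.map (λ p → ⟦ p ⟧↓ ρ) ps ≡ Vec.map (λ p → ⟦ p ⟧↓ ρ) qs → lin ps ρ vs ≡ lin qs ρ vs
      lin-normal []       []        ρ []       e = refl
      lin-normal (p ∷ ps) (p′ ∷ qs) ρ (v ∷ vs) e =
        cong₂ _⊕_ (cong (_· v) (trans (sym (correct p ρ)) (trans (cong Vec.head e) (correct p′ ρ))))
          (lin-normal ps qs ρ vs (cong Vec.tail e))

      vsolve : ∀ {n m} (f : Vec (Polynomial n) n → Vec (Expr n m) m → Expr n m × Expr n m) (ρ : Vec 𝔽 n) (vs : Vec V m) →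
               let l , r = f (Vec.map FS.var (Vec.allFin n)) (Vec.map var (Vec.allFin m)) in
               Vec.map (λ p → ⟦ p ⟧↓ ρ) (coeffs l) ≡ Vec.map (λ p → ⟦ p ⟧↓ ρ) (coeffs r) → eval l ρ vs ≡ eval r ρ vs
      vsolve {n} {m} f ρ vs e =
        let l , r = f (Vec.map FS.var (Vec.allFin n)) (Vec.map var (Vec.allFin m)) in
        trans (lin-coeffs l ρ vs) (trans (lin-normal (coeffs l) (coeffs r) ρ vs e) (sym (lin-coeffs r ρ vs)))

    open VectorSolver public using (vsolve; _:⊕_; _:⊖_; _:·_; :𝟎; ·-0ᵛ)

    ⊕-identityʳ : ∀ v → v ⊕ 0ᵛ ≡ v
    ⊕-identityʳ v = trans (⊕-comm v 0ᵛ) (⊕-identityˡ v)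

    ⊖-self : ∀ v → v ⊖ v ≡ 0ᵛ
    ⊖-self v = vsolve (λ { [] (v ∷ []) → v :⊖ v , :𝟎 }) [] (v ∷ []) refl

    ⊕-⊖ : ∀ u v → (u ⊕ v) ⊖ v ≡ u
    ⊕-⊖ u v = vsolve (λ { [] (u ∷ v ∷ []) → (u :⊕ v) :⊖ v , u }) [] (u ∷ v ∷ []) refl

    ⊖-⊕ : ∀ u v → (u ⊖ v) ⊕ v ≡ u
    ⊖-⊕ u v = vsolve (λ { [] (u ∷ v ∷ []) → (u :⊖ v) :⊕ v , u }) [] (u ∷ v ∷ []) refl

    ·-cancel : ∀ {c v} → c ≢ 0ᶠ → c · v ≡ 0ᵛ → v ≡ 0ᵛ
    ·-cancel {c} {v} n e with inv c n
    ... | d , p = trans (sym (1-· v)) (trans (cong (_· v) (trans (sym p) (*ᶠ-comm c d))) (trans (*-· d c v) (trans (cong (d ·_) e) (·-0ᵛ d))))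

    infix 4 _∈_ _∉_
    _∈_ _∉_ : V → (V → Bool) → Set
    v ∈ X = X v ≡ true
    v ∉ X = ¬ v ∈ X

    infixr 7 _∩_
    _∩_ : (V → Bool) → (V → Bool) → V → Bool
    (X ∩ Y) v = X v ∧ Y v

    infixl 7 _∖_
    _∖_ : (V → Bool) → (V → Bool) → V → Bool
    (X ∖ Y) v = X v ∧ not (Y v)

    record Sub (X : V → Bool) : Set where
      field
        has-0 : 0ᵛ ∈ X
        has-⊕ : ∀ {u v} → u ∈ X → v ∈ X → u ⊕ v ∈ X
        has-· : ∀ c {v} → v ∈ X → c · v ∈ X

      has-⊖ : ∀ {u v} → u ∈ X → v ∈ X → u ⊖ v ∈ X
      has-⊖ h k = has-⊕ h (has-· _ k)

      cancel-⊕ : ∀ {u v} → v ∈ X → u ⊕ v ∈ X → u ∈ X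
      cancel-⊕ {u} {v} h k = subst (_∈ X) (⊕-⊖ u v) (has-⊖ k h)

      cancel-· : ∀ {c v} → c ≢ 0ᶠ → c · v ∈ X → v ∈ X
      cancel-· {c} {v} n k with inv c n
      ... | d , p = subst (_∈ X) (trans (sym (*-· d c v)) (trans (cong (_· v) (trans (*ᶠ-comm d c) p)) (1-· v))) (has-· d k)

      shift : ∀ {u v} c → v ∈ X → X (u ⊕ c · v) ≡ X u
      shift c h = bool-ext (cancel-⊕ (has-· c h)) (λ k → has-⊕ k (has-· c h))
    open Sub public

    ∩-sub : ∀ {X Y} → Sub X → Sub Y → Sub (X ∩ Y)
    ∩-sub a b .has-0 = ∧-true (has-0 a) (has-0 b)
    ∩-sub {X} a b .has-⊕ {u} {v} h k =
      ∧-true (has-⊕ a (∧-trueˡ h) (∧-trueˡ k)) (has-⊕ b (∧-trueʳ {X u} h) (∧-trueʳ {X v} k))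
    ∩-sub {X} a b .has-· c {v} h = ∧-true (has-· a c (∧-trueˡ h)) (has-· b c (∧-trueʳ {X v} h))

    opaque
      ⟨_⟩ : V → V → Bool
      ⟨ P ⟩ v = ΣF.some (λ c → v == c · P)

      ⟨⟩-intro : ∀ {P} c → c · P ∈ ⟨ P ⟩
      ⟨⟩-intro {P} c = ΣF.some-intro _ {c} (==-refl (c · P))

      ⟨⟩-elim : ∀ {P v} → v ∈ ⟨ P ⟩ → ∃ λ c → v ≡ c · P
      ⟨⟩-elim h = let c , e = ΣF.some-elim _ h in c , ==-true e

    ⟨⟩-self : ∀ {P} → P ∈ ⟨ P ⟩
    ⟨⟩-self {P} = subst (_∈ ⟨ P ⟩) (1-· P) (⟨⟩-intro 1ᶠ)

    ⟨⟩-sub : ∀ P → Sub ⟨ P ⟩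
    ⟨⟩-sub P .has-0 = subst (_∈ ⟨ P ⟩) (0-· P) (⟨⟩-intro 0ᶠ)
    ⟨⟩-sub P .has-⊕ h k with ⟨⟩-elim h | ⟨⟩-elim k
    ... | a , refl | b , refl = subst (_∈ ⟨ P ⟩) (+-· a b P) (⟨⟩-intro _)
    ⟨⟩-sub P .has-· c h with ⟨⟩-elim h
    ... | a , refl = subst (_∈ ⟨ P ⟩) (*-· c a P) (⟨⟩-intro _)

    ⟨⟩-⊆ : ∀ {P X} → Sub X → P ∈ X → ⟨ P ⟩ ⊆ X
    ⟨⟩-⊆ s h v k with ⟨⟩-elim k
    ... | c , refl = has-· s c h

    ·-injective : ∀ {P a b} → P ≢ 0ᵛ → a · P ≡ b · P → a ≡ b
    ·-injective {P} {a} {b} n e with (a +ᶠ -ᶠ b) ≟ᶠ 0ᶠ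
    ... | yes z = trans (FS.solve 2 (λ a b → a FS.:= b :+ (a :- b)) refl a b) (trans (cong (b +ᶠ_) z) (+ᶠ-identityʳ b))
    ... | no nz = ⊥-elim (n (·-cancel nz (trans
      (vsolve (λ { (a ∷ b ∷ []) (v ∷ []) → (a :- b) :· v , a :· v :⊖ b :· v }) (a ∷ b ∷ []) (P ∷ []) refl)
      (trans (cong (_⊖ (b · P)) e) (⊖-self _)))))

    ∣⟨⟩∣ : ∀ {P} → P ≢ 0ᵛ → ⌈ ⟨ P ⟩ ⌉ ≡ q
    ∣⟨⟩∣ {P} n = begin
      ⌈ ⟨ P ⟩ ⌉                                 ≡⟨ ∑-cong one ⟩
      ∑ (λ v → ∑ᶠ (λ c → [ v == c · P ]))      ≡⟨ ∑-∑ᶠ _ ⟩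
      ∑ᶠ (λ c → ∑ (λ v → [ v == c · P ]))      ≡⟨ ΣF.∑-cong (λ c → ∑-δ1 (c · P)) ⟩
      ∑ᶠ (λ c → 1ℚ)                             ≡⟨ trans (∑ᶠ-const 1ℚ) (*-identityʳ q) ⟩
      q                                         ∎
      where
      one : ∀ v → [ ⟨ P ⟩ v ] ≡ ∑ᶠ (λ c → [ v == c · P ])
      one v with split (⟨ P ⟩ v)
      ... | inj₂ h = trans (cong [_] (¬true h)) (sym (ΣF.∣∣-none (λ c e → h (subst (_∈ ⟨ P ⟩) (sym (==-true e)) (⟨⟩-intro c)))))
      ... | inj₁ h with ⟨⟩-elim h
      ...   | c , refl = trans (cong [_] h) (sym (ΣF.∣∣-unique _ c (==-refl (c · P)) (λ d e → ·-injective n (sym (==-true e)))))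

    ∑-translate : ∀ (f : V → ℚ) y → ∑ (λ v → f (v ⊕ y)) ≡ ∑ f
    ∑-translate f y = ∑-reindex (_⊕ y) (_⊖ y) (λ x → ⊕-⊖ x y) (λ x → ⊖-⊕ x y) f

    -- Averaging along the direction `y`: a count over the whole space is reduced to a count on one
    -- affine line, at the price of a factor `q`.
    ∑-lines : ∀ (f : V → ℚ) y → ∑ (λ v → ∑ᶠ (λ c → f (v ⊕ c · y))) ≡ q * ∑ f
    ∑-lines f y = begin
      ∑ (λ v → ∑ᶠ (λ c → f (v ⊕ c · y)))   ≡⟨ ∑-∑ᶠ _ ⟩
      ∑ᶠ (λ c → ∑ (λ v → f (v ⊕ c · y)))   ≡⟨ ΣF.∑-cong (λ c → ∑-translate f (c · y)) ⟩
      ∑ᶠ (λ c → ∑ f)                       ≡⟨ ∑ᶠ-const _ ⟩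
      q * ∑ f                              ∎

    -- Sums of subspaces

    infixl 6 _⊞_
    opaque
      _⊞_ : (V → Bool) → (V → Bool) → V → Bool
      (X ⊞ Y) v = some (λ y → Y y ∧ X (v ⊖ y))

      ⊞-intro : ∀ {X Y x y} → x ∈ X → y ∈ Y → x ⊕ y ∈ X ⊞ Y
      ⊞-intro {X} {Y} {x} {y} h k = some-intro _ {y} (∧-true k (subst (_∈ X) (sym (⊕-⊖ x y)) h))

      ⊞-elim : ∀ {X Y v} → v ∈ X ⊞ Y → ∃ λ x → ∃ λ y → x ∈ X × y ∈ Y × v ≡ x ⊕ y
      ⊞-elim {X} {Y} {v} h = let y , k = some-elim _ h in
        v ⊖ y , y , ∧-trueʳ {Y y} k , ∧-trueˡ k , sym (⊖-⊕ v y)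

    ⊞-sub : ∀ {X Y} → Sub X → Sub Y → Sub (X ⊞ Y)
    ⊞-sub {X} {Y} a b .has-0 = subst (_∈ X ⊞ Y) (⊕-identityˡ 0ᵛ) (⊞-intro (has-0 a) (has-0 b))
    ⊞-sub {X} {Y} a b .has-⊕ h k with ⊞-elim h | ⊞-elim k
    ... | x , y , hx , hy , refl | x′ , y′ , kx , ky , refl =
      subst (_∈ X ⊞ Y) (VectorSolver.⊕-mid x x′ y y′) (⊞-intro (has-⊕ a hx kx) (has-⊕ b hy ky))
    ⊞-sub {X} {Y} a b .has-· c h with ⊞-elim h
    ... | x , y , hx , hy , refl = subst (_∈ X ⊞ Y) (sym (·-⊕ c x y)) (⊞-intro (has-· a c hx) (has-· b c hy))

    ⊞-⊆ˡ : ∀ {X Y} → Sub Y → X ⊆ X ⊞ Y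
    ⊞-⊆ˡ {X} {Y} b v h = subst (_∈ X ⊞ Y) (⊕-identityʳ v) (⊞-intro h (has-0 b))

    ⊞-⊆ʳ : ∀ {X Y} → Sub X → Y ⊆ X ⊞ Y
    ⊞-⊆ʳ {X} {Y} a v h = subst (_∈ X ⊞ Y) (⊕-identityˡ v) (⊞-intro (has-0 a) h)

    ⊞-⊆ : ∀ {X Y Z} → Sub Z → X ⊆ Z → Y ⊆ Z → X ⊞ Y ⊆ Z
    ⊞-⊆ s a b v h with ⊞-elim h
    ... | x , y , hx , hy , refl = has-⊕ s (a x hx) (b y hy)

    -- The fibres of (x , y) ↦ x ⊕ y over X ⊞ Y are translates of X ∩ Y. This is the dimension
    -- formula in multiplicative form.
    ∣⊞∣ : ∀ {X Y} → Sub X → Sub Y → ⌈ X ⊞ Y ⌉ * ⌈ X ∩ Y ⌉ ≡ ⌈ X ⌉ * ⌈ Y ⌉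
    ∣⊞∣ {X} {Y} a b = sym (begin
      ⌈ X ⌉ * ⌈ Y ⌉                                       ≡⟨ sym (∑-* ⌈ X ⌉ _) ⟩
      ∑ (λ y → ⌈ X ⌉ * [ Y y ])                          ≡⟨ ∑-cong (λ y → cong (_* [ Y y ]) (sym (∑-translate (λ v → [ X v ]) ((-ᶠ 1ᶠ) · y)))) ⟩
      ∑ (λ y → ∑ (λ v → [ X (v ⊖ y) ]) * [ Y y ])        ≡⟨ ∑-cong (λ y → sym (∑-*ʳ [ Y y ] _)) ⟩
      ∑ (λ y → ∑ (λ v → [ X (v ⊖ y) ] * [ Y y ]))        ≡⟨ ∑-swap _ ⟩
      ∑ (λ v → ∑ (λ y → [ X (v ⊖ y) ] * [ Y y ]))        ≡⟨ ∑-cong fibre ⟩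
      ∑ (λ v → [ (X ⊞ Y) v ] * ⌈ X ∩ Y ⌉)                ≡⟨ ∑-*ʳ _ _ ⟩
      ⌈ X ⊞ Y ⌉ * ⌈ X ∩ Y ⌉                               ∎)
      where
      fibre : ∀ v → ∑ (λ y → [ X (v ⊖ y) ] * [ Y y ]) ≡ [ (X ⊞ Y) v ] * ⌈ X ∩ Y ⌉
      fibre v with split ((X ⊞ Y) v)
      ... | inj₂ n = trans (∑-cong (λ y → trans (sym ([]-∧ (X (v ⊖ y)) (Y y))) (cong [_] (¬true (λ e → n (subst (_∈ X ⊞ Y) (⊖-⊕ v y) (⊞-intro (∧-trueˡ e) (∧-trueʳ {X (v ⊖ y)} e))))))))
          (trans (∑ᴸ-0 (Finite.elems vectors)) (sym (trans (cong (λ t → [ t ] * ⌈ X ∩ Y ⌉) (¬true n)) (*-zeroˡ ⌈ X ∩ Y ⌉))))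
      ... | inj₁ h with ⊞-elim h
      ...   | x , y₀ , hx , hy , refl = begin
        ∑ (λ y → [ X ((x ⊕ y₀) ⊖ y) ] * [ Y y ])                  ≡⟨ sym (∑-translate _ y₀) ⟩
        ∑ (λ y → [ X ((x ⊕ y₀) ⊖ (y ⊕ y₀)) ] * [ Y (y ⊕ y₀) ])    ≡⟨ ∑-cong (λ y → trans (sym ([]-∧ (X _) (Y _))) (cong₂ (λ s t → [ s ∧ t ]) (inX y) (inY y))) ⟩
        ⌈ X ∩ Y ⌉                                                   ≡⟨ sym (trans (cong (λ t → [ t ] * ⌈ X ∩ Y ⌉) h) (*-identityˡ _)) ⟩
        [ (X ⊞ Y) (x ⊕ y₀) ] * ⌈ X ∩ Y ⌉                           ∎
        where
        inX : ∀ y → X ((x ⊕ y₀) ⊖ (y ⊕ y₀)) ≡ X y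
        inX y = bool-ext
          (λ k → subst (_∈ X) (vsolve (λ { [] (x ∷ y ∷ z ∷ []) → x :⊖ ((x :⊕ z) :⊖ (y :⊕ z)) , y }) [] (x ∷ y ∷ y₀ ∷ []) refl) (has-⊖ a hx k))
          (λ k → subst (_∈ X) (vsolve (λ { [] (x ∷ y ∷ z ∷ []) → x :⊖ y , (x :⊕ z) :⊖ (y :⊕ z) }) [] (x ∷ y ∷ y₀ ∷ []) refl) (has-⊖ a hx k))
        inY : ∀ y → Y (y ⊕ y₀) ≡ Y y
        inY y = bool-ext (cancel-⊕ b hy) (λ k → has-⊕ b k hy)

    ∣sub∣>0 : ∀ {X} → Sub X → 0ℚ < ⌈ X ⌉
    ∣sub∣>0 {X} s = ∣∣>0 X 0ᵛ (has-0 s)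

    adjoin : ∀ {X v} → Sub X → v ∉ X → ⌈ X ⊞ ⟨ v ⟩ ⌉ ≡ q * ⌈ X ⌉
    adjoin {X} {v} s n = begin
      ⌈ X ⊞ ⟨ v ⟩ ⌉                        ≡⟨ sym (*-identityʳ _) ⟩
      ⌈ X ⊞ ⟨ v ⟩ ⌉ * 1ℚ                   ≡⟨ cong (⌈ X ⊞ ⟨ v ⟩ ⌉ *_) (sym (∣∣-unique _ 0ᵛ (∧-true (has-0 s) (has-0 (⟨⟩-sub v))) trivial)) ⟩
      ⌈ X ⊞ ⟨ v ⟩ ⌉ * ⌈ X ∩ ⟨ v ⟩ ⌉        ≡⟨ ∣⊞∣ s (⟨⟩-sub v) ⟩
      ⌈ X ⌉ * ⌈ ⟨ v ⟩ ⌉                    ≡⟨ cong (⌈ X ⌉ *_) (∣⟨⟩∣ (λ { refl → n (has-0 s) })) ⟩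
      ⌈ X ⌉ * q                            ≡⟨ *-comm _ q ⟩
      q * ⌈ X ⌉                            ∎
      where
      trivial : ∀ x → x ∈ X ∩ ⟨ v ⟩ → x ≡ 0ᵛ
      trivial x h with ⟨⟩-elim (∧-trueʳ {X x} h)
      ... | c , refl with c ≟ᶠ 0ᶠ
      ...   | yes refl = 0-· v
      ...   | no  nz   = ⊥-elim (n (cancel-· s nz (∧-trueˡ h)))

    ⊞⟨⟩-elim : ∀ {X v w} → w ∈ X ⊞ ⟨ v ⟩ → ∃ λ x → ∃ λ c → x ∈ X × w ≡ x ⊕ c · v
    ⊞⟨⟩-elim h with ⊞-elim h
    ... | x , y , hx , hy , refl with ⟨⟩-elim hy
    ...   | c , refl = x , c , hx , refl

    ⊞⟨⟩-intro : ∀ {X v x} c → x ∈ X → x ⊕ c · v ∈ X ⊞ ⟨ v ⟩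
    ⊞⟨⟩-intro c h = ⊞-intro h (⟨⟩-intro c)

    ⊞⟨⟩-self : ∀ {X v} → Sub X → v ∈ X ⊞ ⟨ v ⟩
    ⊞⟨⟩-self {X} {v} s = ⊞-⊆ʳ {X} {⟨ v ⟩} s v ⟨⟩-self

    exchange : ∀ {X u v} → Sub X → u ∉ X → u ∈ X ⊞ ⟨ v ⟩ → v ∈ X ⊞ ⟨ u ⟩
    exchange {X} {u} {v} s n h with ⊞⟨⟩-elim h
    ... | x , c , hx , refl with c ≟ᶠ 0ᶠ
    ...   | yes refl = ⊥-elim (n (subst (_∈ X) (sym (trans (cong (x ⊕_) (0-· v)) (⊕-identityʳ x))) hx))
    ...   | no nz with inv c nz
    ...     | d , p = subst (_∈ X ⊞ ⟨ x ⊕ c · v ⟩)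
      (trans (vsolve (λ { (c ∷ d ∷ []) (x ∷ v ∷ []) → ((:- d) :· x) :⊕ d :· (x :⊕ c :· v) , (c :* d) :· v }) (c ∷ d ∷ []) (x ∷ v ∷ []) refl)
        (trans (cong (_· v) p) (1-· v)))
      (⊞⟨⟩-intro d (has-· s (-ᶠ d) hx))

-- Abstract polar spaces: orthogonality, totally singular subspaces and generators.

module PolarSpaces where

  open import Defs using (FiniteField)
  open import Data.Nat as ℕ using (ℕ; zero; suc)
  import Data.Nat.Properties as ℕP
  open import Data.Rational using (ℚ; 0ℚ; 1ℚ; _<_; _≤_; _+_; _*_; _-_; -_; positive; nonNegative)
  open import Data.Rational.Properties using (*-identityʳ; *-identityˡ; *-zeroˡ; *-zeroʳ; *-comm; *-assoc; +-identityˡ; +-identityʳ; +-comm; ≤-reflexive; ≤-trans; ≤-refl; <-≤-trans; <⇒≤; *-distribˡ-+; *-cancelˡ-<-nonNeg; *-monoʳ-<-pos; _<?_; ≮⇒≥; <-irrefl; ≤-antisym; neg-antimono-≤; +-monoˡ-<; +-monoʳ-<; +-monoˡ-≤; <-trans; neg-antimono-<)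
  open import Data.Product using (∃; _×_; _,_; proj₁; proj₂)
  open import Data.Sum using (_⊎_; inj₁; inj₂)
  open import Data.Empty using (⊥; ⊥-elim)
  open import Data.Vec using ([]; _∷_)
  open import Relation.Nullary using (¬_; yes; no; Dec; does)
  open import Relation.Binary.PropositionalEquality hiding ([_])
  open import Data.List using (List; []; _∷_; length; filter)
  import Data.List.Membership.Propositional as ∈L
  open import Data.List.Relation.Unary.Any as Any using (Any; here; there)
  open import Data.List.Relation.Unary.All as All using (All; []; _∷_)
  open import Data.List.Relation.Unary.AllPairs using (AllPairs; []; _∷_)
  import Data.List.Properties as LP
  import Data.List.Relation.Unary.All.Properties as AllP
  import Data.List.Membership.Propositional.Properties as ∈P
  import Data.Bool.Properties as BP
  open import Data.Fin using (Fin; zero; suc)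
  open import Data.Unit using (⊤; tt)
  open Numbers
  open LinearAlgebra
  open QS using (solve; _:=_; _:+_; _:*_; _:-_; :-_; :0; :1)

  -- Only linearity in the first argument and reflexivity of orthogonality are required of B, so that bilinear and sesquilinear
  -- forms are covered alike. The number s counts the singular vectors on an affine line y + ⟨P⟩ with y not orthogonal to P, and
  -- Qe stands for q^e.
  record Polar {F : FiniteField} (S : Space F) : Set₁ where
    open Subspaces S
    field
      B      : V → V → 𝔽
      B-⊕    : ∀ u v w → B (u ⊕ v) w ≡ B u w +ᶠ B v w
      B-·    : ∀ c u w → B (c · u) w ≡ c *ᶠ B u w
      B-refl : ∀ {u v} → B u v ≡ 0ᶠ → B v u ≡ 0ᶠ
      Sing   : V → Bool
      Sing-0 : 0ᵛ ∈ Sing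
      Sing-· : ∀ c {v} → v ∈ Sing → c · v ∈ Sing
      Sing-⊕ : ∀ {u v} → u ∈ Sing → v ∈ Sing → B u v ≡ 0ᶠ → u ⊕ v ∈ Sing
      Sing-B : ∀ {v} → v ∈ Sing → B v v ≡ 0ᶠ
      nondeg : ∀ {u} → u ∈ Sing → (∀ v → B v u ≡ 0ᶠ) → u ≡ 0ᵛ
      s      : ℚ
      s-line : ∀ {y P} → P ∈ Sing → B y P ≢ 0ᶠ → ∑ᶠ (λ c → [ Sing (y ⊕ c · P) ]) ≡ s
      d      : ℕ
      Qe     : ℚ
      Qe>0   : 0ℚ < Qe
      -- In every family q^n s = q^(2d+e) with n the vector space dimension: s is 1 for the
      -- quadrics, q for W and the square root of q for the Hermitian spaces.
      size   : ⌈ (λ _ → true) ⌉ * s ≡ Qe * (q ^^ d * q ^^ d)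
      -- A single maximal totally singular subspace takes the place of Witt's theorem; `extend`
      -- derives from it that every totally singular subspace lies in one of the same size.
      G₀     : V → Bool
      G₀-sub  : Sub G₀
      G₀-sing : G₀ ⊆ Sing
      G₀-iso  : ∀ {u v} → u ∈ G₀ → v ∈ G₀ → B u v ≡ 0ᶠ
      G₀-size : ⌈ G₀ ⌉ ≡ q ^^ d
      G₀-max  : ∀ {v} → v ∈ Sing → (∀ {u} → u ∈ G₀ → B v u ≡ 0ᶠ) → v ∈ G₀

  module PolarTheory {F : FiniteField} {S : Space F} (𝒫 : Polar S) where
    open Subspaces S public
    open Polar 𝒫 public
    open ≡-Reasoning

    B-0 : ∀ w → B 0ᵛ w ≡ 0ᶠ
    B-0 w = trans (cong (λ t → B t w) (sym (0-· 0ᵛ))) (trans (B-· 0ᶠ 0ᵛ w) (*ᶠ-zeroˡ _))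

    ⊥-⊕ : ∀ {u v w} → B u w ≡ 0ᶠ → B v w ≡ 0ᶠ → B (u ⊕ v) w ≡ 0ᶠ
    ⊥-⊕ {u} {v} {w} h k = trans (B-⊕ u v w) (trans (cong₂ _+ᶠ_ h k) (+ᶠ-identityʳ 0ᶠ))

    ⊥-· : ∀ c {u w} → B u w ≡ 0ᶠ → B (c · u) w ≡ 0ᶠ
    ⊥-· c {u} {w} h = trans (B-· c u w) (trans (cong (c *ᶠ_) h) (*ᶠ-zeroʳ c))

    ⊥-⊕ʳ : ∀ {u v w} → B w u ≡ 0ᶠ → B w v ≡ 0ᶠ → B w (u ⊕ v) ≡ 0ᶠ
    ⊥-⊕ʳ h k = B-refl (⊥-⊕ (B-refl h) (B-refl k))

    ⊥-·ʳ : ∀ c {u w} → B w u ≡ 0ᶠ → B w (c · u) ≡ 0ᶠ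
    ⊥-·ʳ c h = B-refl (⊥-· c (B-refl h))

    opaque
      perp : V → V → Bool
      perp P v = B v P ΣF.== 0ᶠ

      perp-intro : ∀ {P v} → B v P ≡ 0ᶠ → v ∈ perp P
      perp-intro {P} {v} = does-true (B v P ≟ᶠ 0ᶠ)

      perp-elim : ∀ {P v} → v ∈ perp P → B v P ≡ 0ᶠ
      perp-elim = ΣF.==-true

      perp-== : ∀ P v → perp P v ≡ (B v P ΣF.== 0ᶠ)
      perp-== P v = refl

      Perp : (V → Bool) → V → Bool
      Perp X v = X ⊆ᵇ perp v

      Perp-intro : ∀ {X v} → (∀ {x} → x ∈ X → B v x ≡ 0ᶠ) → v ∈ Perp X
      Perp-intro {X} {v} h = ⊆ᵇ-intro {X} (λ x k → perp-intro (B-refl (h k)))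

      Perp-elim : ∀ {X v} → v ∈ Perp X → ∀ {x} → x ∈ X → B v x ≡ 0ᶠ
      Perp-elim {X} h {x} k = B-refl (perp-elim (⊆ᵇ-elim {X} h x k))

      Perp-or : ∀ X v → v ∈ Perp X ⊎ ∃ λ x → x ∈ X × B x v ≢ 0ᶠ
      Perp-or X v with ⊆-or X (perp v)
      ... | inj₁ h = inj₁ (⊆ᵇ-intro {X} h)
      ... | inj₂ (x , h , n) = inj₂ (x , h , λ e → n (perp-intro e))

    perp-sym : ∀ u v → perp u v ≡ perp v u
    perp-sym u v = bool-ext (λ h → perp-intro (B-refl (perp-elim h))) (λ h → perp-intro (B-refl (perp-elim h)))

    perp-sub : ∀ P → Sub (perp P)
    perp-sub P .has-0 = perp-intro (B-0 P)
    perp-sub P .has-⊕ h k = perp-intro (⊥-⊕ (perp-elim h) (perp-elim k))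
    perp-sub P .has-· c h = perp-intro (⊥-· c (perp-elim h))

    Perp-sub : ∀ X → Sub (Perp X)
    Perp-sub X .has-0 = Perp-intro (λ k → B-0 _)
    Perp-sub X .has-⊕ h k = Perp-intro (λ m → ⊥-⊕ (Perp-elim h m) (Perp-elim k m))
    Perp-sub X .has-· c h = Perp-intro (λ m → ⊥-· c (Perp-elim h m))

    Perp-⟨⟩ : ∀ P v → Perp ⟨ P ⟩ v ≡ perp P v
    Perp-⟨⟩ P v = bool-ext (λ h → perp-intro (Perp-elim h ⟨⟩-self))
      (λ h → Perp-intro (λ k → let c , e = ⟨⟩-elim k in subst (λ t → B v t ≡ 0ᶠ) (sym e) (⊥-·ʳ c (perp-elim h))))

    Perp-⊞ : ∀ {X Y} → Sub X → Sub Y → ∀ v → Perp (X ⊞ Y) v ≡ Perp X v ∧ Perp Y v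
    Perp-⊞ {X} {Y} a b v = bool-ext
      (λ h → ∧-true (Perp-intro (λ k → Perp-elim h (⊞-⊆ˡ {X} {Y} b _ k))) (Perp-intro (λ k → Perp-elim h (⊞-⊆ʳ {X} {Y} a _ k))))
      (λ h → Perp-intro (λ k → let x , y , hx , hy , e = ⊞-elim k in
         subst (λ t → B v t ≡ 0ᶠ) (sym e) (⊥-⊕ʳ (Perp-elim (∧-trueˡ h) hx) (Perp-elim (∧-trueʳ {Perp X v} h) hy))))

    Perp-⊞⟨⟩ : ∀ {X P} → Sub X → ∀ v → Perp (X ⊞ ⟨ P ⟩) v ≡ Perp X v ∧ perp P v
    Perp-⊞⟨⟩ {X} {P} a v = trans (Perp-⊞ a (⟨⟩-sub P) v) (cong (Perp X v ∧_) (Perp-⟨⟩ P v))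

    B-line : ∀ v c y P → B (v ⊕ c · y) P ≡ B v P +ᶠ c *ᶠ B y P
    B-line v c y P = trans (B-⊕ v (c · y) P) (cong (B v P +ᶠ_) (B-· c y P))

    -- On each line of X with direction `y` the function B(-,P) is affine of nonzero slope, so the
    -- line meets `perp P` exactly once.
    hyperplane : ∀ {X y P} → Sub X → y ∈ X → B y P ≢ 0ᶠ → q * ⌈ X ∩ perp P ⌉ ≡ ⌈ X ⌉
    hyperplane {X} {y} {P} sX h n = begin
      q * ⌈ X ∩ perp P ⌉                                              ≡⟨ sym (∑-lines (λ v → [ X v ∧ perp P v ]) y) ⟩
      ∑ (λ v → ∑ᶠ (λ c → [ X (v ⊕ c · y) ∧ perp P (v ⊕ c · y) ]))     ≡⟨ ∑-cong line ⟩
      ⌈ X ⌉                                                           ∎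
      where
      line : ∀ v → ∑ᶠ (λ c → [ X (v ⊕ c · y) ∧ perp P (v ⊕ c · y) ]) ≡ [ X v ]
      line v = begin
        ∑ᶠ (λ c → [ X (v ⊕ c · y) ∧ perp P (v ⊕ c · y) ])
          ≡⟨ ΣF.∑-cong (λ c → trans (cong₂ (λ a b → [ a ∧ b ]) (shift sX c h) (trans (perp-== P _) (cong (ΣF._== 0ᶠ) (B-line v c y P)))) ([]-∧ (X v) _)) ⟩
        ∑ᶠ (λ c → [ X v ] * [ (B v P +ᶠ c *ᶠ B y P) ΣF.== 0ᶠ ])       ≡⟨ ΣF.∑-* [ X v ] _ ⟩
        [ X v ] * ∑ᶠ (λ c → [ (B v P +ᶠ c *ᶠ B y P) ΣF.== 0ᶠ ])       ≡⟨ cong ([ X v ] *_) (one-root (B v P) (B y P) n) ⟩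
        [ X v ] * 1ℚ                                                  ≡⟨ *-identityʳ _ ⟩
        [ X v ]                                                       ∎

    -- Counted along the lines with direction P.
    off-hyperplane : ∀ {X P t} (Z : V → Bool) → Sub X → P ∈ X → B P P ≡ 0ᶠ →
                     (∀ {y} → y ∈ X → B y P ≢ 0ᶠ → ∑ᶠ (λ c → [ Z (y ⊕ c · P) ]) ≡ t) →
                     q * ⌈ (X ∖ perp P) ∩ Z ⌉ ≡ t * (⌈ X ⌉ - ⌈ X ∩ perp P ⌉)
    off-hyperplane {X} {P} {t} Z sX h PP lines = begin
      q * ⌈ (X ∖ perp P) ∩ Z ⌉                                              ≡⟨ sym (∑-lines (λ v → [ ((X ∖ perp P) ∩ Z) v ]) P) ⟩
      ∑ (λ v → ∑ᶠ (λ c → [ ((X ∖ perp P) ∩ Z) (v ⊕ c · P) ]))               ≡⟨ ∑-cong line ⟩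
      ∑ (λ v → t * [ (X ∖ perp P) v ])                                      ≡⟨ ∑-* t _ ⟩
      t * ⌈ X ∖ perp P ⌉                                                    ≡⟨ cong (t *_) (trans (sym (solve 2 (λ a b → a :+ b :- a := b) refl ⌈ X ∩ perp P ⌉ ⌈ X ∖ perp P ⌉)) (cong (_- ⌈ X ∩ perp P ⌉) (sym (∣∣-split X (perp P))))) ⟩
      t * (⌈ X ⌉ - ⌈ X ∩ perp P ⌉)                                          ∎
      where
      line : ∀ v → ∑ᶠ (λ c → [ ((X ∖ perp P) ∩ Z) (v ⊕ c · P) ]) ≡ t * [ (X ∖ perp P) v ]
      line v = begin
        ∑ᶠ (λ c → [ ((X ∖ perp P) ∩ Z) (v ⊕ c · P) ])
          ≡⟨ ΣF.∑-cong (λ c → trans ([]-∧ ((X ∖ perp P) (v ⊕ c · P)) _) (cong (λ b → [ b ] * [ Z (v ⊕ c · P) ])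
               (cong₂ _∧_ (shift sX c h) (cong not (shift (perp-sub P) c (perp-intro PP)))))) ⟩
        ∑ᶠ (λ c → [ (X ∖ perp P) v ] * [ Z (v ⊕ c · P) ])                ≡⟨ ΣF.∑-* [ (X ∖ perp P) v ] _ ⟩
        [ (X ∖ perp P) v ] * ∑ᶠ (λ c → [ Z (v ⊕ c · P) ])                ≡⟨ []-guard ((X ∖ perp P) v) (λ e → lines (∧-trueˡ e) (λ z → true-not (∧-trueʳ {X v} e) (perp-intro z))) ⟩
        [ (X ∖ perp P) v ] * t                                           ≡⟨ *-comm _ t ⟩
        t * [ (X ∖ perp P) v ]                                           ∎

    -- The two cases, X ⊆ u⊥ and X ∩ u⊥ a hyperplane of X, are merged into one formula so that it
    -- can be summed over `u`.
    perp-count : ∀ {X} → Sub X → ∀ u → q * ⌈ X ∩ perp u ⌉ ≡ ⌈ X ⌉ * (1ℚ + (q - 1ℚ) * [ Perp X u ])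
    perp-count {X} sX u with Perp-or X u
    ... | inj₁ h = trans (cong (q *_) (∣∣-cong {X ∩ perp u} {X} (λ x → bool-ext ∧-trueˡ (λ k → ∧-true k (perp-intro (B-refl (Perp-elim h k)))))))
          (trans (solve 2 (λ a b → a :* b := b :* (:1 :+ (a :- :1) :* :1)) refl q ⌈ X ⌉) (cong (λ b → ⌈ X ⌉ * (1ℚ + (q - 1ℚ) * [ b ])) (sym h)))
    ... | inj₂ (x , h , n) = trans (hyperplane sX h n)
          (trans (solve 2 (λ a b → b := b :* (:1 :+ (a :- :1) :* :0)) refl q ⌈ X ⌉)
            (cong (λ b → ⌈ X ⌉ * (1ℚ + (q - 1ℚ) * [ b ])) (sym (¬true (λ k → n (B-refl (Perp-elim k h)))))))

    -- Both sides arise from counting the orthogonal pairs in X × Y.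
    duality : ∀ {X Y} → Sub X → Sub Y → ⌈ X ∩ Perp Y ⌉ * ⌈ Y ⌉ ≡ ⌈ Y ∩ Perp X ⌉ * ⌈ X ⌉
    duality {X} {Y} sX sY = cancel≡ (q - 1ℚ) 0<q-1 (begin
      (q - 1ℚ) * (⌈ X ∩ Perp Y ⌉ * ⌈ Y ⌉)
        ≡⟨ solve 4 (λ q a b c → (q :- :1) :* (a :* b) := b :* (c :+ (q :- :1) :* a) :- c :* b) refl q ⌈ X ∩ Perp Y ⌉ ⌈ Y ⌉ ⌈ X ⌉ ⟩
      ⌈ Y ⌉ * (⌈ X ⌉ + (q - 1ℚ) * ⌈ X ∩ Perp Y ⌉) - ⌈ X ⌉ * ⌈ Y ⌉
        ≡⟨ cong (_- ⌈ X ⌉ * ⌈ Y ⌉) (trans (sym (pairs sY X)) (trans (cong (q *_) swap) (pairs sX Y))) ⟩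
      ⌈ X ⌉ * (⌈ Y ⌉ + (q - 1ℚ) * ⌈ Y ∩ Perp X ⌉) - ⌈ X ⌉ * ⌈ Y ⌉
        ≡⟨ solve 4 (λ q a b c → c :* (b :+ (q :- :1) :* a) :- c :* b := (q :- :1) :* (a :* c)) refl q ⌈ Y ∩ Perp X ⌉ ⌈ Y ⌉ ⌈ X ⌉ ⟩
      (q - 1ℚ) * (⌈ Y ∩ Perp X ⌉ * ⌈ X ⌉) ∎)
      where
      pairs : ∀ {Y} → Sub Y → ∀ X → q * ∑ (λ x → [ X x ] * ⌈ Y ∩ perp x ⌉) ≡ ⌈ Y ⌉ * (⌈ X ⌉ + (q - 1ℚ) * ⌈ X ∩ Perp Y ⌉)
      pairs {Y} sY X = begin
        q * ∑ (λ x → [ X x ] * ⌈ Y ∩ perp x ⌉)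
          ≡⟨ sym (∑-* q _) ⟩
        ∑ (λ x → q * ([ X x ] * ⌈ Y ∩ perp x ⌉))
          ≡⟨ ∑-cong (λ x → trans (solve 3 (λ q a b → q :* (a :* b) := a :* (q :* b)) refl q [ X x ] ⌈ Y ∩ perp x ⌉)
               (trans (cong ([ X x ] *_) (perp-count sY x))
               (trans (solve 4 (λ a y q p → a :* (y :* (:1 :+ (q :- :1) :* p)) := y :* (a :+ (q :- :1) :* (a :* p))) refl [ X x ] ⌈ Y ⌉ q [ Perp Y x ])
                 (cong (λ t → ⌈ Y ⌉ * ([ X x ] + (q - 1ℚ) * t)) (sym ([]-∧ (X x) (Perp Y x))))))) ⟩
        ∑ (λ x → ⌈ Y ⌉ * ([ X x ] + (q - 1ℚ) * [ (X ∩ Perp Y) x ]))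
          ≡⟨ ∑-* ⌈ Y ⌉ _ ⟩
        ⌈ Y ⌉ * ∑ (λ x → [ X x ] + (q - 1ℚ) * [ (X ∩ Perp Y) x ])
          ≡⟨ cong (⌈ Y ⌉ *_) (trans (∑-+ (λ x → [ X x ]) (λ x → (q - 1ℚ) * [ (X ∩ Perp Y) x ])) (cong (⌈ X ⌉ +_) (∑-* (q - 1ℚ) _))) ⟩
        ⌈ Y ⌉ * (⌈ X ⌉ + (q - 1ℚ) * ⌈ X ∩ Perp Y ⌉) ∎
      swap : ∑ (λ x → [ X x ] * ⌈ Y ∩ perp x ⌉) ≡ ∑ (λ y → [ Y y ] * ⌈ X ∩ perp y ⌉)
      swap = begin
        ∑ (λ x → [ X x ] * ⌈ Y ∩ perp x ⌉)             ≡⟨ ∑-cong (λ x → sym (∑-* [ X x ] _)) ⟩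
        ∑ (λ x → ∑ (λ y → [ X x ] * [ Y y ∧ perp x y ])) ≡⟨ ∑-swap _ ⟩
        ∑ (λ y → ∑ (λ x → [ X x ] * [ Y y ∧ perp x y ])) ≡⟨ ∑-cong (λ y → trans (∑-cong (λ x →
            trans (cong ([ X x ] *_) (trans ([]-∧ (Y y) _) (cong (λ b → [ Y y ] * [ b ]) (perp-sym x y))))
            (trans (solve 3 (λ a b c → a :* (b :* c) := b :* (a :* c)) refl [ X x ] [ Y y ] [ perp y x ])
              (cong ([ Y y ] *_) (sym ([]-∧ (X x) _)))))) (∑-* [ Y y ] _)) ⟩
        ∑ (λ y → [ Y y ] * ⌈ X ∩ perp y ⌉)             ∎

    -- Totally singular subspaces and generators

    record TS (X : V → Bool) : Set where
      field
        sub  : Sub X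
        sing : X ⊆ Sing
        iso  : ∀ {u v} → u ∈ X → v ∈ X → B u v ≡ 0ᶠ
    open TS public

    record Gen (X : V → Bool) : Set where
      field
        ts    : TS X
        ∣gen∣ : ⌈ X ⌉ ≡ q ^^ d
    open Gen public

    total : ℚ
    total = ⌈ (λ _ → true) ⌉

    TS-0 : TS ⟨ 0ᵛ ⟩
    TS-0 = record { sub = ⟨⟩-sub 0ᵛ ; sing = λ v h → subst (_∈ Sing) (sym (zero-only h)) Sing-0
                  ; iso = λ h k → subst (λ t → B t _ ≡ 0ᶠ) (sym (zero-only h)) (B-0 _) }
      where
      zero-only : ∀ {v} → v ∈ ⟨ 0ᵛ ⟩ → v ≡ 0ᵛ
      zero-only h = let c , e = ⟨⟩-elim h in trans e (·-0ᵛ c)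

    TS-⟨⟩ : ∀ {P} → P ∈ Sing → TS ⟨ P ⟩
    TS-⟨⟩ {P} h = record { sub = ⟨⟩-sub P
      ; sing = λ v k → let c , e = ⟨⟩-elim k in subst (_∈ Sing) (sym e) (Sing-· c h)
      ; iso = λ k m → let a , e = ⟨⟩-elim k ; b , f = ⟨⟩-elim m in subst₂ (λ x y → B x y ≡ 0ᶠ) (sym e) (sym f) (⊥-· a (⊥-·ʳ b (Sing-B h))) }

    TS-⊞ : ∀ {X Y} → TS X → TS Y → (∀ {x y} → x ∈ X → y ∈ Y → B x y ≡ 0ᶠ) → TS (X ⊞ Y)
    TS-⊞ {X} {Y} a b o = record { sub = ⊞-sub (sub a) (sub b)
      ; sing = λ v h → let x , y , hx , hy , e = ⊞-elim h in subst (_∈ Sing) (sym e) (Sing-⊕ (sing a x hx) (sing b y hy) (o hx hy))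
      ; iso = λ h k → let x , y , hx , hy , e = ⊞-elim h ; x′ , y′ , kx , ky , f = ⊞-elim k in
          subst₂ (λ s t → B s t ≡ 0ᶠ) (sym e) (sym f)
            (⊥-⊕ (⊥-⊕ʳ (iso a hx kx) (o hx ky)) (⊥-⊕ʳ (B-refl (o kx hy)) (iso b hy ky))) }

    TS-⊞⟨⟩ : ∀ {X v} → TS X → v ∈ Sing → v ∈ Perp X → TS (X ⊞ ⟨ v ⟩)
    TS-⊞⟨⟩ {X} {v} a h k = TS-⊞ a (TS-⟨⟩ h) (λ hx hy → let c , e = ⟨⟩-elim hy in
      subst (λ t → B _ t ≡ 0ᶠ) (sym e) (⊥-·ʳ c (B-refl (Perp-elim k hx))))

    TS-∩ : ∀ {X Y} → TS X → Sub Y → TS (X ∩ Y)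
    TS-∩ {X} a b = record { sub = ∩-sub (sub a) b ; sing = λ v h → sing a v (∧-trueˡ h) ; iso = λ h k → iso a (∧-trueˡ h) (∧-trueˡ k) }

    TS-⊆Perp : ∀ {X} → TS X → X ⊆ Perp X
    TS-⊆Perp a v h = Perp-intro (λ k → iso a h k)

    -- Duality against the whole space. The form may have a radical, as for Q(2d,q) in
    -- characteristic 2, but `nondeg` keeps nonzero singular vectors out of it, so X meets it only
    -- in 0.
    TS-perp-size : ∀ {X} → TS X → ⌈ Perp X ⌉ * ⌈ X ⌉ ≡ total
    TS-perp-size {X} a = trans (duality {λ _ → true} {X} record { has-0 = refl ; has-⊕ = λ _ _ → refl ; has-· = λ _ _ → refl } (sub a))
                          (trans (cong (_* total) radical) (*-identityˡ total))
      where
      radical : ⌈ X ∩ Perp (λ _ → true) ⌉ ≡ 1ℚ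
      radical = ∣∣-unique _ 0ᵛ (∧-true (has-0 (sub a)) (has-0 (Perp-sub _)))
        (λ x h → nondeg (sing a x (∧-trueˡ h)) (λ v → B-refl (Perp-elim (∧-trueʳ {X x} h) refl)))

    G₀-gen : Gen G₀
    G₀-gen = record { ts = record { sub = G₀-sub ; sing = G₀-sing ; iso = G₀-iso } ; ∣gen∣ = G₀-size }

    -- Maximality of `G₀` replaces X ∩ G₀⊥ by X ∩ G₀ on one side of `duality`.
    duality-swap : ∀ {X} → TS X → ⌈ G₀ ∩ Perp X ⌉ * ⌈ X ⌉ ≡ ⌈ X ∩ G₀ ⌉ * ⌈ G₀ ⌉
    duality-swap {X} a = trans (duality G₀-sub (sub a)) (cong (_* ⌈ G₀ ⌉) (∣∣-cong {X ∩ Perp G₀} {X ∩ G₀} (λ v → bool-ext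
      (λ h → ∧-true (∧-trueˡ h) (G₀-max (sing a v (∧-trueˡ h)) (Perp-elim (∧-trueʳ {X v} h))))
      (λ h → ∧-true (∧-trueˡ h) (TS-⊆Perp (ts G₀-gen) v (∧-trueʳ {X v} h))))))

    opaque
      -- The generator is X + (G₀ ∩ X⊥). Since X ∩ G₀ ∩ X⊥ = X ∩ G₀, the formula for sums of
      -- subspaces and `duality-swap` give it the size of `G₀`.
      extend : ∀ {X} → TS X → ∃ λ K → Gen K × X ⊆ K
      extend {X} a = K , record { ts = TS-⊞ a inG (λ hx hy → B-refl (Perp-elim (∧-trueʳ {G₀ _} hy) hx)) ; ∣gen∣ = trans eq G₀-size } ,
                     ⊞-⊆ˡ (sub inG)
        where
        Y : V → Bool
        Y = G₀ ∩ Perp X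
        inG : TS Y
        inG = TS-∩ (ts G₀-gen) (Perp-sub X)
        K : V → Bool
        K = X ⊞ Y
        meet : ⌈ X ∩ Y ⌉ ≡ ⌈ X ∩ G₀ ⌉
        meet = ∣∣-cong {X ∩ Y} {X ∩ G₀} (λ v → bool-ext (λ h → ∧-true {X v} (∧-trueˡ h) (∧-trueˡ {G₀ v} (∧-trueʳ {X v} h)))
          (λ h → ∧-true {X v} (∧-trueˡ h) (∧-true {G₀ v} (∧-trueʳ {X v} h) (TS-⊆Perp a v (∧-trueˡ h)))))
        eq : ⌈ K ⌉ ≡ ⌈ G₀ ⌉
        eq = cancel≡ ⌈ X ∩ G₀ ⌉ (∣sub∣>0 (∩-sub (sub a) G₀-sub)) (begin
          ⌈ X ∩ G₀ ⌉ * ⌈ K ⌉     ≡⟨ *-comm _ ⌈ K ⌉ ⟩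
          ⌈ K ⌉ * ⌈ X ∩ G₀ ⌉     ≡⟨ cong (⌈ K ⌉ *_) (sym meet) ⟩
          ⌈ K ⌉ * ⌈ X ∩ Y ⌉      ≡⟨ ∣⊞∣ (sub a) (sub inG) ⟩
          ⌈ X ⌉ * ⌈ Y ⌉          ≡⟨ *-comm ⌈ X ⌉ ⌈ Y ⌉ ⟩
          ⌈ Y ⌉ * ⌈ X ⌉          ≡⟨ duality-swap a ⟩
          ⌈ X ∩ G₀ ⌉ * ⌈ G₀ ⌉    ∎)

    q^d>0 : 0ℚ < q ^^ d
    q^d>0 = ^^>0 d 0<q

    <q* : ∀ {a} → 0ℚ < a → a < q * a
    <q* {a} h = subst₂ _<_ (*-identityʳ a) (*-comm a q) (*-monoʳ-<-pos a {{Data.Rational.positive h}} 1<q)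

    TS-size≤ : ∀ {X} → TS X → ⌈ X ⌉ ≤ q ^^ d
    TS-size≤ {X} a = let K , g , incl = extend a in subst (⌈ X ⌉ ≤_) (∣gen∣ g) (∣∣-mono incl)

    gen-max : ∀ {K v} → Gen K → v ∈ Sing → v ∈ Perp K → v ∈ K
    gen-max {K} {v} g h k with split (K v)
    ... | inj₁ e = e
    ... | inj₂ n = ⊥-elim (≤<-⊥ (TS-size≤ (TS-⊞⟨⟩ (ts g) h k)) bigger)
      where
      bigger : q ^^ d < ⌈ K ⊞ ⟨ v ⟩ ⌉
      bigger = subst₂ _<_ (∣gen∣ g) (sym (adjoin (sub (ts g)) n)) (<q* (∣sub∣>0 (sub (ts g))))

    gen-perp : ∀ {K} → Gen K → ∀ v → Sing v ∧ Perp K v ≡ K v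
    gen-perp {K} g v = bool-ext (λ h → gen-max g (∧-trueˡ h) (∧-trueʳ {Sing v} h)) (λ h → ∧-true (sing (ts g) v h) (TS-⊆Perp (ts g) v h))

    gen-⊆ : ∀ {K M} → Gen K → Gen M → K ⊆ M → M ⊆ K
    gen-⊆ a b h = ⊆-full h (≤-reflexive (trans (∣gen∣ b) (sym (∣gen∣ a))))

    -- For a singular `v` outside a generator `K` this is the unique generator through `v` that
    -- meets `K` in a hyperplane.
    proj : V → (V → Bool) → V → Bool
    proj v K = (K ∩ perp v) ⊞ ⟨ v ⟩

    hyperplane-size : ∀ {K v} → Gen K → v ∈ Sing → v ∉ K → q * ⌈ K ∩ perp v ⌉ ≡ ⌈ K ⌉
    hyperplane-size {K} {v} g h n with Perp-or K v
    ... | inj₁ k = ⊥-elim (n (gen-max g h k))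
    ... | inj₂ (y , k , m) = hyperplane (sub (ts g)) k m

    proj-gen : ∀ {K v} → Gen K → v ∈ Sing → v ∉ K → Gen (proj v K)
    proj-gen {K} {v} g h n = record
      { ts = TS-⊞⟨⟩ (TS-∩ (ts g) (perp-sub v)) h (Perp-intro (λ {x} k → B-refl (perp-elim (∧-trueʳ {K x} k))))
      ; ∣gen∣ = trans (adjoin (∩-sub (sub (ts g)) (perp-sub v)) (λ e → n (∧-trueˡ e))) (trans (hyperplane-size g h n) (∣gen∣ g)) }

    proj-∋ : ∀ {K v} → Gen K → v ∈ proj v K
    proj-∋ {K} {v} g = ⊞⟨⟩-self (∩-sub (sub (ts g)) (perp-sub v))

    ∩perp⊆proj : ∀ K v → K ∩ perp v ⊆ proj v K
    ∩perp⊆proj K v = ⊞-⊆ˡ (⟨⟩-sub v)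

    -- Induction on the codimension m of X in a generator, splitting off a vector of such a generator.
    residue-count : ∀ m k {X} → k ℕ.+ m ≡ d → TS X → ⌈ X ⌉ ≡ q ^^ k →
                    q * ⌈ (Sing ∩ Perp X) ∖ X ⌉ ≡ (q ^^ m - 1ℚ) * (q * q ^^ k + Qe * q ^^ d)
    residue-count zero k {X} e a z = begin
      q * ⌈ (Sing ∩ Perp X) ∖ X ⌉                   ≡⟨ cong (q *_) (∣∣-none λ v h → true-not (∧-trueʳ {(Sing ∩ Perp X) v} h)
                                                         (gen-max g (∧-trueˡ (∧-trueˡ h)) (∧-trueʳ {Sing v} (∧-trueˡ h)))) ⟩
      q * 0ℚ                                        ≡⟨ solve 2 (λ q t → q :* :0 := (:1 :- :1) :* t) refl q (q * q ^^ k + Qe * q ^^ d) ⟩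
      (1ℚ - 1ℚ) * (q * q ^^ k + Qe * q ^^ d)        ∎
      where
      g : Gen X
      g = record { ts = a ; ∣gen∣ = trans z (cong (q ^^_) (trans (sym (ℕP.+-identityʳ k)) e)) }
    residue-count (suc m) k {X} e a z with extend a
    ... | K , gK , X⊆K with outside {K} {X} (subst₂ _<_ (sym z) (sym (trans (∣gen∣ gK) (cong (q ^^_) (sym (trans (sym (ℕP.+-suc k m)) e))))) lt)
      where
      lt : q ^^ k < q ^^ (suc (k ℕ.+ m))
      lt = <-≤-trans (<q* (^^>0 k 0<q)) (mul≤ q (<⇒≤ 0<q) (subst (q ^^ k ≤_) (sym (^^-+ q k m)) (k≤ m)))
        where
        k≤ : ∀ m → q ^^ k ≤ q ^^ k * q ^^ m
        k≤ zero = ≤-reflexive (sym (*-identityʳ _))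
        k≤ (suc m) = ≤-trans (k≤ m) (mul≤ (q ^^ k) (<⇒≤ (^^>0 k 0<q)) (<⇒≤ (<q* (^^>0 m 0<q))))
    -- `P` is taken from a generator over X. The singular vectors of X⊥ inside `perp P` belong to X′
    -- = X + ⟨P⟩, whose residue has rank one less; the others are counted along lines with direction
    -- `P`. Divided by q, the result is q^k (q^r - 1)(q^(r+e-1) + 1), where r = m + 1 is the rank of
    -- the residue of X.
    ...   | P , PK , P∉X = begin
      q * ⌈ (Sing ∩ Perp X) ∖ X ⌉
        ≡⟨ cong (q *_) count ⟩
      q * (c′ + q * D + off - D)
        ≡⟨ solve 4 (λ q c D o → q :* (c :+ q :* D :+ o :- D) := q :* c :+ q :* q :* D :+ q :* o :- q :* D) refl q c′ D off ⟩
      q * c′ + q * q * D + q * off - q * D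
        ≡⟨ cong₂ (λ s t → s + q * q * D + t - q * D) ih off-eq ⟩
      (M - 1ℚ) * (q * (q * D) + Qe * q ^^ d) + q * q * D + (q - 1ℚ) * Qe * q * M * M * D - q * D
        ≡⟨ cong (λ t → (M - 1ℚ) * (q * (q * D) + Qe * t) + q * q * D + (q - 1ℚ) * Qe * q * M * M * D - q * D) qd ⟩
      (M - 1ℚ) * (q * (q * D) + Qe * (D * (q * M))) + q * q * D + (q - 1ℚ) * Qe * q * M * M * D - q * D
        ≡⟨ solve 4 (λ q M D Qe → (M :- :1) :* (q :* (q :* D) :+ Qe :* (D :* (q :* M))) :+ q :* q :* D :+ (q :- :1) :* Qe :* q :* M :* M :* D :- q :* D
                     := (q :* M :- :1) :* (q :* D :+ Qe :* (D :* (q :* M)))) refl q M D Qe ⟩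
      (q * M - 1ℚ) * (q * D + Qe * (D * (q * M)))
        ≡⟨ cong (λ t → (q * M - 1ℚ) * (q * D + Qe * t)) (sym qd) ⟩
      (q * M - 1ℚ) * (q * D + Qe * q ^^ d) ∎
      where
      M D c′ off : ℚ
      M = q ^^ m
      D = q ^^ k
      X′ : V → Bool
      X′ = X ⊞ ⟨ P ⟩
      a′ : TS X′
      a′ = TS-⊞⟨⟩ a (sing (ts gK) P PK) (Perp-intro (λ h → iso (ts gK) PK (X⊆K _ h)))
      c′ = ⌈ (Sing ∩ Perp X′) ∖ X′ ⌉
      off = ⌈ (Perp X ∖ perp P) ∩ Sing ⌉
      z′ : ⌈ X′ ⌉ ≡ q * D
      z′ = trans (adjoin (sub a) P∉X) (cong (q *_) z)
      qd : q ^^ d ≡ D * (q * M)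
      qd = trans (cong (q ^^_) (sym e)) (^^-+ q k (suc m))
      ih : q * c′ ≡ (M - 1ℚ) * (q * (q * D) + Qe * q ^^ d)
      ih = residue-count m (suc k) (trans (sym (ℕP.+-suc k m)) e) a′ z′
      P∈ : P ∈ Perp X
      P∈ = Perp-intro (λ h → iso (ts gK) PK (X⊆K _ h))
      P-sing : P ∈ Sing
      P-sing = sing (ts gK) P PK
      meet : ⌈ Perp X ∩ perp P ⌉ ≡ ⌈ Perp X′ ⌉
      meet = ∣∣-cong (λ v → sym (Perp-⊞⟨⟩ (sub a) v))
      off-eq : q * off ≡ (q - 1ℚ) * Qe * q * M * M * D
      -- Multiplication by `q * D`, the size of X′, turns both perps into `total` by `TS-perp-size`,
      -- and `size` then evaluates `total * s`.
      off-eq = cancel≡ (q * D) (mul>0 0<q (^^>0 k 0<q)) (begin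
        q * D * (q * off)
          ≡⟨ cong (q * D *_) (off-hyperplane Sing (Perp-sub X) P∈ (Sing-B P-sing) (λ _ → s-line P-sing)) ⟩
        q * D * (s * (⌈ Perp X ⌉ - ⌈ Perp X ∩ perp P ⌉))
          ≡⟨ cong (λ t → q * D * (s * (⌈ Perp X ⌉ - t))) meet ⟩
        q * D * (s * (⌈ Perp X ⌉ - ⌈ Perp X′ ⌉))
          ≡⟨ solve 5 (λ q D s x y → q :* D :* (s :* (x :- y)) := s :* (q :* (x :* D) :- y :* (q :* D))) refl q D s ⌈ Perp X ⌉ ⌈ Perp X′ ⌉ ⟩
        s * (q * (⌈ Perp X ⌉ * D) - ⌈ Perp X′ ⌉ * (q * D))
          ≡⟨ cong₂ (λ x y → s * (q * x - y)) (trans (cong (⌈ Perp X ⌉ *_) (sym z)) (TS-perp-size a)) (trans (cong (⌈ Perp X′ ⌉ *_) (sym z′)) (TS-perp-size a′)) ⟩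
        s * (q * total - total)
          ≡⟨ solve 3 (λ s q t → s :* (q :* t :- t) := (q :- :1) :* (t :* s)) refl s q total ⟩
        (q - 1ℚ) * (total * s)
          ≡⟨ cong ((q - 1ℚ) *_) (trans size (cong (λ t → Qe * (t * t)) qd)) ⟩
        (q - 1ℚ) * (Qe * (D * (q * M) * (D * (q * M))))
          ≡⟨ solve 4 (λ q M D Qe → (q :- :1) :* (Qe :* (D :* (q :* M) :* (D :* (q :* M)))) := q :* D :* ((q :- :1) :* Qe :* q :* M :* M :* D)) refl q M D Qe ⟩
        q * D * ((q - 1ℚ) * Qe * q * M * M * D) ∎)
      count : ⌈ (Sing ∩ Perp X) ∖ X ⌉ ≡ c′ + q * D + off - D
      count = begin
        ⌈ (Sing ∩ Perp X) ∖ X ⌉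
          ≡⟨ ∣∣-minus {Sing ∩ Perp X} {X} (λ v h → ∧-true (sing a v h) (TS-⊆Perp a v h)) ⟩
        ⌈ Sing ∩ Perp X ⌉ - ⌈ X ⌉
          ≡⟨ cong₂ _-_ (∣∣-split (Sing ∩ Perp X) (perp P)) z ⟩
        ⌈ (Sing ∩ Perp X) ∩ perp P ⌉ + ⌈ (Sing ∩ Perp X) ∖ perp P ⌉ - D
          ≡⟨ cong₂ (λ x y → x + y - D)
               (trans (∣∣-cong {(Sing ∩ Perp X) ∩ perp P} {Sing ∩ Perp X′} (λ v → trans (BP-assoc (Sing v) (Perp X v) (perp P v)) (cong (Sing v ∧_) (sym (Perp-⊞⟨⟩ (sub a) v))))) inner)
               (∣∣-cong {(Sing ∩ Perp X) ∖ perp P} {(Perp X ∖ perp P) ∩ Sing} (λ v → rot (Sing v) (Perp X v) (not (perp P v)))) ⟩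
        c′ + q * D + off - D ∎
        where
        open import Data.Bool.Properties using () renaming (∧-assoc to BP-assoc)
        rot : ∀ x y z → (x ∧ y) ∧ z ≡ (y ∧ z) ∧ x
        rot true  true  z     = sym (Data.Bool.Properties.∧-identityʳ z)
        rot true  false z     = refl
        rot false true  true  = refl
        rot false true  false = refl
        rot false false z     = refl
        inner : ⌈ Sing ∩ Perp X′ ⌉ ≡ c′ + q * D
        inner = trans (solve 2 (λ a b → a := a :- b :+ b) refl ⌈ Sing ∩ Perp X′ ⌉ ⌈ X′ ⌉)
          (cong₂ _+_ (sym (∣∣-minus {Sing ∩ Perp X′} {X′} (λ v h → ∧-true (sing a′ v h) (TS-⊆Perp a′ v h)))) z′)

    -- Weights, Cameron-Liebler sets and the number of members through a subspace.

    wt : (V → ℚ) → (V → Bool) → ℚ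
    wt W X = ∑ (λ v → [ X v ] * W v)

    wt-cong : ∀ {X Y} W → (∀ v → v ∈ Sing → X v ≡ Y v) → (∀ v → v ∉ Sing → W v ≡ 0ℚ) → wt W X ≡ wt W Y
    wt-cong {X} {Y} W h supp = ∑-cong (λ v → one v (split (Sing v)))
      where
      one : ∀ v → v ∈ Sing ⊎ v ∉ Sing → [ X v ] * W v ≡ [ Y v ] * W v
      one v (inj₁ e) = cong (λ b → [ b ] * W v) (h v e)
      one v (inj₂ n) = trans (cong ([ X v ] *_) (supp v n)) (trans (trans (*-zeroʳ [ X v ]) (sym (*-zeroʳ [ Y v ]))) (cong ([ Y v ] *_) (sym (supp v n))))

    -- Double counting: the total weight of a family of sets is known once the number of its sets
    -- through each vector `u` is known.
    weigh-family : ∀ W (Y : V → Bool) (X : V → V → Bool) →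
                   ∑ (λ v → [ Y v ] * wt W (X v)) ≡ ∑ (λ u → ⌈ (λ v → Y v ∧ X v u) ⌉ * W u)
    weigh-family W Y X = begin
      ∑ (λ v → [ Y v ] * wt W (X v))                      ≡⟨ ∑-cong (λ v → sym (∑-* [ Y v ] _)) ⟩
      ∑ (λ v → ∑ (λ u → [ Y v ] * ([ X v u ] * W u)))     ≡⟨ ∑-swap _ ⟩
      ∑ (λ u → ∑ (λ v → [ Y v ] * ([ X v u ] * W u)))     ≡⟨ ∑-cong (λ u → trans (∑-cong (λ v → trans (sym (*-assoc [ Y v ] [ X v u ] (W u))) (cong (_* W u) (sym ([]-∧ (Y v) (X v u)))))) (∑-*ʳ (W u) _)) ⟩
      ∑ (λ u → ⌈ (λ v → Y v ∧ X v u) ⌉ * W u)             ∎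

    ∑-two : ∀ (f g : V → ℚ) a b → ∑ (λ u → a * f u + b * g u) ≡ a * ∑ f + b * ∑ g
    ∑-two f g a b = trans (∑-+ _ _) (cong₂ _+_ (∑-* a f) (∑-* b g))

    -- Members are described by the indicator `χ` alone, a form stable under removal of a pencil;
    -- lists of members are kept apart. Predicates are not extensional, so `χ-mono` states that `χ`
    -- respects equality of sets.
    record CLSet : Set where
      field
        W      : V → ℚ
        W-0    : W 0ᵛ ≡ 0ℚ
        W-sing : ∀ v → v ∉ Sing → W v ≡ 0ℚ
        χ      : (V → Bool) → Bool
        χ-mono : ∀ {K M} → K ⊆ M → M ⊆ K → χ K ≡ true → χ M ≡ true
        wt-gen : ∀ {K} → Gen K → wt W K ≡ [ χ K ]

      x : ℚ
      x = ∑ W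

    module Residue (𝓛 : CLSet) {X : V → Bool} (a : TS X) where
      open CLSet 𝓛

      Y : V → Bool
      Y = (Sing ∩ Perp X) ∖ X

      Y-TS : ∀ {v} → v ∈ Y → TS (X ⊞ ⟨ v ⟩)
      Y-TS {v} h = TS-⊞⟨⟩ a (∧-trueˡ (∧-trueˡ h)) (∧-trueʳ {Sing v} (∧-trueˡ h))
      Y-size : ∀ {v} → v ∈ Y → ⌈ X ⊞ ⟨ v ⟩ ⌉ ≡ q * ⌈ X ⌉
      Y-size {v} h = adjoin (sub a) (true-not (∧-trueʳ {(Sing ∩ Perp X) v} h))

      -- Every family used below meets each of the three classes X, Y and the singular vectors off
      -- X⊥ uniformly, so its weight involves only W(X) and W(X⊥).
      two-step : ∀ A C (N : V → ℚ) → (∀ u → u ∈ X → N u ≡ A) → (∀ u → u ∈ Y → N u ≡ C) → (∀ u → u ∈ Sing → u ∉ Perp X → N u ≡ 0ℚ) →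
                 ∑ (λ u → N u * W u) ≡ A * wt W X + C * (wt W (Perp X) - wt W X)
      two-step A C N hA hC h0 = trans (∑-cong (λ u → one u (split (Sing u)) (split (Perp X u)) (split (X u))))
        (trans (∑-two (λ u → [ X u ] * W u) (λ u → [ Perp X u ] * W u - [ X u ] * W u) A C) (cong (λ t → A * wt W X + C * t) (∑-- _ _)))
        where
        one : ∀ u → u ∈ Sing ⊎ u ∉ Sing → u ∈ Perp X ⊎ u ∉ Perp X → u ∈ X ⊎ u ∉ X →
              N u * W u ≡ A * ([ X u ] * W u) + C * ([ Perp X u ] * W u - [ X u ] * W u)
        one u (inj₂ ns) _ _ rewrite W-sing u ns =
          solve 5 (λ n A C x y → n :* :0 := A :* (x :* :0) :+ C :* (y :* :0 :- x :* :0)) refl (N u) A C [ X u ] [ Perp X u ]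
        one u (inj₁ _) _ (inj₁ ux) rewrite hA u ux | ux | TS-⊆Perp a u ux =
          solve 3 (λ A C w → A :* w := A :* (:1 :* w) :+ C :* (:1 :* w :- :1 :* w)) refl A C (W u)
        one u (inj₁ us) (inj₁ up) (inj₂ nx) rewrite hC u (∧-true (∧-true us up) (not-true nx)) | ¬true nx | up =
          solve 3 (λ A C w → C :* w := A :* (:0 :* w) :+ C :* (:1 :* w :- :0 :* w)) refl A C (W u)
        one u (inj₁ us) (inj₂ np) (inj₂ nx) rewrite h0 u us np | ¬true nx | ¬true np =
          solve 3 (λ A C w → :0 :* w := A :* (:0 :* w) :+ C :* (:0 :* w :- :0 :* w)) refl A C (W u)
      -- A vector of X lies in all the spans X + ⟨v⟩. A vector u of Y lies in X + ⟨v⟩ exactly when v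
      -- lies in (X + ⟨u⟩) ∖ X, by exchange.
      spans : ∑ (λ v → [ Y v ] * wt W (X ⊞ ⟨ v ⟩)) ≡ ⌈ Y ⌉ * wt W X + (q * ⌈ X ⌉ - ⌈ X ⌉) * (wt W (Perp X) - wt W X)
      spans = trans (weigh-family W Y (λ v → X ⊞ ⟨ v ⟩)) (two-step ⌈ Y ⌉ (q * ⌈ X ⌉ - ⌈ X ⌉) (λ u → ⌈ (λ v → Y v ∧ (X ⊞ ⟨ v ⟩) u) ⌉)
        (λ u ux → ∣∣-cong (λ v → bool-ext (∧-trueˡ {Y v}) (λ h → ∧-true h (⊞-⊆ˡ (⟨⟩-sub v) u ux))))
        (λ u uy → trans (∣∣-cong {λ v → Y v ∧ (X ⊞ ⟨ v ⟩) u} {(X ⊞ ⟨ u ⟩) ∖ X} (λ v → bool-ext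
            (λ h → ∧-true (exchange (sub a) (true-not (∧-trueʳ {(Sing ∩ Perp X) u} uy)) (∧-trueʳ {Y v} h)) (∧-trueʳ {(Sing ∩ Perp X) v} (∧-trueˡ {Y v} h)))
            (λ h → let vS = ∧-trueˡ {(X ⊞ ⟨ u ⟩) v} h ; vX = ∧-trueʳ {(X ⊞ ⟨ u ⟩) v} h ; t = Y-TS uy in
               ∧-true {Y v} (∧-true {(Sing ∩ Perp X) v} (∧-true (sing t v vS) (Perp-intro (λ k → iso t vS (⊞-⊆ˡ (⟨⟩-sub u) _ k)))) vX) (exchange (sub a) (true-not vX) vS))))
          (trans (∣∣-minus {X ⊞ ⟨ u ⟩} {X} (⊞-⊆ˡ (⟨⟩-sub u))) (cong (_- ⌈ X ⌉) (Y-size uy))))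
        (λ u us np → ∣∣-none (λ v h → np (Perp-intro (λ k → iso (Y-TS (∧-trueˡ {Y v} h)) (∧-trueʳ {Y v} h) (⊞-⊆ˡ (⟨⟩-sub v) _ k))))))

    -- The number of generators of a polar space of rank m with parameter e.
    bb : ℕ → ℚ
    bb zero    = 1ℚ
    bb (suc m) = bb m * (1ℚ + Qe * q ^^ m)

    -- Serves to identify `x`, the total weight, with the parameter, which is defined through the
    -- length of the list.
    module Counting (𝓛 : CLSet) (Ls : List (V → Bool)) (gens : All Gen Ls) (distinct : AllPairs (λ K M → ¬ K ⊆ M) Ls)
                    (χ-in : ∀ {K} → Gen K → CLSet.χ 𝓛 K ≡ true → Any (K ⊆_) Ls)
                    (in-χ : ∀ {K} → Gen K → Any (K ⊆_) Ls → CLSet.χ 𝓛 K ≡ true) where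
      open CLSet 𝓛

      cnt : (V → Bool) → ℚ
      cnt X = ∑ᴸ Ls (λ K → [ X ⊆ᵇ K ])

      private
        count-gen : ∀ Ms {K} → Gen K → All Gen Ms → AllPairs (λ K M → ¬ K ⊆ M) Ms →
                    (∑ᴸ Ms (λ M → [ K ⊆ᵇ M ]) ≡ 1ℚ × Any (K ⊆_) Ms) ⊎ (∑ᴸ Ms (λ M → [ K ⊆ᵇ M ]) ≡ 0ℚ × ¬ Any (K ⊆_) Ms)
        count-gen [] g gs ds = inj₂ (refl , λ ())
        count-gen (M ∷ Ms) {K} g (gM ∷ gs) (p ∷ ds) with split (K ⊆ᵇ M) | count-gen Ms g gs ds
        ... | inj₁ e | inj₁ (eq , a) = ⊥-elim (clash p a)
          where
          clash : ∀ {Ms} → All (λ N → ¬ M ⊆ N) Ms → Any (K ⊆_) Ms → ⊥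
          clash (n ∷ ns) (here h)  = n (λ v k → h v (gen-⊆ g gM (⊆ᵇ-elim {K} {M} e) v k))
          clash (n ∷ ns) (there a) = clash ns a
        ... | inj₁ e | inj₂ (eq , n) = inj₁ (cong₂ (λ b t → [ b ] + t) e eq , here (⊆ᵇ-elim {K} {M} e))
        ... | inj₂ m | inj₁ (eq , a) = inj₁ (cong₂ (λ b t → [ b ] + t) (¬true m) eq , there a)
        ... | inj₂ m | inj₂ (eq , n) = inj₂ (cong₂ (λ b t → [ b ] + t) (¬true m) eq , λ { (here h) → m (⊆ᵇ-intro {K} {M} h) ; (there a) → n a })

        cnt-gen : ∀ {K} → Gen K → cnt K ≡ [ χ K ]
        cnt-gen {K} g with count-gen Ls g gens distinct
        ... | inj₁ (e , a) = trans e (cong [_] (sym (in-χ g a)))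
        ... | inj₂ (e , n) = trans e (cong [_] (sym (¬true (λ h → n (χ-in g h)))))

        -- The number of generators of a polar space of rank m through a given point; in rank 0
        -- there are no points, whence 0.
        bb′ : ℕ → ℚ
        bb′ zero    = 0ℚ
        bb′ (suc m) = bb m

        -- Both sides are q times the number of pairs of a nonzero singular vector and a generator
        -- containing it, in a polar space of rank n.
        bb-step : ∀ n → bb′ n * ((q ^^ n - 1ℚ) * (q + Qe * q ^^ n)) ≡ bb n * (q * (q ^^ n - 1ℚ))
        bb-step zero    = solve 2 (λ q e → :0 :* ((:1 :- :1) :* (q :+ e :* :1)) := :1 :* (q :* (:1 :- :1))) refl q Qe
        bb-step (suc n) = solve 4 (λ b q M e → b :* ((q :* M :- :1) :* (q :+ e :* (q :* M))) := b :* (:1 :+ e :* M) :* (q :* (q :* M :- :1))) refl (bb n) q (q ^^ n) Qe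

      -- The formula is what summation of `wt-gen` over all generators through X would give: a
      -- vector of X lies in `bb m` of them, a singular vector of X⊥ outside X in `bb′ m`. As
      -- generators are not enumerated, the induction passes from X to the subspaces X + ⟨v⟩ with v
      -- in Y and counts the pairs of v and a member through X + ⟨v⟩.
      through : ∀ m k {X} → k ℕ.+ m ≡ d → TS X → ⌈ X ⌉ ≡ q ^^ k → cnt X ≡ bb′ m * (wt W (Perp X) - wt W X) + bb m * wt W X
      through zero k {X} e a z = trans (cnt-gen g) (trans (sym (wt-gen g))
        (solve 2 (λ x y → x := :0 :* (y :- x) :+ :1 :* x) refl (wt W X) (wt W (Perp X))))
        where
        g : Gen X
        g = record { ts = a ; ∣gen∣ = trans z (cong (q ^^_) (trans (sym (ℕP.+-identityʳ k)) e)) }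
      through (suc n) k {X} e a z = cancel≡ (q * D * (q * M - 1ℚ)) (mul>0 (mul>0 0<q (^^>0 k 0<q)) gap) (begin
        q * D * (q * M - 1ℚ) * cnt X
          ≡⟨ solve 4 (λ q D M c → q :* D :* (q :* M :- :1) :* c := q :* ((D :* (q :* M) :- D) :* c)) refl q D M (cnt X) ⟩
        q * ((D * (q * M) - D) * cnt X)
          ≡⟨ cong (q *_) (trans (cong (λ t → (t - D) * cnt X) (sym qd)) (trans (sym left) right)) ⟩
        q * (bb′ n * (c * w₀ + (c′ + q * D - D) * w₁ - (c * w₀ + (q * D - D) * w₁)) + bb n * (c * w₀ + (q * D - D) * w₁))
          ≡⟨ solve 8 (λ q b′ b c c′ D w₀ w₁ → q :* (b′ :* (c :* w₀ :+ (c′ :+ q :* D :- D) :* w₁ :- (c :* w₀ :+ (q :* D :- D) :* w₁)) :+ b :* (c :* w₀ :+ (q :* D :- D) :* w₁))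
                := b′ :* (q :* c′) :* w₁ :+ b :* (q :* c :* w₀ :+ q :* (q :* D :- D) :* w₁)) refl q (bb′ n) (bb n) c c′ D w₀ w₁ ⟩
        bb′ n * (q * c′) * w₁ + bb n * (q * c * w₀ + q * (q * D - D) * w₁)
          ≡⟨ cong₂ (λ s t → bb′ n * s * w₁ + bb n * (t * w₀ + q * (q * D - D) * w₁)) (trans c′-eq (cong (λ t → (M - 1ℚ) * (q * (q * D) + Qe * t)) qd)) (trans c-eq (cong (λ t → (q * M - 1ℚ) * (q * D + Qe * t)) qd)) ⟩
        bb′ n * ((M - 1ℚ) * (q * (q * D) + Qe * (D * (q * M)))) * w₁ + bb n * ((q * M - 1ℚ) * (q * D + Qe * (D * (q * M))) * w₀ + q * (q * D - D) * w₁)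
          ≡⟨ solve 8 (λ q b′ b M D Qe w₀ w₁ → b′ :* ((M :- :1) :* (q :* (q :* D) :+ Qe :* (D :* (q :* M)))) :* w₁ :+ b :* ((q :* M :- :1) :* (q :* D :+ Qe :* (D :* (q :* M))) :* w₀ :+ q :* (q :* D :- D) :* w₁)
                := q :* D :* (b′ :* ((M :- :1) :* (q :+ Qe :* M))) :* w₁ :+ b :* ((q :* M :- :1) :* (q :* D :+ Qe :* (D :* (q :* M))) :* w₀ :+ q :* (q :* D :- D) :* w₁)) refl q (bb′ n) (bb n) M D Qe w₀ w₁ ⟩
        q * D * (bb′ n * ((M - 1ℚ) * (q + Qe * M))) * w₁ + bb n * ((q * M - 1ℚ) * (q * D + Qe * (D * (q * M))) * w₀ + q * (q * D - D) * w₁)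
          ≡⟨ cong (λ t → q * D * t * w₁ + bb n * ((q * M - 1ℚ) * (q * D + Qe * (D * (q * M))) * w₀ + q * (q * D - D) * w₁)) (bb-step n) ⟩
        q * D * (bb n * (q * (M - 1ℚ))) * w₁ + bb n * ((q * M - 1ℚ) * (q * D + Qe * (D * (q * M))) * w₀ + q * (q * D - D) * w₁)
          ≡⟨ solve 7 (λ q b M D Qe w₀ w₁ → q :* D :* (b :* (q :* (M :- :1))) :* w₁ :+ b :* ((q :* M :- :1) :* (q :* D :+ Qe :* (D :* (q :* M))) :* w₀ :+ q :* (q :* D :- D) :* w₁)
                := q :* D :* (q :* M :- :1) :* (b :* w₁ :+ b :* (:1 :+ Qe :* M) :* w₀)) refl q (bb n) M D Qe w₀ w₁ ⟩
        q * D * (q * M - 1ℚ) * (bb n * w₁ + bb n * (1ℚ + Qe * M) * w₀) ∎)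
        where
        M D c c′ w₀ w₁ : ℚ
        M = q ^^ n
        D = q ^^ k
        w₀ = wt W X
        w₁ = wt W (Perp X) - wt W X
        open Residue 𝓛 a hiding (spans)
        c = ⌈ Y ⌉
        -- The number of singular vectors of (X + ⟨v⟩)⊥ outside X + ⟨v⟩. It is defined by its
        -- formula because one value is needed for all v in Y.
        c′ = (M - 1ℚ) * (q * (q * D) + Qe * q ^^ d) * proj₁ q⁻¹
        c-eq : q * c ≡ (q * M - 1ℚ) * (q * D + Qe * q ^^ d)
        c-eq = residue-count (suc n) k e a z
        c′-eq : q * c′ ≡ (M - 1ℚ) * (q * (q * D) + Qe * q ^^ d)
        c′-eq = trans (solve 3 (λ q t r → q :* (t :* r) := t :* (q :* r)) refl q ((M - 1ℚ) * (q * (q * D) + Qe * q ^^ d)) (proj₁ q⁻¹))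
          (trans (cong ((M - 1ℚ) * (q * (q * D) + Qe * q ^^ d) *_) (proj₂ q⁻¹)) (*-identityʳ _))
        qd : q ^^ d ≡ D * (q * M)
        qd = trans (cong (q ^^_) (sym e)) (^^-+ q k (suc n))
        gap : 0ℚ < q * M - 1ℚ
        gap = subst (0ℚ <_) (solve 3 (λ q M t → (q :* M :- M) :+ (M :- :1) := q :* M :- :1) refl q M M)
          (<-≤-trans (subst (0ℚ <_) (solve 2 (λ q M → (q :- :1) :* M := q :* M :- M) refl q M) (mul>0 0<q-1 (^^>0 n 0<q)))
            (≤-trans (≤-reflexive (sym (+-identityʳ _))) (Data.Rational.Properties.+-monoʳ-≤ (q * M - M) (diff≥0 (1≤ n)))))
          where
          1≤ : ∀ n → 1ℚ ≤ q ^^ n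
          1≤ zero    = ≤-refl
          1≤ (suc n) = ≤-trans (1≤ n) (<⇒≤ (<q* (^^>0 n 0<q)))
        left : ∑ (λ v → [ Y v ] * cnt (X ⊞ ⟨ v ⟩)) ≡ (q ^^ d - D) * cnt X
        left = begin
          ∑ (λ v → [ Y v ] * cnt (X ⊞ ⟨ v ⟩))
            ≡⟨ ∑-cong (λ v → sym (∑ᴸ-* Ls [ Y v ] _)) ⟩
          ∑ (λ v → ∑ᴸ Ls (λ K → [ Y v ] * [ X ⊞ ⟨ v ⟩ ⊆ᵇ K ]))
            ≡⟨ ∑-swapᴸ Ls _ ⟩
          ∑ᴸ Ls (λ K → ∑ (λ v → [ Y v ] * [ X ⊞ ⟨ v ⟩ ⊆ᵇ K ]))
            ≡⟨ ∑ᴸ-cong∈ Ls (λ K m → per (All.lookup gens m)) ⟩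
          ∑ᴸ Ls (λ K → (q ^^ d - D) * [ X ⊆ᵇ K ])
            ≡⟨ ∑ᴸ-* Ls (q ^^ d - D) _ ⟩
          (q ^^ d - D) * cnt X ∎
          where
          per : ∀ {K} → Gen K → ∑ (λ v → [ Y v ] * [ X ⊞ ⟨ v ⟩ ⊆ᵇ K ]) ≡ (q ^^ d - D) * [ X ⊆ᵇ K ]
          per {K} g with split (X ⊆ᵇ K)
          ... | inj₂ n⊆ = trans (∑-cong (λ v → trans (cong (λ b → [ Y v ] * [ b ]) (¬true (λ h → n⊆ (⊆ᵇ-intro {X} {K} (λ u k → ⊆ᵇ-elim {X ⊞ ⟨ v ⟩} {K} h u (⊞-⊆ˡ (⟨⟩-sub v) u k)))))) (*-zeroʳ [ Y v ])))
                (trans (∑ᴸ-0 (Finite.elems vectors)) (sym (trans (cong (λ b → (q ^^ d - D) * [ b ]) (¬true n⊆)) (*-zeroʳ (q ^^ d - D)))))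
          ... | inj₁ y⊆ = begin
            ∑ (λ v → [ Y v ] * [ X ⊞ ⟨ v ⟩ ⊆ᵇ K ])    ≡⟨ ∑-cong (λ v → trans (sym ([]-∧ (Y v) _)) (cong [_] (pointwise v))) ⟩
            ⌈ K ∖ X ⌉                                 ≡⟨ ∣∣-minus {K} {X} XK ⟩
            ⌈ K ⌉ - ⌈ X ⌉                             ≡⟨ cong₂ _-_ (∣gen∣ g) z ⟩
            q ^^ d - D                                ≡⟨ sym (trans (cong (λ b → (q ^^ d - D) * [ b ]) y⊆) (*-identityʳ _)) ⟩
            (q ^^ d - D) * [ X ⊆ᵇ K ]                 ∎
            where
            XK : X ⊆ K
            XK = ⊆ᵇ-elim {X} {K} y⊆
            pointwise : ∀ v → Y v ∧ (X ⊞ ⟨ v ⟩ ⊆ᵇ K) ≡ (K ∖ X) v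
            pointwise v = bool-ext
              (λ h → ∧-true (⊆ᵇ-elim {X ⊞ ⟨ v ⟩} {K} (∧-trueʳ {Y v} h) v (⊞⟨⟩-self (sub a))) (∧-trueʳ {(Sing ∩ Perp X) v} (∧-trueˡ {Y v} h)))
              (λ h → ∧-true {Y v} (∧-true {(Sing ∩ Perp X) v} (∧-true (sing (ts g) v (∧-trueˡ {K v} h)) (Perp-intro (λ k → iso (ts g) (∧-trueˡ {K v} h) (XK _ k)))) (∧-trueʳ {K v} h))
                (⊆ᵇ-intro {X ⊞ ⟨ v ⟩} {K} (⊞-⊆ (sub (ts g)) XK (⟨⟩-⊆ (sub (ts g)) (∧-trueˡ {K v} h)))))
        Y-size′ : ∀ {v} → v ∈ Y → ⌈ X ⊞ ⟨ v ⟩ ⌉ ≡ q ^^ suc k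
        Y-size′ h = trans (Y-size h) (cong (q *_) z)
        spans : ∑ (λ v → [ Y v ] * wt W (X ⊞ ⟨ v ⟩)) ≡ c * w₀ + (q * D - D) * w₁
        spans = trans (Residue.spans 𝓛 a) (cong (λ t → c * w₀ + (q * t - t) * w₁) z)
        perps : ∑ (λ v → [ Y v ] * wt W (Perp (X ⊞ ⟨ v ⟩))) ≡ c * w₀ + (c′ + q * D - D) * w₁
        perps = trans (weigh-family W Y (λ v → Perp (X ⊞ ⟨ v ⟩))) (two-step c (c′ + q * D - D) (λ u → ⌈ (λ v → Y v ∧ Perp (X ⊞ ⟨ v ⟩) u) ⌉)
          (λ u ux → ∣∣-cong (λ v → bool-ext (∧-trueˡ {Y v}) (λ h → ∧-true h (trans (Perp-⊞⟨⟩ (sub a) u)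
            (∧-true (TS-⊆Perp a u ux) (perp-intro (B-refl (Perp-elim (∧-trueʳ {Sing v} (∧-trueˡ {(Sing ∩ Perp X) v} h)) ux))))))))
          (λ u uy → cancel≡ q 0<q (begin
            q * ⌈ (λ v → Y v ∧ Perp (X ⊞ ⟨ v ⟩) u) ⌉
              ≡⟨ cong (q *_) (trans (∣∣-split (λ v → Y v ∧ Perp (X ⊞ ⟨ v ⟩) u) (X ⊞ ⟨ u ⟩)) (cong₂ _+_ (∣∣-cong (inside u uy)) (∣∣-cong (beyond u uy)))) ⟩
            q * (⌈ (X ⊞ ⟨ u ⟩) ∖ X ⌉ + ⌈ (Sing ∩ Perp (X ⊞ ⟨ u ⟩)) ∖ (X ⊞ ⟨ u ⟩) ⌉)
              ≡⟨ *-distribˡ-+ q _ _ ⟩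
            q * ⌈ (X ⊞ ⟨ u ⟩) ∖ X ⌉ + q * ⌈ (Sing ∩ Perp (X ⊞ ⟨ u ⟩)) ∖ (X ⊞ ⟨ u ⟩) ⌉
              ≡⟨ cong₂ (λ s t → q * s + t) (trans (∣∣-minus {X ⊞ ⟨ u ⟩} {X} (⊞-⊆ˡ (⟨⟩-sub u))) (cong₂ _-_ (Y-size′ uy) z))
                   (trans (residue-count n (suc k) (trans (sym (ℕP.+-suc k n)) e) (Y-TS uy) (Y-size′ uy)) (sym c′-eq)) ⟩
            q * (q * D - D) + q * c′
              ≡⟨ solve 3 (λ q D c → q :* (q :* D :- D) :+ q :* c := q :* (c :+ q :* D :- D)) refl q D c′ ⟩
            q * (c′ + q * D - D) ∎))
          (λ u us np → ∣∣-none (λ v h → np (∧-trueˡ (trans (sym (Perp-⊞⟨⟩ {X} {v} (sub a) u)) (∧-trueʳ {Y v} h))))))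
          where
          inside : ∀ u → u ∈ Y → ∀ v → (Y v ∧ Perp (X ⊞ ⟨ v ⟩) u) ∧ (X ⊞ ⟨ u ⟩) v ≡ ((X ⊞ ⟨ u ⟩) ∖ X) v
          inside u uy v = bool-ext
            (λ h → ∧-true {(X ⊞ ⟨ u ⟩) v} (∧-trueʳ {Y v ∧ Perp (X ⊞ ⟨ v ⟩) u} h) (∧-trueʳ {(Sing ∩ Perp X) v} (∧-trueˡ {Y v} (∧-trueˡ {Y v ∧ Perp (X ⊞ ⟨ v ⟩) u} h))))
            (λ h → let vS = ∧-trueˡ {(X ⊞ ⟨ u ⟩) v} h ; vX = ∧-trueʳ {(X ⊞ ⟨ u ⟩) v} h ; t = Y-TS uy in
              ∧-true {Y v ∧ Perp (X ⊞ ⟨ v ⟩) u}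
                (∧-true {Y v} (∧-true {(Sing ∩ Perp X) v} (∧-true (sing t v vS) (Perp-intro (λ k → iso t vS (⊞-⊆ˡ (⟨⟩-sub u) _ k)))) vX)
                  (trans (Perp-⊞⟨⟩ (sub a) u) (∧-true (∧-trueʳ {Sing u} (∧-trueˡ {(Sing ∩ Perp X) u} uy)) (perp-intro (iso t (⊞⟨⟩-self (sub a)) vS)))))
                vS)
          beyond : ∀ u → u ∈ Y → ∀ v → (Y v ∧ Perp (X ⊞ ⟨ v ⟩) u) ∧ not ((X ⊞ ⟨ u ⟩) v) ≡ ((Sing ∩ Perp (X ⊞ ⟨ u ⟩)) ∖ (X ⊞ ⟨ u ⟩)) v
          beyond u uy v = bool-ext
            (λ h → let h′ = ∧-trueˡ {Y v ∧ Perp (X ⊞ ⟨ v ⟩) u} h ; vY = ∧-trueˡ {(Sing ∩ Perp X) v} (∧-trueˡ {Y v} h′) in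
              ∧-true {(Sing ∩ Perp (X ⊞ ⟨ u ⟩)) v} (∧-true (∧-trueˡ {Sing v} vY) (trans (Perp-⊞⟨⟩ (sub a) v) (∧-true (∧-trueʳ {Sing v} vY)
                (trans (perp-sym u v) (∧-trueʳ {Perp X u} (trans (sym (Perp-⊞⟨⟩ (sub a) u)) (∧-trueʳ {Y v} h′)))))))
                (∧-trueʳ {Y v ∧ Perp (X ⊞ ⟨ v ⟩) u} h))
            (λ h → let vS = ∧-trueˡ {(Sing ∩ Perp (X ⊞ ⟨ u ⟩)) v} h ; nv = ∧-trueʳ {(Sing ∩ Perp (X ⊞ ⟨ u ⟩)) v} h
                       vP = trans (sym (Perp-⊞⟨⟩ {X} {u} (sub a) v)) (∧-trueʳ {Sing v} vS) in
              ∧-true {Y v ∧ Perp (X ⊞ ⟨ v ⟩) u}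
                (∧-true {Y v} (∧-true {(Sing ∩ Perp X) v} (∧-true (∧-trueˡ {Sing v} vS) (∧-trueˡ {Perp X v} vP)) (not-true (λ k → true-not nv (⊞-⊆ˡ (⟨⟩-sub u) v k))))
                  (trans (Perp-⊞⟨⟩ (sub a) u) (∧-true (∧-trueʳ {Sing u} (∧-trueˡ {(Sing ∩ Perp X) u} uy)) (trans (perp-sym v u) (∧-trueʳ {Perp X v} vP)))))
                nv)
        right : ∑ (λ v → [ Y v ] * cnt (X ⊞ ⟨ v ⟩)) ≡
                bb′ n * (c * w₀ + (c′ + q * D - D) * w₁ - (c * w₀ + (q * D - D) * w₁)) + bb n * (c * w₀ + (q * D - D) * w₁)
        right = begin
          ∑ (λ v → [ Y v ] * cnt (X ⊞ ⟨ v ⟩))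
            ≡⟨ ∑-cong (λ v → trans ([]-guard (Y v) (λ h → through n (suc k) (trans (sym (ℕP.+-suc k n)) e) (Y-TS h) (Y-size′ h)))
                 (solve 5 (λ y b b′ P S → y :* (b′ :* (P :- S) :+ b :* S) := b′ :* (y :* P :- y :* S) :+ b :* (y :* S)) refl [ Y v ] (bb n) (bb′ n) (wt W (Perp (X ⊞ ⟨ v ⟩))) (wt W (X ⊞ ⟨ v ⟩)))) ⟩
          ∑ (λ v → bb′ n * ([ Y v ] * wt W (Perp (X ⊞ ⟨ v ⟩)) - [ Y v ] * wt W (X ⊞ ⟨ v ⟩)) + bb n * ([ Y v ] * wt W (X ⊞ ⟨ v ⟩)))
            ≡⟨ ∑-two _ _ (bb′ n) (bb n) ⟩
          bb′ n * ∑ (λ v → [ Y v ] * wt W (Perp (X ⊞ ⟨ v ⟩)) - [ Y v ] * wt W (X ⊞ ⟨ v ⟩)) + bb n * ∑ (λ v → [ Y v ] * wt W (X ⊞ ⟨ v ⟩))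
            ≡⟨ cong₂ (λ s t → bb′ n * s + bb n * t) (trans (∑-- _ _) (cong₂ _-_ perps spans)) spans ⟩
          bb′ n * (c * w₀ + (c′ + q * D - D) * w₁ - (c * w₀ + (q * D - D) * w₁)) + bb n * (c * w₀ + (q * D - D) * w₁) ∎

      length-total : ∀ {m} → suc m ≡ d → ι (length Ls) ≡ bb m * x
      length-total {m} e = begin
        ι (length Ls)             ≡⟨ sym (∑ᴸ-len Ls) ⟩
        ∑ᴸ Ls (λ _ → 1ℚ)          ≡⟨ ∑ᴸ-cong∈ Ls (λ K k → cong [_] (sym (⊆ᵇ-intro {⟨ 0ᵛ ⟩} {K} (⟨⟩-⊆ (sub (ts (All.lookup gens k))) (has-0 (sub (ts (All.lookup gens k)))))))) ⟩
        cnt ⟨ 0ᵛ ⟩                ≡⟨ through (suc m) 0 e TS-0 one ⟩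
        bb m * (wt W (Perp ⟨ 0ᵛ ⟩) - wt W ⟨ 0ᵛ ⟩) + bb (suc m) * wt W ⟨ 0ᵛ ⟩
                                  ≡⟨ cong₂ (λ s t → bb m * (s - t) + bb (suc m) * t) all none ⟩
        bb m * (x - 0ℚ) + bb (suc m) * 0ℚ
                                  ≡⟨ solve 3 (λ b x t → b :* (x :- :0) :+ t :* :0 := b :* x) refl (bb m) x (bb (suc m)) ⟩
        bb m * x                  ∎
        where
        only-0 : ∀ {v} → v ∈ ⟨ 0ᵛ ⟩ → v ≡ 0ᵛ
        only-0 h = let c , p = ⟨⟩-elim h in trans p (·-0ᵛ c)
        one : ⌈ ⟨ 0ᵛ ⟩ ⌉ ≡ 1ℚ
        one = ∣∣-unique _ 0ᵛ ⟨⟩-self (λ v → only-0)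
        all : wt W (Perp ⟨ 0ᵛ ⟩) ≡ x
        all = ∑-cong (λ v → trans (cong (λ b → [ b ] * W v) (Perp-intro (λ h → subst (λ t → B v t ≡ 0ᶠ) (sym (only-0 h)) (B-refl (B-0 v))))) (*-identityˡ (W v)))
        none : wt W ⟨ 0ᵛ ⟩ ≡ 0ℚ
        none = trans (∑-cong (λ v → trans ([]-guard (⟨ 0ᵛ ⟩ v) (λ h → trans (cong W (only-0 h)) W-0)) (*-zeroʳ [ ⟨ 0ᵛ ⟩ v ]))) (∑ᴸ-0 (Finite.elems vectors))

    ⟨⟩-sym : ∀ {u v} → u ≢ 0ᵛ → u ∈ ⟨ v ⟩ → v ∈ ⟨ u ⟩
    ⟨⟩-sym {u} {v} n h with ⟨⟩-elim h
    ... | c , refl with c ≟ᶠ 0ᶠ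
    ...   | yes refl = ⊥-elim (n (0-· v))
    ...   | no nz = cancel-· (⟨⟩-sub (c · v)) nz ⟨⟩-self

    -- If u lies in (K ∩ v⊥) + ⟨v⟩, which is totally singular, then K ∩ v⊥ ⊆ u⊥. So u lies in (K ∩
    -- u⊥) + ⟨v⟩, and exchange applies.
    proj-sym : ∀ {K u v} → Gen K → v ∈ Sing → u ∉ K → v ∉ K → u ∈ proj v K → v ∈ proj u K
    proj-sym {K} {u} {v} g hv n m h = exchange sX (λ k → n (∧-trueˡ k)) u∈
      where
      sX : Sub (K ∩ perp u)
      sX = ∩-sub (sub (ts g)) (perp-sub u)
      pg = ts (proj-gen g hv m)
      u∈ : u ∈ (K ∩ perp u) ⊞ ⟨ v ⟩
      u∈ = let x , c , hx , e = ⊞⟨⟩-elim h in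
        subst (_∈ (K ∩ perp u) ⊞ ⟨ v ⟩) (sym e) (⊞⟨⟩-intro c (∧-true (∧-trueˡ hx) (perp-intro (iso pg (∩perp⊆proj K v x hx) h))))

    -- Degrees of points, heavy points and full point-pencils.

    module Degree (𝓛 : CLSet) where
      open CLSet 𝓛

      -- q² times the normalised number x_P of members of 𝓛 through P.
      Δ : V → ℚ
      Δ P = Qe * q ^^ d * wt W ⟨ P ⟩ + q * q * wt W (perp P)

      supported : ∀ {v} (s t : ℚ) → (v ∈ Sing → s * W v ≡ t * W v) → s * W v ≡ t * W v
      supported {v} s t h with split (Sing v)
      ... | inj₁ e = h e
      ... | inj₂ n rewrite W-sing v n = trans (*-zeroʳ s) (sym (*-zeroʳ t))

      -- The generators meeting π in a hyperplane and not containing P ∈ π, each counted through its vectors outside π.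
      degree : ∀ {π P} → Gen π → P ∈ π → P ≢ 0ᵛ →
               q * q * q * ∑ (λ v → [ (Sing ∖ perp P) v ] * wt W (proj v π)) ≡
               (q - 1ℚ) * q ^^ d * (q * q * x - Δ P) + (q - 1ℚ) * Qe * (q ^^ d * q ^^ d) * wt W π
      degree {π} {P} g hP P≢0 = begin
        q * q * q * ∑ (λ v → [ Y v ] * wt W (proj v π))
          ≡⟨ cong (q * q * q *_) (weigh-family W Y (λ v → proj v π)) ⟩
        q * q * q * ∑ (λ u → N u * W u)
          ≡⟨ sym (∑-* (q * q * q) _) ⟩
        ∑ (λ u → q * q * q * (N u * W u))
          ≡⟨ ∑-cong (λ u → trans (sym (*-assoc (q * q * q) (N u) (W u))) (trans (supported (q * q * q * N u) (a * ([ π u ] - [ ⟨ P ⟩ u ]) + b * (1ℚ - [ perp P u ])) (one u (split (π u))))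
                (solve 6 (λ a b p l r w → (a :* (p :- l) :+ b :* (:1 :- r)) :* w := a :* (p :* w :- l :* w) :+ b :* (w :- r :* w)) refl a b [ π u ] [ ⟨ P ⟩ u ] [ perp P u ] (W u)))) ⟩
        ∑ (λ u → a * ([ π u ] * W u - [ ⟨ P ⟩ u ] * W u) + b * (W u - [ perp P u ] * W u))
          ≡⟨ ∑-two _ _ a b ⟩
        a * ∑ (λ u → [ π u ] * W u - [ ⟨ P ⟩ u ] * W u) + b * ∑ (λ u → W u - [ perp P u ] * W u)
          ≡⟨ cong₂ (λ s t → a * s + b * t) (∑-- _ _) (∑-- W _) ⟩
        a * (wt W π - wt W ⟨ P ⟩) + b * (x - wt W (perp P))
          ≡⟨ solve 7 (λ q e D x w l r → (q :- :1) :* e :* (D :* D) :* (w :- l) :+ (q :- :1) :* (q :* q) :* D :* (x :- r)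
               := (q :- :1) :* D :* (q :* q :* x :- (e :* D :* l :+ q :* q :* r)) :+ (q :- :1) :* e :* (D :* D) :* w) refl q Qe (q ^^ d) x (wt W π) (wt W ⟨ P ⟩) (wt W (perp P)) ⟩
        (q - 1ℚ) * q ^^ d * (q * q * x - Δ P) + (q - 1ℚ) * Qe * (q ^^ d * q ^^ d) * wt W π ∎
        where
        a b : ℚ
        a = (q - 1ℚ) * Qe * (q ^^ d * q ^^ d)
        b = (q - 1ℚ) * (q * q) * q ^^ d
        Y : V → Bool
        Y = Sing ∖ perp P
        N : V → ℚ
        N u = ⌈ (λ v → Y v ∧ proj v π u) ⌉
        sP : P ∈ Sing
        sP = sing (ts g) P hP
        Y-sing : ∀ {v} → v ∈ Y → v ∈ Sing
        Y-sing = ∧-trueˡ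
        Y-far : ∀ {v} → v ∈ Y → B v P ≢ 0ᶠ
        Y-far {v} h e = true-not (∧-trueʳ {Sing v} h) (perp-intro e)
        Y-out : ∀ {v} → v ∈ Y → v ∉ π
        Y-out h k = Y-far h (iso (ts g) k hP)
        proj-ts : ∀ {v} → v ∈ Y → TS (proj v π)
        proj-ts h = ts (proj-gen g (Y-sing h) (Y-out h))
        none : ∀ u → (∀ {v} → v ∈ Y → u ∉ proj v π) → N u ≡ 0ℚ
        none u h = ∣∣-none (λ v k → h (∧-trueˡ {Y v} k) (∧-trueʳ {Y v} k))

        -- For u in π the generator `proj v π` contains u exactly when v ⊥ u, so the vectors v are
        -- the singular ones in u⊥ ∖ P⊥.
        inner : ∀ u → u ∈ π → u ∉ ⟨ P ⟩ → q * q * q * N u ≡ a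
        inner u hu nu = begin
          q * q * q * N u
            ≡⟨ cong (q * q * q *_) (∣∣-cong {λ v → Y v ∧ proj v π u} {(perp u ∖ perp P) ∩ Sing} (λ v → bool-ext
                 (λ h → let h′ = ∧-trueˡ {Y v} h in ∧-true {(perp u ∖ perp P) v} (∧-true (perp-intro (iso (proj-ts h′) (proj-∋ g) (∧-trueʳ {Y v} h))) (∧-trueʳ {Sing v} h′)) (Y-sing h′))
                 (λ h → let h′ = ∧-trueˡ {(perp u ∖ perp P) v} h in
                    ∧-true {Y v} (∧-true (∧-trueʳ {(perp u ∖ perp P) v} h) (∧-trueʳ {perp u v} h′)) (∩perp⊆proj π v u (∧-true hu (trans (perp-sym v u) (∧-trueˡ {perp u v} h′))))))) ⟩
          q * q * q * ⌈ (perp u ∖ perp P) ∩ Sing ⌉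
            ≡⟨ solve 2 (λ q n → q :* q :* q :* n := q :* q :* (q :* n)) refl q ⌈ (perp u ∖ perp P) ∩ Sing ⌉ ⟩
          q * q * (q * ⌈ (perp u ∖ perp P) ∩ Sing ⌉)
            ≡⟨ cong (q * q *_) (off-hyperplane Sing (perp-sub u) (perp-intro (iso (ts g) hP hu)) (Sing-B sP) (λ _ → s-line sP)) ⟩
          q * q * (s * (⌈ perp u ⌉ - ⌈ perp u ∩ perp P ⌉))
            ≡⟨ solve 4 (λ q s y z → q :* q :* (s :* (y :- z)) := s :* (q :* (y :* q) :- z :* (q :* q))) refl q s ⌈ perp u ⌉ ⌈ perp u ∩ perp P ⌉ ⟩
          s * (q * (⌈ perp u ⌉ * q) - ⌈ perp u ∩ perp P ⌉ * (q * q))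
            ≡⟨ cong₂ (λ y z → s * (q * y - z)) size₁ size₂ ⟩
          s * (q * total - total)
            ≡⟨ solve 3 (λ s q t → s :* (q :* t :- t) := (q :- :1) :* (t :* s)) refl s q total ⟩
          (q - 1ℚ) * (total * s)
            ≡⟨ trans (cong ((q - 1ℚ) *_) size) (sym (*-assoc (q - 1ℚ) Qe _)) ⟩
          a ∎
          where
          u≢0 : u ≢ 0ᵛ
          u≢0 e = nu (subst (_∈ ⟨ P ⟩) (sym e) (has-0 (⟨⟩-sub P)))
          tP : TS ⟨ P ⟩
          tP = TS-⟨⟩ sP
          tu : TS ⟨ u ⟩
          tu = TS-⟨⟩ (sing (ts g) u hu)
          tPu : TS (⟨ P ⟩ ⊞ ⟨ u ⟩)
          tPu = TS-⊞⟨⟩ tP (sing (ts g) u hu) (trans (Perp-⟨⟩ P u) (perp-intro (iso (ts g) hu hP)))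
          size₁ : ⌈ perp u ⌉ * q ≡ total
          size₁ = trans (cong₂ _*_ (∣∣-cong (λ v → sym (Perp-⟨⟩ u v))) (sym (∣⟨⟩∣ u≢0))) (TS-perp-size tu)
          size₂ : ⌈ perp u ∩ perp P ⌉ * (q * q) ≡ total
          size₂ = trans (cong₂ _*_
            (∣∣-cong {perp u ∩ perp P} {Perp (⟨ P ⟩ ⊞ ⟨ u ⟩)} (λ v → sym (trans (Perp-⊞⟨⟩ (⟨⟩-sub P) v) (trans (cong (_∧ perp u v) (Perp-⟨⟩ P v)) (∧-comm (perp P v) (perp u v))))))
            (sym (trans (adjoin (⟨⟩-sub P) nu) (cong (q *_) (∣⟨⟩∣ P≢0))))) (TS-perp-size tPu)
            where open import Data.Bool.Properties using (∧-comm)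

        -- For u outside π, `proj-sym` turns the condition into v in `proj u π`; what remains is
        -- that generator without its hyperplane in P⊥.
        outer : ∀ u → u ∈ Sing → u ∉ π → u ∉ perp P → q * q * q * N u ≡ b
        outer u su nu far = begin
          q * q * q * N u
            ≡⟨ cong (q * q * q *_) (∣∣-cong {λ v → Y v ∧ proj v π u} {pu ∖ perp P} (λ v → bool-ext
                 (λ h → let h′ = ∧-trueˡ {Y v} h in ∧-true (proj-sym g (Y-sing h′) nu (Y-out h′) (∧-trueʳ {Y v} h)) (∧-trueʳ {Sing v} h′))
                 (λ h → let h′ = ∧-trueˡ {pu v} h ; sv = sing tu v h′ ; f = ∧-trueʳ {pu v} h in
                    ∧-true {Y v} (∧-true sv f) (proj-sym g su (λ k → true-not f (perp-intro (iso (ts g) k hP))) nu h′)))) ⟩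
          q * q * q * ⌈ pu ∖ perp P ⌉
            ≡⟨ cong (q * q * q *_) (trans (sym (solve 2 (λ a b → a :+ b :- a := b) refl ⌈ pu ∩ perp P ⌉ ⌈ pu ∖ perp P ⌉)) (cong (_- ⌈ pu ∩ perp P ⌉) (sym (∣∣-split pu (perp P))))) ⟩
          q * q * q * (⌈ pu ⌉ - ⌈ pu ∩ perp P ⌉)
            ≡⟨ solve 3 (λ q y z → q :* q :* q :* (y :- z) := q :* q :* (q :* y :- q :* z)) refl q ⌈ pu ⌉ ⌈ pu ∩ perp P ⌉ ⟩
          q * q * (q * ⌈ pu ⌉ - q * ⌈ pu ∩ perp P ⌉)
            ≡⟨ cong₂ (λ y z → q * q * (q * y - z)) (∣gen∣ gu) (trans (hyperplane (sub tu) (proj-∋ g) (λ e → far (perp-intro e))) (∣gen∣ gu)) ⟩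
          q * q * (q * q ^^ d - q ^^ d)
            ≡⟨ solve 2 (λ q D → q :* q :* (q :* D :- D) := (q :- :1) :* (q :* q) :* D) refl q (q ^^ d) ⟩
          b ∎
          where
          pu : V → Bool
          pu = proj u π
          gu : Gen pu
          gu = proj-gen g su nu
          tu : TS pu
          tu = ts gu

        -- The two remaining kinds of u contribute nothing. A nonzero multiple of P in `proj v π`
        -- would give v ⊥ P. If u lies outside π and is orthogonal to P, then `proj u π` contains P,
        -- and v in `proj u π` again gives v ⊥ P.
        one : ∀ u → u ∈ π ⊎ u ∉ π → u ∈ Sing → q * q * q * N u * W u ≡ (a * ([ π u ] - [ ⟨ P ⟩ u ]) + b * (1ℚ - [ perp P u ])) * W u
        one u (inj₁ hu) su with split (⟨ P ⟩ u)
        ... | inj₂ nu = cong (_* W u) (trans (inner u hu nu) (sym (trans (cong₂ (λ s t → a * (s - t) + b * (1ℚ - [ perp P u ])) (cong [_] hu) (cong [_] (¬true nu)))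
                (trans (cong (λ t → a * (1ℚ - 0ℚ) + b * (1ℚ - t)) (cong [_] (perp-intro (iso (ts g) hu hP)))) (solve 2 (λ a b → a :* (:1 :- :0) :+ b :* (:1 :- :1) := a) refl a b)))))
        ... | inj₁ hl with u ≟ᵛ 0ᵛ
        ...   | yes refl rewrite W-0 = trans (*-zeroʳ (q * q * q * N 0ᵛ)) (sym (*-zeroʳ (a * ([ π 0ᵛ ] - [ ⟨ P ⟩ 0ᵛ ]) + b * (1ℚ - [ perp P 0ᵛ ]))))
        ...   | no nz = cong (_* W u) (trans (trans (cong (q * q * q *_) (none u zero-case)) (*-zeroʳ (q * q * q))) (sym (trans (cong₂ (λ s t → a * (s - t) + b * (1ℚ - [ perp P u ])) (cong [_] hu) (cong [_] hl))
                (trans (cong (λ t → a * (1ℚ - 1ℚ) + b * (1ℚ - t)) (cong [_] (perp-intro (iso (ts g) hu hP)))) (solve 2 (λ a b → a :* (:1 :- :1) :+ b :* (:1 :- :1) := :0) refl a b)))))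
          where
          zero-case : ∀ {v} → v ∈ Y → u ∉ proj v π
          zero-case {v} h k = let c , e = ⟨⟩-elim (⟨⟩-sym nz hl) in
            Y-far h (subst (λ t → B v t ≡ 0ᶠ) (sym e) (⊥-·ʳ c (iso (proj-ts h) (proj-∋ g) k)))
        one u (inj₂ nu) su with split (perp P u)
        ... | inj₂ far = cong (_* W u) (trans (outer u su nu far) (sym (trans (cong₂ (λ s t → a * ([ π u ] - s) + b * (1ℚ - t)) (cong [_] off) (cong [_] (¬true far)))
                (trans (cong (λ s → a * (s - 0ℚ) + b * (1ℚ - 0ℚ)) (cong [_] (¬true nu))) (solve 2 (λ a b → a :* (:0 :- :0) :+ b :* (:1 :- :0) := b) refl a b)))))
          where
          off : ⟨ P ⟩ u ≡ false
          off = ¬true (λ k → nu (⟨⟩-⊆ (sub (ts g)) hP u k))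
        ... | inj₁ near = cong (_* W u) (trans (trans (cong (q * q * q *_) (none u zero-case)) (*-zeroʳ (q * q * q))) (sym (trans (cong₂ (λ s t → a * ([ π u ] - s) + b * (1ℚ - t)) (cong [_] off) (cong [_] near))
                (trans (cong (λ s → a * (s - 0ℚ) + b * (1ℚ - 1ℚ)) (cong [_] (¬true nu))) (solve 2 (λ a b → a :* (:0 :- :0) :+ b :* (:1 :- :1) := :0) refl a b)))))
          where
          off : ⟨ P ⟩ u ≡ false
          off = ¬true (λ k → nu (⟨⟩-⊆ (sub (ts g)) hP u k))
          zero-case : ∀ {v} → v ∈ Y → u ∉ proj v π
          zero-case {v} h k = Y-far h (iso (ts (proj-gen g su nu)) (proj-sym g (Y-sing h) nu (Y-out h) k)
            (∩perp⊆proj π u P (∧-true hP (trans (perp-sym u P) near))))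

      -- Applied to a member it yields the lower bound for `x`; applied to a hyperplane of a member
      -- it yields the number of members through that hyperplane.
      weigh-degree : ∀ {X} → TS X →
                     q * ∑ (λ P → [ X P ] * Δ P) ≡ q * (q - 1ℚ) * Qe * q ^^ d * wt W X + q * q * ⌈ X ⌉ * (x + (q - 1ℚ) * wt W (Perp X))
      weigh-degree {X} a = begin
        q * ∑ (λ P → [ X P ] * Δ P)
          ≡⟨ cong (q *_) (trans (∑-cong (λ P → solve 5 (λ c e l r k → c :* (e :* l :+ k :* r) := e :* (c :* l) :+ k :* (c :* r)) refl [ X P ] (Qe * q ^^ d) (wt W ⟨ P ⟩) (wt W (perp P)) (q * q))) (∑-two _ _ (Qe * q ^^ d) (q * q))) ⟩
        q * (Qe * q ^^ d * ∑ (λ P → [ X P ] * wt W ⟨ P ⟩) + q * q * ∑ (λ P → [ X P ] * wt W (perp P)))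
          ≡⟨ cong (λ t → q * (Qe * q ^^ d * t + q * q * ∑ (λ P → [ X P ] * wt W (perp P)))) lines ⟩
        q * (Qe * q ^^ d * ((q - 1ℚ) * wt W X) + q * q * ∑ (λ P → [ X P ] * wt W (perp P)))
          ≡⟨ solve 5 (λ q e D w z → q :* (e :* D :* ((q :- :1) :* w) :+ q :* q :* z) := q :* (q :- :1) :* e :* D :* w :+ q :* q :* (q :* z)) refl q Qe (q ^^ d) (wt W X) _ ⟩
        q * (q - 1ℚ) * Qe * q ^^ d * wt W X + q * q * (q * ∑ (λ P → [ X P ] * wt W (perp P)))
          ≡⟨ cong (λ t → q * (q - 1ℚ) * Qe * q ^^ d * wt W X + q * q * t) perps ⟩
        q * (q - 1ℚ) * Qe * q ^^ d * wt W X + q * q * (⌈ X ⌉ * (x + (q - 1ℚ) * wt W (Perp X)))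
          ≡⟨ cong (q * (q - 1ℚ) * Qe * q ^^ d * wt W X +_) (sym (*-assoc (q * q) ⌈ X ⌉ _)) ⟩
        q * (q - 1ℚ) * Qe * q ^^ d * wt W X + q * q * ⌈ X ⌉ * (x + (q - 1ℚ) * wt W (Perp X)) ∎
        where
        lines : ∑ (λ P → [ X P ] * wt W ⟨ P ⟩) ≡ (q - 1ℚ) * wt W X
        lines = trans (weigh-family W X ⟨_⟩) (trans (∑-cong each) (∑-* (q - 1ℚ) _))
          where
          each : ∀ u → ⌈ (λ P → X P ∧ ⟨ P ⟩ u) ⌉ * W u ≡ (q - 1ℚ) * ([ X u ] * W u)
          each u with u ≟ᵛ 0ᵛ
          ... | yes refl rewrite W-0 = trans (*-zeroʳ ⌈ (λ P → X P ∧ ⟨ P ⟩ 0ᵛ) ⌉) (sym (solve 2 (λ a b → a :* (b :* :0) := :0) refl (q - 1ℚ) [ X 0ᵛ ]))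
          ... | no nz = trans (cong (_* W u) (through-u (split (X u)))) (*-assoc (q - 1ℚ) [ X u ] (W u))
            where
            through-u : u ∈ X ⊎ u ∉ X → ⌈ (λ P → X P ∧ ⟨ P ⟩ u) ⌉ ≡ (q - 1ℚ) * [ X u ]
            through-u (inj₂ n) = trans (∣∣-none (λ P h → n (⟨⟩-⊆ (sub a) (∧-trueˡ {X P} h) u (∧-trueʳ {X P} h))))
              (sym (trans (cong (λ b → (q - 1ℚ) * [ b ]) (¬true n)) (*-zeroʳ (q - 1ℚ))))
            through-u (inj₁ m) = trans (∣∣-cong {λ P → X P ∧ ⟨ P ⟩ u} {⟨ u ⟩ ∖ ⟨ 0ᵛ ⟩} (λ P → bool-ext
                (λ h → ∧-true (⟨⟩-sym nz (∧-trueʳ {X P} h)) (not-true (λ k → let c , e = ⟨⟩-elim k in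
                   nz (let c′ , e′ = ⟨⟩-elim (∧-trueʳ {X P} h) in trans e′ (trans (cong (c′ ·_) (trans e (·-0ᵛ c))) (·-0ᵛ c′))))))
                (λ h → ∧-true (⟨⟩-⊆ (sub a) m P (∧-trueˡ {⟨ u ⟩ P} h)) (⟨⟩-sym (λ e → true-not (∧-trueʳ {⟨ u ⟩ P} h) (subst (_∈ ⟨ 0ᵛ ⟩) (sym e) ⟨⟩-self)) (∧-trueˡ {⟨ u ⟩ P} h)))))
              (trans (∣∣-minus {⟨ u ⟩} {⟨ 0ᵛ ⟩} (⟨⟩-⊆ (⟨⟩-sub u) (has-0 (⟨⟩-sub u))))
              (trans (cong₂ _-_ (∣⟨⟩∣ nz) (∣∣-unique _ 0ᵛ ⟨⟩-self (λ v h → let c , e = ⟨⟩-elim h in trans e (·-0ᵛ c))))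
                (sym (trans (cong (λ b → (q - 1ℚ) * [ b ]) m) (*-identityʳ _)))))
        perps : q * ∑ (λ P → [ X P ] * wt W (perp P)) ≡ ⌈ X ⌉ * (x + (q - 1ℚ) * wt W (Perp X))
        perps = begin
          q * ∑ (λ P → [ X P ] * wt W (perp P))                  ≡⟨ cong (q *_) (weigh-family W X perp) ⟩
          q * ∑ (λ u → ⌈ (λ P → X P ∧ perp P u) ⌉ * W u)         ≡⟨ sym (∑-* q _) ⟩
          ∑ (λ u → q * (⌈ (λ P → X P ∧ perp P u) ⌉ * W u))       ≡⟨ ∑-cong each ⟩
          ∑ (λ u → ⌈ X ⌉ * W u + (⌈ X ⌉ * (q - 1ℚ)) * ([ Perp X u ] * W u))  ≡⟨ ∑-two W _ ⌈ X ⌉ (⌈ X ⌉ * (q - 1ℚ)) ⟩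
          ⌈ X ⌉ * x + (⌈ X ⌉ * (q - 1ℚ)) * wt W (Perp X)
            ≡⟨ solve 4 (λ n x q w → n :* x :+ n :* (q :- :1) :* w := n :* (x :+ (q :- :1) :* w)) refl ⌈ X ⌉ x q (wt W (Perp X)) ⟩
          ⌈ X ⌉ * (x + (q - 1ℚ) * wt W (Perp X)) ∎
          where
          each : ∀ u → q * (⌈ (λ P → X P ∧ perp P u) ⌉ * W u) ≡ ⌈ X ⌉ * W u + (⌈ X ⌉ * (q - 1ℚ)) * ([ Perp X u ] * W u)
          each u = trans (sym (*-assoc q _ (W u))) (trans (cong (_* W u) (trans (cong (q *_) (∣∣-cong {λ P → X P ∧ perp P u} {X ∩ perp u} (λ P → cong (X P ∧_) (perp-sym P u)))) (perp-count (sub a) u)))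
            (solve 4 (λ n q p w → n :* (:1 :+ (q :- :1) :* p) :* w := n :* w :+ n :* (q :- :1) :* (p :* w)) refl ⌈ X ⌉ q [ Perp X u ] (W u)))

    0<q^2 : 0ℚ < q * q
    0<q^2 = mul>0 0<q 0<q

    module Fullness (𝓛 : CLSet) where
      open CLSet 𝓛
      open Degree 𝓛 public

      -- The zero vector has exactly the borderline value, so a heavy vector is automatically
      -- nonzero and statements about flat vectors hold at 0 as well.
      Δ-0 : Δ 0ᵛ ≡ q * q * x
      Δ-0 = trans (cong₂ (λ s t → Qe * q ^^ d * s + q * q * t) line all) (solve 3 (λ e D y → e :* D :* :0 :+ y := y) refl Qe (q ^^ d) (q * q * x))
        where
        line : wt W ⟨ 0ᵛ ⟩ ≡ 0ℚ
        line = trans (∑-cong (λ v → trans ([]-guard (⟨ 0ᵛ ⟩ v) (λ h → trans (cong W (let c , e = ⟨⟩-elim h in trans e (·-0ᵛ c))) W-0)) (*-zeroʳ [ ⟨ 0ᵛ ⟩ v ]))) (∑ᴸ-0 (Finite.elems vectors))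
        all : wt W (perp 0ᵛ) ≡ x
        all = ∑-cong (λ v → trans (cong (λ b → [ b ] * W v) (perp-intro (B-refl (B-0 v)))) (*-identityˡ (W v)))

      wt-in : ∀ {K} → Gen K → χ K ≡ true → wt W K ≡ 1ℚ
      wt-in g h = trans (wt-gen g) (cong [_] h)

      wt-out : ∀ {K} → Gen K → ¬ χ K ≡ true → wt W K ≡ 0ℚ
      wt-out g h = trans (wt-gen g) (cong [_] (¬true h))

      term≥0 : ∀ {π P} → Gen π → P ∈ π → ∀ v → 0ℚ ≤ [ (Sing ∖ perp P) v ] * wt W (proj v π)
      term≥0 {π} {P} g hP v = subst (0ℚ ≤_)
        ([]-guard ((Sing ∖ perp P) v) (λ h → sym (wt-gen (proj-gen g (∧-trueˡ h) (λ k → true-not (∧-trueʳ {Sing v} h) (perp-intro (iso (ts g) k hP)))))))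
        (mul≥0 ([]≥0 ((Sing ∖ perp P) v)) ([]≥0 (χ (proj v π))))

      degree-out : ∀ {π P} → Gen π → P ∈ π → P ≢ 0ᵛ → ¬ χ π ≡ true →
                   q * q * q * ∑ (λ v → [ (Sing ∖ perp P) v ] * wt W (proj v π)) ≡ (q - 1ℚ) * q ^^ d * (q * q * x - Δ P)
      degree-out {π} {P} g hP nz h = trans (degree g hP nz) (trans (cong ((q - 1ℚ) * q ^^ d * (q * q * x - Δ P) +_) (trans (cong ((q - 1ℚ) * Qe * (q ^^ d * q ^^ d) *_) (wt-out g h)) (*-zeroʳ ((q - 1ℚ) * Qe * (q ^^ d * q ^^ d))))) (+-identityʳ _))

      out-light : ∀ {π P} → Gen π → P ∈ π → P ≢ 0ᵛ → ¬ χ π ≡ true → Δ P ≤ q * q * x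
      out-light {π} {P} g hP nz h = ≥0-diff (cancel≤ ((q - 1ℚ) * q ^^ d) (mul>0 0<q-1 q^d>0)
        (subst₂ _≤_ (sym (*-zeroʳ ((q - 1ℚ) * q ^^ d))) (degree-out g hP nz h)
          (mul≥0 (<⇒≤ (mul>0 0<q^2 0<q)) (∑ᴸ-≥0 (Finite.elems vectors) (term≥0 g hP)))))

      Full : V → Set
      Full P = P ∈ Sing × P ≢ 0ᵛ × (∀ {π} → Gen π → P ∈ π → χ π ≡ true)

      heavy-full : ∀ {P} → P ∈ Sing → q * q * x < Δ P → Full P
      heavy-full {P} sP h = sP , (λ { refl → <-irrefl (sym Δ-0) h }) , full
        where
        full : ∀ {π} → Gen π → P ∈ π → χ π ≡ true
        full {π} g hP with split (χ π)
        ... | inj₁ e = e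
        ... | inj₂ n = ⊥-elim (≤<-⊥ (out-light g hP (λ { refl → <-irrefl (sym Δ-0) h }) n) h)

      heavy-or : ∀ {π} → Gen π → (∃ λ P → P ∈ π × q * q * x < Δ P) ⊎ (∀ {P} → P ∈ π → Δ P ≤ q * q * x)
      heavy-or {π} g with search (λ P → π P ∧ does (q * q * x <? Δ P))
      ... | inj₁ (P , h) = inj₁ (P , ∧-trueˡ h , true-does (q * q * x <? Δ P) (∧-trueʳ {π P} h))
      ... | inj₂ n = inj₂ λ {P} h → ≮⇒≥ (λ k → n P (∧-true h (does-true (q * q * x <? Δ P) k)))

      -- For a member both W(π) and W(π⊥) equal 1, because the singular vectors of π⊥ are those of
      -- π. The bound q^(e-1) + 1 in the theorem is the value of `x` at which the total slack on a
      -- member vanishes.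
      excess : ∀ {π} → Gen π → χ π ≡ true → q * ∑ (λ P → [ π P ] * (q * q * x - Δ P)) ≡ q ^^ d * (q * (q - 1ℚ)) * (q * x - (Qe + q))
      excess {π} g h = begin
        q * ∑ (λ P → [ π P ] * (q * q * x - Δ P))
          ≡⟨ cong (q *_) (trans (∑-cong (λ P → solve 3 (λ p a b → p :* (a :- b) := a :* p :- p :* b) refl [ π P ] (q * q * x) (Δ P))) (trans (∑-- _ _) (cong (_- ∑ (λ P → [ π P ] * Δ P)) (∑-* (q * q * x) _)))) ⟩
        q * (q * q * x * ⌈ π ⌉ - ∑ (λ P → [ π P ] * Δ P))
          ≡⟨ solve 3 (λ q a b → q :* (a :- b) := q :* a :- q :* b) refl q (q * q * x * ⌈ π ⌉) _ ⟩
        q * (q * q * x * ⌈ π ⌉) - q * ∑ (λ P → [ π P ] * Δ P)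
          ≡⟨ cong₂ (λ n t → q * (q * q * x * n) - t) (∣gen∣ g) (trans (weigh-degree (ts g)) (trans (cong₂ (λ n w → q * (q - 1ℚ) * Qe * q ^^ d * wt W π + q * q * n * (x + (q - 1ℚ) * w)) (∣gen∣ g) perp-wt) (cong (λ w → q * (q - 1ℚ) * Qe * q ^^ d * w + q * q * q ^^ d * (x + (q - 1ℚ) * w)) (wt-in g h)))) ⟩
        q * (q * q * x * q ^^ d) - (q * (q - 1ℚ) * Qe * q ^^ d * 1ℚ + q * q * q ^^ d * (x + (q - 1ℚ) * 1ℚ))
          ≡⟨ solve 4 (λ q x D e → q :* (q :* q :* x :* D) :- (q :* (q :- :1) :* e :* D :* :1 :+ q :* q :* D :* (x :+ (q :- :1) :* :1)) := D :* (q :* (q :- :1)) :* (q :* x :- (e :+ q))) refl q x (q ^^ d) Qe ⟩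
        q ^^ d * (q * (q - 1ℚ)) * (q * x - (Qe + q)) ∎
        where
        perp-wt : wt W (Perp π) ≡ wt W π
        perp-wt = wt-cong W (λ v e → trans (sym (cong (_∧ Perp π v) e)) (gen-perp g v)) W-sing

      light-bound : ∀ {π} → Gen π → χ π ≡ true → (∀ {P} → P ∈ π → Δ P ≤ q * q * x) → Qe + q ≤ q * x
      light-bound {π} g h light = ≥0-diff (cancel≤ (q ^^ d * (q * (q - 1ℚ))) (mul>0 q^d>0 (mul>0 0<q 0<q-1))
        (subst₂ _≤_ (sym (*-zeroʳ (q ^^ d * (q * (q - 1ℚ))))) (excess g h) (mul≥0 (<⇒≤ 0<q) (∑ᴸ-≥0 (Finite.elems vectors) (λ P → slack P (split (π P)))))))
        where
        slack : ∀ P → P ∈ π ⊎ P ∉ π → 0ℚ ≤ [ π P ] * (q * q * x - Δ P)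
        slack P (inj₁ m) = mul≥0 ([]≥0 (π P)) (diff≥0 (light m))
        slack P (inj₂ n) = ≤-reflexive (sym (trans (cong (λ b → [ b ] * (q * q * x - Δ P)) (¬true n)) (*-zeroˡ (q * q * x - Δ P))))

      light-flat : ∀ {π} → Gen π → χ π ≡ true → (∀ {P} → P ∈ π → Δ P ≤ q * q * x) → q * x ≡ Qe + q → ∀ {P} → P ∈ π → Δ P ≡ q * q * x
      light-flat {π} g h light e {P} hP = ≤-antisym (light hP) (≥0-diff (≤-trans (≤-reflexive (sym sum0)) flip))
        where
        f : V → ℚ
        f P = [ π P ] * (q * q * x - Δ P)
        slack : ∀ P → P ∈ π ⊎ P ∉ π → 0ℚ ≤ f P
        slack P (inj₁ m) = mul≥0 ([]≥0 (π P)) (diff≥0 (light m))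
        slack P (inj₂ n) = ≤-reflexive (sym (trans (cong (λ b → [ b ] * (q * q * x - Δ P)) (¬true n)) (*-zeroˡ (q * q * x - Δ P))))
        sum0 : ∑ f ≡ 0ℚ
        sum0 = cancel≡ q 0<q (trans (excess g h) (trans (cong (λ t → q ^^ d * (q * (q - 1ℚ)) * (t - (Qe + q))) e)
          (solve 3 (λ q e a → a :* (e :+ q :- (e :+ q)) := q :* :0) refl q Qe (q ^^ d * (q * (q - 1ℚ))))))
        flip : ∑ f ≤ Δ P - q * q * x
        flip = ≤-trans (≤-reflexive sum0) (subst (0ℚ ≤_) (solve 2 (λ a b → :- (a :- b) := b :- a) refl (q * q * x) (Δ P))
          (neg-antimono-≤ {q * q * x - Δ P} {0ℚ} (≤-trans (≤-reflexive (sym (trans (cong (λ b → [ b ] * (q * q * x - Δ P)) hP) (*-identityˡ _)))) (≤-trans (∑ᴸ-term (Finite.elems vectors) (λ u → slack u (split (π u))) (Finite.complete vectors P)) (≤-reflexive sum0)))))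

      -- With Δ constant on X, `weigh-degree` becomes a linear relation between W(X) and W(X⊥). For
      -- a generator it determines W(X) itself, as `flat-gen` records.
      flat : ∀ {X} → TS X → (∀ {P} → P ∈ X → Δ P ≡ q * q * x) → q * ⌈ X ⌉ * x ≡ Qe * q ^^ d * wt W X + q * ⌈ X ⌉ * wt W (Perp X)
      flat {X} a h = cancel≡ (q * (q - 1ℚ)) (mul>0 0<q 0<q-1) (begin
        q * (q - 1ℚ) * (q * ⌈ X ⌉ * x)
          ≡⟨ solve 3 (λ q n x → q :* (q :- :1) :* (q :* n :* x) := q :* (n :* (q :* q :* x)) :- q :* q :* n :* x) refl q ⌈ X ⌉ x ⟩
        q * (⌈ X ⌉ * (q * q * x)) - q * q * ⌈ X ⌉ * x
          ≡⟨ cong (λ t → q * t - q * q * ⌈ X ⌉ * x) (trans (sym (∑-*ʳ (q * q * x) _)) (∑-cong (λ P → []-guard (X P) (λ m → sym (h m))))) ⟩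
        q * ∑ (λ P → [ X P ] * Δ P) - q * q * ⌈ X ⌉ * x
          ≡⟨ cong (_- q * q * ⌈ X ⌉ * x) (weigh-degree a) ⟩
        q * (q - 1ℚ) * Qe * q ^^ d * wt W X + q * q * ⌈ X ⌉ * (x + (q - 1ℚ) * wt W (Perp X)) - q * q * ⌈ X ⌉ * x
          ≡⟨ solve 7 (λ q e D w n x z → q :* (q :- :1) :* e :* D :* w :+ q :* q :* n :* (x :+ (q :- :1) :* z) :- q :* q :* n :* x := q :* (q :- :1) :* (e :* D :* w :+ q :* n :* z)) refl q Qe (q ^^ d) (wt W X) ⌈ X ⌉ x (wt W (Perp X)) ⟩
        q * (q - 1ℚ) * (Qe * q ^^ d * wt W X + q * ⌈ X ⌉ * wt W (Perp X)) ∎)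

      flat-gen : ∀ {π} → Gen π → (∀ {P} → P ∈ π → Δ P ≡ q * q * x) → q * x ≡ (Qe + q) * wt W π
      flat-gen {π} g h = cancel≡ (q ^^ d) q^d>0 (begin
        q ^^ d * (q * x)                               ≡⟨ solve 3 (λ D q x → D :* (q :* x) := q :* D :* x) refl (q ^^ d) q x ⟩
        q * q ^^ d * x                                 ≡⟨ cong (λ t → q * t * x) (sym (∣gen∣ g)) ⟩
        q * ⌈ π ⌉ * x                                  ≡⟨ flat (ts g) h ⟩
        Qe * q ^^ d * wt W π + q * ⌈ π ⌉ * wt W (Perp π)
          ≡⟨ cong₂ (λ n w → Qe * q ^^ d * wt W π + q * n * w) (∣gen∣ g) (wt-cong W (λ v e → trans (sym (cong (_∧ Perp π v) e)) (gen-perp g v)) W-sing) ⟩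
        Qe * q ^^ d * wt W π + q * q ^^ d * wt W π     ≡⟨ solve 4 (λ e D w q → e :* D :* w :+ q :* D :* w := D :* ((e :+ q) :* w)) refl Qe (q ^^ d) (wt W π) q ⟩
        q ^^ d * ((Qe + q) * wt W π)                   ∎)

      -- Not immediate, since W need not vanish even if every generator has weight 0. Without
      -- members the sum in `degree` is 0 for every generator and every nonzero vector on it, so all
      -- vectors of `G₀` are flat, and `flat-gen` evaluates `x`.
      empty-total : (∀ {K} → Gen K → ¬ χ K ≡ true) → x ≡ 0ℚ
      empty-total h = cancel≡ q 0<q (trans (flat-gen G₀-gen all-flat) (trans (cong ((Qe + q) *_) (wt-out G₀-gen (h G₀-gen)))
        (solve 2 (λ e q → (e :+ q) :* :0 := q :* :0) refl Qe q)))
        where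
        all-flat : ∀ {P} → P ∈ G₀ → Δ P ≡ q * q * x
        all-flat {P} hP with P ≟ᵛ 0ᵛ
        ... | yes refl = Δ-0
        ... | no nz = sym (trans (solve 2 (λ a b → a := a :- b :+ b) refl (q * q * x) (Δ P)) (trans (cong (_+ Δ P) zero-diff) (+-identityˡ (Δ P))))
          where
          zero-diff : q * q * x - Δ P ≡ 0ℚ
          zero-diff = cancel≡ ((q - 1ℚ) * q ^^ d) (mul>0 0<q-1 q^d>0) (trans (sym (degree-out G₀-gen hP nz (h G₀-gen)))
            (trans (cong (q * q * q *_) (trans (∑-cong (λ v → trans ([]-guard ((Sing ∖ perp P) v) (λ k →
                let g = proj-gen G₀-gen (∧-trueˡ k) (λ m → true-not (∧-trueʳ {Sing v} k) (perp-intro (G₀-iso m hP))) in wt-out g (h g)))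
              (*-zeroʳ [ (Sing ∖ perp P) v ]))) (∑ᴸ-0 (Finite.elems vectors)))) (solve 2 (λ q a → q :* q :* q :* :0 := a :* :0) refl q ((q - 1ℚ) * q ^^ d))))

    -- Splitting off point-pencils

    -- A finite list containing every member up to equality of sets. Its length is the termination
    -- measure of `decompose`, and it makes the search for a heavy vector on some member decidable.
    record Covers (𝓛 : CLSet) (Ls : List (V → Bool)) : Set where
      open CLSet 𝓛
      field
        members : All (λ K → Gen K × χ K ≡ true) Ls
        covers  : ∀ {K} → Gen K → χ K ≡ true → Any (K ⊆_) Ls

    record Pencils (𝓛 : CLSet) : Set where
      open CLSet 𝓛
      field
        k        : ℕ
        vertex   : Fin k → V
        k≡x      : ι k ≡ x
        singular : ∀ i → vertex i ∈ Sing
        nonzero  : ∀ i → vertex i ≢ 0ᵛ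
        apart    : ∀ i j → i ≢ j → B (vertex i) (vertex j) ≢ 0ᶠ
        pencil   : ∀ {π} → Gen π → χ π ≡ true → ∃ λ i → vertex i ∈ π
        pencil⁻¹ : ∀ {π} → Gen π → ∀ i → vertex i ∈ π → χ π ≡ true

    module _ (𝓛 : CLSet) {P : V} (full : Fullness.Full 𝓛 P) where
      open CLSet 𝓛

      -- A point-pencil is itself a Cameron-Liebler set, with weight concentrated in its vertex;
      -- since the whole pencil lies in the set, the weights can be subtracted.
      remove : CLSet
      remove = record
        { W = W′
        ; W-0 = trans (cong₂ (λ s b → s - [ b ]) W-0 (==-false (λ e → proj₁ (proj₂ full) (sym e)))) refl
        ; W-sing = λ v n → trans (cong₂ (λ s b → s - [ b ]) (W-sing v n) (==-false (λ { refl → n (proj₁ full) }))) refl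
        ; χ = λ K → χ K ∧ not (K P)
        ; χ-mono = λ {K} {M} a b h → ∧-true (χ-mono a b (∧-trueˡ h)) (not-true (λ m → true-not (∧-trueʳ {χ K} h) (b P m)))
        ; wt-gen = λ {K} g → trans (difference K) (trans (cong (_- [ K P ]) (wt-gen g)) (minus (χ K) (K P) (proj₂ (proj₂ full) g)))
        }
        where
        W′ : V → ℚ
        W′ v = W v - [ v == P ]
        difference : ∀ K → wt W′ K ≡ wt W K - [ K P ]
        difference K = trans (∑-cong (λ v → solve 3 (λ k w p → k :* (w :- p) := k :* w :- p :* k) refl [ K v ] (W v) [ v == P ]))
          (trans (∑-- _ _) (cong (λ t → wt W K - t) (∑-δ (λ v → [ K v ]) P)))
        minus : ∀ a b → (b ≡ true → a ≡ true) → [ a ] - [ b ] ≡ [ a ∧ not b ]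
        minus true  true  h = refl
        minus true  false h = refl
        minus false true  h = ⊥-elim (false-¬true refl (h refl))
        minus false false h = refl

      remove-x : CLSet.x remove ≡ x - 1ℚ
      remove-x = trans (∑-- W _) (cong (λ t → x - t) (∑-δ1 P))

      pencils-cons : Pencils remove → Pencils 𝓛
      pencils-cons ps = record
        { k = suc k ; vertex = vs
        ; k≡x = trans (cong (1ℚ +_) (trans k≡x remove-x)) (solve 1 (λ x → :1 :+ (x :- :1) := x) refl x)
        ; singular = λ { zero → proj₁ full ; (suc i) → singular i }
        ; nonzero = λ { zero → proj₁ (proj₂ full) ; (suc i) → nonzero i }
        ; apart = λ { zero zero n → ⊥-elim (n refl) ; zero (suc j) n → far j ; (suc i) zero n → λ e → far i (B-refl e) ; (suc i) (suc j) n → apart i j (λ e → n (cong suc e)) }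
        ; pencil = pen
        ; pencil⁻¹ = λ { g zero h → proj₂ (proj₂ full) g h ; g (suc i) h → ∧-trueˡ (pencil⁻¹ g i h) }
        }
        where
        open Pencils ps
        vs : Fin (suc k) → V
        vs zero    = P
        vs (suc i) = vertex i
        -- If the vertices were orthogonal, a generator through both would belong to the remaining
        -- set by `pencil⁻¹`, although every generator through P has been removed.
        far : ∀ i → B P (vertex i) ≢ 0ᶠ
        far i e = let K , g , incl = extend (TS-⊞⟨⟩ (TS-⟨⟩ (proj₁ full)) (singular i) (trans (Perp-⟨⟩ P (vertex i)) (perp-intro (B-refl e)))) in
          true-not (∧-trueʳ {χ K} (pencil⁻¹ g i (incl _ (⊞⟨⟩-self (⟨⟩-sub P))))) (incl P (⊞-⊆ˡ (⟨⟩-sub (vertex i)) P ⟨⟩-self))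
        pen : ∀ {π} → Gen π → χ π ≡ true → ∃ λ i → vs i ∈ π
        pen {π} g h with split (π P)
        ... | inj₁ m = zero , m
        ... | inj₂ n = let i , m = pencil g (∧-true h (not-true n)) in suc i , m

      Avoids? : (K : V → Bool) → Dec (not (K P) ≡ true)
      Avoids? K = not (K P) BP.≟ true

      remove-covers : ∀ {Ls} → Covers 𝓛 Ls → Covers remove (filter Avoids? Ls)
      remove-covers {Ls} c = record
        { members = All.map (λ ((g , h) , a) → g , ∧-true h a) (All.zip (AllP.filter⁺ Avoids? members , AllP.all-filter Avoids? Ls))
        ; covers = λ {K} g h → let M , m , s = ∈L.find (covers g (∧-trueˡ h)) in
            ∈L.lose (∈P.∈-filter⁺ Avoids? m (not-true (λ k → true-not (∧-trueʳ {χ K} h) (gen-⊆ g (proj₁ (All.lookup members m)) s P k)))) s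
        }
        where open Covers c

      remove-shorter : ∀ {Ls} → Covers 𝓛 Ls → length (filter Avoids? Ls) ℕ.< length Ls
      remove-shorter {Ls} c = LP.filter-notAll Avoids? Ls (Any.map (λ {K} s a → true-not a (s P P∈)) (Covers.covers c gK (proj₂ (proj₂ full) gK P∈)))
        where
        ext = extend (TS-⟨⟩ (proj₁ full))
        gK = proj₁ (proj₂ ext)
        P∈ = proj₂ (proj₂ ext) P ⟨⟩-self

    -- `small` is a condition on the parameter that survives x ↦ x - 1 and guarantees a full vertex
    -- on any member. It is trivial in rank one and is the strict inequality q x < q^e + q in higher
    -- rank.
    module _ (small : ℚ → Set) (small-pred : ∀ {a} → small a → small (a - 1ℚ))
             (find-full : ∀ 𝓛 → small (CLSet.x 𝓛) → ∀ {K} → Gen K → CLSet.χ 𝓛 K ≡ true → ∃ λ P → Fullness.Full 𝓛 P) where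

      decompose : ∀ n 𝓛 Ls → length Ls ℕ.≤ n → Covers 𝓛 Ls → small (CLSet.x 𝓛) → Pencils 𝓛
      decompose n 𝓛 [] _ c sm = record
        { k = 0 ; vertex = λ () ; k≡x = sym (Fullness.empty-total 𝓛 none) ; singular = λ () ; nonzero = λ () ; apart = λ ()
        ; pencil = λ g h → ⊥-elim (none g h) ; pencil⁻¹ = λ g () }
        where
        none : ∀ {K} → Gen K → ¬ CLSet.χ 𝓛 K ≡ true
        none g h with Covers.covers c g h
        ... | ()
      decompose (suc n) 𝓛 (K ∷ Ls) (ℕ.s≤s le) c sm with Covers.members c
      ... | (g , h) ∷ _ = let P , full = find-full 𝓛 sm g h in
        pencils-cons 𝓛 full (decompose n (remove 𝓛 full) (filter (Avoids? 𝓛 full) (K ∷ Ls))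
          (ℕP.≤-pred (ℕP.≤-trans (remove-shorter 𝓛 full c) (ℕ.s≤s le))) (remove-covers 𝓛 full c)
          (subst small (sym (remove-x 𝓛 full)) (small-pred sm)))

    -- The equality case x = q^(e-1) + 1 in which no point is full; T is the set of vectors on the members of 𝓛.
    module Extreme (𝓛 : CLSet) {k₀ : ℕ} (d-suc : suc k₀ ≡ d) (x-eq : q * CLSet.x 𝓛 ≡ Qe + q)
                   (on-flat : ∀ {K} → Gen K → CLSet.χ 𝓛 K ≡ true → ∀ {P} → P ∈ K → Fullness.Δ 𝓛 P ≡ q * q * CLSet.x 𝓛) where
      open CLSet 𝓛 public
      open Fullness 𝓛 public

      record Member (K : V → Bool) : Set where
        constructor member
        field
          gen : Gen K
          inχ : χ K ≡ true
      open Member public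

      T : V → Set
      T v = ∃ λ K → Member K × v ∈ K

      transfer : ∀ {K M} → Member K → Gen M → K ⊆ M → Member M
      transfer (member g h) g′ s = member g′ (χ-mono s (gen-⊆ g g′ s) h)

      T-sing : ∀ {v} → T v → v ∈ Sing
      T-sing (K , m , h) = sing (ts (gen m)) _ h

      T-· : ∀ c {v} → T v → T (c · v)
      T-· c (K , m , h) = K , m , has-· (sub (ts (gen m))) c h

      T-flat : ∀ {v} → T v → Δ v ≡ q * q * x
      T-flat (K , m , h) = on-flat (gen m) (inχ m) h

      x>1 : 1ℚ < x
      x>1 = *-cancelˡ-<-nonNeg q {{nonNegative (<⇒≤ 0<q)}} (subst₂ _<_ (trans (+-identityˡ q) (sym (*-identityʳ q))) (sym x-eq) (+-monoˡ-< q Qe>0))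

      far-point : ∀ {K v} → Gen K → v ∈ Sing → v ∉ K → ∃ λ y → y ∈ K × B y v ≢ 0ᶠ
      far-point {K} {v} g h n with Perp-or K v
      ... | inj₁ k = ⊥-elim (n (gen-max g h k))
      ... | inj₂ r = r

      -- Suppose `proj P K` is not a member. As Δ P has its borderline value, the sum in `degree` is
      -- 0, so no generator that meets `proj P K` in a hyperplane and avoids P is a member. But K is
      -- such a generator: it is recovered as `proj v π` for v in K not orthogonal to P.
      T-proj : ∀ {K P} → Member K → T P → P ∉ K → Member (proj P K)
      T-proj {K} {P} m tP n with split (χ (proj P K))
      ... | inj₁ e = member (proj-gen (gen m) (T-sing tP) n) e
      ... | inj₂ out with far-point (gen m) (T-sing tP) n
      ...   | v , vK , far = ⊥-elim (χM (inχ (transfer m gM K⊆M)))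
        where
        π : V → Bool
        π = proj P K
        gπ : Gen π
        gπ = proj-gen (gen m) (T-sing tP) n
        P≢0 : P ≢ 0ᵛ
        P≢0 refl = n (has-0 (sub (ts (gen m))))
        vS : v ∈ Sing
        vS = sing (ts (gen m)) v vK
        v∉π : v ∉ π
        v∉π h = far (iso (ts gπ) h (proj-∋ (gen m)))
        M : V → Bool
        M = proj v π
        gM : Gen M
        gM = proj-gen gπ vS v∉π
        f : V → ℚ
        f u = [ (Sing ∖ perp P) u ] * wt W (proj u π)
        sum0 : ∑ f ≡ 0ℚ
        sum0 = cancel≡ (q * q * q) (mul>0 (mul>0 0<q 0<q) 0<q) (trans (degree-out gπ (proj-∋ (gen m)) P≢0 out)
          (trans (cong (λ t → (q - 1ℚ) * q ^^ d * (q * q * x - t)) (T-flat tP)) (solve 3 (λ a b q → a :* (b :- b) := q :* q :* q :* :0) refl ((q - 1ℚ) * q ^^ d) (q * q * x) q)))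
        χM : ¬ χ M ≡ true
        χM h = ≤<-⊥ (≤-trans (≤-reflexive (sym one)) (≤-trans (∑ᴸ-term (Finite.elems vectors) (term≥0 gπ (proj-∋ (gen m))) (Finite.complete vectors v)) (≤-reflexive sum0))) 0<1
          where
          one : f v ≡ 1ℚ
          one = trans (cong₂ (λ b t → [ b ] * t) (∧-true vS (not-true (λ k → far (perp-elim k)))) (wt-in gM h)) (*-identityˡ 1ℚ)
        K⊆M : K ⊆ M
        K⊆M u uK = ⊞-⊆ {K ∩ perp P} {⟨ v ⟩} (sub (ts gM)) (λ w h → ∩perp⊆proj π v w (∧-true (∩perp⊆proj K P w h) (perp-intro (iso (ts (gen m)) (∧-trueˡ h) vK))))
          (⟨⟩-⊆ (sub (ts gM)) (proj-∋ gπ)) u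
          (⊆-full {(K ∩ perp P) ⊞ ⟨ v ⟩} {K} (⊞-⊆ (sub (ts (gen m))) (λ _ → ∧-trueˡ) (⟨⟩-⊆ (sub (ts (gen m))) vK))
            (≤-reflexive (sym (trans (adjoin (∩-sub (sub (ts (gen m))) (perp-sub P)) (λ h → far (perp-elim (∧-trueʳ {K v} h)))) (hyperplane-size (gen m) (T-sing tP) n)))) u uK)

      -- All vectors of π are flat, so `flat-gen` applies; weight 0 would give x = 0, against x > 1.
      T-gen : ∀ {π} → Gen π → (∀ {v} → v ∈ π → T v) → Member π
      T-gen {π} g h with split (χ π)
      ... | inj₁ e = member g e
      ... | inj₂ n = ⊥-elim (<-irrefl (sym zero-x) (<-trans 0<1 x>1))
        where
        zero-x : x ≡ 0ℚ
        zero-x = cancel≡ q 0<q (trans (flat-gen g (λ k → T-flat (h k))) (trans (cong ((Qe + q) *_) (wt-out g n)) (solve 2 (λ e q → (e :+ q) :* :0 := q :* :0) refl Qe q)))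

      -- If v is not in K, then u lies in K ∩ v⊥, and the member `proj v K` contains both vectors.
      T-⊕ : ∀ {u v} → T u → T v → B u v ≡ 0ᶠ → T (u ⊕ v)
      T-⊕ {u} {v} (K , m , uK) tv o with split (K v)
      ... | inj₁ vK = K , m , has-⊕ (sub (ts (gen m))) uK vK
      ... | inj₂ n = proj v K , p , has-⊕ (sub (ts (gen p))) (∩perp⊆proj K v u (∧-true uK (perp-intro o))) (proj-∋ (gen m))
        where
        p : Member (proj v K)
        p = T-proj m tv n

      -- Hyperplanes of members

      module Hyperplane {K : V → Bool} (m : Member K) {z y : V} (zK : z ∈ K) (far : B z y ≢ 0ᶠ) where
        H : V → Bool
        H = K ∩ perp y
        tK : TS K
        tK = ts (gen m)
        tH : TS H
        tH = TS-∩ tK (perp-sub y)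
        open Residue 𝓛 tH public
        H-size : q * ⌈ H ⌉ ≡ ⌈ K ⌉
        H-size = hyperplane (sub tK) zK far
        H-gen : ∀ {v} → v ∈ Y → Gen (H ⊞ ⟨ v ⟩)
        H-gen h = record { ts = Y-TS h ; ∣gen∣ = trans (Y-size h) (trans H-size (∣gen∣ (gen m))) }
        z∉H : z ∉ H
        z∉H h = far (perp-elim (∧-trueʳ {K z} h))
        K⊆ : ∀ {u} → u ∈ K → u ∉ H → K ⊆ H ⊞ ⟨ u ⟩
        K⊆ {u} uK n = ⊆-full {H ⊞ ⟨ u ⟩} {K} (⊞-⊆ (sub tK) (λ _ → ∧-trueˡ) (⟨⟩-⊆ (sub tK) uK)) (≤-reflexive (sym (trans (adjoin (sub tH) n) H-size)))
        H>0 : 0ℚ < ⌈ H ⌉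
        H>0 = ∣sub∣>0 (sub tH)

        -- Each member through H accounts for (q - 1) |H| of the vectors v, so exactly `x` members
        -- contain H. The count weighs the spans H + ⟨v⟩ and evaluates the result by `flat` for X =
        -- H.
        members-through : ⌈ (λ v → Y v ∧ χ (H ⊞ ⟨ v ⟩)) ⌉ ≡ (q - 1ℚ) * ⌈ H ⌉ * x
        members-through = cancel≡ q 0<q (begin
          q * ⌈ (λ v → Y v ∧ χ (H ⊞ ⟨ v ⟩)) ⌉
            ≡⟨ cong (q *_) (trans (∑-cong (λ v → trans ([]-∧ (Y v) _) ([]-guard (Y v) (λ h → sym (wt-gen (H-gen h)))))) spans) ⟩
          q * (⌈ Y ⌉ * wt W H + (q * ⌈ H ⌉ - ⌈ H ⌉) * (wt W (Perp H) - wt W H))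
            ≡⟨ solve 5 (λ q y w n z → q :* (y :* w :+ (q :* n :- n) :* (z :- w)) := q :* y :* w :+ q :* (q :* n :- n) :* (z :- w)) refl q ⌈ Y ⌉ (wt W H) ⌈ H ⌉ (wt W (Perp H)) ⟩
          q * ⌈ Y ⌉ * wt W H + q * (q * ⌈ H ⌉ - ⌈ H ⌉) * (wt W (Perp H) - wt W H)
            ≡⟨ cong (λ t → t * wt W H + q * (q * ⌈ H ⌉ - ⌈ H ⌉) * (wt W (Perp H) - wt W H)) (trans (residue-count 1 k₀ (trans (ℕP.+-comm k₀ 1) d-suc) tH size-k)
                 (cong₂ (λ a b → (q * 1ℚ - 1ℚ) * (q * a + Qe * b)) (sym size-k) size-d)) ⟩
          (q * 1ℚ - 1ℚ) * (q * ⌈ H ⌉ + Qe * (q * ⌈ H ⌉)) * wt W H + q * (q * ⌈ H ⌉ - ⌈ H ⌉) * (wt W (Perp H) - wt W H)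
            ≡⟨ solve 5 (λ q n e w z → (q :* :1 :- :1) :* (q :* n :+ e :* (q :* n)) :* w :+ q :* (q :* n :- n) :* (z :- w) := (q :- :1) :* (e :* (q :* n) :* w :+ q :* n :* z)) refl q ⌈ H ⌉ Qe (wt W H) (wt W (Perp H)) ⟩
          (q - 1ℚ) * (Qe * (q * ⌈ H ⌉) * wt W H + q * ⌈ H ⌉ * wt W (Perp H))
            ≡⟨ cong (λ t → (q - 1ℚ) * (Qe * t * wt W H + q * ⌈ H ⌉ * wt W (Perp H))) (sym size-d) ⟩
          (q - 1ℚ) * (Qe * q ^^ d * wt W H + q * ⌈ H ⌉ * wt W (Perp H))
            ≡⟨ cong ((q - 1ℚ) *_) (sym (flat tH (λ {P} h → T-flat (K , m , ∧-trueˡ {K P} h)))) ⟩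
          (q - 1ℚ) * (q * ⌈ H ⌉ * x)
            ≡⟨ solve 3 (λ q n x → (q :- :1) :* (q :* n :* x) := q :* ((q :- :1) :* n :* x)) refl q ⌈ H ⌉ x ⟩
          q * ((q - 1ℚ) * ⌈ H ⌉ * x) ∎)
          where
          size-d : q ^^ d ≡ q * ⌈ H ⌉
          size-d = trans (sym (∣gen∣ (gen m))) (sym H-size)
          size-k : ⌈ H ⌉ ≡ q ^^ k₀
          size-k = cancel≡ q 0<q (trans (sym size-d) (cong (q ^^_) (sym d-suc)))

        opaque
          another-member : ∃ λ v → v ∈ Y × Member (H ⊞ ⟨ v ⟩) × v ∉ K
          another-member = let v , h , n = outside {λ v → Y v ∧ χ (H ⊞ ⟨ v ⟩)} {K ∖ H} few in
            v , ∧-trueˡ {Y v} h , member (H-gen (∧-trueˡ {Y v} h)) (∧-trueʳ {Y v} h) ,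
            λ k → n (∧-true k (∧-trueʳ {(Sing ∩ Perp H) v} (∧-trueˡ {Y v} h)))
            where
            few : ⌈ K ∖ H ⌉ < ⌈ (λ v → Y v ∧ χ (H ⊞ ⟨ v ⟩)) ⌉
            few = subst₂ _<_ (trans (solve 2 (λ q n → (q :- :1) :* n :* :1 := q :* n :- n) refl q ⌈ H ⌉) (trans (cong (_- ⌈ H ⌉) H-size) (sym (∣∣-minus {K} {H} (λ _ → ∧-trueˡ))))) (sym members-through)
              (*-monoʳ-<-pos ((q - 1ℚ) * ⌈ H ⌉) {{positive (mul>0 0<q-1 H>0)}} x>1)

      Opposite : (V → Bool) → (V → Bool) → Set
      Opposite K M = ∀ {v} → v ∈ K → v ∈ M → v ≡ 0ᵛ

      separate : ∀ {u} → u ∈ Sing → u ≢ 0ᵛ → ∃ λ y → B u y ≢ 0ᶠ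
      separate {u} su nz with search (λ y → not (perp y u))
      ... | inj₁ (y , h) = y , λ e → true-not h (perp-intro e)
      ... | inj₂ rad = ⊥-elim (nz (nondeg su (λ v → B-refl (all v (split (perp v u))))))
        where
        all : ∀ v → u ∈ perp v ⊎ u ∉ perp v → B u v ≡ 0ᶠ
        all v (inj₁ k) = perp-elim k
        all v (inj₂ k) = ⊥-elim (rad v (not-true k))

      module _ {K M : V → Bool} (mK : Member K) (mM : Member M) {u : V} (uK : u ∈ K) (uM : u ∈ M) {y : V} (far : B u y ≢ 0ᶠ) where
        open Hyperplane mM uM far

        -- The hyperplane H of M avoids u ∈ K, and no vector of K outside H is gained by moving to another member through H.
        shrink : ∀ {v} → v ∈ Y → v ∉ M → ⌈ K ∩ (H ⊞ ⟨ v ⟩) ⌉ + 1ℚ ≤ ⌈ K ∩ M ⌉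
        shrink {v} vY v∉M = subst₂ _≤_ (+-comm 1ℚ ⌈ K ∩ (H ⊞ ⟨ v ⟩) ⌉) (solve 2 (λ a b → a :- b :+ b := a) refl ⌈ K ∩ M ⌉ ⌈ K ∩ (H ⊞ ⟨ v ⟩) ⌉)
          (+-monoˡ-≤ ⌈ K ∩ (H ⊞ ⟨ v ⟩) ⌉ (subst (1ℚ ≤_) (∣∣-minus {K ∩ M} {K ∩ (H ⊞ ⟨ v ⟩)} (λ w k → ∧-true (∧-trueˡ k) (∧-trueˡ {M w} (smaller w k))))
            (subst (λ b → [ b ] ≤ ⌈ (K ∩ M) ∖ (K ∩ (H ⊞ ⟨ v ⟩)) ⌉) (∧-true {(K ∩ M) u} (∧-true uK uM) (not-true (λ k → z∉H (smaller u k))))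
              (∑ᴸ-term (Finite.elems vectors) (λ w → []≥0 (((K ∩ M) ∖ (K ∩ (H ⊞ ⟨ v ⟩))) w)) (Finite.complete vectors u)))))
          where
          H⊥v : ∀ {w} → w ∈ H → B w v ≡ 0ᶠ
          H⊥v k = B-refl (Perp-elim (∧-trueʳ {Sing v} (∧-trueˡ {(Sing ∩ Perp H) v} vY)) k)
          smaller : ∀ w → w ∈ K ∩ (H ⊞ ⟨ v ⟩) → w ∈ H
          smaller w k with ⊞⟨⟩-elim (∧-trueʳ {K w} k)
          ... | t , c , tH′ , refl with c ≟ᶠ 0ᶠ
          ...   | yes refl = subst (_∈ H) (sym (trans (cong (t ⊕_) (0-· v)) (⊕-identityʳ t))) tH′
          ...   | no nz = ⊥-elim (v∉M (gen-max (gen mM) (sing (ts (H-gen vY)) v (⊞⟨⟩-self (sub tH)))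
            (Perp-intro (λ {s} sM → let h₀ , b , hH , e = ⊞⟨⟩-elim (K⊆ uM z∉H s sM) in
              subst (λ s → B v s ≡ 0ᶠ) (sym e) (⊥-⊕ʳ (B-refl (H⊥v hH)) (⊥-·ʳ b v⊥u))))))
            where
            v⊥u : B v u ≡ 0ᶠ
            v⊥u = integral nz (trans (sym (+ᶠ-identityˡ _)) (trans (cong (_+ᶠ c *ᶠ B v u) (sym (iso tK (∧-trueˡ tH′) uM)))
              (trans (sym (B-line t c v u)) (iso (ts (gen mK)) (∧-trueˡ k) uK))))

        closer : ∃ λ M′ → Member M′ × ⌈ K ∩ M′ ⌉ + 1ℚ ≤ ⌈ K ∩ M ⌉
        closer = let v , vY , m′ , n = another-member in H ⊞ ⟨ v ⟩ , m′ , shrink vY n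

      -- Induction on an upper bound for |K ∩ M|: as long as the intersection is not zero, `closer`
      -- lowers its size by at least 1, and the size stays positive because of the zero vector.
      opposite : ∀ n {K M} → Member K → Member M → ⌈ K ∩ M ⌉ ≤ ι n → ∃ λ M′ → Member M′ × Opposite K M′
      opposite n {K} {M} mK mM le = search-case (search (λ u → (K ∩ M) u ∧ not (u == 0ᵛ)))
        where
        step : ∀ n → ⌈ K ∩ M ⌉ ≤ ι n → (∃ λ M′ → Member M′ × ⌈ K ∩ M′ ⌉ + 1ℚ ≤ ⌈ K ∩ M ⌉) → ∃ λ M′ → Member M′ × Opposite K M′
        step zero le _ = ⊥-elim (≤<-⊥ le (∣sub∣>0 (∩-sub (sub (ts (gen mK))) (sub (ts (gen mM))))))
        step (suc n) le (M′ , m′ , s) = opposite n mK m′ (subst₂ _≤_ (solve 1 (λ a → a :+ :1 :- :1 := a) refl ⌈ K ∩ M′ ⌉) (solve 1 (λ a → :1 :+ a :- :1 := a) refl (ι n)) (+-monoˡ-≤ (- 1ℚ) (≤-trans s le)))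
        case : ∀ v → v ∈ K → v ∈ M → ¬ v ∈ (λ u → (K ∩ M) u ∧ not (u == 0ᵛ)) → Dec (v ≡ 0ᵛ) → v ≡ 0ᵛ
        case v vK vM none (yes e) = e
        case v vK vM none (no ne) = ⊥-elim (none (∧-true (∧-true vK vM) (not-true (λ k → ne (==-true k)))))
        search-case : (∃ λ u → (K ∩ M) u ∧ not (u == 0ᵛ) ≡ true) ⊎ (∀ u → ¬ (K ∩ M) u ∧ not (u == 0ᵛ) ≡ true) → ∃ λ M′ → Member M′ × Opposite K M′
        search-case (inj₂ none) = M , mM , λ {v} vK vM → case v vK vM (none v) (v ≟ᵛ 0ᵛ)
        search-case (inj₁ (u , h)) = step n le (closer mK mM (∧-trueˡ (∧-trueˡ h)) uM (proj₂ (separate (sing (ts (gen mM)) u uM) (λ { refl → true-not (∧-trueʳ {(K ∩ M) u} h) (==-refl u) }))))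
          where
          uM : u ∈ M
          uM = ∧-trueʳ {K u} (∧-trueˡ h)

      -- Compares T with a candidate Z inside U that meets every line of U with direction P in K,
      -- not orthogonal to P, in `t` vectors. Relative to a hyperplane H of K, `Z-count` gives the
      -- number of vectors of Z and `members-through` the number of vectors on members. Equality of
      -- the two forces T ⊆ Z; a deficit produces a vector of T outside U.
      module Sandwich {K K′ : V → Bool} (mK : Member K) (mK′ : Member K′) (opp : Opposite K K′)
                      {U : V → Bool} (sU : Sub U) (K⊆U : K ⊆ U) (K′⊆U : K′ ⊆ U)
                      (Z : V → Bool) (Z⊆U : Z ⊆ U) (Z-sing : Z ⊆ Sing) (K⊆Z : K ⊆ Z)
                      (t : ℚ) (Z-line : ∀ {y P} → P ∈ K → y ∈ U → B y P ≢ 0ᶠ → ∑ᶠ (λ c → [ Z (y ⊕ c · P) ]) ≡ t) where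

        private
          gK = gen mK

        -- K meets the radical of U trivially, since U contains the opposite member K′. This is what
        -- lets `duality` compute sizes inside U.
        anisotropic : ∀ {v} → v ∈ K → (∀ {u} → u ∈ U → B v u ≡ 0ᶠ) → v ≡ 0ᵛ
        anisotropic vK h = opp vK (gen-max (gen mK′) (sing (ts gK) _ vK) (Perp-intro (λ k → h (K′⊆U _ k))))

        U-size : ∀ {X} → Sub X → X ⊆ K → ⌈ U ∩ Perp X ⌉ * ⌈ X ⌉ ≡ ⌈ U ⌉
        U-size {X} sX h = trans (duality sU sX) (trans (cong (_* ⌈ U ⌉) (∣∣-unique (X ∩ Perp U) 0ᵛ (∧-true (has-0 sX) (has-0 (Perp-sub U)))
          (λ v k → anisotropic (h v (∧-trueˡ k)) (Perp-elim (∧-trueʳ {X v} k))))) (*-identityˡ ⌈ U ⌉))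

        module _ {z y : V} (zK : z ∈ K) (far : B z y ≢ 0ᶠ) where
          open Hyperplane mK zK far

          -- Vectors of Y ∩ Z orthogonal to z are orthogonal to all of K, hence lie in K. The others
          -- are counted along the lines with direction z.
          Z-count : q * ⌈ K ⌉ * ⌈ Y ∩ Z ⌉ ≡ (q - 1ℚ) * (⌈ K ⌉ * ⌈ K ⌉ + t * ⌈ U ⌉)
          Z-count = begin
            q * ⌈ K ⌉ * ⌈ Y ∩ Z ⌉
              ≡⟨ cong (q * ⌈ K ⌉ *_) (trans (∣∣-split (Y ∩ Z) (perp z)) (cong₂ _+_ (∣∣-cong near) (∣∣-cong off))) ⟩
            q * ⌈ K ⌉ * (⌈ K ∖ H ⌉ + ⌈ (X ∖ perp z) ∩ Z ⌉)
              ≡⟨ solve 4 (λ q n a b → q :* n :* (a :+ b) := n :* (q :* a) :+ n :* (q :* b)) refl q ⌈ K ⌉ ⌈ K ∖ H ⌉ ⌈ (X ∖ perp z) ∩ Z ⌉ ⟩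
            ⌈ K ⌉ * (q * ⌈ K ∖ H ⌉) + ⌈ K ⌉ * (q * ⌈ (X ∖ perp z) ∩ Z ⌉)
              ≡⟨ cong₂ (λ a b → ⌈ K ⌉ * (q * a) + ⌈ K ⌉ * b) (trans (∣∣-minus {K} {H} (λ _ → ∧-trueˡ)) (cong (_- ⌈ H ⌉) (sym H-size)))
                   (off-hyperplane Z sX zX (iso tK zK zK) (λ {y} k → Z-line zK (∧-trueˡ {U y} k))) ⟩
            ⌈ K ⌉ * (q * (q * ⌈ H ⌉ - ⌈ H ⌉)) + ⌈ K ⌉ * (t * (⌈ X ⌉ - ⌈ X ∩ perp z ⌉))
              ≡⟨ cong (λ n → n * (q * (q * ⌈ H ⌉ - ⌈ H ⌉)) + ⌈ K ⌉ * (t * (⌈ X ⌉ - ⌈ X ∩ perp z ⌉))) (sym H-size) ⟩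
            q * ⌈ H ⌉ * (q * (q * ⌈ H ⌉ - ⌈ H ⌉)) + ⌈ K ⌉ * (t * (⌈ X ⌉ - ⌈ X ∩ perp z ⌉))
              ≡⟨ cong (q * ⌈ H ⌉ * (q * (q * ⌈ H ⌉ - ⌈ H ⌉)) +_) (trans (solve 4 (λ n t a b → n :* (t :* (a :- b)) := t :* (a :* n :- b :* n)) refl ⌈ K ⌉ t ⌈ X ⌉ ⌈ X ∩ perp z ⌉)
                   (cong₂ (λ a b → t * (a - b)) (trans (cong (⌈ X ⌉ *_) (sym H-size)) (trans (solve 3 (λ a q h → a :* (q :* h) := q :* (a :* h)) refl ⌈ X ⌉ q ⌈ H ⌉) (cong (q *_) (U-size (sub tH) (λ _ → ∧-trueˡ)))))
                     (trans (cong (_* ⌈ K ⌉) (∣∣-cong perpK)) (U-size (sub tK) (λ _ k → k))))) ⟩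
            q * ⌈ H ⌉ * (q * (q * ⌈ H ⌉ - ⌈ H ⌉)) + t * (q * ⌈ U ⌉ - ⌈ U ⌉)
              ≡⟨ solve 4 (λ q h t u → q :* h :* (q :* (q :* h :- h)) :+ t :* (q :* u :- u) := (q :- :1) :* (q :* h :* (q :* h) :+ t :* u)) refl q ⌈ H ⌉ t ⌈ U ⌉ ⟩
            (q - 1ℚ) * (q * ⌈ H ⌉ * (q * ⌈ H ⌉) + t * ⌈ U ⌉)
              ≡⟨ cong (λ n → (q - 1ℚ) * (n * n + t * ⌈ U ⌉)) H-size ⟩
            (q - 1ℚ) * (⌈ K ⌉ * ⌈ K ⌉ + t * ⌈ U ⌉) ∎
            where
            X : V → Bool
            X = U ∩ Perp H
            sX : Sub X
            sX = ∩-sub sU (Perp-sub H)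
            zX : z ∈ X
            zX = ∧-true (K⊆U z zK) (Perp-intro (λ {u} k → iso tK zK (∧-trueˡ {K u} k)))
            all-K : ∀ {v} → v ∈ Perp H → B v z ≡ 0ᶠ → v ∈ Perp K
            all-K hv o = Perp-intro (λ {u} uK → let h₀ , c , hH , e = ⊞⟨⟩-elim (K⊆ zK z∉H u uK) in
              subst (λ u → B _ u ≡ 0ᶠ) (sym e) (⊥-⊕ʳ (Perp-elim hv hH) (⊥-·ʳ c o)))
            near : ∀ v → (Y ∩ Z) v ∧ perp z v ≡ (K ∖ H) v
            near v = bool-ext
              (λ k → let yv = ∧-trueˡ {Y v} (∧-trueˡ {(Y ∩ Z) v} k) ; sv = ∧-trueˡ {(Sing ∩ Perp H) v} yv in
                ∧-true (gen-max gK (∧-trueˡ {Sing v} sv) (all-K (∧-trueʳ {Sing v} sv) (perp-elim (∧-trueʳ {(Y ∩ Z) v} k)))) (∧-trueʳ {(Sing ∩ Perp H) v} yv))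
              (λ k → let vK = ∧-trueˡ {K v} k in
                ∧-true {(Y ∩ Z) v} (∧-true {Y v} (∧-true {(Sing ∩ Perp H) v} (∧-true (sing tK v vK) (Perp-intro (λ {u} j → iso tK vK (∧-trueˡ {K u} j)))) (∧-trueʳ {K v} k)) (K⊆Z v vK)) (perp-intro (iso tK vK zK)))
            off : ∀ v → (Y ∩ Z) v ∧ not (perp z v) ≡ ((X ∖ perp z) ∩ Z) v
            off v = bool-ext
              (λ k → let yz = ∧-trueˡ {(Y ∩ Z) v} k ; zv = ∧-trueʳ {Y v} yz in
                ∧-true {(X ∖ perp z) v} (∧-true {X v} (∧-true (Z⊆U v zv) (∧-trueʳ {Sing v} (∧-trueˡ {(Sing ∩ Perp H) v} (∧-trueˡ {Y v} yz)))) (∧-trueʳ {(Y ∩ Z) v} k)) zv)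
              (λ k → let xv = ∧-trueˡ {(X ∖ perp z) v} k ; zv = ∧-trueʳ {(X ∖ perp z) v} k ; np = ∧-trueʳ {X v} xv in
                ∧-true {(Y ∩ Z) v} (∧-true {Y v} (∧-true {(Sing ∩ Perp H) v} (∧-true (Z-sing v zv) (∧-trueʳ {U v} (∧-trueˡ {X v} xv)))
                  (not-true (λ j → true-not np (perp-intro (iso tK (∧-trueˡ {K v} j) zK))))) zv) np)
            perpK : ∀ v → (X ∩ perp z) v ≡ (U ∩ Perp K) v
            perpK v = bool-ext
              (λ k → let xv = ∧-trueˡ {X v} k in ∧-true (∧-trueˡ {U v} xv) (all-K (∧-trueʳ {U v} xv) (perp-elim (∧-trueʳ {X v} k))))
              (λ k → ∧-true {X v} (∧-true (∧-trueˡ {U v} k) (Perp-intro (λ {u} j → Perp-elim (∧-trueʳ {U v} k) (∧-trueˡ {K u} j)))) (perp-intro (Perp-elim (∧-trueʳ {U v} k) zK)))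

          through-Z : (∀ {v} → v ∈ Z → T v) → ∀ {v} → v ∈ Y ∩ Z → χ (H ⊞ ⟨ v ⟩) ≡ true
          through-Z Z⊆T {v} h with split (K v)
          ... | inj₁ vK = inχ (transfer mK (H-gen vY) (K⊆ vK (true-not (∧-trueʳ {(Sing ∩ Perp H) v} vY))))
            where
            vY : v ∈ Y
            vY = ∧-trueˡ {Y v} h
          ... | inj₂ n = χ-mono (gen-⊆ (H-gen vY) (gen p) H⊆) H⊆ (inχ p)
            where
            vY : v ∈ Y
            vY = ∧-trueˡ {Y v} h
            p : Member (proj v K)
            p = T-proj mK (Z⊆T (∧-trueʳ {Y v} h)) n
            H⊆ : H ⊞ ⟨ v ⟩ ⊆ proj v K
            H⊆ = ⊞-⊆ (sub (ts (gen p))) (λ w k → ∩perp⊆proj K v w (∧-true (∧-trueˡ {K w} k) (perp-intro (B-refl (Perp-elim (∧-trueʳ {Sing v} (∧-trueˡ {(Sing ∩ Perp H) v} vY)) k)))))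
              (⟨⟩-⊆ (sub (ts (gen p))) (proj-∋ gK))

        -- The numerical hypothesis is the `size` law of a polar space on U with parameter e - 1;
        -- with it the count for Z exhausts `members-through`. For P in T outside K, the hyperplane
        -- H = P⊥ ∩ K is used: the member `proj P K` passes through it, so P is one of the counted
        -- vectors.
        T⊆Z : (∀ {v} → v ∈ Z → T v) → t * ⌈ U ⌉ * q ≡ Qe * (⌈ K ⌉ * ⌈ K ⌉) → ∀ {v} → T v → v ∈ Z
        T⊆Z Z⊆T num {P} tP with split (K P)
        ... | inj₁ k = K⊆Z P k
        ... | inj₂ n with far-point gK (T-sing tP) n
        ...   | z , zK , far = ∧-trueʳ {Y P} (⊆-full {Y ∩ Z} {λ v → Y v ∧ χ (H ⊞ ⟨ v ⟩)} (λ v k → ∧-true (∧-trueˡ {Y v} k) (through-Z zK far Z⊆T k)) (≤-reflexive counts) P (∧-true P∈Y (inχ (T-proj mK tP n))))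
          where
          open Hyperplane mK zK far
          P∈Y : P ∈ Y
          P∈Y = ∧-true {(Sing ∩ Perp H) P} (∧-true (T-sing tP) (Perp-intro (λ {u} k → B-refl (perp-elim (∧-trueʳ {K u} k))))) (not-true (λ k → n (∧-trueˡ {K P} k)))
          counts : ⌈ (λ v → Y v ∧ χ (H ⊞ ⟨ v ⟩)) ⌉ ≡ ⌈ Y ∩ Z ⌉
          counts = cancel≡ (q * (q * ⌈ K ⌉)) (mul>0 0<q (mul>0 0<q (∣sub∣>0 (sub tK)))) (begin
            q * (q * ⌈ K ⌉) * ⌈ (λ v → Y v ∧ χ (H ⊞ ⟨ v ⟩)) ⌉   ≡⟨ cong (q * (q * ⌈ K ⌉) *_) members-through ⟩
            q * (q * ⌈ K ⌉) * ((q - 1ℚ) * ⌈ H ⌉ * x)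
              ≡⟨ solve 4 (λ q n h x → q :* (q :* n) :* ((q :- :1) :* h :* x) := (q :- :1) :* n :* (q :* h) :* (q :* x)) refl q ⌈ K ⌉ ⌈ H ⌉ x ⟩
            (q - 1ℚ) * ⌈ K ⌉ * (q * ⌈ H ⌉) * (q * x)           ≡⟨ cong₂ (λ a b → (q - 1ℚ) * ⌈ K ⌉ * a * b) H-size x-eq ⟩
            (q - 1ℚ) * ⌈ K ⌉ * ⌈ K ⌉ * (Qe + q)
              ≡⟨ solve 3 (λ q n e → (q :- :1) :* n :* n :* (e :+ q) := (q :- :1) :* (q :* (n :* n) :+ e :* (n :* n))) refl q ⌈ K ⌉ Qe ⟩
            (q - 1ℚ) * (q * (⌈ K ⌉ * ⌈ K ⌉) + Qe * (⌈ K ⌉ * ⌈ K ⌉))  ≡⟨ cong (λ a → (q - 1ℚ) * (q * (⌈ K ⌉ * ⌈ K ⌉) + a)) (sym num) ⟩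
            (q - 1ℚ) * (q * (⌈ K ⌉ * ⌈ K ⌉) + t * ⌈ U ⌉ * q)
              ≡⟨ solve 4 (λ q n t u → (q :- :1) :* (q :* (n :* n) :+ t :* u :* q) := q :* ((q :- :1) :* (n :* n :+ t :* u))) refl q ⌈ K ⌉ t ⌈ U ⌉ ⟩
            q * ((q - 1ℚ) * (⌈ K ⌉ * ⌈ K ⌉ + t * ⌈ U ⌉))       ≡⟨ cong (q *_) (sym (Z-count zK far)) ⟩
            q * (q * ⌈ K ⌉ * ⌈ Y ∩ Z ⌉)                        ≡⟨ sym (*-assoc q (q * ⌈ K ⌉) _) ⟩
            q * (q * ⌈ K ⌉) * ⌈ Y ∩ Z ⌉                        ∎)

        -- The strict form of the comparison in `T⊆Z`: all singular vectors of U together are too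
        -- few, so some member through H leaves U. It is needed for e = 2.
        escape : Sing ∩ U ⊆ Z → t * ⌈ U ⌉ * q < Qe * (⌈ K ⌉ * ⌈ K ⌉) → ∀ {z y} → z ∈ K → B z y ≢ 0ᶠ → ∃ λ v → T v × v ∉ U
        escape SU⊆Z num {z} {y} zK far = let v , h , n = outside {λ v → Y v ∧ χ (H ⊞ ⟨ v ⟩)} {Y ∩ Z} few ; vY = ∧-trueˡ {Y v} h in
          v , (H ⊞ ⟨ v ⟩ , member (H-gen vY) (∧-trueʳ {Y v} h) , ⊞⟨⟩-self (sub tH)) , λ k → n (∧-true vY (SU⊆Z v (∧-true (∧-trueˡ {Sing v} (∧-trueˡ {(Sing ∩ Perp H) v} vY)) k)))
          where
          open Hyperplane mK zK far
          scale : ℚ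
          scale = q * (q * ⌈ K ⌉)
          few : ⌈ Y ∩ Z ⌉ < ⌈ (λ v → Y v ∧ χ (H ⊞ ⟨ v ⟩)) ⌉
          few = *-cancelˡ-<-nonNeg scale {{nonNegative (<⇒≤ (mul>0 0<q (mul>0 0<q (∣sub∣>0 (sub tK)))))}} (subst₂ _<_ lhs rhs
            (*-monoʳ-<-pos (q - 1ℚ) {{positive 0<q-1}} (+-monoʳ-< (q * (⌈ K ⌉ * ⌈ K ⌉)) num)))
            where
            lhs : (q - 1ℚ) * (q * (⌈ K ⌉ * ⌈ K ⌉) + t * ⌈ U ⌉ * q) ≡ scale * ⌈ Y ∩ Z ⌉
            lhs = trans (solve 4 (λ q n t u → (q :- :1) :* (q :* (n :* n) :+ t :* u :* q) := q :* ((q :- :1) :* (n :* n :+ t :* u))) refl q ⌈ K ⌉ t ⌈ U ⌉)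
              (trans (cong (q *_) (sym (Z-count zK far))) (sym (*-assoc q (q * ⌈ K ⌉) _)))
            rhs : (q - 1ℚ) * (q * (⌈ K ⌉ * ⌈ K ⌉) + Qe * (⌈ K ⌉ * ⌈ K ⌉)) ≡ scale * ⌈ (λ v → Y v ∧ χ (H ⊞ ⟨ v ⟩)) ⌉
            rhs = trans (solve 3 (λ q n e → (q :- :1) :* (q :* (n :* n) :+ e :* (n :* n)) := (q :- :1) :* n :* n :* (e :+ q)) refl q ⌈ K ⌉ Qe)
              (trans (cong₂ (λ a b → (q - 1ℚ) * ⌈ K ⌉ * a * b) (sym H-size) (sym x-eq))
              (trans (solve 4 (λ q n h x → (q :- :1) :* n :* (q :* h) :* (q :* x) := q :* (q :* n) :* ((q :- :1) :* h :* x)) refl q ⌈ K ⌉ ⌈ H ⌉ x) (cong (scale *_) (sym members-through))))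

    -- The set T in the extremal case, for e = 1, 3/2 and 2.

    module Shapes (𝓛 : CLSet) {k₀ : ℕ} (d-suc : suc (suc k₀) ≡ d) (x-eq : q * CLSet.x 𝓛 ≡ Qe + q)
                  (on-flat : ∀ {K} → Gen K → CLSet.χ 𝓛 K ≡ true → ∀ {P} → P ∈ K → Fullness.Δ 𝓛 P ≡ q * q * CLSet.x 𝓛) where
      open Extreme 𝓛 d-suc x-eq on-flat public

      q<gen : ∀ {K} → Gen K → q < ⌈ K ⌉
      q<gen g = <-≤-trans (<q* 0<q) (≤-trans (mul≤ q (<⇒≤ 0<q) (q≤ k₀)) (≤-reflexive (sym (trans (∣gen∣ g) (cong (q ^^_) (sym d-suc))))))
        where
        q≤ : ∀ n → q ≤ q ^^ suc n
        q≤ zero    = ≤-reflexive (sym (*-identityʳ q))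
        q≤ (suc n) = ≤-trans (q≤ n) (<⇒≤ (<q* (^^>0 (suc n) 0<q)))

      nonzero-in : ∀ {X} → Sub X → 1ℚ < ⌈ X ⌉ → ∃ λ v → v ∈ X × v ≢ 0ᵛ
      nonzero-in {X} sX h = let v , a , n = outside {X} {⟨ 0ᵛ ⟩} (subst (_< ⌈ X ⌉) (sym one) h) in
        v , a , λ e → n (subst (_∈ ⟨ 0ᵛ ⟩) (sym e) ⟨⟩-self)
        where
        one : ⌈ ⟨ 0ᵛ ⟩ ⌉ ≡ 1ℚ
        one = ∣∣-unique _ 0ᵛ ⟨⟩-self (λ v h → let c , e = ⟨⟩-elim h in trans e (·-0ᵛ c))

      -- Two members through a common hyperplane already account for 2 ≤ x.
      q≤Qe : ∀ {K} → Member K → q ≤ Qe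
      q≤Qe {K} mK = ≥0-diff (subst (0ℚ ≤_) (solve 2 (λ e q → (e :+ q) :- (q :+ q) := e :- q) refl Qe q) (diff≥0 2q≤))
        where
        pt : ∃ λ u → u ∈ K × u ≢ 0ᵛ
        pt = nonzero-in (sub (ts (gen mK))) (<-trans 1<q (q<gen (gen mK)))
        open Hyperplane mK (proj₁ (proj₂ pt)) (proj₂ (separate (sing (ts (gen mK)) _ (proj₁ (proj₂ pt))) (proj₂ (proj₂ pt))))
        bound : (q - 1ℚ) * ⌈ H ⌉ + (q - 1ℚ) * ⌈ H ⌉ ≤ (q - 1ℚ) * ⌈ H ⌉ * x
        bound = let v , vY , m′ , n = another-member in subst₂ _≤_
          (trans (∑-+ _ _) (cong₂ _+_ (trans (∣∣-minus {K} {H} (λ _ → ∧-trueˡ)) (trans (cong (_- ⌈ H ⌉) (sym H-size)) (solve 2 (λ q n → q :* n :- n := (q :- :1) :* n) refl q ⌈ H ⌉)))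
            (trans (∣∣-minus {H ⊞ ⟨ v ⟩} {H} (⊞-⊆ˡ (⟨⟩-sub v))) (trans (cong (_- ⌈ H ⌉) (Y-size vY)) (solve 2 (λ q n → q :* n :- n := (q :- :1) :* n) refl q ⌈ H ⌉)))))
          members-through
          (∑ᴸ-mono (Finite.elems vectors) (λ w → disjoint _ _ _
            (λ a → ∧-true {Y w} (∧-true {(Sing ∩ Perp H) w} (∧-true (sing tK w (∧-trueˡ {K w} a)) (Perp-intro (λ k → iso tK (∧-trueˡ {K w} a) (∧-trueˡ k)))) (∧-trueʳ {K w} a))
              (inχ (transfer mK (H-gen (∧-true {(Sing ∩ Perp H) w} (∧-true (sing tK w (∧-trueˡ {K w} a)) (Perp-intro (λ k → iso tK (∧-trueˡ {K w} a) (∧-trueˡ k)))) (∧-trueʳ {K w} a))) (K⊆ (∧-trueˡ {K w} a) (true-not (∧-trueʳ {K w} a))))))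
            (λ b → let t = ts (gen m′) ; wM = ∧-trueˡ {(H ⊞ ⟨ v ⟩) w} b ; wH = ∧-trueʳ {(H ⊞ ⟨ v ⟩) w} b
                       wY = ∧-true {(Sing ∩ Perp H) w} (∧-true (sing t w wM) (Perp-intro (λ k → iso t wM (⊞-⊆ˡ (⟨⟩-sub v) _ k)))) wH in
              ∧-true {Y w} wY (inχ (transfer m′ (H-gen wY) (⊞-⊆ (sub (ts (H-gen wY))) (⊞-⊆ˡ (⟨⟩-sub w)) (⟨⟩-⊆ (sub (ts (H-gen wY))) (exchange (sub tH) (true-not wH) wM))))))
            (λ a b → n (⊞-⊆ (sub tK) (λ _ → ∧-trueˡ) (⟨⟩-⊆ (sub tK) (∧-trueˡ {K w} a)) v (exchange (sub tH) (true-not (∧-trueʳ {K w} a)) (∧-trueˡ {(H ⊞ ⟨ v ⟩) w} b))))))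
          where
          disjoint : ∀ a b c → (a ≡ true → c ≡ true) → (b ≡ true → c ≡ true) → (a ≡ true → b ≡ true → ⊥) → [ a ] + [ b ] ≤ [ c ]
          disjoint true  true  c f g n = ⊥-elim (n refl refl)
          disjoint true  false c f g n rewrite f refl = ≤-reflexive (+-identityʳ 1ℚ)
          disjoint false true  c f g n rewrite g refl = ≤-reflexive (+-identityˡ 1ℚ)
          disjoint false false c f g n = ≤-trans (≤-reflexive (+-identityˡ 0ℚ)) ([]≥0 c)
        2≤x : 1ℚ + 1ℚ ≤ x
        2≤x = cancel≤ ((q - 1ℚ) * ⌈ H ⌉) (mul>0 0<q-1 H>0) (subst (_≤ (q - 1ℚ) * ⌈ H ⌉ * x) (solve 1 (λ a → a :+ a := a :* (:1 :+ :1)) refl ((q - 1ℚ) * ⌈ H ⌉)) bound)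
        2q≤ : q + q ≤ Qe + q
        2q≤ = subst₂ _≤_ (solve 1 (λ q → q :* (:1 :+ :1) := q :+ q) refl q) x-eq (mul≤ q (<⇒≤ 0<q) 2≤x)

      module Pair {K K′ : V → Bool} (mK : Member K) (mK′ : Member K′) (opp : Opposite K K′) where

        tK : TS K
        tK = ts (gen mK)
        tK′ : TS K′
        tK′ = ts (gen mK′)

        T-K : ∀ {v} → v ∈ K → T v
        T-K h = K , mK , h

        T-K′ : ∀ {v} → v ∈ K′ → T v
        T-K′ h = K′ , mK′ , h

        U : V → Bool
        U = K ⊞ K′

        sU : Sub U
        sU = ⊞-sub (sub tK) (sub tK′)

        K⊆U : K ⊆ U
        K⊆U = ⊞-⊆ˡ (sub tK′)

        K′⊆U : K′ ⊆ U
        K′⊆U = ⊞-⊆ʳ (sub tK)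

        ∣U∣ : ⌈ U ⌉ ≡ ⌈ K ⌉ * ⌈ K ⌉
        ∣U∣ = trans (sym (*-identityʳ ⌈ U ⌉)) (trans (cong (⌈ U ⌉ *_) (sym (∣∣-unique (K ∩ K′) 0ᵛ (∧-true (has-0 (sub tK)) (has-0 (sub tK′))) (λ v h → opp (∧-trueˡ h) (∧-trueʳ {K v} h)))))
          (trans (∣⊞∣ (sub tK) (sub tK′)) (cong (⌈ K ⌉ *_) (trans (∣gen∣ (gen mK′)) (sym (∣gen∣ (gen mK)))))))

        K-free : ∀ {a} → a ∈ K → a ∈ Perp K′ → a ≡ 0ᵛ
        K-free h k = opp h (gen-max (gen mK′) (sing tK _ h) k)

        K′-free : ∀ {b} → b ∈ K′ → b ∈ Perp K → b ≡ 0ᵛ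
        K′-free h k = opp (gen-max (gen mK) (sing tK′ _ h) k) h

        partner : ∀ {a} → a ∈ K → a ≢ 0ᵛ → ∃ λ b → b ∈ K′ × B b a ≢ 0ᶠ
        partner {a} h nz = far-point (gen mK′) (sing tK a h) (λ k → nz (opp h k))

        -- This is where rank at least two enters: K ∩ b⊥ contains a nonzero a′. A partner of a′ in
        -- K′ is made orthogonal to a by adding a multiple of b, which is harmless because a′ ⊥ b,
        -- and is then scaled.
        second-pair : ∀ {a b} → a ∈ K → b ∈ K′ → B a b ≢ 0ᶠ →
                      ∃ λ a′ → ∃ λ b′ → a′ ∈ K × b′ ∈ K′ × B a′ b ≡ 0ᶠ × B b′ a ≡ 0ᶠ × B b′ a′ ≡ 1ᶠ
        second-pair {a} {b} ha hb nab =
          a′ , proj₁ i · b₂ , a′K , has-· (sub tK′) _ b₂K′ , a′⊥b , ⊥-· _ b₂⊥a ,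
          trans (B-· (proj₁ i) b₂ a′) (trans (*ᶠ-comm (proj₁ i) (B b₂ a′)) (proj₂ i))
          where
          small : 1ℚ < ⌈ K ∩ perp b ⌉
          small = *-cancelˡ-<-nonNeg q {{nonNegative (<⇒≤ 0<q)}} (subst₂ _<_ (sym (*-identityʳ q)) (sym (hyperplane (sub tK) ha nab)) (q<gen (gen mK)))
          pt : ∃ λ v → v ∈ K ∩ perp b × v ≢ 0ᵛ
          pt = nonzero-in (∩-sub (sub tK) (perp-sub b)) small
          a′ : V
          a′ = proj₁ pt
          a′K : a′ ∈ K
          a′K = ∧-trueˡ (proj₁ (proj₂ pt))
          a′⊥b : B a′ b ≡ 0ᶠ
          a′⊥b = perp-elim (∧-trueʳ {K a′} (proj₁ (proj₂ pt)))
          b₁ : ∃ λ y → y ∈ K′ × B y a′ ≢ 0ᶠ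
          b₁ = partner a′K (proj₂ (proj₂ pt))
          nba : B b a ≢ 0ᶠ
          nba e = nab (B-refl e)
          c : 𝔽
          c = root (B (proj₁ b₁) a) (B b a) nba
          b₂ : V
          b₂ = proj₁ b₁ ⊕ c · b
          b₂K′ : b₂ ∈ K′
          b₂K′ = has-⊕ (sub tK′) (proj₁ (proj₂ b₁)) (has-· (sub tK′) c hb)
          b₂⊥a : B b₂ a ≡ 0ᶠ
          b₂⊥a = trans (B-line (proj₁ b₁) c b a) (root-eq (B (proj₁ b₁) a) (B b a) nba)
          b₂-a′ : B b₂ a′ ≢ 0ᶠ
          b₂-a′ e = proj₂ (proj₂ b₁) (trans (sym (trans (B-line (proj₁ b₁) c b a′) (trans (cong (λ t → B (proj₁ b₁) a′ +ᶠ c *ᶠ t) (B-refl a′⊥b)) (trans (cong (B (proj₁ b₁) a′ +ᶠ_) (*ᶠ-zeroʳ c)) (+ᶠ-identityʳ _))))) e)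
          i : ∃ λ y → B b₂ a′ *ᶠ y ≡ 1ᶠ
          i = inv (B b₂ a′) b₂-a′

        hyperbolic-pair : ∃ λ a → ∃ λ b → a ∈ K × b ∈ K′ × B a b ≢ 0ᶠ
        hyperbolic-pair = let a , ha , nz = nonzero-in (sub tK) (<-trans 1<q (q<gen (gen mK))) ; b , hb , n = partner ha nz in
          a , b , ha , hb , λ e → n (B-refl e)

        split-unique : ∀ {a b a′ b′} → a ∈ K → b ∈ K′ → a′ ∈ K → b′ ∈ K′ → a ⊕ b ≡ a′ ⊕ b′ → a ≡ a′ × b ≡ b′
        split-unique {a} {b} {a′} {b′} ha hb ha′ hb′ e = from (opp (has-⊖ (sub tK) ha ha′) (subst (_∈ K′) (sym diff) (has-⊖ (sub tK′) hb′ hb)))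
          where
          diff : a ⊖ a′ ≡ b′ ⊖ b
          diff = trans (vsolve (λ { [] (a ∷ b ∷ c ∷ []) → a :⊖ c , ((a :⊕ b) :⊖ c) :⊖ b }) [] (a ∷ b ∷ a′ ∷ []) refl)
            (trans (cong (λ t → (t ⊖ a′) ⊖ b) e) (vsolve (λ { [] (b ∷ c ∷ d ∷ []) → ((c :⊕ d) :⊖ c) :⊖ b , d :⊖ b }) [] (b ∷ a′ ∷ b′ ∷ []) refl))
          from : a ⊖ a′ ≡ 0ᵛ → a ≡ a′ × b ≡ b′
          from z = trans (sym (⊖-⊕ a a′)) (trans (cong (_⊕ a′) z) (⊕-identityˡ a′)) ,
                   sym (trans (sym (⊖-⊕ b′ b)) (trans (cong (_⊕ b) (trans (sym diff) z)) (⊕-identityˡ b)))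

        split-⊥ : ∀ {a b u} → a ∈ K → b ∈ K′ → u ∈ K → B (a ⊕ b) u ≡ B b u
        split-⊥ {a} {b} {u} ha hb hu = trans (B-⊕ a b u) (trans (cong (_+ᶠ B b u) (iso tK ha hu)) (+ᶠ-identityˡ (B b u)))

        U-radical : ∀ {a b} → a ∈ K → b ∈ K′ → (∀ {u} → u ∈ K → B (a ⊕ b) u ≡ 0ᶠ) → (∀ {u} → u ∈ K′ → B (a ⊕ b) u ≡ 0ᶠ) → a ≡ 0ᵛ × b ≡ 0ᵛ
        U-radical {a} {b} ha hb h k =
          K-free ha (Perp-intro (λ {u} m → trans (sym (+ᶠ-identityʳ (B a u))) (trans (cong (B a u +ᶠ_) (sym (iso tK′ hb m))) (trans (sym (B-⊕ a b u)) (k m))))) ,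
          K′-free hb (Perp-intro (λ m → trans (sym (split-⊥ ha hb m)) (h m)))

        module Hyperbolic (Qe≡q : Qe ≡ q) where

          -- The hyperbolic quadric on U with quadratic form a + b ↦ B(a,b). Each line in question
          -- contains one of its vectors, so t = 1.
          Z : V → Bool
          Z v = some (λ b → K′ b ∧ (K (v ⊖ b) ∧ perp b (v ⊖ b)))

          Z-intro : ∀ {a b} → a ∈ K → b ∈ K′ → B a b ≡ 0ᶠ → a ⊕ b ∈ Z
          Z-intro {a} {b} ha hb o = some-intro _ {b} (∧-true hb (subst (λ t → K t ∧ perp b t ≡ true) (sym (⊕-⊖ a b)) (∧-true ha (perp-intro o))))

          Z-elim : ∀ {v} → v ∈ Z → ∃ λ a → ∃ λ b → a ∈ K × b ∈ K′ × B a b ≡ 0ᶠ × v ≡ a ⊕ b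
          Z-elim {v} h = let b , k = some-elim _ h ; k′ = ∧-trueʳ {K′ b} k in
            v ⊖ b , b , ∧-trueˡ k′ , ∧-trueˡ k , perp-elim (∧-trueʳ {K (v ⊖ b)} k′) , sym (⊖-⊕ v b)

          Z⇒T : ∀ {v} → v ∈ Z → T v
          Z⇒T h = let a , b , ha , hb , o , e = Z-elim h in subst T (sym e) (T-⊕ (T-K ha) (T-K′ hb) o)

          Z-line : ∀ {y P} → P ∈ K → y ∈ U → B y P ≢ 0ᶠ → ∑ᶠ (λ c → [ Z (y ⊕ c · P) ]) ≡ 1ℚ
          Z-line {y} {P} hP hy n with ⊞-elim hy
          ... | a , b , ha , hb , refl = trans (ΣF.∑-cong (λ c → cong [_] (bool-ext (to c) (back c)))) (one-root (B a b) (B P b) (λ e → n (trans (split-⊥ ha hb hP) (B-refl e))))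
            where
            regroup : ∀ c → (a ⊕ b) ⊕ c · P ≡ (a ⊕ c · P) ⊕ b
            regroup c = vsolve (λ { (c ∷ []) (a ∷ b ∷ p ∷ []) → (a :⊕ b) :⊕ c :· p , (a :⊕ c :· p) :⊕ b }) (c ∷ []) (a ∷ b ∷ P ∷ []) refl
            to : ∀ c → (a ⊕ b) ⊕ c · P ∈ Z → ((B a b +ᶠ c *ᶠ B P b) ΣF.== 0ᶠ) ≡ true
            to c h = let a′ , b′ , ha′ , hb′ , o , e = Z-elim h
                         ea , eb = split-unique (has-⊕ (sub tK) ha (has-· (sub tK) c hP)) hb ha′ hb′ (trans (sym (regroup c)) e) in
              does-true (_ ≟ᶠ _) (trans (sym (B-line a c P b)) (subst₂ (λ s t → B s t ≡ 0ᶠ) (sym ea) (sym eb) o))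
            back : ∀ c → ((B a b +ᶠ c *ᶠ B P b) ΣF.== 0ᶠ) ≡ true → (a ⊕ b) ⊕ c · P ∈ Z
            back c h = subst (_∈ Z) (sym (regroup c)) (Z-intro (has-⊕ (sub tK) ha (has-· (sub tK) c hP)) hb (trans (B-line a c P b) (ΣF.==-true h)))

          T⇒Z : ∀ {v} → T v → v ∈ Z
          T⇒Z = Sandwich.T⊆Z mK mK′ opp sU K⊆U K′⊆U Z
            (λ v h → let a , b , ha , hb , o , e = Z-elim h in subst (_∈ U) (sym e) (⊞-intro ha hb))
            (λ v h → T-sing (Z⇒T h))
            (λ v h → subst (_∈ Z) (⊕-identityʳ v) (Z-intro h (has-0 (sub tK′)) (B-refl (B-0 v))))
            1ℚ Z-line Z⇒T
            (trans (cong (λ t → 1ℚ * t * q) ∣U∣) (trans (solve 2 (λ n q → :1 :* n :* q := q :* n) refl (⌈ K ⌉ * ⌈ K ⌉) q) (cong (_* (⌈ K ⌉ * ⌈ K ⌉)) (sym Qe≡q))))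

          -- For an alternating form, closure of T under orthogonal sums forces 1 + 1 = 0.
          char-2 : (∀ u v → B v u ≡ -ᶠ B u v) → 1ᶠ +ᶠ 1ᶠ ≡ 0ᶠ
          char-2 alt = trans (cong₂ _+ᶠ_ (sym p₁) (sym p₂)) value
            where
            hp = hyperbolic-pair
            a₁ = proj₁ hp
            b₁ = proj₁ (proj₂ hp)
            a₁K : a₁ ∈ K
            a₁K = proj₁ (proj₂ (proj₂ hp))
            b₁K′ : b₁ ∈ K′
            b₁K′ = proj₁ (proj₂ (proj₂ (proj₂ hp)))
            n : B a₁ b₁ ≢ 0ᶠ
            n = proj₂ (proj₂ (proj₂ (proj₂ hp)))
            sp = second-pair a₁K b₁K′ n
            a₂ = proj₁ sp
            b₂ = -ᶠ 1ᶠ · proj₁ (proj₂ sp)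
            a₂K : a₂ ∈ K
            a₂K = proj₁ (proj₂ (proj₂ sp))
            b₂K′ : b₂ ∈ K′
            b₂K′ = has-· (sub tK′) _ (proj₁ (proj₂ (proj₂ (proj₂ sp))))
            a₂⊥b₁ : B a₂ b₁ ≡ 0ᶠ
            a₂⊥b₁ = proj₁ (proj₂ (proj₂ (proj₂ (proj₂ sp))))
            b₂⊥a₁ : B b₂ a₁ ≡ 0ᶠ
            b₂⊥a₁ = ⊥-· _ (proj₁ (proj₂ (proj₂ (proj₂ (proj₂ (proj₂ sp))))))
            b₂a₂ : B b₂ a₂ ≡ -ᶠ 1ᶠ
            b₂a₂ = trans (B-· _ _ a₂) (trans (cong (-ᶠ 1ᶠ *ᶠ_) (proj₂ (proj₂ (proj₂ (proj₂ (proj₂ (proj₂ sp))))))) (*ᶠ-identityʳ _))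
            i : ∃ λ y → B a₁ b₁ *ᶠ y ≡ 1ᶠ
            i = inv (B a₁ b₁) n
            a₃ = proj₁ i · a₁
            a₃K : a₃ ∈ K
            a₃K = has-· (sub tK) _ a₁K
            p₁ : B a₃ b₁ ≡ 1ᶠ
            p₁ = trans (B-· _ a₁ b₁) (trans (*ᶠ-comm _ _) (proj₂ i))
            p₂ : B a₂ b₂ ≡ 1ᶠ
            p₂ = trans (alt b₂ a₂) (trans (cong -ᶠ_ b₂a₂) (FS.solve 0 (FS.:- (FS.:- FS.:1) FS.:= FS.:1) refl))
            v⊥w : B (a₃ ⊕ b₂) (a₂ ⊕ b₁) ≡ 0ᶠ
            v⊥w = begin
              B (a₃ ⊕ b₂) (a₂ ⊕ b₁)                       ≡⟨ alt (a₂ ⊕ b₁) (a₃ ⊕ b₂) ⟩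
              -ᶠ B (a₂ ⊕ b₁) (a₃ ⊕ b₂)                    ≡⟨ cong -ᶠ_ (trans (B-⊕ a₂ b₁ _) (cong₂ _+ᶠ_ (trans (alt _ a₂) (cong -ᶠ_ (trans (split-⊥ a₃K b₂K′ a₂K) b₂a₂)))
                                                                (trans (alt _ b₁) (cong -ᶠ_ (trans (B-⊕ a₃ b₂ b₁) (cong₂ _+ᶠ_ p₁ (iso tK′ b₂K′ b₁K′))))))) ⟩
              -ᶠ (-ᶠ (-ᶠ 1ᶠ) +ᶠ -ᶠ (1ᶠ +ᶠ 0ᶠ))            ≡⟨ FS.solve 0 (FS.:- (FS.:- (FS.:- FS.:1) FS.:+ FS.:- (FS.:1 FS.:+ FS.:0)) FS.:= FS.:0) refl ⟩
              0ᶠ                                          ∎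
            -- Both a₃ + b₂ and a₂ + b₁ lie in T and they are orthogonal, the contributions 1 and -1
            -- cancelling. So their sum lies in T, hence in Z, which says that B(a₃ + a₂, b₂ + b₁) =
            -- 1 + 1 vanishes.
            in-T : T ((a₃ ⊕ b₂) ⊕ (a₂ ⊕ b₁))
            in-T = T-⊕ (T-⊕ (T-K a₃K) (T-K′ b₂K′) (B-refl (⊥-·ʳ _ b₂⊥a₁))) (T-⊕ (T-K a₂K) (T-K′ b₁K′) a₂⊥b₁) v⊥w
            value : B a₃ b₁ +ᶠ B a₂ b₂ ≡ 0ᶠ
            value = let a , b , ha , hb , o , e = Z-elim (T⇒Z in-T)
                        ea , eb = split-unique (has-⊕ (sub tK) a₃K a₂K) (has-⊕ (sub tK′) b₂K′ b₁K′) ha hb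
                          (trans (sym (VectorSolver.⊕-mid a₃ b₂ a₂ b₁)) e) in
              trans (sym (begin
                B (a₃ ⊕ a₂) (b₂ ⊕ b₁)                     ≡⟨ B-⊕ a₃ a₂ _ ⟩
                B a₃ (b₂ ⊕ b₁) +ᶠ B a₂ (b₂ ⊕ b₁)          ≡⟨ cong₂ _+ᶠ_ (right b₂ b₁ a₃) (right b₂ b₁ a₂) ⟩
                (B a₃ b₂ +ᶠ B a₃ b₁) +ᶠ (B a₂ b₂ +ᶠ B a₂ b₁)  ≡⟨ cong₂ (λ s t → (s +ᶠ B a₃ b₁) +ᶠ (B a₂ b₂ +ᶠ t)) (B-refl (⊥-·ʳ _ b₂⊥a₁)) a₂⊥b₁ ⟩
                (0ᶠ +ᶠ B a₃ b₁) +ᶠ (B a₂ b₂ +ᶠ 0ᶠ)         ≡⟨ cong₂ _+ᶠ_ (+ᶠ-identityˡ _) (+ᶠ-identityʳ _) ⟩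
                B a₃ b₁ +ᶠ B a₂ b₂                         ∎))
                (subst₂ (λ s t → B s t ≡ 0ᶠ) (sym ea) (sym eb) o)
              where
              right : ∀ u v w → B w (u ⊕ v) ≡ B w u +ᶠ B w v
              right u v w = trans (alt (u ⊕ v) w) (trans (cong -ᶠ_ (B-⊕ u v w)) (trans (FS.solve 2 (λ a b → FS.:- (a FS.:+ b) FS.:= FS.:- a FS.:+ FS.:- b) refl (B u w) (B v w)) (cong₂ _+ᶠ_ (sym (alt u w)) (sym (alt v w)))))

        -- Hermitian forms: a singular a + b with B a b ≠ 0 lies on a totally singular line with two points of the previous kind.
        module HermitianPair (σ : 𝔽 → 𝔽) (σ-+ : ∀ a b → σ (a +ᶠ b) ≡ σ a +ᶠ σ b) (σ-* : ∀ a b → σ (a *ᶠ b) ≡ σ a *ᶠ σ b)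
                             (σ-σ : ∀ a → σ (σ a) ≡ a) (herm : ∀ u v → B v u ≡ σ (B u v))
                             (λ₀ : 𝔽) (λ₀-norm : λ₀ *ᶠ σ λ₀ ≡ 1ᶠ) (λ₀≢1 : λ₀ ≢ 1ᶠ) (Qe≡sq : s * q ≡ Qe) where

          σ-1 : σ 1ᶠ ≡ 1ᶠ
          σ-1 = trans (sym (*ᶠ-identityˡ _)) (trans (cong (_*ᶠ σ 1ᶠ) (sym (σ-σ 1ᶠ))) (trans (sym (σ-* (σ 1ᶠ) 1ᶠ)) (trans (cong σ (*ᶠ-identityʳ (σ 1ᶠ))) (σ-σ 1ᶠ))))

          Z : V → Bool
          Z = Sing ∩ U

          Z⇒T : ∀ {v} → v ∈ Z → T v
          Z⇒T {v} h with ⊞-elim (∧-trueʳ {Sing v} h)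
          ... | a , b , ha , hb , refl with B a b ≟ᶠ 0ᶠ
          ...   | yes o = T-⊕ (T-K ha) (T-K′ hb) o
          ...   | no n = subst T combine (T-⊕ (T-· _ u₁T) (T-· _ u₂T) (⊥-· _ (⊥-·ʳ _ u₁⊥u₂)))
            where
            v′ : V
            v′ = a ⊕ b
            sp = second-pair ha hb n
            a′ = proj₁ sp
            b′ = proj₁ (proj₂ sp)
            a′K : a′ ∈ K
            a′K = proj₁ (proj₂ (proj₂ sp))
            b′K′ : b′ ∈ K′
            b′K′ = proj₁ (proj₂ (proj₂ (proj₂ sp)))
            a′⊥b : B a′ b ≡ 0ᶠ
            a′⊥b = proj₁ (proj₂ (proj₂ (proj₂ (proj₂ sp))))
            b′⊥a : B b′ a ≡ 0ᶠ
            b′⊥a = proj₁ (proj₂ (proj₂ (proj₂ (proj₂ (proj₂ sp)))))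
            b′a′ : B b′ a′ ≡ 1ᶠ
            b′a′ = proj₂ (proj₂ (proj₂ (proj₂ (proj₂ (proj₂ sp)))))
            a′b′ : B a′ b′ ≡ 1ᶠ
            a′b′ = trans (herm b′ a′) (trans (cong σ b′a′) σ-1)
            c : 𝔽
            c = B b a
            trace : B a b +ᶠ c ≡ 0ᶠ
            trace = trans (sym (begin
              B (a ⊕ b) (a ⊕ b)                       ≡⟨ B-⊕ a b _ ⟩
              B a (a ⊕ b) +ᶠ B b (a ⊕ b)              ≡⟨ cong₂ _+ᶠ_ (trans (herm _ a) (trans (cong σ (trans (split-⊥ ha hb ha) refl)) (sym (herm b a)))) (trans (herm _ b) (trans (cong σ (trans (B-⊕ a b b) (trans (cong (B a b +ᶠ_) (iso tK′ hb hb)) (+ᶠ-identityʳ _)))) (sym (herm a b)))) ⟩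
              B a b +ᶠ c                              ∎)) (Sing-B (∧-trueˡ h))
            -- A singular vector orthogonal to v′. The K-part a + l c a′ and the K′-part b + l b′ of
            -- v′ + l w have product B(a,b) + l σ(l) c, which is 0 when l has norm 1, since B(a,b) +
            -- c = 0.
            w : V
            w = b′ ⊕ c · a′
            on-line : ∀ l → l *ᶠ σ l ≡ 1ᶠ → T (v′ ⊕ l · w)
            on-line l norm = subst T (vsolve (λ { (l ∷ c ∷ []) (a ∷ b ∷ s ∷ t ∷ []) → (a :⊕ (l FS.:* c) :· s) :⊕ (b :⊕ l :· t) , (a :⊕ b) :⊕ l :· (t :⊕ c :· s) }) (l ∷ c ∷ []) (a ∷ b ∷ a′ ∷ b′ ∷ []) refl)
              (T-⊕ (T-K (has-⊕ (sub tK) ha (has-· (sub tK) _ a′K))) (T-K′ (has-⊕ (sub tK′) hb (has-· (sub tK′) l b′K′))) (begin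
                B (a ⊕ (l *ᶠ c) · a′) (b ⊕ l · b′)                        ≡⟨ B-line a (l *ᶠ c) a′ _ ⟩
                B a (b ⊕ l · b′) +ᶠ (l *ᶠ c) *ᶠ B a′ (b ⊕ l · b′)          ≡⟨ cong₂ (λ s t → s +ᶠ (l *ᶠ c) *ᶠ t) (right a) (right a′) ⟩
                (B a b +ᶠ σ l *ᶠ B a b′) +ᶠ (l *ᶠ c) *ᶠ (B a′ b +ᶠ σ l *ᶠ B a′ b′)
                  ≡⟨ cong₂ (λ s t → (B a b +ᶠ σ l *ᶠ s) +ᶠ (l *ᶠ c) *ᶠ t) (B-refl b′⊥a) (cong₂ (λ s t → s +ᶠ σ l *ᶠ t) a′⊥b a′b′) ⟩
                (B a b +ᶠ σ l *ᶠ 0ᶠ) +ᶠ (l *ᶠ c) *ᶠ (0ᶠ +ᶠ σ l *ᶠ 1ᶠ)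
                  ≡⟨ FS.solve 4 (λ t l m c → (t FS.:+ m FS.:* FS.:0) FS.:+ (l FS.:* c) FS.:* (FS.:0 FS.:+ m FS.:* FS.:1) FS.:= t FS.:+ (l FS.:* m) FS.:* c) refl (B a b) l (σ l) c ⟩
                B a b +ᶠ (l *ᶠ σ l) *ᶠ c                                    ≡⟨ cong (λ t → B a b +ᶠ t *ᶠ c) norm ⟩
                B a b +ᶠ 1ᶠ *ᶠ c                                            ≡⟨ trans (cong (B a b +ᶠ_) (*ᶠ-identityˡ c)) trace ⟩
                0ᶠ                                                          ∎))
              where
              right : ∀ u → B u (b ⊕ l · b′) ≡ B u b +ᶠ σ l *ᶠ B u b′
              right u = trans (herm _ u) (trans (cong σ (B-line b l b′ u)) (trans (σ-line u) (cong₂ (λ s t → s +ᶠ σ l *ᶠ t) (sym (herm b u)) (sym (herm b′ u)))))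
                where
                σ-line : ∀ u → σ (B b u +ᶠ l *ᶠ B b′ u) ≡ σ (B b u) +ᶠ σ l *ᶠ σ (B b′ u)
                σ-line u = trans (σ-+ _ _) (cong (σ (B b u) +ᶠ_) (σ-* l _))
            u₁T : T (v′ ⊕ 1ᶠ · w)
            u₁T = on-line 1ᶠ (trans (cong (1ᶠ *ᶠ_) σ-1) (*ᶠ-identityˡ 1ᶠ))
            u₂T : T (v′ ⊕ λ₀ · w)
            u₂T = on-line λ₀ λ₀-norm
            w⊥v : B w v′ ≡ 0ᶠ
            w⊥v = ⊥-⊕ (⊥-⊕ʳ b′⊥a (iso tK′ b′K′ hb)) (⊥-· c (⊥-⊕ʳ (iso tK a′K ha) a′⊥b))
            w⊥w : B w w ≡ 0ᶠ
            w⊥w = begin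
              B w w                                    ≡⟨ B-line b′ c a′ w ⟩
              B b′ w +ᶠ c *ᶠ B a′ w                    ≡⟨ cong₂ (λ s t → s +ᶠ c *ᶠ t)
                  (trans (herm w b′) (trans (cong σ (trans (B-line b′ c a′ b′) (trans (cong₂ (λ s t → s +ᶠ c *ᶠ t) (iso tK′ b′K′ b′K′) a′b′) (trans (+ᶠ-identityˡ _) (*ᶠ-identityʳ c))))) (sym (herm b a))))
                  (trans (herm w a′) (trans (cong σ (trans (B-line b′ c a′ a′) (trans (cong₂ (λ s t → s +ᶠ c *ᶠ t) b′a′ (iso tK a′K a′K)) (trans (cong (1ᶠ +ᶠ_) (*ᶠ-zeroʳ c)) (+ᶠ-identityʳ _))))) σ-1)) ⟩
              B a b +ᶠ c *ᶠ 1ᶠ                         ≡⟨ trans (cong (B a b +ᶠ_) (*ᶠ-identityʳ c)) trace ⟩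
              0ᶠ                                       ∎
            v⊥v : B v′ v′ ≡ 0ᶠ
            v⊥v = Sing-B (∧-trueˡ h)
            u₁⊥u₂ : B (v′ ⊕ 1ᶠ · w) (v′ ⊕ λ₀ · w) ≡ 0ᶠ
            u₁⊥u₂ = ⊥-⊕ (⊥-⊕ʳ v⊥v (⊥-·ʳ λ₀ (B-refl w⊥v))) (⊥-· 1ᶠ (⊥-⊕ʳ w⊥v (⊥-·ʳ λ₀ w⊥w)))
            gap : λ₀ +ᶠ -ᶠ 1ᶠ ≢ 0ᶠ
            gap e = λ₀≢1 (trans (FS.solve 1 (λ l → l FS.:= (l FS.:+ FS.:- FS.:1) FS.:+ FS.:1) refl λ₀) (trans (cong (_+ᶠ 1ᶠ) e) (+ᶠ-identityˡ 1ᶠ)))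
            j : ∃ λ y → (λ₀ +ᶠ -ᶠ 1ᶠ) *ᶠ y ≡ 1ᶠ
            j = inv _ gap
            -- λ₀ (v′ + w) - (v′ + λ₀ w) = (λ₀ - 1) v′; this is why a second element of norm 1 is
            -- required.
            combine : (proj₁ j *ᶠ λ₀) · (v′ ⊕ 1ᶠ · w) ⊕ (-ᶠ proj₁ j) · (v′ ⊕ λ₀ · w) ≡ v′
            combine = trans (vsolve (λ { (l ∷ j ∷ []) (v ∷ w ∷ []) → (j FS.:* l) :· (v :⊕ FS.:1 :· w) :⊕ (FS.:- j) :· (v :⊕ l :· w) , ((l FS.:+ FS.:- FS.:1) FS.:* j) :· v }) (λ₀ ∷ proj₁ j ∷ []) (v′ ∷ w ∷ []) refl)
              (trans (cong (_· v′) (proj₂ j)) (1-· v′))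

          T⇒Z : ∀ {v} → T v → v ∈ Z
          T⇒Z = T⊆Z Z⇒T (trans (cong (λ t → s * t * q) ∣U∣) (trans (solve 3 (λ s n q → s :* n :* q := s :* q :* n) refl s (⌈ K ⌉ * ⌈ K ⌉) q) (cong (_* (⌈ K ⌉ * ⌈ K ⌉)) Qe≡sq)))
            where
            open Sandwich mK mK′ opp sU K⊆U K′⊆U Z (λ v → ∧-trueʳ {Sing v}) (λ v → ∧-trueˡ) (λ v h → ∧-true (sing tK v h) (K⊆U v h)) s
              (λ {y} {P} hP hy n → trans (ΣF.∑-cong (λ c → cong [_] (bool-ext (∧-trueˡ {Sing (y ⊕ c · P)}) (λ k → ∧-true k (has-⊕ sU hy (has-· sU c (K⊆U P hP))))))) (s-line (sing tK P hP) n))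

        -- By duality (X + ⟨P⟩) ∩ Y⊥ has q elements. A nonzero one has a nonzero coefficient at P,
        -- because X ∩ Y⊥ = 0, and can be scaled to the form P + a.
        complement-shift : ∀ {X Y P} → Member X → Member Y → (∀ {a} → a ∈ X → a ∈ Perp Y → a ≡ 0ᵛ) → (∀ {b} → b ∈ Y → b ∈ Perp X → b ≡ 0ᵛ) →
                           P ∉ X → ∃ λ a → a ∈ X × P ⊕ a ∈ Perp Y
        complement-shift {X} {Y} {P} mX mY freeX freeY n = from (nonzero-in (∩-sub (⊞-sub sX (⟨⟩-sub P)) (Perp-sub Y)) (subst (1ℚ <_) (sym count) 1<q))
          where
          sX : Sub X
          sX = sub (ts (gen mX))
          sY : Sub Y
          sY = sub (ts (gen mY))
          count : ⌈ (X ⊞ ⟨ P ⟩) ∩ Perp Y ⌉ ≡ q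
          count = cancel≡ ⌈ Y ⌉ (∣sub∣>0 sY) (begin
            ⌈ Y ⌉ * ⌈ (X ⊞ ⟨ P ⟩) ∩ Perp Y ⌉               ≡⟨ *-comm ⌈ Y ⌉ _ ⟩
            ⌈ (X ⊞ ⟨ P ⟩) ∩ Perp Y ⌉ * ⌈ Y ⌉               ≡⟨ duality (⊞-sub sX (⟨⟩-sub P)) sY ⟩
            ⌈ Y ∩ Perp (X ⊞ ⟨ P ⟩) ⌉ * ⌈ X ⊞ ⟨ P ⟩ ⌉       ≡⟨ cong₂ _*_ (∣∣-unique _ 0ᵛ (∧-true (has-0 sY) (has-0 (Perp-sub _))) (λ b h → freeY (∧-trueˡ h) (∧-trueˡ (trans (sym (Perp-⊞⟨⟩ {X} {P} sX b)) (∧-trueʳ {Y b} h))))) (adjoin sX n) ⟩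
            1ℚ * (q * ⌈ X ⌉)                              ≡⟨ cong (λ t → 1ℚ * (q * t)) (trans (∣gen∣ (gen mX)) (sym (∣gen∣ (gen mY)))) ⟩
            1ℚ * (q * ⌈ Y ⌉)                              ≡⟨ solve 2 (λ q y → :1 :* (q :* y) := y :* q) refl q ⌈ Y ⌉ ⟩
            ⌈ Y ⌉ * q                                     ∎)
          from : (∃ λ v → v ∈ (X ⊞ ⟨ P ⟩) ∩ Perp Y × v ≢ 0ᵛ) → ∃ λ a → a ∈ X × P ⊕ a ∈ Perp Y
          from (v , h , nz) with ⊞⟨⟩-elim (∧-trueˡ h)
          ... | a , c , ha , refl with c ≟ᶠ 0ᶠ
          ...   | yes refl = ⊥-elim (nz (trans a≡ (freeX ha (subst (_∈ Perp Y) a≡ (∧-trueʳ {(X ⊞ ⟨ P ⟩) (a ⊕ 0ᶠ · P)} h)))))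
            where
            a≡ : a ⊕ 0ᶠ · P ≡ a
            a≡ = trans (cong (a ⊕_) (0-· P)) (⊕-identityʳ a)
          ...   | no cz with inv c cz
          ...     | e , ce = e · a , has-· sX e ha , subst (_∈ Perp Y)
            (trans (vsolve (λ { (c ∷ e ∷ []) (a ∷ p ∷ []) → e :· (a :⊕ c :· p) , (c FS.:* e) :· p :⊕ e :· a }) (c ∷ e ∷ []) (a ∷ P ∷ []) refl)
              (trans (cong (λ t → t · P ⊕ e · a) ce) (cong (_⊕ e · a) (1-· P))))
            (has-· (Perp-sub Y) e (∧-trueʳ {(X ⊞ ⟨ P ⟩) (a ⊕ c · P)} h))

        -- With p orthogonal to K and K′, the singular vectors p + a + b are joined to a single one of them by
        -- orthogonal translations along K and K′.
        module QuadraticPair (Q : V → 𝔽) (Q-⊕ : ∀ u v → Q (u ⊕ v) ≡ Q u +ᶠ Q v +ᶠ B u v) (Q-· : ∀ c v → Q (c · v) ≡ c *ᶠ c *ᶠ Q v)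
                             (Sing⇒Q : ∀ {v} → v ∈ Sing → Q v ≡ 0ᶠ) (Q⇒Sing : ∀ {v} → Q v ≡ 0ᶠ → v ∈ Sing)
                             (B-sym : ∀ u v → B v u ≡ B u v) (s≡1 : s ≡ 1ℚ) (Qe≡qq : Qe ≡ q * q) where

          Sing-line : ∀ {X} → Sub X → K ⊆ X → ∀ {y P} → P ∈ K → y ∈ X → B y P ≢ 0ᶠ → ∑ᶠ (λ c → [ (Sing ∩ X) (y ⊕ c · P) ]) ≡ s
          Sing-line sX K⊆X {y} {P} hP hy n = trans (ΣF.∑-cong (λ c → cong [_] (bool-ext (∧-trueˡ {Sing (y ⊕ c · P)}) (λ k → ∧-true k (has-⊕ sX hy (has-· sX c (K⊆X P hP))))))) (s-line (sing tK P hP) n)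

          n>0 : 0ℚ < ⌈ K ⌉ * ⌈ K ⌉
          n>0 = mul>0 (∣sub∣>0 (sub tK)) (∣sub∣>0 (sub tK))

          opaque
            -- U has dimension 2d, while a polar space with parameter e - 1 = 1 defined by a
            -- quadratic form needs 2d + 1: the count on U is short by a factor q, and `escape`
            -- applies.
            outer : ∃ λ P → T P × P ∉ U
            outer = let a , b , ha , hb , n = hyperbolic-pair in
              Sandwich.escape mK mK′ opp sU K⊆U K′⊆U (Sing ∩ U) (λ v → ∧-trueʳ {Sing v}) (λ v → ∧-trueˡ) (λ v h → ∧-true (sing tK v h) (K⊆U v h)) s (Sing-line sU K⊆U)
                (λ v h → h) small ha n
              where
              small : s * ⌈ U ⌉ * q < Qe * (⌈ K ⌉ * ⌈ K ⌉)
              small = subst₂ _<_ (trans (solve 2 (λ n q → n :* q := :1 :* n :* q) refl (⌈ K ⌉ * ⌈ K ⌉) q) (sym (cong₂ (λ s u → s * u * q) s≡1 ∣U∣)))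
                (trans (solve 2 (λ n q → q :* (n :* q) := q :* q :* n) refl (⌈ K ⌉ * ⌈ K ⌉) q) (cong (_* (⌈ K ⌉ * ⌈ K ⌉)) (sym Qe≡qq))) (<q* (mul>0 n>0 0<q))

            -- Two applications of `complement-shift` move the outer vector P to a vector p = P + a
            -- + b orthogonal to K and K′, so that P = p + (-a) + (-b) remains a known vector of T.
            centre : ∃ λ p → ∃ λ a → ∃ λ b → a ∈ K × b ∈ K′ × p ∈ Perp K × p ∈ Perp K′ × p ∉ U × T (p ⊕ (a ⊕ b))
            centre =
              let P , tP , n = outer
                  a , ha , p₁ = complement-shift mK mK′ K-free K′-free (λ h → n (K⊆U P h))
                  b , hb , p₂ = complement-shift mK′ mK K′-free K-free (λ h → n (cancel-⊕ sU (K⊆U a ha) (K′⊆U (P ⊕ a) h)))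
              in (P ⊕ a) ⊕ b , -ᶠ 1ᶠ · a , -ᶠ 1ᶠ · b , has-· (sub tK) _ ha , has-· (sub tK′) _ hb , p₂ ,
                 has-⊕ (Perp-sub K′) p₁ (TS-⊆Perp tK′ b hb) ,
                 (λ h → n (cancel-⊕ sU (K⊆U a ha) (cancel-⊕ sU (K′⊆U b hb) h))) ,
                 subst T (vsolve (λ { [] (P ∷ a ∷ b ∷ []) → P , ((P :⊕ a) :⊕ b) :⊕ ((FS.:- FS.:1) :· a :⊕ (FS.:- FS.:1) :· b) }) [] (P ∷ a ∷ b ∷ []) refl) tP

          p a₀ b₀ : V
          p = proj₁ centre
          a₀ = proj₁ (proj₂ centre)
          b₀ = proj₁ (proj₂ (proj₂ centre))
          a₀K : a₀ ∈ K
          a₀K = proj₁ (proj₂ (proj₂ (proj₂ centre)))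
          b₀K′ : b₀ ∈ K′
          b₀K′ = proj₁ (proj₂ (proj₂ (proj₂ (proj₂ centre))))
          p⊥K : p ∈ Perp K
          p⊥K = proj₁ (proj₂ (proj₂ (proj₂ (proj₂ (proj₂ centre)))))
          p⊥K′ : p ∈ Perp K′
          p⊥K′ = proj₁ (proj₂ (proj₂ (proj₂ (proj₂ (proj₂ (proj₂ centre))))))
          p∉U : p ∉ U
          p∉U = proj₁ (proj₂ (proj₂ (proj₂ (proj₂ (proj₂ (proj₂ (proj₂ centre)))))))
          T₀ : T (p ⊕ (a₀ ⊕ b₀))
          T₀ = proj₂ (proj₂ (proj₂ (proj₂ (proj₂ (proj₂ (proj₂ (proj₂ centre)))))))

          Qp≢0 : Q p ≢ 0ᶠ
          Qp≢0 e = p∉U (K⊆U p (gen-max (gen mK) (Q⇒Sing e) p⊥K))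

          B-⊕ʳ : ∀ u v w → B w (u ⊕ v) ≡ B w u +ᶠ B w v
          B-⊕ʳ u v w = trans (B-sym (u ⊕ v) w) (trans (B-⊕ u v w) (cong₂ _+ᶠ_ (B-sym w u) (B-sym w v)))

          Q-pair : ∀ {a b} → a ∈ K → b ∈ K′ → Q (a ⊕ b) ≡ B a b
          Q-pair {a} {b} ha hb = trans (Q-⊕ a b) (trans (cong₂ (λ s t → s +ᶠ t +ᶠ B a b) (Sing⇒Q (sing tK a ha)) (Sing⇒Q (sing tK′ b hb)))
            (FS.solve 1 (λ t → FS.:0 FS.:+ FS.:0 FS.:+ t FS.:= t) refl (B a b)))

          Q-sum : ∀ {a b} → a ∈ K → b ∈ K′ → Q (p ⊕ (a ⊕ b)) ≡ Q p +ᶠ B a b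
          Q-sum {a} {b} ha hb = trans (Q-⊕ p (a ⊕ b)) (trans (cong₂ (λ s t → Q p +ᶠ s +ᶠ t) (Q-pair ha hb) (⊥-⊕ʳ (Perp-elim p⊥K ha) (Perp-elim p⊥K′ hb))) (+ᶠ-identityʳ _))

          t : 𝔽
          t = -ᶠ Q p

          t≢0 : t ≢ 0ᶠ
          t≢0 = neg≢0 Qp≢0

          value : ∀ {a b} → a ∈ K → b ∈ K′ → p ⊕ (a ⊕ b) ∈ Sing → B a b ≡ t
          value {a} {b} ha hb h = trans (FS.solve 2 (λ x y → y FS.:= FS.:- x FS.:+ (x FS.:+ y)) refl (Q p) (B a b)) (trans (cong (t +ᶠ_) (trans (sym (Q-sum ha hb)) (Sing⇒Q h))) (+ᶠ-identityʳ t))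

          -- The difference a′ - a lies in K, hence in T, and is orthogonal to p + (a + b) because
          -- B(a,b) = B(a′,b); so `T-⊕` applies.
          move : ∀ {a a′ b} → a ∈ K → a′ ∈ K → b ∈ K′ → B a b ≡ B a′ b → T (p ⊕ (a ⊕ b)) → T (p ⊕ (a′ ⊕ b))
          move {a} {a′} {b} ha ha′ hb e h = subst T (vsolve (λ { [] (p ∷ a ∷ a′ ∷ b ∷ []) → (p :⊕ (a :⊕ b)) :⊕ (a′ :⊖ a) , p :⊕ (a′ :⊕ b) }) [] (p ∷ a ∷ a′ ∷ b ∷ []) refl)
            (T-⊕ h (T-K (has-⊖ (sub tK) ha′ ha)) (B-refl (⊥-⊕ʳ (B-refl (Perp-elim p⊥K (has-⊖ (sub tK) ha′ ha))) (⊥-⊕ʳ (iso tK (has-⊖ (sub tK) ha′ ha) ha)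
              (trans (B-line a′ (-ᶠ 1ᶠ) a b) (trans (cong (λ s → B a′ b +ᶠ -ᶠ 1ᶠ *ᶠ s) e) (FS.solve 1 (λ s → s FS.:+ (FS.:- FS.:1) FS.:* s FS.:= FS.:0) refl (B a′ b))))))))

          move′ : ∀ {a b b′} → a ∈ K → b ∈ K′ → b′ ∈ K′ → B a b ≡ B a b′ → T (p ⊕ (a ⊕ b)) → T (p ⊕ (a ⊕ b′))
          move′ {a} {b} {b′} ha hb hb′ e h = subst T (vsolve (λ { [] (p ∷ a ∷ b ∷ b′ ∷ []) → (p :⊕ (a :⊕ b)) :⊕ (b′ :⊖ b) , p :⊕ (a :⊕ b′) }) [] (p ∷ a ∷ b ∷ b′ ∷ []) refl)
            (T-⊕ h (T-K′ (has-⊖ (sub tK′) hb′ hb)) (B-refl (⊥-⊕ʳ (B-refl (Perp-elim p⊥K′ (has-⊖ (sub tK′) hb′ hb))) (⊥-⊕ʳ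
              (trans (B-line b′ (-ᶠ 1ᶠ) b a) (trans (cong₂ (λ s s′ → s +ᶠ -ᶠ 1ᶠ *ᶠ s′) (trans (B-sym a b′) (sym e)) (B-sym a b)) (FS.solve 1 (λ s → s FS.:+ (FS.:- FS.:1) FS.:* s FS.:= FS.:0) refl (B a b))))
              (iso tK′ (has-⊖ (sub tK′) hb′ hb) hb)))))

          -- The path (a₀, b₀) → (a₀, b₁) → (a₁, b₁) → (a₁, b) → (a, b) inside { B = t }, for a b₁ with B a₂ b₁ ≠ 0 = B a₂ b.
          reach : ∀ {a b} → a ∈ K → b ∈ K′ → p ⊕ (a ⊕ b) ∈ Sing → T (p ⊕ (a ⊕ b))
          reach {a} {b} ha hb h = from (choose (B a₂ b₀ ≟ᶠ 0ᶠ))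
            where
            ab≡t : B a b ≡ t
            ab≡t = value ha hb h
            a₀b₀≡t : B a₀ b₀ ≡ t
            a₀b₀≡t = value a₀K b₀K′ (T-sing T₀)
            sp = second-pair ha hb (λ e → t≢0 (trans (sym ab≡t) e))
            a₂ = proj₁ sp
            b₂ = proj₁ (proj₂ sp)
            a₂K : a₂ ∈ K
            a₂K = proj₁ (proj₂ (proj₂ sp))
            b₂K′ : b₂ ∈ K′
            b₂K′ = proj₁ (proj₂ (proj₂ (proj₂ sp)))
            a₂⊥b : B a₂ b ≡ 0ᶠ
            a₂⊥b = proj₁ (proj₂ (proj₂ (proj₂ (proj₂ sp))))
            b₂a₂ : B b₂ a₂ ≡ 1ᶠ
            b₂a₂ = proj₂ (proj₂ (proj₂ (proj₂ (proj₂ (proj₂ sp)))))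
            b₀a₀≢0 : B b₀ a₀ ≢ 0ᶠ
            b₀a₀≢0 e = t≢0 (trans (sym a₀b₀≡t) (B-refl e))
            -- If a₂ ⊥ b₀, the vector b₀ is corrected by some b₃ in K′ that is orthogonal to a₀ and
            -- has B(a₂,b₃) = 1.
            choose : Dec (B a₂ b₀ ≡ 0ᶠ) → ∃ λ b₁ → b₁ ∈ K′ × B a₀ b₁ ≡ t × B a₂ b₁ ≢ 0ᶠ
            choose (no n) = b₀ , b₀K′ , a₀b₀≡t , n
            choose (yes z) = b₀ ⊕ b₃ , has-⊕ (sub tK′) b₀K′ b₃K′ ,
              trans (B-⊕ʳ b₀ b₃ a₀) (trans (cong₂ _+ᶠ_ a₀b₀≡t (B-refl b₃⊥a₀)) (+ᶠ-identityʳ t)) ,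
              λ e → 1≢0 (trans (sym a₂b₃) (trans (sym (+ᶠ-identityˡ _)) (trans (cong (_+ᶠ B a₂ b₃) (sym z)) (trans (sym (B-⊕ʳ b₀ b₃ a₂)) e))))
              where
              c : 𝔽
              c = root (B b₂ a₀) (B b₀ a₀) b₀a₀≢0
              b₃ : V
              b₃ = b₂ ⊕ c · b₀
              b₃K′ : b₃ ∈ K′
              b₃K′ = has-⊕ (sub tK′) b₂K′ (has-· (sub tK′) c b₀K′)
              b₃⊥a₀ : B b₃ a₀ ≡ 0ᶠ
              b₃⊥a₀ = trans (B-line b₂ c b₀ a₀) (root-eq (B b₂ a₀) (B b₀ a₀) b₀a₀≢0)
              a₂b₃ : B a₂ b₃ ≡ 1ᶠ
              a₂b₃ = trans (B-sym b₃ a₂) (trans (B-line b₂ c b₀ a₂) (trans (cong₂ (λ s s′ → s +ᶠ c *ᶠ s′) b₂a₂ (B-refl z)) (trans (cong (1ᶠ +ᶠ_) (*ᶠ-zeroʳ c)) (+ᶠ-identityʳ 1ᶠ))))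
            from : (∃ λ b₁ → b₁ ∈ K′ × B a₀ b₁ ≡ t × B a₂ b₁ ≢ 0ᶠ) → T (p ⊕ (a ⊕ b))
            from (b₁ , b₁K′ , a₀b₁ , n) =
              move a₁K ha hb (trans a₁b (sym ab≡t))
                (move′ a₁K b₁K′ hb (trans a₁b₁ (sym a₁b))
                  (move a₀K a₁K b₁K′ (trans a₀b₁ (sym a₁b₁))
                    (move′ a₀K b₀K′ b₁K′ (trans a₀b₀≡t (sym a₀b₁)) T₀)))
              where
              -- Chosen so that B(a₁,b₁) = t for a₁ = a + ν a₂; since a₂ ⊥ b, the value B(a₁,b) = t
              -- is kept.
              ν : 𝔽
              ν = root (B a b₁ +ᶠ -ᶠ t) (B a₂ b₁) n
              a₁ : V
              a₁ = a ⊕ ν · a₂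
              a₁K : a₁ ∈ K
              a₁K = has-⊕ (sub tK) ha (has-· (sub tK) ν a₂K)
              a₁b₁ : B a₁ b₁ ≡ t
              a₁b₁ = trans (B-line a ν a₂ b₁) (trans (FS.solve 4 (λ x ν y t → x FS.:+ ν FS.:* y FS.:= ((x FS.:+ FS.:- t) FS.:+ ν FS.:* y) FS.:+ t) refl (B a b₁) ν (B a₂ b₁) t)
                (trans (cong (_+ᶠ t) (root-eq (B a b₁ +ᶠ -ᶠ t) (B a₂ b₁) n)) (+ᶠ-identityˡ t)))
              a₁b : B a₁ b ≡ t
              a₁b = trans (B-line a ν a₂ b) (trans (cong₂ (λ s s′ → s +ᶠ ν *ᶠ s′) ab≡t a₂⊥b) (trans (cong (t +ᶠ_) (*ᶠ-zeroʳ ν)) (+ᶠ-identityʳ t)))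

          U⁺ : V → Bool
          U⁺ = U ⊞ ⟨ p ⟩

          Z : V → Bool
          Z = Sing ∩ U⁺

          Z⇒T : ∀ {v} → v ∈ Z → T v
          Z⇒T {v} h with ⊞⟨⟩-elim (∧-trueʳ {Sing v} h)
          ... | u , c , hu , refl with ⊞-elim hu
          ...   | a , b , ha , hb , refl with c ≟ᶠ 0ᶠ
          ...     | yes refl = subst T (sym flat-eq) (T-⊕ (T-K ha) (T-K′ hb) (trans (sym (Q-pair ha hb)) (Sing⇒Q (subst (_∈ Sing) flat-eq (∧-trueˡ h)))))
            where
            flat-eq : (a ⊕ b) ⊕ 0ᶠ · p ≡ a ⊕ b
            flat-eq = trans (cong ((a ⊕ b) ⊕_) (0-· p)) (⊕-identityʳ (a ⊕ b))
          ...     | no nz with inv c nz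
          ...       | e , ce = subst T back (T-· c (reach (has-· (sub tK) e ha) (has-· (sub tK′) e hb) (subst (_∈ Sing) forth (Sing-· e (∧-trueˡ h)))))
            where
            forth : e · ((a ⊕ b) ⊕ c · p) ≡ p ⊕ (e · a ⊕ e · b)
            forth = trans (vsolve (λ { (c ∷ e ∷ []) (a ∷ b ∷ p ∷ []) → e :· ((a :⊕ b) :⊕ c :· p) , (c FS.:* e) :· p :⊕ (e :· a :⊕ e :· b) }) (c ∷ e ∷ []) (a ∷ b ∷ p ∷ []) refl)
              (trans (cong (λ s → s · p ⊕ (e · a ⊕ e · b)) ce) (cong (_⊕ (e · a ⊕ e · b)) (1-· p)))
            back : c · (p ⊕ (e · a ⊕ e · b)) ≡ (a ⊕ b) ⊕ c · p
            back = trans (vsolve (λ { (c ∷ e ∷ []) (a ∷ b ∷ p ∷ []) → c :· (p :⊕ (e :· a :⊕ e :· b)) , (c FS.:* e) :· (a :⊕ b) :⊕ c :· p }) (c ∷ e ∷ []) (a ∷ b ∷ p ∷ []) refl)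
              (trans (cong (λ s → s · (a ⊕ b) ⊕ c · p) ce) (cong (_⊕ c · p) (1-· (a ⊕ b))))

          T⇒Z : ∀ {v} → T v → v ∈ Z
          T⇒Z = Sandwich.T⊆Z mK mK′ opp sU⁺ K⊆U⁺ (λ v h → ⊞-⊆ˡ (⟨⟩-sub p) v (K′⊆U v h)) Z (λ v → ∧-trueʳ {Sing v}) (λ v → ∧-trueˡ) (λ v h → ∧-true (sing tK v h) (K⊆U⁺ v h)) s (Sing-line sU⁺ K⊆U⁺)
            Z⇒T (trans (cong₂ (λ s u → s * u * q) s≡1 (trans (adjoin sU p∉U) (cong (q *_) ∣U∣))) (trans (solve 2 (λ n q → :1 :* (q :* n) :* q := q :* q :* n) refl (⌈ K ⌉ * ⌈ K ⌉) q) (cong (_* (⌈ K ⌉ * ⌈ K ⌉)) (sym Qe≡qq))))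
            where
            sU⁺ : Sub U⁺
            sU⁺ = ⊞-sub sU (⟨⟩-sub p)
            K⊆U⁺ : K ⊆ U⁺
            K⊆U⁺ v h = ⊞-⊆ˡ (⟨⟩-sub p) v (K⊆U v h)

    -- The dichotomy: pencils or the extremal configuration.

    module _ (𝓛 : CLSet) (Ls : List (V → Bool)) (cov : Covers 𝓛 Ls) where
      open CLSet 𝓛
      open Fullness 𝓛
      open Covers cov

      record Extremal-data {k : ℕ} (d-suc : suc (suc k) ≡ d) : Set where
        field
          x-eq    : q * x ≡ Qe + q
          on-flat : ∀ {K} → Gen K → χ K ≡ true → ∀ {P} → P ∈ K → Δ P ≡ q * q * x
          some-K  : ∃ λ K → Gen K × χ K ≡ true

      -- In rank one a generator is a single point, so every nonzero vector of a member is full,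
      -- whatever the parameter.
      rank-one : 1 ≡ d → Pencils 𝓛
      rank-one d≡1 = decompose (λ _ → ⊤) (λ _ → tt) find (length Ls) 𝓛 Ls ℕP.≤-refl cov tt
        where
        find : ∀ 𝓜 → ⊤ → ∀ {K} → Gen K → CLSet.χ 𝓜 K ≡ true → ∃ λ P → Fullness.Full 𝓜 P
        find 𝓜 _ {K} g h = let P , hP , n = outside {K} {⟨ 0ᵛ ⟩} (subst₂ _<_ (sym one) (sym size-q) 1<q) ; nz = λ e → n (subst (_∈ ⟨ 0ᵛ ⟩) (sym e) ⟨⟩-self) in
          P , sing (ts g) P hP , nz , λ {π} g′ h′ → CLSet.χ-mono 𝓜 (K⊆ g′ hP nz h′) (gen-⊆ g g′ (K⊆ g′ hP nz h′)) h
          where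
          q^1 : q ^^ d ≡ q
          q^1 = trans (cong (q ^^_) (sym d≡1)) (*-identityʳ q)
          size-q : ⌈ K ⌉ ≡ q
          size-q = trans (∣gen∣ g) q^1
          one : ⌈ ⟨ 0ᵛ ⟩ ⌉ ≡ 1ℚ
          one = ∣∣-unique _ 0ᵛ ⟨⟩-self (λ v k → let c , e = ⟨⟩-elim k in trans e (·-0ᵛ c))
          K⊆ : ∀ {π P} → Gen π → P ∈ K → P ≢ 0ᵛ → P ∈ π → K ⊆ π
          K⊆ {π} {P} g′ hP nz h′ v hv = ⟨⟩-⊆ (sub (ts g′)) h′ v (⊆-full {⟨ P ⟩} {K} (⟨⟩-⊆ (sub (ts g)) hP) (≤-reflexive (trans size-q (sym (∣⟨⟩∣ nz)))) v hv)

      heavy-member : (∃ λ P → Full P) ⊎ (∀ {K} → K ∈L.∈ Ls → ∀ {P} → P ∈ K → Δ P ≤ q * q * x)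
      heavy-member = go Ls members
        where
        go : ∀ Ms → All (λ K → Gen K × χ K ≡ true) Ms → (∃ λ P → Full P) ⊎ (∀ {K} → K ∈L.∈ Ms → ∀ {P} → P ∈ K → Δ P ≤ q * q * x)
        go [] [] = inj₂ λ ()
        go (K ∷ Ms) ((g , _) ∷ ms) = join (heavy-or g) (go Ms ms)
          where
          join : (∃ λ P → P ∈ K × q * q * x < Δ P) ⊎ (∀ {P} → P ∈ K → Δ P ≤ q * q * x) →
                 (∃ λ P → Full P) ⊎ (∀ {K} → K ∈L.∈ Ms → ∀ {P} → P ∈ K → Δ P ≤ q * q * x) →
                 (∃ λ P → Full P) ⊎ (∀ {M} → M ∈L.∈ (K ∷ Ms) → ∀ {P} → P ∈ M → Δ P ≤ q * q * x)
          join (inj₁ (P , hP , h)) _ = inj₁ (P , heavy-full (sing (ts g) P hP) h)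
          join (inj₂ _) (inj₁ f) = inj₁ f
          join (inj₂ l) (inj₂ r) = inj₂ λ { (here refl) → l ; (there m) → r m }

      -- Once one pencil has been removed, `x` lies strictly below the bound and stays there, so
      -- `light-bound` supplies a heavy vector on any remaining member. If no full vector turns up
      -- at the start, either the set is empty or `light-bound` forces equality.
      higher-rank : q * x ≤ Qe + q → ∀ {k} (d-suc : suc (suc k) ≡ d) → Pencils 𝓛 ⊎ Extremal-data d-suc
      higher-rank bound d-suc = cases Ls refl heavy-member
        where
        small : ℚ → Set
        small a = q * a < Qe + q
        below : ∀ {a} → q * a ≤ Qe + q → small (a - 1ℚ)
        below {a} h = <-≤-trans (subst₂ _<_ (solve 2 (λ q a → q :* a :- q := q :* (a :- :1)) refl q a) (+-identityʳ (q * a))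
          (+-monoʳ-< (q * a) (neg-antimono-< {0ℚ} {q} 0<q))) h
        find : ∀ 𝓜 → small (CLSet.x 𝓜) → ∀ {K} → Gen K → CLSet.χ 𝓜 K ≡ true → ∃ λ P → Fullness.Full 𝓜 P
        find 𝓜 sm g h = either (Fullness.heavy-or 𝓜 g)
          where
          either : _ ⊎ _ → ∃ λ P → Fullness.Full 𝓜 P
          either (inj₁ (P , hP , heavy)) = P , Fullness.heavy-full 𝓜 (sing (ts g) P hP) heavy
          either (inj₂ light) = ⊥-elim (≤<-⊥ (Fullness.light-bound 𝓜 g h light) sm)
        cases : ∀ Ms → Ls ≡ Ms → (∃ λ P → Full P) ⊎ (∀ {K} → K ∈L.∈ Ls → ∀ {P} → P ∈ K → Δ P ≤ q * q * x) → Pencils 𝓛 ⊎ Extremal-data d-suc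
        cases Ms e (inj₁ (P , full)) = inj₁ (pencils-cons 𝓛 full (decompose small (λ h → below (<⇒≤ h)) find (length Ls) (remove 𝓛 full)
          (filter (Avoids? 𝓛 full) Ls) (ℕP.<⇒≤ (remove-shorter 𝓛 full cov)) (remove-covers 𝓛 full cov) (subst small (sym (remove-x 𝓛 full)) (below bound))))
        cases [] e (inj₂ light) = inj₁ (decompose small (λ h → below (<⇒≤ h)) find 0 𝓛 [] ℕP.≤-refl (subst (Covers 𝓛) e cov) none)
          where
          none : small x
          none = subst (λ t → q * t < Qe + q) (sym (empty-total (λ {K} g h → case (subst (Any (K ⊆_)) e (covers g h))))) (subst (_< Qe + q) (sym (*-zeroʳ q)) (<-trans Qe>0 (subst (_< Qe + q) (+-identityʳ Qe) (+-monoʳ-< Qe 0<q))))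
            where
            case : ∀ {K : V → Bool} → ¬ Any (K ⊆_) []
            case ()
        cases (K ∷ Ms) e (inj₂ light) = inj₂ (record
          { x-eq = x≡ ; on-flat = λ g h → light-flat g h (lightK g h) x≡ ; some-K = K , proj₁ mK , proj₂ mK })
          where
          mK : Gen K × χ K ≡ true
          mK = All.lookup members (subst (K ∈L.∈_) (sym e) (here refl))
          lightK : ∀ {M} → Gen M → χ M ≡ true → ∀ {P} → P ∈ M → Δ P ≤ q * q * x
          lightK g h {P} hP = let N , m , s = ∈L.find (covers g h) in light m (s P hP)
          x≡ : q * x ≡ Qe + q
          x≡ = ≤-antisym bound (light-bound (proj₁ mK) (proj₂ mK) (lightK (proj₁ mK) (proj₂ mK)))

    -- The interface between the extremal configuration and the coordinates of the embedded space:
    -- T, two opposite members, and the facts about their sum that give nondegeneracy. The three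
    -- extensions say which vectors T consists of, for e = 1, 3/2 and 2.
    record Frame (𝓛 : CLSet) : Set₁ where
      open CLSet 𝓛
      field
        T            : V → Set
        T-sing       : ∀ {v} → T v → v ∈ Sing
        T-in         : ∀ {K v} → Gen K → χ K ≡ true → v ∈ K → T v
        T-gen        : ∀ {π} → Gen π → (∀ {v} → v ∈ π → T v) → χ π ≡ true
        K K′         : V → Bool
        gen-K        : Gen K
        gen-K′       : Gen K′
        T-K          : ∀ {v} → v ∈ K → T v
        ∣K⊞K′∣       : ⌈ K ⊞ K′ ⌉ ≡ ⌈ K ⌉ * ⌈ K ⌉
        radical      : ∀ {a b} → a ∈ K → b ∈ K′ → (∀ {u} → u ∈ K → B (a ⊕ b) u ≡ 0ᶠ) → (∀ {u} → u ∈ K′ → B (a ⊕ b) u ≡ 0ᶠ) → a ≡ 0ᵛ × b ≡ 0ᵛ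
        split-unique : ∀ {a b a′ b′} → a ∈ K → b ∈ K′ → a′ ∈ K → b′ ∈ K′ → a ⊕ b ≡ a′ ⊕ b′ → a ≡ a′ × b ≡ b′

    record HyperbolicFrame (𝓛 : CLSet) : Set₁ where
      field
        frame : Frame 𝓛
      open Frame frame public
      field
        T⇒ : ∀ {v} → T v → ∃ λ a → ∃ λ b → a ∈ K × b ∈ K′ × B a b ≡ 0ᶠ × v ≡ a ⊕ b
        ⇒T : ∀ {a b} → a ∈ K → b ∈ K′ → B a b ≡ 0ᶠ → T (a ⊕ b)

    record SubspaceFrame (𝓛 : CLSet) : Set₁ where
      field
        frame : Frame 𝓛
      open Frame frame public
      field
        T⇒ : ∀ {v} → T v → v ∈ K ⊞ K′
        ⇒T : ∀ {v} → v ∈ Sing → v ∈ K ⊞ K′ → T v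

    record EllipticFrame (𝓛 : CLSet) (Q : V → 𝔽) : Set₁ where
      field
        frame : Frame 𝓛
      open Frame frame public
      field
        p    : V
        p⊥   : ∀ {u} → u ∈ K ⊞ K′ → B p u ≡ 0ᶠ
        p∉   : p ∉ K ⊞ K′
        Qp≢0 : Q p ≢ 0ᶠ
        T⇒   : ∀ {v} → T v → v ∈ (K ⊞ K′) ⊞ ⟨ p ⟩
        ⇒T   : ∀ {v} → v ∈ Sing → v ∈ (K ⊞ K′) ⊞ ⟨ p ⟩ → T v

    module Frames {𝓛 : CLSet} {Ls : List (V → Bool)} {cov : Covers 𝓛 Ls} {k : ℕ} {d-suc : suc (suc k) ≡ d} (ex : Extremal-data 𝓛 Ls cov d-suc) where
      open CLSet 𝓛
      open Extremal-data ex
      private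
        module Sh = Shapes 𝓛 d-suc x-eq on-flat
        open Sh using (T; Member; member; Opposite; T-sing; T-gen; module Member)

        K₀ : V → Bool
        K₀ = proj₁ some-K

        m₀ : Member K₀
        m₀ = member (proj₁ (proj₂ some-K)) (proj₂ (proj₂ some-K))

      opaque
        opposite-pair : ∃ λ K′ → Member K′ × Opposite K₀ K′
        -- The descent starts at the member itself, with the size of the whole space as bound.
        opposite-pair = Sh.opposite (length (Finite.elems vectors)) m₀ m₀ (≤-trans (∣∣-mono {K₀ ∩ K₀} {λ _ → true} (λ _ _ → refl)) (≤-reflexive (∑ᴸ-len (Finite.elems vectors))))

      private
        module Pr = Sh.Pair m₀ (proj₁ (proj₂ opposite-pair)) (proj₂ (proj₂ opposite-pair))

      opaque
        q≤Qe : q ≤ Qe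
        q≤Qe = Sh.q≤Qe m₀

        the-frame : Frame 𝓛
        the-frame = record
          { T = T ; T-sing = T-sing ; T-in = λ {K} g h m → K , member g h , m ; T-gen = λ g h → Member.inχ (T-gen g h)
          ; K = K₀ ; K′ = proj₁ opposite-pair ; gen-K = Member.gen m₀ ; gen-K′ = Member.gen (proj₁ (proj₂ opposite-pair)) ; T-K = Pr.T-K
          ; ∣K⊞K′∣ = Pr.∣U∣ ; radical = Pr.U-radical ; split-unique = Pr.split-unique }

        hyperbolic-frame : Qe ≡ q → HyperbolicFrame 𝓛
        hyperbolic-frame e = record { frame = the-frame ; T⇒ = λ h → Hy.Z-elim (Hy.T⇒Z h) ; ⇒T = λ ha hb o → Hy.Z⇒T (Hy.Z-intro ha hb o) }
          where module Hy = Pr.Hyperbolic e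

        alternating-char-2 : Qe ≡ q → (∀ u v → B v u ≡ -ᶠ B u v) → 1ᶠ +ᶠ 1ᶠ ≡ 0ᶠ
        alternating-char-2 e = Pr.Hyperbolic.char-2 e

        hermitian-frame : (σ : 𝔽 → 𝔽) → (∀ a b → σ (a +ᶠ b) ≡ σ a +ᶠ σ b) → (∀ a b → σ (a *ᶠ b) ≡ σ a *ᶠ σ b) → (∀ a → σ (σ a) ≡ a) →
                          (∀ u v → B v u ≡ σ (B u v)) → (∃ λ l → l *ᶠ σ l ≡ 1ᶠ × l ≢ 1ᶠ) → s * q ≡ Qe → SubspaceFrame 𝓛
        hermitian-frame σ σ-+ σ-* σ-σ herm (l , norm , l≢1) e = record { frame = the-frame ; T⇒ = λ {v} h → ∧-trueʳ {Sing v} (He.T⇒Z h) ; ⇒T = λ h k → He.Z⇒T (∧-true h k) }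
          where module He = Pr.HermitianPair σ σ-+ σ-* σ-σ herm l norm l≢1 e

        elliptic-frame : (Q : V → 𝔽) → (∀ u v → Q (u ⊕ v) ≡ Q u +ᶠ Q v +ᶠ B u v) → (∀ c v → Q (c · v) ≡ c *ᶠ c *ᶠ Q v) →
                         (∀ {v} → v ∈ Sing → Q v ≡ 0ᶠ) → (∀ {v} → Q v ≡ 0ᶠ → v ∈ Sing) → (∀ u v → B v u ≡ B u v) → s ≡ 1ℚ → Qe ≡ q * q → EllipticFrame 𝓛 Q
        elliptic-frame Q Q-⊕ Q-· S⇒ ⇒S sym′ s1 e = record { frame = the-frame ; p = El.p
          ; p⊥ = λ m → let a , b , ha , hb , eq = ⊞-elim m in subst (λ t → B El.p t ≡ 0ᶠ) (sym eq) (⊥-⊕ʳ (Perp-elim El.p⊥K ha) (Perp-elim El.p⊥K′ hb))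
          ; p∉ = El.p∉U ; Qp≢0 = El.Qp≢0 ; T⇒ = λ {v} h → ∧-trueʳ {Sing v} (El.T⇒Z h) ; ⇒T = λ h k → El.Z⇒T (∧-true h k) }
          where module El = Pr.QuadraticPair Q Q-⊕ Q-· S⇒ ⇒S sym′ s1 e

-- Sesquilinear and quadratic forms in coordinates.

module SesquilinearForms where

  open import Defs using (FiniteField)
  import Defs as D
  open import Data.Nat as ℕ using (ℕ; zero; suc)
  open import Data.Fin using (Fin; zero; suc)
  open import Relation.Binary.PropositionalEquality hiding ([_])
  open Numbers using (module Finite; module FiniteSums; does-true; true-does)
  open LinearAlgebra
  open RingSolver

  module Forms (F : FiniteField) where
    open Field F public
    open FS using (solve; _:=_; _:+_; _:*_; :-_; _:-_; :0; :1)
    open ≡-Reasoning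

    ΣF : ∀ {n} → (Fin n → 𝔽) → 𝔽
    ΣF = D.ΣF F

    ΣF-cong : ∀ {n} {f g : Fin n → 𝔽} → (∀ i → f i ≡ g i) → ΣF f ≡ ΣF g
    ΣF-cong {zero}  h = refl
    ΣF-cong {suc n} h = cong₂ _+ᶠ_ (h zero) (ΣF-cong (λ i → h (suc i)))

    ΣF-+ : ∀ {n} (f g : Fin n → 𝔽) → ΣF (λ i → f i +ᶠ g i) ≡ ΣF f +ᶠ ΣF g
    ΣF-+ {zero}  f g = sym (+ᶠ-identityʳ 0ᶠ)
    ΣF-+ {suc n} f g = trans (cong ((f zero +ᶠ g zero) +ᶠ_) (ΣF-+ (λ i → f (suc i)) (λ i → g (suc i))))
      (solve 4 (λ a b c d → a :+ b :+ (c :+ d) := a :+ c :+ (b :+ d)) refl (f zero) (g zero) _ _)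

    ΣF-* : ∀ {n} c (f : Fin n → 𝔽) → ΣF (λ i → c *ᶠ f i) ≡ c *ᶠ ΣF f
    ΣF-* {zero}  c f = sym (*ᶠ-zeroʳ c)
    ΣF-* {suc n} c f = trans (cong (c *ᶠ f zero +ᶠ_) (ΣF-* c (λ i → f (suc i)))) (solve 3 (λ c a b → c :* a :+ c :* b := c :* (a :+ b)) refl c (f zero) _)

    ΣF-*ʳ : ∀ {n} c (f : Fin n → 𝔽) → ΣF (λ i → f i *ᶠ c) ≡ ΣF f *ᶠ c
    ΣF-*ʳ {n} c f = trans (ΣF-cong {n} (λ i → *ᶠ-comm (f i) c)) (trans (ΣF-* {n} c f) (*ᶠ-comm c _))

    ΣF-0 : ∀ {n} → ΣF {n} (λ _ → 0ᶠ) ≡ 0ᶠ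
    ΣF-0 {zero}  = refl
    ΣF-0 {suc n} = trans (+ᶠ-identityˡ _) (ΣF-0 {n})

    ΣF-swap : ∀ {m n} (f : Fin m → Fin n → 𝔽) → ΣF (λ i → ΣF (f i)) ≡ ΣF (λ j → ΣF (λ i → f i j))
    ΣF-swap {zero}  {n} f = sym (ΣF-0 {n})
    ΣF-swap {suc m} {n} f = trans (cong (ΣF (f zero) +ᶠ_) (ΣF-swap (λ i → f (suc i)))) (sym (ΣF-+ (f zero) (λ j → ΣF (λ i → f (suc i) j))))

    ΣF-hom : ∀ {n} (σ : 𝔽 → 𝔽) → σ 0ᶠ ≡ 0ᶠ → (∀ a b → σ (a +ᶠ b) ≡ σ a +ᶠ σ b) → (f : Fin n → 𝔽) → σ (ΣF f) ≡ ΣF (λ i → σ (f i))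
    ΣF-hom {zero}  σ z a f = z
    ΣF-hom {suc n} σ z a f = trans (a _ _) (cong (σ (f zero) +ᶠ_) (ΣF-hom σ z a (λ i → f (suc i))))

    Fun : ℕ → Set
    Fun = D.Vec F

    infixl 6 _∔_
    _∔_ : ∀ {n} → Fun n → Fun n → Fun n
    (u ∔ v) i = u i +ᶠ v i

    infixr 7 _∙_
    _∙_ : ∀ {n} → 𝔽 → Fun n → Fun n
    (c ∙ v) i = c *ᶠ v i

    Matrix : ℕ → Set
    Matrix n = Fin n → Fin n → 𝔽

    -- τ is the identity for bilinear forms and the field involution for Hermitian ones.
    module Sesquilinear (τ : 𝔽 → 𝔽) where

      form : ∀ {n} → Matrix n → Fun n → Fun n → 𝔽
      form a u v = ΣF (λ i → ΣF (λ j → u i *ᶠ (a i j *ᶠ τ (v j))))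

      form-cong : ∀ {n} {a b : Matrix n} {u u′ v v′ : Fun n} → (∀ i j → a i j ≡ b i j) → (∀ i → u i ≡ u′ i) → (∀ i → v i ≡ v′ i) → form a u v ≡ form b u′ v′
      form-cong {n} h k l = ΣF-cong {n} (λ i → ΣF-cong {n} (λ j → cong₂ _*ᶠ_ (k i) (cong₂ _*ᶠ_ (h i j) (cong τ (l j)))))

      form-∔ˡ : ∀ {n} (a : Matrix n) u u′ v → form a (u ∔ u′) v ≡ form a u v +ᶠ form a u′ v
      form-∔ˡ {n} a u u′ v = trans (ΣF-cong {n} (λ i → trans (ΣF-cong {n} (λ j → solve 3 (λ x y z → (x :+ y) :* z := x :* z :+ y :* z) refl (u i) (u′ i) (a i j *ᶠ τ (v j)))) (ΣF-+ {n} (λ j → u i *ᶠ (a i j *ᶠ τ (v j))) (λ j → u′ i *ᶠ (a i j *ᶠ τ (v j)))))) (ΣF-+ {n} _ _)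

      form-∙ˡ : ∀ {n} (a : Matrix n) c u v → form a (c ∙ u) v ≡ c *ᶠ form a u v
      form-∙ˡ {n} a c u v = trans (ΣF-cong {n} (λ i → trans (ΣF-cong {n} (λ j → *ᶠ-assoc c (u i) (a i j *ᶠ τ (v j)))) (ΣF-* {n} c (λ j → u i *ᶠ (a i j *ᶠ τ (v j)))))) (ΣF-* {n} c _)

      form-Σˡ : ∀ {k n} (a : Matrix n) (M : Fin k → Fun n) (x : Fun k) v → form a (D.comb F M x) v ≡ ΣF (λ l → x l *ᶠ form a (M l) v)
      form-Σˡ {zero} {n} a M x v = trans (ΣF-cong {n} (λ i → trans (ΣF-cong {n} (λ j → *ᶠ-zeroˡ (a i j *ᶠ τ (v j)))) (ΣF-0 {n}))) (ΣF-0 {n})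
      form-Σˡ {suc k} {n} a M x v = trans (form-∔ˡ a (x zero ∙ M zero) (D.comb F (λ i → M (suc i)) (λ i → x (suc i))) v)
        (cong₂ _+ᶠ_ (form-∙ˡ a (x zero) (M zero) v) (form-Σˡ a (λ i → M (suc i)) (λ i → x (suc i)) v))

      module Conjugate (τ-0 : τ 0ᶠ ≡ 0ᶠ) (τ-+ : ∀ a b → τ (a +ᶠ b) ≡ τ a +ᶠ τ b) (τ-* : ∀ a b → τ (a *ᶠ b) ≡ τ a *ᶠ τ b) (τ-τ : ∀ a → τ (τ a) ≡ a) where

        form-conj : ∀ {n} (a b : Matrix n) → (∀ i j → b j i ≡ τ (a i j)) → ∀ u v → form b v u ≡ τ (form a u v)
        form-conj {n} a b h u v = sym (begin
          τ (form a u v)                                                   ≡⟨ ΣF-hom {n} τ τ-0 τ-+ _ ⟩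
          ΣF (λ i → τ (ΣF (λ j → u i *ᶠ (a i j *ᶠ τ (v j)))))              ≡⟨ ΣF-cong {n} (λ i → ΣF-hom {n} τ τ-0 τ-+ _) ⟩
          ΣF (λ i → ΣF (λ j → τ (u i *ᶠ (a i j *ᶠ τ (v j)))))              ≡⟨ ΣF-cong {n} (λ i → ΣF-cong {n} (λ j → term i j)) ⟩
          ΣF (λ i → ΣF (λ j → v j *ᶠ (b j i *ᶠ τ (u i))))                  ≡⟨ ΣF-swap {n} {n} _ ⟩
          form b v u                                                       ∎)
          where
          term : ∀ i j → τ (u i *ᶠ (a i j *ᶠ τ (v j))) ≡ v j *ᶠ (b j i *ᶠ τ (u i))
          term i j = trans (τ-* _ _) (trans (cong (τ (u i) *ᶠ_) (trans (τ-* _ _) (cong₂ _*ᶠ_ (sym (h i j)) (τ-τ (v j)))))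
            (solve 3 (λ x y z → x :* (y :* z) := z :* (y :* x)) refl (τ (u i)) (b j i) (v j)))

        -- Linearity in the second argument is reduced to the first through the conjugate transpose;
        -- the result is the Gram matrix of the two families.
        form-comb : ∀ {k n} (a : Matrix n) (M M′ : Fin k → Fun n) x y →
                    form a (D.comb F M x) (D.comb F M′ y) ≡ form (λ i j → form a (M i) (M′ j)) x y
        form-comb {k} a M M′ x y = trans (form-Σˡ a M x _) (ΣF-cong {k} (λ i → trans (cong (x i *ᶠ_) (right i)) (sym (ΣF-* {k} (x i) _))))
          where
          aᵗ : Matrix _
          aᵗ i j = τ (a j i)
          flip : ∀ u v → form a u v ≡ τ (form aᵗ v u)
          flip u v = form-conj aᵗ a (λ i j → sym (τ-τ (a j i))) v u
          right : ∀ i → form a (M i) (D.comb F M′ y) ≡ ΣF (λ j → form a (M i) (M′ j) *ᶠ τ (y j))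
          right i = trans (flip (M i) _) (trans (cong τ (form-Σˡ aᵗ M′ y (M i))) (trans (ΣF-hom {k} τ τ-0 τ-+ _)
            (ΣF-cong {k} (λ j → trans (τ-* (y j) _) (trans (*ᶠ-comm _ _) (cong (_*ᶠ τ (y j)) (sym (flip (M i) (M′ j)))))))))

    open module Bilinear = Sesquilinear (λ a → a) public
    open Bilinear.Conjugate refl (λ _ _ → refl) (λ _ _ → refl) (λ _ → refl) public

    form-∙ʳ : ∀ {n} (a : Matrix n) c u v → form a u (c ∙ v) ≡ c *ᶠ form a u v
    form-∙ʳ a c u v = trans (form-conj (λ i j → a j i) a (λ i j → refl) (c ∙ v) u) (trans (form-∙ˡ (λ i j → a j i) c v u)
      (cong (c *ᶠ_) (form-conj a (λ i j → a j i) (λ i j → refl) u v)))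

    form-∔ʳ : ∀ {n} (a : Matrix n) u v w → form a u (v ∔ w) ≡ form a u v +ᶠ form a u w
    form-∔ʳ a u v w = trans (form-conj (λ i j → a j i) a (λ i j → refl) (v ∔ w) u) (trans (form-∔ˡ (λ i j → a j i) v w u)
      (cong₂ _+ᶠ_ (form-conj a (λ i j → a j i) (λ i j → refl) u v) (form-conj a (λ i j → a j i) (λ i j → refl) u w)))

    form-neg : ∀ {n} (a : Matrix n) u v → form (λ i j → -ᶠ a i j) u v ≡ -ᶠ form a u v
    form-neg {n} a u v = trans (ΣF-cong {n} (λ i → trans (ΣF-cong {n} (λ j → solve 3 (λ x y z → x :* (:- y :* z) := (:- :1) :* (x :* (y :* z))) refl (u i) (a i j) (v j))) (ΣF-* {n} (-ᶠ 1ᶠ) _)))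
      (trans (ΣF-* {n} (-ᶠ 1ᶠ) _) (solve 1 (λ x → (:- :1) :* x := :- x) refl _))

    form-+ : ∀ {n} (a b : Matrix n) u v → form (λ i j → a i j +ᶠ b i j) u v ≡ form a u v +ᶠ form b u v
    form-+ {n} a b u v = trans (ΣF-cong {n} (λ i → trans (ΣF-cong {n} (λ j → solve 4 (λ x y y′ z → x :* ((y :+ y′) :* z) := x :* (y :* z) :+ x :* (y′ :* z)) refl (u i) (a i j) (b i j) (v j))) (ΣF-+ {n} (λ j → u i *ᶠ (a i j *ᶠ v j)) (λ j → u i *ᶠ (b i j *ᶠ v j))))) (ΣF-+ {n} _ _)

    -- The first row and the first column cancel, and the rest is a smaller alternating matrix. The
    -- vanishing diagonal is what makes this valid in characteristic 2.
    alternating-self : ∀ {n} (a : Matrix n) → (∀ i → a i i ≡ 0ᶠ) → (∀ i j → a j i ≡ -ᶠ a i j) → ∀ v → form a v v ≡ 0ᶠ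
    alternating-self {zero}  a h k v = refl
    alternating-self {suc n} a h k v = begin
      (v zero *ᶠ (a zero zero *ᶠ v zero) +ᶠ ΣF (λ j → v zero *ᶠ (a zero (suc j) *ᶠ v (suc j)))) +ᶠ ΣF (λ i → v (suc i) *ᶠ (a (suc i) zero *ᶠ v zero) +ᶠ ΣF (λ j → v (suc i) *ᶠ (a (suc i) (suc j) *ᶠ v (suc j))))
        ≡⟨ cong₂ (λ s t → (v zero *ᶠ (s *ᶠ v zero) +ᶠ R) +ᶠ t) (h zero) (ΣF-+ {n} (λ i → v (suc i) *ᶠ (a (suc i) zero *ᶠ v zero)) (λ i → ΣF (λ j → v (suc i) *ᶠ (a (suc i) (suc j) *ᶠ v (suc j))))) ⟩
      (v zero *ᶠ (0ᶠ *ᶠ v zero) +ᶠ R) +ᶠ (ΣF (λ i → v (suc i) *ᶠ (a (suc i) zero *ᶠ v zero)) +ᶠ form (λ i j → a (suc i) (suc j)) (λ i → v (suc i)) (λ i → v (suc i)))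
        ≡⟨ cong₂ (λ s t → (v zero *ᶠ (0ᶠ *ᶠ v zero) +ᶠ R) +ᶠ (s +ᶠ t)) column (alternating-self (λ i j → a (suc i) (suc j)) (λ i → h (suc i)) (λ i j → k (suc i) (suc j)) (λ i → v (suc i))) ⟩
      (v zero *ᶠ (0ᶠ *ᶠ v zero) +ᶠ R) +ᶠ (-ᶠ R +ᶠ 0ᶠ)
        ≡⟨ solve 2 (λ x r → (x :* (:0 :* x) :+ r) :+ (:- r :+ :0) := :0) refl (v zero) R ⟩
      0ᶠ ∎
      where
      R : 𝔽
      R = ΣF (λ j → v zero *ᶠ (a zero (suc j) *ᶠ v (suc j)))
      column : ΣF (λ i → v (suc i) *ᶠ (a (suc i) zero *ᶠ v zero)) ≡ -ᶠ R
      column = trans (ΣF-cong {n} (λ i → trans (cong (λ t → v (suc i) *ᶠ (t *ᶠ v zero)) (k zero (suc i)))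
        (solve 3 (λ x y z → x :* (:- y :* z) := (:- :1) :* (z :* (y :* x))) refl (v (suc i)) (a zero (suc i)) (v zero))))
        (trans (ΣF-* {n} (-ᶠ 1ᶠ) (λ j → v zero *ᶠ (a zero (suc j) *ᶠ v (suc j)))) (solve 1 (λ x → (:- :1) :* x := :- x) refl R))

    quadVal : ∀ {n} → Matrix n → Fun n → 𝔽
    quadVal = D.quadVal F

    quadVal-form : ∀ {n} (c : Matrix n) v → quadVal c v ≡ form c v v
    quadVal-form {n} c v = ΣF-cong {n} (λ i → ΣF-cong {n} (λ j → solve 3 (λ c x y → c :* (x :* y) := x :* (c :* y)) refl (c i j) (v i) (v j)))

    quadVal-cong : ∀ {n} (c : Matrix n) {u v} → (∀ i → u i ≡ v i) → quadVal c u ≡ quadVal c v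
    quadVal-cong {n} c h = ΣF-cong {n} (λ i → ΣF-cong {n} (λ j → cong (c i j *ᶠ_) (cong₂ _*ᶠ_ (h i) (h j))))

    quadVal-∙ : ∀ {n} (c : Matrix n) t v → quadVal c (t ∙ v) ≡ t *ᶠ t *ᶠ quadVal c v
    quadVal-∙ c t v = trans (quadVal-form c (t ∙ v)) (trans (form-∙ˡ c t v (t ∙ v)) (trans (cong (t *ᶠ_) (form-∙ʳ c t v v))
      (trans (sym (*ᶠ-assoc t t _)) (cong (t *ᶠ t *ᶠ_) (sym (quadVal-form c v))))))

    quadVal-comb : ∀ {k n} (c : Matrix n) (M : Fin k → Fun n) x → quadVal c (D.comb F M x) ≡ quadVal (λ i j → form c (M i) (M j)) x
    quadVal-comb c M x = trans (quadVal-form c _) (trans (form-comb c M M x x) (sym (quadVal-form _ x)))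

    symmetrise : ∀ {n} → Matrix n → Matrix n
    symmetrise c i j = c i j +ᶠ c j i

    bil-quadratic : ∀ {n} (c : Matrix n) u v → D.bil F D.quadratic c u v ≡ form (symmetrise c) u v
    bil-quadratic c u v = begin
      quadVal c (u ∔ v) +ᶠ (-ᶠ quadVal c u +ᶠ -ᶠ quadVal c v)
        ≡⟨ cong₂ _+ᶠ_ (trans (quadVal-form c (u ∔ v)) (trans (form-∔ˡ c u v _) (cong₂ _+ᶠ_ (form-∔ʳ c u u v) (form-∔ʳ c v u v))))
             (cong₂ (λ s t → -ᶠ s +ᶠ -ᶠ t) (quadVal-form c u) (quadVal-form c v)) ⟩
      ((form c u u +ᶠ form c u v) +ᶠ (form c v u +ᶠ form c v v)) +ᶠ (-ᶠ form c u u +ᶠ -ᶠ form c v v)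
        ≡⟨ solve 4 (λ a b c d → ((a :+ b) :+ (c :+ d)) :+ (:- a :+ :- d) := b :+ c) refl (form c u u) (form c u v) (form c v u) (form c v v) ⟩
      form c u v +ᶠ form c v u
        ≡⟨ cong (form c u v +ᶠ_) (form-conj (λ i j → c j i) c (λ i j → refl) u v) ⟩
      form c u v +ᶠ form (λ i j → c j i) u v
        ≡⟨ sym (form-+ c _ u v) ⟩
      form (symmetrise c) u v ∎

    polarisation : ∀ {n} (c : Matrix n) u v → quadVal c (u ∔ v) ≡ quadVal c u +ᶠ quadVal c v +ᶠ D.bil F D.quadratic c u v
    polarisation c u v = solve 3 (λ a b x → x := a :+ b :+ (x :+ (:- a :+ :- b))) refl (quadVal c u) (quadVal c v) (quadVal c (u ∔ v))

-- Coordinate vectors, spans and bases.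

module CoordinateSpaces where

  open import Defs using (FiniteField)
  import Defs as D
  open import Data.Nat as ℕ using (ℕ; zero; suc)
  import Data.Nat.Properties as ℕP
  open import Data.Rational using (1ℚ; _<_; _≤_; _+_; _*_)
  open import Data.Rational.Properties using (*-identityʳ; *-identityˡ; *-comm; ≤-reflexive; ≤-trans; <-≤-trans; <⇒≤)
  open import Data.Fin using (Fin; zero; suc)
  open import Data.List using (List; []; _∷_; cartesianProductWith)
  import Data.List.Membership.Propositional.Properties as ∈P
  import Data.List.Membership.Propositional as ∈L
  open import Data.List.Relation.Unary.Any using (here)
  open import Data.List.Relation.Unary.All using ([])
  open import Data.List.Relation.Unary.AllPairs using ([]; _∷_)
  open import Data.List.Relation.Unary.Unique.Propositional using (Unique)
  import Data.List.Relation.Unary.Unique.Propositional.Properties as UP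
  open import Data.Vec as Vec using (Vec; []; _∷_; lookup; tabulate; zipWith; replicate)
  open import Data.Vec.Properties using (≡-dec; lookup∘tabulate; tabulate∘lookup; tabulate-cong; lookup-zipWith; lookup-map; lookup-replicate; ∷-injective)
  open import Data.Vec.Functional as VF using ()
  open import Data.Product using (∃; _×_; _,_)
  open import Data.Empty using (⊥-elim)
  open import Relation.Nullary using (yes; no)
  open import Relation.Binary.PropositionalEquality hiding ([_])
  open Numbers
  open LinearAlgebra
  open SesquilinearForms

  module Coordinates (F : FiniteField) (N : ℕ) where
    open Forms F using (ΣF; ΣF-cong; ΣF-*; ΣF-+; ΣF-*ʳ; ΣF-0; ΣF-swap; Fun)

    private
      module Fd = Field F
      open Fd using (𝔽; _+ᶠ_; _*ᶠ_; -ᶠ_; 0ᶠ; 1ᶠ; *ᶠ-zeroˡ; *ᶠ-identityˡ; *ᶠ-comm; +ᶠ-comm; +ᶠ-identityˡ; +ᶠ-identityʳ)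
      module FS = Fd.FS

      cons : ∀ {n} → 𝔽 → Vec 𝔽 n → Vec 𝔽 (suc n)
      cons = _∷_

    enum : ∀ n → List (Vec 𝔽 n)
    enum zero    = [] ∷ []
    enum (suc n) = cartesianProductWith cons (FiniteField.elems F) (enum n)

    enum-complete : ∀ {n} (v : Vec 𝔽 n) → v ∈L.∈ enum n
    enum-complete []      = here refl
    enum-complete (x ∷ v) = ∈P.∈-cartesianProductWith⁺ cons (FiniteField.complete F x) (enum-complete v)

    enum-unique : ∀ n → Unique (enum n)
    enum-unique zero    = [] ∷ []
    enum-unique (suc n) = UP.cartesianProductWith⁺ cons ∷-injective (FiniteField.unique F) (enum-unique n)

    private
      zip-assoc : ∀ {n} (u v w : Vec 𝔽 n) → zipWith _+ᶠ_ (zipWith _+ᶠ_ u v) w ≡ zipWith _+ᶠ_ u (zipWith _+ᶠ_ v w)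
      zip-assoc []      []      []      = refl
      zip-assoc (a ∷ u) (b ∷ v) (c ∷ w) = cong₂ _∷_ (FS.solve 3 (λ a b c → (a FS.:+ b) FS.:+ c FS.:= a FS.:+ (b FS.:+ c)) refl a b c) (zip-assoc u v w)

      zip-comm : ∀ {n} (u v : Vec 𝔽 n) → zipWith _+ᶠ_ u v ≡ zipWith _+ᶠ_ v u
      zip-comm []      []      = refl
      zip-comm (a ∷ u) (b ∷ v) = cong₂ _∷_ (+ᶠ-comm a b) (zip-comm u v)

      zip-0 : ∀ {n} (v : Vec 𝔽 n) → zipWith _+ᶠ_ (replicate n 0ᶠ) v ≡ v
      zip-0 []      = refl
      zip-0 (a ∷ v) = cong₂ _∷_ (+ᶠ-identityˡ a) (zip-0 v)

      map-zip : ∀ {n} c (u v : Vec 𝔽 n) → Vec.map (c *ᶠ_) (zipWith _+ᶠ_ u v) ≡ zipWith _+ᶠ_ (Vec.map (c *ᶠ_) u) (Vec.map (c *ᶠ_) v)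
      map-zip c []      []      = refl
      map-zip c (a ∷ u) (b ∷ v) = cong₂ _∷_ (FS.solve 3 (λ c a b → c FS.:* (a FS.:+ b) FS.:= c FS.:* a FS.:+ c FS.:* b) refl c a b) (map-zip c u v)

      map-+ : ∀ {n} a b (v : Vec 𝔽 n) → Vec.map ((a +ᶠ b) *ᶠ_) v ≡ zipWith _+ᶠ_ (Vec.map (a *ᶠ_) v) (Vec.map (b *ᶠ_) v)
      map-+ a b []      = refl
      map-+ a b (c ∷ v) = cong₂ _∷_ (FS.solve 3 (λ a b c → (a FS.:+ b) FS.:* c FS.:= a FS.:* c FS.:+ b FS.:* c) refl a b c) (map-+ a b v)

      map-* : ∀ {n} a b (v : Vec 𝔽 n) → Vec.map ((a *ᶠ b) *ᶠ_) v ≡ Vec.map (a *ᶠ_) (Vec.map (b *ᶠ_) v)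
      map-* a b []      = refl
      map-* a b (c ∷ v) = cong₂ _∷_ (FS.solve 3 (λ a b c → (a FS.:* b) FS.:* c FS.:= a FS.:* (b FS.:* c)) refl a b c) (map-* a b v)

      map-1 : ∀ {n} (v : Vec 𝔽 n) → Vec.map (1ᶠ *ᶠ_) v ≡ v
      map-1 []      = refl
      map-1 (c ∷ v) = cong₂ _∷_ (*ᶠ-identityˡ c) (map-1 v)

      map-0 : ∀ {n} (v : Vec 𝔽 n) → Vec.map (0ᶠ *ᶠ_) v ≡ replicate n 0ᶠ
      map-0 []      = refl
      map-0 (c ∷ v) = cong₂ _∷_ (*ᶠ-zeroˡ c) (map-0 v)

    space : Space F
    space = record
      { vectors = record { Carrier = Vec 𝔽 N ; _≟_ = ≡-dec Fd._≟ᶠ_ ; elems = enum N ; complete = enum-complete ; unique = enum-unique N }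
      ; _⊕_ = zipWith _+ᶠ_ ; 0ᵛ = replicate N 0ᶠ ; _·_ = λ c → Vec.map (c *ᶠ_)
      ; ⊕-assoc = zip-assoc ; ⊕-comm = zip-comm ; ⊕-identityˡ = zip-0
      ; ·-⊕ = map-zip ; +-· = map-+ ; *-· = map-* ; 1-· = map-1 ; 0-· = map-0 }

    open Subspaces space hiding (𝔽; _+ᶠ_; _*ᶠ_; -ᶠ_; 0ᶠ; 1ᶠ; *ᶠ-zeroˡ; *ᶠ-identityˡ; *ᶠ-comm; +ᶠ-comm; +ᶠ-identityˡ; +ᶠ-identityʳ; module FS)

    lookup-⊕ : ∀ u v i → lookup (u ⊕ v) i ≡ lookup u i +ᶠ lookup v i
    lookup-⊕ u v i = lookup-zipWith _+ᶠ_ i u v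

    lookup-· : ∀ c v i → lookup (c · v) i ≡ c *ᶠ lookup v i
    lookup-· c v i = lookup-map i (c *ᶠ_) v

    lookup-0 : ∀ i → lookup 0ᵛ i ≡ 0ᶠ
    lookup-0 i = lookup-replicate i 0ᶠ

    ext : ∀ {u v : V} → (∀ i → lookup u i ≡ lookup v i) → u ≡ v
    ext {u} {v} h = trans (sym (tabulate∘lookup u)) (trans (tabulate-cong h) (tabulate∘lookup v))

    ∣V∣ : ⌈ (λ _ → true) ⌉ ≡ q ^^ N
    ∣V∣ = go N
      where
      go : ∀ n → ∑ᴸ (enum n) (λ _ → 1ℚ) ≡ q ^^ n
      go zero    = refl
      go (suc n) = trans (product (FiniteField.elems F)) (cong₂ _*_ (trans (∑ᴸ-len (FiniteField.elems F)) (sym q-def)) (go n))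
        where
        open import Data.Rational.Properties using (*-zeroˡ; *-distribʳ-+)
        product : ∀ xs → ∑ᴸ (cartesianProductWith cons xs (enum n)) (λ _ → 1ℚ) ≡ ∑ᴸ xs (λ _ → 1ℚ) * ∑ᴸ (enum n) (λ _ → 1ℚ)
        product []       = sym (*-zeroˡ (∑ᴸ (enum n) (λ _ → 1ℚ)))
        product (x ∷ xs) = trans (∑ᴸ-++ (Data.List.map (cons x) (enum n)) _ (λ _ → 1ℚ)) (trans (cong₂ _+_ (trans (∑ᴸ-map (cons x) (enum n) (λ _ → 1ℚ)) (sym (*-identityˡ _))) (product xs))
          (sym (*-distribʳ-+ (∑ᴸ (enum n) (λ _ → 1ℚ)) 1ℚ (∑ᴸ xs (λ _ → 1ℚ)))))

    -- Spans of families of coordinate functions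

    Family : ℕ → Set
    Family k = Fin k → Fun N

    comb : ∀ {k} → Family k → Fun k → Fun N
    comb = D.comb F

    span : ∀ {k} → Family k → V → Bool
    span {zero}  M = ⟨ 0ᵛ ⟩
    span {suc k} M = span (λ i → M (suc i)) ⊞ ⟨ tabulate (M zero) ⟩

    span-sub : ∀ {k} (M : Family k) → Sub (span M)
    span-sub {zero}  M = ⟨⟩-sub 0ᵛ
    span-sub {suc k} M = ⊞-sub (span-sub (λ i → M (suc i))) (⟨⟩-sub (tabulate (M zero)))

    span-intro : ∀ {k} (M : Family k) c {v} → (∀ j → lookup v j ≡ comb M c j) → v ∈ span M
    span-intro {zero}  M c h = subst (_∈ ⟨ 0ᵛ ⟩) (ext (λ i → trans (lookup-0 i) (sym (h i)))) ⟨⟩-self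
    span-intro {suc k} M c {v} h = subst (_∈ span M)
      (ext {tabulate (comb M′ c′) ⊕ c zero · tabulate (M zero)} (λ j → trans (lookup-⊕ (tabulate (comb M′ c′)) (c zero · tabulate (M zero)) j) (trans (cong₂ _+ᶠ_ (lookup∘tabulate (comb M′ c′) j)
        (trans (lookup-· (c zero) (tabulate (M zero)) j) (cong (c zero *ᶠ_) (lookup∘tabulate _ j)))) (trans (+ᶠ-comm (comb M′ c′ j) (c zero *ᶠ M zero j)) (sym (h j))))))
      (⊞⟨⟩-intro (c zero) (span-intro M′ c′ (λ j → lookup∘tabulate (comb M′ c′) j)))
      where
      M′ = λ i → M (suc i)
      c′ = λ i → c (suc i)

    span-elim : ∀ {k} (M : Family k) {v} → v ∈ span M → ∃ λ c → ∀ j → lookup v j ≡ comb M c j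
    span-elim {zero}  M h = (λ ()) , λ j → trans (cong (λ v → lookup v j) (let c , e = ⟨⟩-elim h in trans e (·-0ᵛ c))) (lookup-0 j)
    span-elim {suc k} M {v} h with ⊞⟨⟩-elim h
    ... | u , c , hu , refl with span-elim (λ i → M (suc i)) hu
    ...   | c′ , e = (c VF.∷ c′) , λ j → trans (lookup-⊕ u (c · tabulate (M zero)) j) (trans (cong₂ _+ᶠ_ (e j)
        (trans (lookup-· c (tabulate (M zero)) j) (cong (c *ᶠ_) (lookup∘tabulate _ j)))) (+ᶠ-comm _ _))

    span-⊆ : ∀ {k} (M : Family k) {X} → Sub X → (∀ i → tabulate (M i) ∈ X) → span M ⊆ X
    span-⊆ {zero}  M s h = ⟨⟩-⊆ s (has-0 s)
    span-⊆ {suc k} M s h = ⊞-⊆ s (span-⊆ (λ i → M (suc i)) s (λ i → h (suc i))) (⟨⟩-⊆ s (h zero))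

    span-self : ∀ {k} (M : Family k) i → tabulate (M i) ∈ span M
    span-self M zero    = ⊞-⊆ʳ (span-sub (λ i → M (suc i))) (tabulate (M zero)) ⟨⟩-self
    span-self M (suc i) = ⊞-⊆ˡ (⟨⟩-sub (tabulate (M zero))) (tabulate (M (suc i))) (span-self (λ i → M (suc i)) i)

    Independent : ∀ {k} → Family k → Set
    Independent = D.Independent F

    comb-tail : ∀ {k} (M : Family (suc k)) (c : Fun k) j → comb M (0ᶠ VF.∷ c) j ≡ comb (λ i → M (suc i)) c j
    comb-tail M c j = trans (cong (_+ᶠ comb (λ i → M (suc i)) c j) (*ᶠ-zeroˡ (M zero j))) (+ᶠ-identityˡ _)

    independent-tail : ∀ {k} {M : Family (suc k)} → Independent M → Independent (λ i → M (suc i))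
    independent-tail {k} {M} ind c h i = ind (0ᶠ VF.∷ c) (λ j → trans (comb-tail M c j) (h j)) (suc i)

    independent-head : ∀ {k} {M : Family (suc k)} → Independent M → tabulate (M zero) ∉ span (λ i → M (suc i))
    independent-head {k} {M} ind h with span-elim (λ i → M (suc i)) h
    ... | c , e = neg≢0 1≢0 (ind ((-ᶠ 1ᶠ) VF.∷ c) (λ j → trans (cong (-ᶠ 1ᶠ *ᶠ M zero j +ᶠ_) (trans (sym (e j)) (lookup∘tabulate (M zero) j)))
        (FS.solve 1 (λ m → (FS.:- FS.:1) FS.:* m FS.:+ m FS.:= FS.:0) refl (M zero j))) zero)

    ∣span∣ : ∀ {k} (M : Family k) → Independent M → ⌈ span M ⌉ ≡ q ^^ k
    ∣span∣ {zero}  M ind = ∣∣-unique _ 0ᵛ ⟨⟩-self (λ v h → let c , e = ⟨⟩-elim h in trans e (·-0ᵛ c))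
    ∣span∣ {suc k} M ind = trans (adjoin (span-sub (λ i → M (suc i))) (independent-head {M = M} ind)) (cong (q *_) (∣span∣ (λ i → M (suc i)) (independent-tail {M = M} ind)))

    independent-cons : ∀ {k} {M : Family k} {v} → Independent M → v ∉ span M → Independent (lookup v VF.∷ M)
    independent-cons {k} {M} {v} ind n c h = λ { zero → c₀ ; (suc i) → ind (λ i → c (suc i)) (λ j → trans (sym (trans (cong (λ t → t *ᶠ lookup v j +ᶠ comb M (λ i → c (suc i)) j) c₀)
        (trans (cong (_+ᶠ comb M (λ i → c (suc i)) j) (*ᶠ-zeroˡ _)) (+ᶠ-identityˡ _)))) (h j)) i }
      where
      c₀ : c zero ≡ 0ᶠ
      c₀ with c zero Fd.≟ᶠ 0ᶠ
      ... | yes e = e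
      ... | no nz = ⊥-elim (n (cancel-· (span-sub M) (neg≢0 nz) (span-intro M (λ i → c (suc i)) (λ j → trans (lookup-· (-ᶠ c zero) v j)
        (trans (FS.solve 3 (λ c v m → FS.:- c FS.:* v FS.:= m FS.:- (c FS.:* v FS.:+ m)) refl (c zero) (lookup v j) (comb M (λ i → c (suc i)) j))
          (trans (cong (λ t → comb M (λ i → c (suc i)) j +ᶠ -ᶠ t) (h j)) (FS.solve 1 (λ m → m FS.:- FS.:0 FS.:= m) refl _)))))))

    opaque
      -- A greedy construction: an independent family of j < k vectors inside X spans only q^j
      -- vectors, so X contains one outside its span.
      basis : ∀ k {X} → Sub X → ⌈ X ⌉ ≡ q ^^ k → ∃ λ (M : Family k) → Independent M × (∀ v → span M v ≡ X v)
      basis k {X} s z = let M , ind , incl = grow k ℕP.≤-refl in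
        M , ind , λ v → bool-ext (incl v) (⊆-full incl (≤-reflexive (trans z (sym (∣span∣ M ind)))) v)
        where
        grow : ∀ j → j ℕ.≤ k → ∃ λ (M : Family j) → Independent M × span M ⊆ X
        grow zero le = (λ ()) , (λ c h ()) , ⟨⟩-⊆ s (has-0 s)
        grow (suc j) le = let M , ind , incl = grow j (ℕP.<⇒≤ le)
                              v , hv , n = outside {X} {span M} (subst₂ _<_ (sym (∣span∣ M ind)) (sym z) (power le)) in
          (lookup v VF.∷ M) , independent-cons ind n , span-⊆ (lookup v VF.∷ M) s
            (λ { zero → subst (_∈ X) (sym (tabulate∘lookup v)) hv ; (suc i) → incl _ (span-self M i) })
          where
          power : ∀ {j k} → j ℕ.< k → q ^^ j < q ^^ k
          power {j} {k} lt with ℕP.m≤n⇒∃[o]m+o≡n lt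
          ... | o , refl = <-≤-trans (subst₂ _<_ (*-identityʳ (q ^^ j)) (*-comm (q ^^ j) q) (Data.Rational.Properties.*-monoʳ-<-pos (q ^^ j) {{Data.Rational.positive (^^>0 j 0<q)}} 1<q))
            (subst (q * q ^^ j ≤_) (sym (trans (cong (q *_) (^^-+ q j o)) (sym (Data.Rational.Properties.*-assoc q (q ^^ j) (q ^^ o)))))
              (≤-trans (≤-reflexive (sym (*-identityʳ (q * q ^^ j)))) (mul≤ (q * q ^^ j) (<⇒≤ (mul>0 0<q (^^>0 j 0<q))) (1≤ o))))
            where
            1≤ : ∀ n → 1ℚ ≤ q ^^ n
            1≤ zero    = Data.Rational.Properties.≤-refl
            1≤ (suc n) = ≤-trans (1≤ n) (≤-trans (≤-reflexive (sym (*-identityˡ (q ^^ n)))) (subst₂ _≤_ (*-comm (q ^^ n) 1ℚ) (*-comm (q ^^ n) q) (mul≤ (q ^^ n) (<⇒≤ (^^>0 n 0<q)) (<⇒≤ 1<q))))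

    comb-comb : ∀ {k n} (M : Fin n → Fun N) (G : Fin k → Fun n) c j → comb M (D.comb F G c) j ≡ comb (λ i → comb M (G i)) c j
    comb-comb {k} {n} M G c j = trans (ΣF-cong {n} (λ i → trans (sym (ΣF-*ʳ {k} (M i j) (λ l → c l *ᶠ G l i))) (ΣF-cong {k} (λ l → Fd.*ᶠ-assoc (c l) (G l i) (M i j)))))
      (trans (ΣF-swap {n} {k} _) (ΣF-cong {k} (λ l → ΣF-* {n} (c l) (λ i → G l i *ᶠ M i j))))

    comb-cong : ∀ {k} {M M′ : Family k} {c c′ : Fun k} → (∀ i j → M i j ≡ M′ i j) → (∀ i → c i ≡ c′ i) → ∀ j → comb M c j ≡ comb M′ c′ j
    comb-cong {k} h e j = ΣF-cong {k} (λ i → cong₂ _*ᶠ_ (e i) (h i j))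

-- The three kinds of forms, and the number of singular vectors on a line.

module ClassicalForms where

  open import Defs using (FiniteField)
  import Defs as D
  open import Data.Nat as ℕ using (ℕ; zero; suc)
  open import Data.Rational using (ℚ; 0ℚ; 1ℚ; _<_; _≤_; _+_; _*_; _-_; -_)
  open import Data.Rational.Properties using (*-identityʳ; ≤-reflexive; ≤-trans; <-≤-trans)
  open import Data.Fin using (Fin; zero; suc)
  open import Data.Product using (∃; _×_; _,_; proj₁; proj₂)
  open import Data.Sum using (inj₁; inj₂)
  open import Data.Empty using (⊥-elim)
  open import Relation.Nullary using (Dec; does)
  open import Relation.Binary.PropositionalEquality hiding ([_])
  open Numbers
  open LinearAlgebra
  open SesquilinearForms

  module FormFact (F : FiniteField) where
    open Forms F public
    open FS using (solve; _:=_; _:+_; _:*_; :-_; _:-_; :0; :1)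

    -- A common interface on coordinate functions, where equality is pointwise; hence the congruence
    -- fields. For quadratic forms total singularity speaks of Q only, for the others of the form
    -- only, and the `ts` fields pass between the two.
    record FormFacts {n} (fk : D.FormKind) (f : D.Form F fk n) : Set where
      bil : Fun n → Fun n → 𝔽
      bil = D.bil F fk f
      Sg : Fun n → Set
      Sg = D.Singular F fk f
      field
        bil-cong : ∀ {u u′ v v′} → (∀ i → u i ≡ u′ i) → (∀ i → v i ≡ v′ i) → bil u v ≡ bil u′ v′
        bil-∔    : ∀ u v w → bil (u ∔ v) w ≡ bil u w +ᶠ bil v w
        bil-∙    : ∀ c u w → bil (c ∙ u) w ≡ c *ᶠ bil u w
        bil-refl : ∀ {u v} → bil u v ≡ 0ᶠ → bil v u ≡ 0ᶠ
        Sg?      : ∀ v → Dec (Sg v)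
        Sg-cong  : ∀ {u v} → (∀ i → u i ≡ v i) → Sg u → Sg v
        Sg-∙     : ∀ c {v} → Sg v → Sg (c ∙ v)
        Sg-∔     : ∀ {u v} → Sg u → Sg v → bil u v ≡ 0ᶠ → Sg (u ∔ v)
        Sg-bil   : ∀ {v} → Sg v → bil v v ≡ 0ᶠ
        s        : ℚ
        s-line   : ∀ {y P} → Sg P → bil y P ≢ 0ᶠ → ∑ᶠ (λ c → [ does (Sg? (y ∔ c ∙ P)) ]) ≡ s
        ts-bil   : ∀ {k} {M : Fin k → Fun n} → D.TotallySingular F fk f M → ∀ x y → bil (D.comb F M x) (D.comb F M y) ≡ 0ᶠ
        ts-Sg    : ∀ {k} {M : Fin k → Fun n} → D.TotallySingular F fk f M → ∀ x → Sg (D.comb F M x)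
        ts-intro : ∀ {k} {M : Fin k → Fun n} → (∀ x → Sg (D.comb F M x)) → (∀ x y → bil (D.comb F M x) (D.comb F M y) ≡ 0ᶠ) → D.TotallySingular F fk f M

    comb-∔ : ∀ {k n} (M : Fin k → Fun n) x y j → D.comb F M (x ∔ y) j ≡ D.comb F M x j +ᶠ D.comb F M y j
    comb-∔ {k} M x y j = trans (ΣF-cong {k} (λ i → solve 3 (λ a b c → (a :+ b) :* c := a :* c :+ b :* c) refl (x i) (y i) (M i j))) (ΣF-+ {k} (λ i → x i *ᶠ M i j) (λ i → y i *ᶠ M i j))

    quadratic-facts : ∀ {n} (c : Matrix n) → FormFacts {n} D.quadratic c
    quadratic-facts {n} c = record
      { bil-cong = λ {u} {u′} {v} {v′} h k → trans (bil-quadratic c u v) (trans (form-cong (λ i j → refl) h k) (sym (bil-quadratic c u′ v′)))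
      ; bil-∔ = λ u v w → trans (bil-quadratic c (u ∔ v) w) (trans (form-∔ˡ (symmetrise c) u v w) (sym (cong₂ _+ᶠ_ (bil-quadratic c u w) (bil-quadratic c v w))))
      ; bil-∙ = λ t u w → trans (bil-quadratic c (t ∙ u) w) (trans (form-∙ˡ (symmetrise c) t u w) (cong (t *ᶠ_) (sym (bil-quadratic c u w))))
      ; bil-refl = λ {u} {v} h → trans (bil-sym u v) h
      ; Sg? = λ v → quadVal c v ≟ᶠ 0ᶠ
      ; Sg-cong = λ h e → trans (sym (quadVal-cong c h)) e
      ; Sg-∙ = λ t {v} h → trans (quadVal-∙ c t v) (trans (cong (t *ᶠ t *ᶠ_) h) (*ᶠ-zeroʳ _))
      ; Sg-∔ = λ {u} {v} h k o → trans (polarisation c u v) (trans (cong₂ _+ᶠ_ (cong₂ _+ᶠ_ h k) o) (solve 0 (:0 :+ :0 :+ :0 := :0) refl))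
      ; Sg-bil = λ {v} h → trans (bil-self v) (trans (cong₂ _+ᶠ_ h h) (+ᶠ-identityʳ 0ᶠ))
      ; s = 1ℚ
      ; s-line = λ {y} {P} h n → trans (ΣF.∑-cong (λ t → cong (λ a → [ a ΣF.== 0ᶠ ]) (on-line y P h t))) (one-root (quadVal c y) (b y P) n)
      ; ts-bil = λ {k} {M} h x y → trans (solve 3 (λ s t u → s :+ (:- t :+ :- u) := s :- t :- u) refl (quadVal c (D.comb F M x ∔ D.comb F M y)) (quadVal c (D.comb F M x)) (quadVal c (D.comb F M y)))
          (trans (cong₂ _+ᶠ_ (cong₂ (λ s t → s +ᶠ -ᶠ t) (trans (sym (quadVal-cong c (comb-∔ M x y))) (h (x ∔ y))) (h x)) (cong -ᶠ_ (h y))) (solve 0 (:0 :- :0 :- :0 := :0) refl))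
      ; ts-Sg = λ h → h
      ; ts-intro = λ h _ → h
      }
      where
      b : Fun n → Fun n → 𝔽
      b = D.bil F D.quadratic c
      bil-sym : ∀ u v → b v u ≡ b u v
      bil-sym u v = cong₂ _+ᶠ_ (quadVal-cong c (λ i → +ᶠ-comm (v i) (u i))) (+ᶠ-comm _ _)
      bil-self : ∀ v → b v v ≡ quadVal c v +ᶠ quadVal c v
      bil-self v = trans (cong (_+ᶠ (-ᶠ quadVal c v +ᶠ -ᶠ quadVal c v)) (trans (quadVal-cong c (λ i → solve 1 (λ x → x :+ x := (:1 :+ :1) :* x) refl (v i))) (quadVal-∙ c (1ᶠ +ᶠ 1ᶠ) v)))
        (solve 1 (λ q → (:1 :+ :1) :* (:1 :+ :1) :* q :+ (:- q :+ :- q) := q :+ q) refl (quadVal c v))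
      on-line : ∀ y P → quadVal c P ≡ 0ᶠ → ∀ t → quadVal c (y ∔ t ∙ P) ≡ quadVal c y +ᶠ t *ᶠ b y P
      on-line y P h t = trans (polarisation c y (t ∙ P)) (trans (cong₂ (λ p r → quadVal c y +ᶠ p +ᶠ r) (trans (quadVal-∙ c t P) (trans (cong (t *ᶠ t *ᶠ_) h) (*ᶠ-zeroʳ _)))
        (trans (bil-quadratic c y (t ∙ P)) (trans (form-∙ʳ (symmetrise c) t y P) (cong (t *ᶠ_) (sym (bil-quadratic c y P))))))
        (cong (_+ᶠ t *ᶠ b y P) (+ᶠ-identityʳ (quadVal c y))))

    alternating-facts : ∀ {n} (f : D.Form F D.alternating n) → FormFacts {n} D.alternating f
    alternating-facts {n} (a , h , k) = record
      { bil-cong = form-cong (λ i j → refl)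
      ; bil-∔ = form-∔ˡ a
      ; bil-∙ = form-∙ˡ a
      ; bil-refl = λ {u} {v} e → trans (anti u v) (trans (cong -ᶠ_ e) (solve 0 (:- :0 := :0) refl))
      ; Sg? = λ v → form a v v ≟ᶠ 0ᶠ
      ; Sg-cong = λ _ _ → alternating-self a h k _
      ; Sg-∙ = λ _ _ → alternating-self a h k _
      ; Sg-∔ = λ _ _ _ → alternating-self a h k _
      ; Sg-bil = λ e → e
      ; s = q
      ; s-line = λ {y} {P} _ _ → trans (ΣF.∑-cong (λ c → cong [_] (does-true (form a (y ∔ c ∙ P) (y ∔ c ∙ P) ≟ᶠ 0ᶠ) (alternating-self a h k _)))) (trans (∑ᶠ-const 1ℚ) (*-identityʳ q))
      ; ts-bil = λ e → e
      ; ts-Sg = λ _ _ → alternating-self a h k _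
      ; ts-intro = λ _ e → e
      }
      where
      anti : ∀ u v → form a v u ≡ -ᶠ form a u v
      anti u v = trans (form-conj (λ i j → a j i) a (λ i j → refl) u v) (trans (form-cong (λ i j → k i j) (λ _ → refl) (λ _ → refl)) (form-neg a u v))

    -- The trace c + σ c has fibres of size r over the fixed field: it is onto the fixed field, and its kernel is θ times
    -- the fixed field for any θ ≠ 0 with σ θ = - θ.
    module Trace (I : D.Involution F) (r : ℕ) (r²≡q : r ℕ.* r ≡ FiniteField.q F) where
      open D.Involution I public

      σ-0 : σ 0ᶠ ≡ 0ᶠ
      σ-0 = trans (solve 1 (λ a → a := (a :+ a) :- a) refl (σ 0ᶠ)) (trans (cong (λ t → t +ᶠ -ᶠ σ 0ᶠ) (trans (sym (σ-+ 0ᶠ 0ᶠ)) (cong σ (+ᶠ-identityʳ 0ᶠ)))) (-ᶠ-inverseʳ (σ 0ᶠ)))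

      σ-1 : σ 1ᶠ ≡ 1ᶠ
      σ-1 = trans (sym (*ᶠ-identityˡ _)) (trans (cong (_*ᶠ σ 1ᶠ) (sym (σ-σ 1ᶠ))) (trans (sym (σ-* (σ 1ᶠ) 1ᶠ)) (trans (cong σ (*ᶠ-identityʳ (σ 1ᶠ))) (σ-σ 1ᶠ))))

      σ-neg : ∀ a → σ (-ᶠ a) ≡ -ᶠ σ a
      σ-neg a = trans (solve 2 (λ a b → b := :- a :+ (a :+ b)) refl (σ a) (σ (-ᶠ a))) (trans (cong (-ᶠ σ a +ᶠ_) (trans (sym (σ-+ a (-ᶠ a))) (trans (cong σ (-ᶠ-inverseʳ a)) σ-0))) (+ᶠ-identityʳ _))

      fix : 𝔽 → Bool
      fix k = σ k ΣF.== k

      fibre : 𝔽 → 𝔽 → Bool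
      fibre k c = (c +ᶠ σ c) ΣF.== k

      a₀ : 𝔽
      a₀ = proj₁ σ-nontriv

      trace-fixed : ∀ c → σ (c +ᶠ σ c) ≡ c +ᶠ σ c
      trace-fixed c = trans (σ-+ c (σ c)) (trans (cong (σ c +ᶠ_) (σ-σ c)) (+ᶠ-comm (σ c) c))

      -- A trace that vanishes identically gives σ = -id; together with σ 1 = 1 this gives 1 + 1 =
      -- 0, so σ would be the identity.
      nonzero-trace : ∃ λ c → c +ᶠ σ c ≢ 0ᶠ
      nonzero-trace with ΣF.search (λ c → not (fibre 0ᶠ c))
      ... | inj₁ (c , h) = c , λ e → true-not h (does-true (_ ≟ᶠ _) e)
      ... | inj₂ none = ⊥-elim (proj₂ σ-nontriv (trans (σ≡- a₀) (-≡ a₀)))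
        where
        tr0 : ∀ c → c +ᶠ σ c ≡ 0ᶠ
        tr0 c with split (fibre 0ᶠ c)
        ... | inj₁ h = ΣF.==-true h
        ... | inj₂ n = ⊥-elim (none c (not-true n))
        σ≡- : ∀ c → σ c ≡ -ᶠ c
        σ≡- c = trans (solve 2 (λ c s → s := :- c :+ (c :+ s)) refl c (σ c)) (trans (cong (-ᶠ c +ᶠ_) (tr0 c)) (+ᶠ-identityʳ _))
        -≡ : ∀ c → -ᶠ c ≡ c
        -≡ c = trans (sym (trans (cong (-ᶠ c +ᶠ_) (trans (solve 1 (λ c → c :+ c := (:1 :+ :1) :* c) refl c) (trans (cong (_*ᶠ c) (trans (cong (1ᶠ +ᶠ_) (sym σ-1)) (tr0 1ᶠ))) (*ᶠ-zeroˡ c)))) (+ᶠ-identityʳ _)))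
          (solve 1 (λ c → :- c :+ (c :+ c) := c) refl c)

      -- The trace is linear over the fixed field, so an element c₀ of trace t ≠ 0 is scaled by k /
      -- t, which is fixed because t and k are.
      onto : ∀ {k} → σ k ≡ k → ∃ λ c → c +ᶠ σ c ≡ k
      onto {k} fk = c₀ *ᶠ e , (begin
        c₀ *ᶠ e +ᶠ σ (c₀ *ᶠ e)      ≡⟨ cong (c₀ *ᶠ e +ᶠ_) (trans (σ-* c₀ e) (cong (σ c₀ *ᶠ_) σe)) ⟩
        c₀ *ᶠ e +ᶠ σ c₀ *ᶠ e        ≡⟨ solve 3 (λ a b e → a :* e :+ b :* e := (a :+ b) :* e) refl c₀ (σ c₀) e ⟩
        t *ᶠ e                      ≡⟨ te ⟩
        k                           ∎)
        where
        open ≡-Reasoning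
        c₀ = proj₁ nonzero-trace
        t = c₀ +ᶠ σ c₀
        i = inv t (proj₂ nonzero-trace)
        e = proj₁ i *ᶠ k
        te : t *ᶠ e ≡ k
        te = trans (sym (*ᶠ-assoc t (proj₁ i) k)) (trans (cong (_*ᶠ k) (proj₂ i)) (*ᶠ-identityˡ k))
        cancel-t : ∀ {x y} → t *ᶠ x ≡ t *ᶠ y → x ≡ y
        cancel-t {x} {y} eq = trans (solve 2 (λ x y → x := (x :- y) :+ y) refl x y) (trans (cong (_+ᶠ y) (integral (proj₂ nonzero-trace)
          (trans (solve 3 (λ t x y → t :* (x :- y) := t :* x :- t :* y) refl t x y) (trans (cong (_+ᶠ -ᶠ (t *ᶠ y)) eq) (-ᶠ-inverseʳ _))))) (+ᶠ-identityˡ y))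
        σe : σ e ≡ e
        σe = cancel-t (trans (cong (_*ᶠ σ e) (sym (trace-fixed c₀))) (trans (sym (σ-* t e)) (trans (cong σ te) (trans fk (sym te)))))

      fibre-size : ∀ {k} → σ k ≡ k → ΣF.⌈ fibre k ⌉ ≡ ΣF.⌈ fibre 0ᶠ ⌉
      fibre-size {k} fk = trans (sym (ΣF.∑-reindex (_+ᶠ c) (_+ᶠ -ᶠ c) (λ x → solve 2 (λ x c → x :+ c :- c := x) refl x c) (λ x → solve 2 (λ x c → x :- c :+ c := x) refl x c) (λ x → [ fibre k x ])))
        (ΣF.∣∣-cong (λ x → bool-ext
          (λ h → does-true (_ ≟ᶠ _) (trans (solve 2 (λ a k → a := (a :+ k) :- k) refl (x +ᶠ σ x) k) (trans (cong (_+ᶠ -ᶠ k) (trans (sym (shifted x)) (ΣF.==-true h))) (-ᶠ-inverseʳ k))))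
          (λ h → does-true (_ ≟ᶠ _) (trans (shifted x) (trans (cong (_+ᶠ k) (ΣF.==-true h)) (+ᶠ-identityˡ k))))))
        where
        c = proj₁ (onto fk)
        shifted : ∀ x → (x +ᶠ c) +ᶠ σ (x +ᶠ c) ≡ (x +ᶠ σ x) +ᶠ k
        shifted x = trans (cong ((x +ᶠ c) +ᶠ_) (σ-+ x c)) (trans (solve 4 (λ x c s t → (x :+ c) :+ (s :+ t) := (x :+ s) :+ (c :+ t)) refl x c (σ x) (σ c)) (cong ((x +ᶠ σ x) +ᶠ_) (proj₂ (onto fk))))

      θ : 𝔽
      θ = a₀ +ᶠ -ᶠ σ a₀

      θ≢0 : θ ≢ 0ᶠ
      θ≢0 e = proj₂ σ-nontriv (sym (trans (solve 2 (λ a s → a := (a :- s) :+ s) refl a₀ (σ a₀)) (trans (cong (_+ᶠ σ a₀) e) (+ᶠ-identityˡ _))))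

      σ-θ : σ θ ≡ -ᶠ θ
      σ-θ = trans (σ-+ a₀ _) (trans (cong (σ a₀ +ᶠ_) (trans (σ-neg (σ a₀)) (cong -ᶠ_ (σ-σ a₀)))) (solve 2 (λ a s → s :- a := :- (a :- s)) refl a₀ (σ a₀)))

      ∑-scale : ∀ {b} → b ≢ 0ᶠ → ∀ f → ∑ᶠ (λ c → f (c *ᶠ b)) ≡ ∑ᶠ f
      ∑-scale {b} n f = ΣF.∑-reindex (_*ᶠ b) (_*ᶠ proj₁ i) (λ x → trans (*ᶠ-assoc x b _) (trans (cong (x *ᶠ_) (proj₂ i)) (*ᶠ-identityʳ x)))
        (λ x → trans (*ᶠ-assoc x _ b) (trans (cong (x *ᶠ_) (trans (*ᶠ-comm _ b) (proj₂ i))) (*ᶠ-identityʳ x))) f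
        where i = inv b n

      kernel-size : ΣF.⌈ fibre 0ᶠ ⌉ ≡ ΣF.⌈ fix ⌉
      kernel-size = trans (sym (∑-scale θ≢0 (λ c → [ fibre 0ᶠ c ]))) (ΣF.∣∣-cong (λ c → bool-ext
        (λ h → does-true (_ ≟ᶠ _) (back c (ΣF.==-true h)))
        (λ h → does-true (_ ≟ᶠ _) (trans (scaled c) (trans (cong (λ t → (c +ᶠ -ᶠ t) *ᶠ θ) (ΣF.==-true h)) (trans (cong (_*ᶠ θ) (-ᶠ-inverseʳ c)) (*ᶠ-zeroˡ θ)))))))
        where
        scaled : ∀ c → c *ᶠ θ +ᶠ σ (c *ᶠ θ) ≡ (c +ᶠ -ᶠ σ c) *ᶠ θ
        scaled c = trans (cong (c *ᶠ θ +ᶠ_) (trans (σ-* c θ) (cong (σ c *ᶠ_) σ-θ))) (solve 3 (λ c s t → c :* t :+ s :* (:- t) := (c :- s) :* t) refl c (σ c) θ)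
        back : ∀ c → c *ᶠ θ +ᶠ σ (c *ᶠ θ) ≡ 0ᶠ → σ c ≡ c
        back c e = sym (trans (solve 2 (λ a s → a := (a :- s) :+ s) refl c (σ c)) (trans (cong (_+ᶠ σ c) (integral θ≢0 (trans (*ᶠ-comm θ _) (trans (sym (scaled c)) e)))) (+ᶠ-identityˡ _)))

      rℚ : ℚ
      rℚ = ι r

      -- The field is partitioned by the value of the trace into as many fibres as there are fixed
      -- elements, all of the size of the kernel, and kernel and fixed field have equal size. So
      -- that size is the square root of q, without any Galois theory.
      kernel²≡q : ΣF.⌈ fibre 0ᶠ ⌉ * ΣF.⌈ fibre 0ᶠ ⌉ ≡ q
      kernel²≡q = begin
        ΣF.⌈ fibre 0ᶠ ⌉ * ΣF.⌈ fibre 0ᶠ ⌉                ≡⟨ cong (_* ΣF.⌈ fibre 0ᶠ ⌉) kernel-size ⟩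
        ΣF.⌈ fix ⌉ * ΣF.⌈ fibre 0ᶠ ⌉                      ≡⟨ sym (ΣF.∑-*ʳ _ _) ⟩
        ∑ᶠ (λ k → [ fix k ] * ΣF.⌈ fibre 0ᶠ ⌉)            ≡⟨ ΣF.∑-cong (λ k → []-guard (fix k) (λ h → sym (fibre-size (ΣF.==-true h)))) ⟩
        ∑ᶠ (λ k → [ fix k ] * ΣF.⌈ fibre k ⌉)             ≡⟨ ΣF.∑-cong (λ k → sym (ΣF.∑-* [ fix k ] _)) ⟩
        ∑ᶠ (λ k → ∑ᶠ (λ c → [ fix k ] * [ fibre k c ]))    ≡⟨ ΣF.∑-swap _ ⟩
        ∑ᶠ (λ c → ∑ᶠ (λ k → [ fix k ] * [ fibre k c ]))    ≡⟨ ΣF.∑-cong each ⟩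
        ∑ᶠ (λ c → 1ℚ)                                      ≡⟨ trans (∑ᶠ-const 1ℚ) (*-identityʳ q) ⟩
        q                                                  ∎
        where
        open ≡-Reasoning
        each : ∀ c → ∑ᶠ (λ k → [ fix k ] * [ fibre k c ]) ≡ 1ℚ
        each c = trans (ΣF.∑-cong (λ k → sym ([]-∧ (fix k) (fibre k c)))) (ΣF.∣∣-unique _ (c +ᶠ σ c)
          (∧-true (does-true (_ ≟ᶠ _) (trace-fixed c)) (ΣF.==-refl (c +ᶠ σ c))) (λ k h → sym (ΣF.==-true (∧-trueʳ {fix k} h))))

      r²ℚ : rℚ * rℚ ≡ q
      r²ℚ = trans (sym (ι-* r r)) (trans (cong ι r²≡q) (sym q-def))

      square-inj : ∀ {a b : ℚ} → 0ℚ ≤ a → 0ℚ < b → a * a ≡ b * b → a ≡ b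
      square-inj {a} {b} ha hb e = trans (QS.solve 2 (λ a b → a QS.:= (a QS.:- b) QS.:+ b) refl a b) (trans (cong (_+ b) zero-diff) (Data.Rational.Properties.+-identityˡ b))
        where
        zero-diff : a - b ≡ 0ℚ
        zero-diff = cancel≡ (a + b) (<-≤-trans hb (≤-trans (≤-reflexive (sym (Data.Rational.Properties.+-identityˡ b))) (Data.Rational.Properties.+-monoˡ-≤ b ha)))
          (trans (QS.solve 2 (λ a b → (a QS.:+ b) QS.:* (a QS.:- b) QS.:= a QS.:* a QS.:- b QS.:* b) refl a b) (trans (cong (_- b * b) e) (QS.solve 2 (λ b c → b QS.:* b QS.:- b QS.:* b QS.:= c QS.:* QS.:0) refl b (a + b))))

      rℚ>0 : 0ℚ < rℚ
      rℚ>0 = positive-root r r²≡q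
        where
        positive-root : ∀ r → r ℕ.* r ≡ FiniteField.q F → 0ℚ < ι r
        positive-root zero e = ⊥-elim (≤<-⊥ (≤-reflexive (trans q-def (cong ι (sym e)))) 0<q)
        positive-root (suc r) e = ι>0 r

      fibre-r : ∀ {k} → σ k ≡ k → ΣF.⌈ fibre k ⌉ ≡ rℚ
      fibre-r fk = trans (fibre-size fk) (square-inj (ΣF.∣∣≥0 (fibre 0ᶠ)) rℚ>0 (trans kernel²≡q (sym r²ℚ)))

      -- The quotient σ(a₀) / a₀, as in Hilbert 90, for an element a₀ moved by σ.
      norm-one : ∃ λ l → l *ᶠ σ l ≡ 1ᶠ × l ≢ 1ᶠ
      norm-one = σ a₀ *ᶠ y , trans (cong (σ a₀ *ᶠ y *ᶠ_) (trans (σ-* (σ a₀) y) (cong (_*ᶠ σ y) (σ-σ a₀)))) (trans (solve 4 (λ s y a z → s :* y :* (a :* z) := (a :* y) :* (s :* z)) refl (σ a₀) y a₀ (σ y))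
          (trans (cong₂ _*ᶠ_ (proj₂ i) (trans (sym (σ-* a₀ y)) (trans (cong σ (proj₂ i)) σ-1))) (*ᶠ-identityˡ 1ᶠ))) ,
        λ e → proj₂ σ-nontriv (trans (sym (*ᶠ-identityʳ (σ a₀))) (trans (cong (σ a₀ *ᶠ_) (sym (trans (*ᶠ-comm y a₀) (proj₂ i)))) (trans (sym (*ᶠ-assoc (σ a₀) y a₀)) (trans (cong (_*ᶠ a₀) e) (*ᶠ-identityˡ a₀)))))
        where
        a₀≢0 : a₀ ≢ 0ᶠ
        a₀≢0 e = proj₂ σ-nontriv (trans (cong σ e) (trans σ-0 (sym e)))
        i = inv a₀ a₀≢0
        y = proj₁ i

    hermitian-facts : ∀ {n} (H : D.Hermitian F n) → FormFacts {n} D.hermitian H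
    hermitian-facts {n} H = record
      { bil-cong = form′-cong (λ i j → refl)
      ; bil-∔ = form-∔ˡ′ h
      ; bil-∙ = form-∙ˡ′ h
      ; bil-refl = λ {u} {v} e → trans (conj u v) (trans (cong σ e) σ-0)
      ; Sg? = λ v → b v v ≟ᶠ 0ᶠ
      ; Sg-cong = λ k e → trans (sym (form′-cong (λ i j → refl) k k)) e
      ; Sg-∙ = λ c {v} e → trans (form-∙ˡ′ h c v (c ∙ v)) (trans (cong (c *ᶠ_) (trans (conj (c ∙ v) v) (trans (cong σ (trans (form-∙ˡ′ h c v v) (trans (cong (c *ᶠ_) e) (*ᶠ-zeroʳ c)))) σ-0))) (*ᶠ-zeroʳ c))
      ; Sg-∔ = λ {u} {v} e k o → trans (form-∔ˡ′ h u v (u ∔ v)) (trans (cong₂ _+ᶠ_ (right0 u v u e (trans (conj u v) (trans (cong σ o) σ-0))) (right0 u v v o k)) (+ᶠ-identityʳ 0ᶠ))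
      ; Sg-bil = λ e → e
      ; s = rℚ
      -- y + c P is singular exactly when the trace of c B(P,y) equals -B(y,y). Scaling by B(P,y) ≠
      -- 0 permutes the field, so the count is the size r of a trace fibre.
      ; s-line = λ {y} {P} hP n → trans (ΣF.∑-cong (λ c → cong [_] (bool-ext (to y P hP c) (back y P hP c)))) (trans (∑-scale (λ e → n (trans (conj P y) (trans (cong σ e) σ-0))) (λ c → [ fibre (-ᶠ b y y) c ]))
          (fibre-r (trans (σ-neg (b y y)) (cong -ᶠ_ (sym (conj y y))))))
      ; ts-bil = λ e → e
      ; ts-Sg = λ e x → e x x
      ; ts-intro = λ _ e → e
      }
      where
      open D.Hermitian H using (h; herm; r; r²≡q) renaming (inv to I)
      open Trace I r r²≡q
      open Sesquilinear σ renaming (form to form′; form-cong to form′-cong; form-∔ˡ to form-∔ˡ′; form-∙ˡ to form-∙ˡ′; form-Σˡ to form-Σˡ′)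
      b : Fun n → Fun n → 𝔽
      b = form′ h
      conj : ∀ u v → b v u ≡ σ (b u v)
      conj = Sesquilinear.Conjugate.form-conj σ σ-0 σ-+ σ-* σ-σ h h herm
      right0 : ∀ u v w → b u w ≡ 0ᶠ → b v w ≡ 0ᶠ → b w (u ∔ v) ≡ 0ᶠ
      right0 u v w e k = trans (conj (u ∔ v) w) (trans (cong σ (trans (form-∔ˡ′ h u v w) (trans (cong₂ _+ᶠ_ e k) (+ᶠ-identityʳ 0ᶠ)))) σ-0)
      line : ∀ y P → b P P ≡ 0ᶠ → ∀ c → b (y ∔ c ∙ P) (y ∔ c ∙ P) ≡ b y y +ᶠ (c *ᶠ b P y +ᶠ σ (c *ᶠ b P y))
      line y P hP c = trans (form-∔ˡ′ h y (c ∙ P) _) (trans (cong₂ _+ᶠ_ (right y) (trans (form-∙ˡ′ h c P _) (cong (c *ᶠ_) (trans (right P) (trans (cong₂ _+ᶠ_ refl (trans (cong σ (trans (form-∙ˡ′ h c P P) (trans (cong (c *ᶠ_) hP) (*ᶠ-zeroʳ c)))) σ-0)) (+ᶠ-identityʳ _))))))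
        (trans (cong (λ t → b y y +ᶠ t +ᶠ c *ᶠ b P y) (cong σ (form-∙ˡ′ h c P y))) (solve 3 (λ a s t → a :+ s :+ t := a :+ (t :+ s)) refl (b y y) (σ (c *ᶠ b P y)) (c *ᶠ b P y))))
        where
        right : ∀ w → b w (y ∔ c ∙ P) ≡ b w y +ᶠ σ (b (c ∙ P) w)
        right w = trans (conj (y ∔ c ∙ P) w) (trans (cong σ (form-∔ˡ′ h y (c ∙ P) w)) (trans (σ-+ _ _) (cong (_+ᶠ σ (b (c ∙ P) w)) (sym (conj y w)))))
      to : ∀ y P → b P P ≡ 0ᶠ → ∀ c → does (b (y ∔ c ∙ P) (y ∔ c ∙ P) ≟ᶠ 0ᶠ) ≡ true → fibre (-ᶠ b y y) (c *ᶠ b P y) ≡ true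
      to y P hP c e = does-true (_ ≟ᶠ _) (trans (solve 2 (λ a t → t := :- a :+ (a :+ t)) refl (b y y) _) (trans (cong (-ᶠ b y y +ᶠ_) (trans (sym (line y P hP c)) (true-does (_ ≟ᶠ _) e))) (+ᶠ-identityʳ _)))
      back : ∀ y P → b P P ≡ 0ᶠ → ∀ c → fibre (-ᶠ b y y) (c *ᶠ b P y) ≡ true → does (b (y ∔ c ∙ P) (y ∔ c ∙ P) ≟ᶠ 0ᶠ) ≡ true
      back y P hP c e = does-true (_ ≟ᶠ _) (trans (line y P hP c) (trans (cong (b y y +ᶠ_) (ΣF.==-true e)) (-ᶠ-inverseʳ (b y y))))

-- Passage from the given polar space to the abstract one, and construction of the embedded space.

module Models where

  open import Defs using (FiniteField)
  import Defs as D
  open import Data.Nat as ℕ using (ℕ; zero; suc)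
  import Data.Nat.Properties as ℕP
  import Data.Integer as ℤ
  import Data.Integer.Properties as ℤP
  import Data.Bool.Properties as BP
  open import Data.Bool using (if_then_else_)
  open import Data.Bool.ListAction using (any)
  open import Data.Rational using (ℚ; 0ℚ; 1ℚ; _<_; _≤_; _+_; _*_; _/_; toℚᵘ)
  import Data.Rational.Unnormalised as ℚᵘ
  import Data.Rational.Unnormalised.Properties as ℚᵘP
  open import Data.Rational.Properties using (*-identityʳ; *-identityˡ; *-comm; *-zeroˡ; *-distribˡ-+; <⇒≤; toℚᵘ-injective; toℚᵘ-homo-*; toℚᵘ-homo-+; toℚᵘ-fromℚᵘ)
  open import Data.Fin using (Fin; zero; suc)
  open import Data.List using (List; []; _∷_; length; map)
  import Data.List.Properties as LP
  import Data.List.Membership.Propositional as ∈L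
  import Data.List.Membership.Propositional.Properties as ∈P
  open import Data.List.Relation.Unary.Any as Any using (Any; here; there; any?)
  import Data.List.Relation.Unary.Any.Properties as AnyP
  open import Data.List.Relation.Unary.All as All using (All; []; _∷_)
  import Data.List.Relation.Unary.All.Properties as AllP
  open import Data.List.Relation.Unary.AllPairs as AP using (AllPairs; []; _∷_)
  open import Data.Vec as Vec using ([]; _∷_; lookup; tabulate)
  open import Data.Vec.Properties using (lookup∘tabulate; tabulate∘lookup; tabulate-cong)
  open import Data.Vec.Functional as VF using ()
  open import Data.Product using (Σ; ∃; _×_; _,_; proj₁; proj₂)
  open import Data.Sum using (_⊎_; inj₁; inj₂)
  open import Data.Empty using (⊥-elim)
  open import Relation.Nullary using (¬_; Dec; yes; no; does)
  open import Relation.Nullary.Decidable using (isYes≗does)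
  open import Relation.Binary.PropositionalEquality hiding ([_])
  open import Function.Bundles using (mk⇔; Equivalence)
  open Numbers
  open LinearAlgebra
  open PolarSpaces
  open SesquilinearForms
  open CoordinateSpaces
  open ClassicalForms

  ι-toℚᵘ : ∀ n → toℚᵘ (ι n) ℚᵘ.≃ ℚᵘ.mkℚᵘ (ℤ.+ n) 0
  ι-toℚᵘ zero    = ℚᵘ.*≡* refl
  ι-toℚᵘ (suc n) = ℚᵘP.≃-trans (toℚᵘ-homo-+ 1ℚ (ι n)) (ℚᵘP.≃-trans (ℚᵘP.+-congʳ ℚᵘ.1ℚᵘ (ι-toℚᵘ n))
    (ℚᵘ.*≡* (cong (λ t → (ℤ.+ 1 ℤ.+ t) ℤ.* ℤ.+ 1) (ℤP.*-identityʳ (ℤ.+ n)))))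

  /-* : ∀ n m .{{_ : ℕ.NonZero m}} → (ℤ.+ n / m) * ι m ≡ ι n
  /-* n (suc m) = toℚᵘ-injective (ℚᵘP.≃-trans (toℚᵘ-homo-* (ℤ.+ n / suc m) (ι (suc m))) (ℚᵘP.≃-trans
    (ℚᵘP.*-cong (toℚᵘ-fromℚᵘ (ℚᵘ.mkℚᵘ (ℤ.+ n) m)) (ι-toℚᵘ (suc m))) (ℚᵘP.≃-trans (ℚᵘ.*≡* arith) (ℚᵘP.≃-sym (ι-toℚᵘ n)))))
    where
    arith : (ℤ.+ n ℤ.* ℤ.+ suc m) ℤ.* ℤ.+ 1 ≡ ℤ.+ n ℤ.* ℤ.+ (suc m ℕ.* 1)
    arith = trans (ℤP.*-identityʳ _) (cong (λ t → ℤ.+ n ℤ.* ℤ.+ t) (sym (ℕP.*-identityʳ (suc m))))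

  /1 : ∀ n → ℤ.+ n / 1 ≡ ι n
  /1 n = trans (sym (*-identityʳ _)) (/-* n 1)

  module Model (F : FiniteField) (d₀ : ℕ) (P : D.ClassicalPolarSpace F d₀) where
    open D.ClassicalPolarSpace P
    module FFm = FormFact F
    open FFm using (FormFacts; Fun; comb-∔)

    private
      n₀ : ℕ
      n₀ = D.dim kind d₀
      module FL = Field F

    module Geometry (facts : FormFacts {n₀} (D.formKind kind) form)
             (q-base : FL.q ≡ ι (D.base F P) ^^ D.unit F P)
             (size₀ : FL.q ^^ n₀ * FormFacts.s facts ≡ ι (D.base F P) ^^ D.eB F P * (FL.q ^^ d₀ * FL.q ^^ d₀)) where
      open FormFacts facts
      open Coordinates F n₀ using (space; Independent; comb-comb; comb-cong; span; Family; span-sub; span-intro; span-elim; span-⊆; span-self; ∣span∣; ∣V∣; basis; independent-cons; ext; lookup-⊕; lookup-·; lookup-0; comb)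
      open Subspaces space using (V; _∈_; _∉_; _⊕_; _·_; 0ᵛ; Sub; ⌈_⌉; 𝔽; _⊆_; q)

      private
        Bᵥ : V → V → 𝔽
        Bᵥ u v = bil (lookup u) (lookup v)
        Singᵥ : V → Bool
        Singᵥ v = does (Sg? (lookup v))
        M₀ : Family d₀
        M₀ = proj₁ witt₁

      Sing-intro : ∀ {v} → Sg (lookup v) → v ∈ Singᵥ
      Sing-intro {v} h = does-true (Sg? (lookup v)) h

      Sing-elim : ∀ {v} → v ∈ Singᵥ → Sg (lookup v)
      Sing-elim {v} h = true-does (Sg? (lookup v)) h

      ts⇒sing : ∀ {k} {M : Family k} → D.TotallySingular F (D.formKind kind) form M → span M ⊆ Singᵥ
      ts⇒sing {M = M} t v h = let c , e = span-elim M h in Sing-intro {v} (Sg-cong (λ j → sym (e j)) (ts-Sg t c))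

      ts⇒iso : ∀ {k} {M : Family k} → D.TotallySingular F (D.formKind kind) form M → ∀ {u v} → u ∈ span M → v ∈ span M → Bᵥ u v ≡ FL.0ᶠ
      ts⇒iso {M = M} t h k = let c , e = span-elim M h ; c′ , e′ = span-elim M k in trans (bil-cong e e′) (ts-bil t c c′)

      comb-∈ : ∀ {k} (M : Family k) c → tabulate (comb M c) ∈ span M
      comb-∈ M c = span-intro M c (lookup∘tabulate (comb M c))

      ts⇐ : ∀ {k} {M : Family k} → span M ⊆ Singᵥ → (∀ {u v} → u ∈ span M → v ∈ span M → Bᵥ u v ≡ FL.0ᶠ) → D.TotallySingular F (D.formKind kind) form M
      ts⇐ {M = M} h k = ts-intro (λ x → Sg-cong (lookup∘tabulate (comb M x)) (Sing-elim {tabulate (comb M x)} (h _ (comb-∈ M x))))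
        (λ x y → trans (bil-cong (λ i → sym (lookup∘tabulate (comb M x) i)) (λ i → sym (lookup∘tabulate (comb M y) i))) (k (comb-∈ M x) (comb-∈ M y)))

      Bᵥ-⊕ : ∀ u v w → Bᵥ (u ⊕ v) w ≡ Bᵥ u w FL.+ᶠ Bᵥ v w
      Bᵥ-⊕ u v w = trans (bil-cong (lookup-⊕ u v) (λ _ → refl)) (bil-∔ (lookup u) (lookup v) (lookup w))

      Bᵥ-· : ∀ c u w → Bᵥ (c · u) w ≡ c FL.*ᶠ Bᵥ u w
      Bᵥ-· c u w = trans (bil-cong (lookup-· c u) (λ _ → refl)) (bil-∙ c (lookup u) (lookup w))

      Bᵥ-refl : ∀ {u v} → Bᵥ u v ≡ FL.0ᶠ → Bᵥ v u ≡ FL.0ᶠ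
      Bᵥ-refl = bil-refl

      ⊥-⊕ : ∀ {u v w} → Bᵥ u w ≡ FL.0ᶠ → Bᵥ v w ≡ FL.0ᶠ → Bᵥ (u ⊕ v) w ≡ FL.0ᶠ
      ⊥-⊕ {u} {v} {w} h k = trans (Bᵥ-⊕ u v w) (trans (cong₂ FL._+ᶠ_ h k) (FL.+ᶠ-identityʳ FL.0ᶠ))

      ⊥-· : ∀ c {u w} → Bᵥ u w ≡ FL.0ᶠ → Bᵥ (c · u) w ≡ FL.0ᶠ
      ⊥-· c {u} {w} h = trans (Bᵥ-· c u w) (trans (cong (c FL.*ᶠ_) h) (FL.*ᶠ-zeroʳ c))

      ⊥ʳ-⊕ : ∀ {u v w} → Bᵥ w u ≡ FL.0ᶠ → Bᵥ w v ≡ FL.0ᶠ → Bᵥ w (u ⊕ v) ≡ FL.0ᶠ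
      ⊥ʳ-⊕ {u} {v} {w} h k = Bᵥ-refl {u ⊕ v} {w} (⊥-⊕ {u} {v} {w} (Bᵥ-refl {w} {u} h) (Bᵥ-refl {w} {v} k))

      ⊥ʳ-· : ∀ c {u w} → Bᵥ w u ≡ FL.0ᶠ → Bᵥ w (c · u) ≡ FL.0ᶠ
      ⊥ʳ-· c {u} {w} h = Bᵥ-refl {c · u} {w} (⊥-· c {u} {w} (Bᵥ-refl {w} {u} h))

      Singᵥ-⊕ : ∀ {u v} → u ∈ Singᵥ → v ∈ Singᵥ → Bᵥ u v ≡ FL.0ᶠ → u ⊕ v ∈ Singᵥ
      Singᵥ-⊕ {u} {v} h k o = Sing-intro {u ⊕ v} (Sg-cong (λ i → sym (lookup-⊕ u v i)) (Sg-∔ (Sing-elim {u} h) (Sing-elim {v} k) o))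

      Singᵥ-· : ∀ c {v} → v ∈ Singᵥ → c · v ∈ Singᵥ
      Singᵥ-· c {v} h = Sing-intro {c · v} (Sg-cong (λ i → sym (lookup-· c v i)) (Sg-∙ c (Sing-elim {v} h)))

      -- A singular vector orthogonal to the first Witt subspace and outside it would extend its
      -- basis to d + 1 independent vectors with totally singular span, which `witt₂` forbids. The
      -- double negation is harmless since `span` is Boolean.
      too-big : ∀ {v} → v ∈ Singᵥ → (∀ {u} → u ∈ span M₀ → Bᵥ v u ≡ FL.0ᶠ) → ¬ v ∉ span M₀
      too-big {v} h o n = witt₂ (lookup v VF.∷ M₀) (independent-cons (proj₁ (proj₂ witt₁)) n) (ts⇐ sg is)
        where
        open Subspaces space using (⊞⟨⟩-elim)
        t₀ = proj₂ (proj₂ witt₁)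
        parts : ∀ {u} → u ∈ span (lookup v VF.∷ M₀) → ∃ λ y → ∃ λ c → y ∈ span M₀ × u ≡ y ⊕ c · v
        parts k = let y , c , hy , e = ⊞⟨⟩-elim k in y , c , hy , trans e (cong (λ t → y ⊕ c · t) (tabulate∘lookup v))
        sg : span (lookup v VF.∷ M₀) ⊆ Singᵥ
        sg u k = let y , c , hy , e = parts k in subst (_∈ Singᵥ) (sym e) (Singᵥ-⊕ {y} {c · v} (ts⇒sing t₀ y hy) (Singᵥ-· c {v} h) (⊥ʳ-· c {v} {y} (Bᵥ-refl {v} {y} (o hy))))
        is : ∀ {u w} → u ∈ span (lookup v VF.∷ M₀) → w ∈ span (lookup v VF.∷ M₀) → Bᵥ u w ≡ FL.0ᶠ
        is k l = let y , c , hy , e = parts k ; y′ , c′ , hy′ , e′ = parts l in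
          subst₂ (λ s t → Bᵥ s t ≡ FL.0ᶠ) (sym e) (sym e′)
            (⊥-⊕ {y} {c · v} {y′ ⊕ c′ · v} (⊥ʳ-⊕ {y′} {c′ · v} {y} (ts⇒iso t₀ hy hy′) (⊥ʳ-· c′ {v} {y} (Bᵥ-refl {v} {y} (o hy))))
              (⊥-· c {v} {y′ ⊕ c′ · v} (⊥ʳ-⊕ {y′} {c′ · v} {v} (o hy′) (⊥ʳ-· c′ {v} {v} (Sg-bil (Sing-elim {v} h))))))

      polar : Polar space
      polar = record
        { B = Bᵥ ; B-⊕ = Bᵥ-⊕ ; B-· = Bᵥ-· ; B-refl = λ {u} {v} → Bᵥ-refl {u} {v}
        ; Sing = Singᵥ ; Sing-0 = zero-sing ; Sing-· = λ c {v} → Singᵥ-· c {v} ; Sing-⊕ = λ {u} {v} → Singᵥ-⊕ {u} {v} ; Sing-B = λ {v} h → Sg-bil (Sing-elim {v} h)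
        ; nondeg = λ {u} h o → ext (λ i → trans (nondeg (lookup u) (Sing-elim {u} h) (λ w → trans (bil-cong (λ _ → refl) (λ j → sym (lookup∘tabulate w j))) (bil-refl (o (tabulate w)))) i) (sym (lookup-0 i)))
        ; s = s
        ; s-line = λ {y} {P} h n → trans (FL.ΣF.∑-cong (λ c → cong [_] (bool-ext
            (λ k → does-true (Sg? _) (Sg-cong (λ j → trans (lookup-⊕ y (c · P) j) (cong (lookup y j FL.+ᶠ_) (lookup-· c P j))) (Sing-elim {y ⊕ c · P} k)))
            (λ k → Sing-intro {y ⊕ c · P} (Sg-cong (λ j → sym (trans (lookup-⊕ y (c · P) j) (cong (lookup y j FL.+ᶠ_) (lookup-· c P j)))) (true-does (Sg? _) k))))))
            (s-line (Sing-elim {P} h) n)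
        ; d = d₀
        ; Qe = ι (D.base F P) ^^ D.eB F P
        ; Qe>0 = ^^>0 (D.eB F P) (ι-nz>0 (D.base F P) {{D.base-nonZero F P}})
        ; size = trans (cong (_* s) ∣V∣) size₀
        ; G₀ = span M₀ ; G₀-sub = span-sub M₀ ; G₀-sing = ts⇒sing t₀ ; G₀-iso = ts⇒iso t₀
        ; G₀-size = ∣span∣ M₀ (proj₁ (proj₂ witt₁))
        ; G₀-max = λ {v} h o → decide {v} (too-big {v} h o)
        }
        where
        t₀ = proj₂ (proj₂ witt₁)
        zero-sing : 0ᵛ ∈ Singᵥ
        zero-sing = ts⇒sing t₀ 0ᵛ (Subspaces.has-0 (span-sub M₀))
        decide : ∀ {v} → ¬ v ∉ span M₀ → v ∈ span M₀
        decide {v} h with span M₀ v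
        ... | true  = refl
        ... | false = ⊥-elim (h λ ())

      open PolarTheory polar hiding (Sub; V; _∈_; _∉_; _⊕_; _·_; 0ᵛ; ⌈_⌉; 𝔽; _⊆_; q; s; ⊥-⊕; ⊥-·)

      IsGen : Family d₀ → Set
      IsGen = D.IsGenerator F P

      gen-of : ∀ {M} → IsGen M → Gen (span M)
      gen-of {M} (ind , t) = record { ts = record { sub = span-sub M ; sing = ts⇒sing t ; iso = ts⇒iso t } ; ∣gen∣ = ∣span∣ M ind }

      opaque
        of-gen : ∀ {X} → Gen X → ∃ λ M → IsGen M × (∀ v → span M v ≡ X v)
        of-gen {X} g = let M , ind , e = basis d₀ (sub (ts g)) (∣gen∣ g) in
          M , (ind , ts⇐ (λ v h → sing (ts g) v (trans (sym (e v)) h)) (λ {u} {v} h k → iso (ts g) (trans (sym (e u)) h) (trans (sym (e v)) k))) , e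

      same⇒⊆ : ∀ {k l} {M : Family k} {M′ : Family l} → D.SameSpan F M M′ → span M ⊆ span M′
      same⇒⊆ {M = M} {M′} h v k = let c , e = Equivalence.to (h (lookup v)) (span-elim M k) in span-intro M′ c e

      ⊆⇒span : ∀ {k l} {M : Family k} {M′ : Family l} → span M ⊆ span M′ → ∀ v → D._∈span_ F v M → D._∈span_ F v M′
      ⊆⇒span {M = M} {M′} h v (c , e) = let c′ , e′ = span-elim M′ (h (tabulate v) (span-intro M c (λ j → trans (lookup∘tabulate v j) (e j)))) in
        c′ , λ j → trans (sym (lookup∘tabulate v j)) (e′ j)

      ⊆⇒same : ∀ {k l} {M : Family k} {M′ : Family l} → span M ⊆ span M′ → span M′ ⊆ span M → D.SameSpan F M M′
      ⊆⇒same {M = M} {M′} h k v = mk⇔ (⊆⇒span {M = M} {M′} h v) (⊆⇒span {M = M′} {M} k v)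

      same-sym : ∀ {k l} {M : Family k} {M′ : Family l} → D.SameSpan F M M′ → D.SameSpan F M′ M
      same-sym h v = mk⇔ (Equivalence.from (h v)) (Equivalence.to (h v))

      point-∈ : ∀ {k} {M : Family k} {v} → D._∈span_ F (lookup v) M → v ∈ span M
      point-∈ {M = M} (c , e) = span-intro M c e

      any-intro : ∀ {A : Set} (f : A → Bool) {x xs} → x ∈L.∈ xs → f x ≡ true → any f xs ≡ true
      any-intro f {xs = y ∷ xs} (here refl) h rewrite h = refl
      any-intro f {xs = y ∷ xs} (there m) h with f y
      ... | true  = refl
      ... | false = any-intro f m h

      any-elim : ∀ {A : Set} (f : A → Bool) xs → any f xs ≡ true → ∃ λ x → f x ≡ true
      any-elim f (y ∷ xs) h with f y in e
      ... | true  = y , e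
      ... | false = any-elim f xs h

      -- `allVecs` enumerates functions, so a given function can be located in it only up to
      -- pointwise equality.
      all-vectors : ∀ k (c : Fun k) → ∃ λ c′ → c′ ∈L.∈ D.allVecs F P k × (∀ i → c′ i ≡ c i)
      all-vectors zero    c = (λ ()) , here refl , λ ()
      all-vectors (suc k) c = let c′ , m , e = all-vectors k (λ i → c (suc i)) in
        (c zero VF.∷ c′) ,
        ∈P.∈-concatMap⁺ (λ a → map (λ v → a VF.∷ v) (D.allVecs F P k)) (∈L.lose (FiniteField.complete F (c zero)) (∈P.∈-map⁺ (λ v → c zero VF.∷ v) m)) ,
        λ { zero → refl ; (suc i) → e i }

      in-span : ∀ {k} v (M : Family k) → D.inSpan? F P v M ≡ span M (tabulate v)
      in-span {k} v M = bool-ext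
        (λ h → let c , e = any-elim _ (D.allVecs F P k) h in span-intro M c (λ j → trans (lookup∘tabulate v j) (eq-elim e j)))
        (λ h → let c , e = span-elim M h ; c′ , m , e′ = all-vectors k c in
          any-intro (λ c → D.eqV? F P v (comb M c)) m (eq-intro (λ j → trans (sym (lookup∘tabulate v j)) (trans (e j) (sym (Coordinates.comb-cong F n₀ {M = M} {M′ = M} (λ _ _ → refl) e′ j))))))
        where
        open import Data.Fin.Properties using (all?)
        eq-elim : ∀ {u w : Fun n₀} → D.eqV? F P u w ≡ true → ∀ j → u j ≡ w j
        eq-elim {u} {w} h = true-does (all? (λ j → FiniteField._≟_ F (u j) (w j))) (trans (sym (isYes≗does _)) h)
        eq-intro : ∀ {u w : Fun n₀} → (∀ j → u j ≡ w j) → D.eqV? F P u w ≡ true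
        eq-intro {u} {w} h = trans (isYes≗does _) (does-true (all? (λ j → FiniteField._≟_ F (u j) (w j))) h)

      module Translate (L : List (Family d₀)) (LG : D.IsGeneratorSet F P L) (CL : D.DegreeOneCL F P L) where
        Ls : List (V → Bool)
        Ls = map span L

        contained? : (K : V → Bool) → ∀ M → Dec (K ⊆ᵇ M ≡ true)
        contained? K M = (K ⊆ᵇ M) BP.≟ true

        χ : (V → Bool) → Bool
        χ K = does (any? (contained? K) Ls)

        χ-intro : ∀ {K} → Any (K ⊆_) Ls → χ K ≡ true
        χ-intro {K} h = does-true (any? (contained? K) Ls) (Any.map (λ {M} s → ⊆ᵇ-intro {K} {M} s) h)

        χ-elim : ∀ {K} → χ K ≡ true → Any (K ⊆_) Ls
        χ-elim {K} h = Any.map (λ {M} s → ⊆ᵇ-elim {K} {M} s) (true-does (any? (contained? K) Ls) h)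

        generators : All Gen Ls
        generators = AllP.map⁺ (All.tabulate (λ m → gen-of (proj₁ LG _ m)))

        listed : ∀ {π} → IsGen π → D._∈ₗ_ F P π L → χ (span π) ≡ true
        listed {π} g h = χ-intro (AnyP.map⁺ (Any.map (λ {M} e → same⇒⊆ {M = π} {M} e) h))

        listed⁻¹ : ∀ {π} → IsGen π → χ (span π) ≡ true → D._∈ₗ_ F P π L
        listed⁻¹ {π} g h = let M , m , s = ∈L.find (AnyP.map⁻ (χ-elim h)) in
          ∈L.lose m (⊆⇒same {M = π} {M} s (gen-⊆ (gen-of g) (gen-of (proj₁ LG M m)) s))

        w : Fun n₀ → ℚ
        w = proj₁ CL

        -- Cutting the given weight down to singular vectors changes no sum over a generator, and
        -- provides the support condition `W-sing`.
        weight : Fun n₀ → ℚ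
        weight v = [ D.normalised F P v ∧ Singᵥ (tabulate v) ] * w v

        -- Since w need not respect pointwise equality, the weight of a vector collects all listed functions that represent it.
        W : V → ℚ
        W u = ∑ᴸ (D.allVecs F P n₀) (λ v → [ u == tabulate v ] * weight v)

        weigh-point-sum : ∀ X → wt W X ≡ ∑ᴸ (D.allVecs F P n₀) (λ v → [ X (tabulate v) ] * weight v)
        weigh-point-sum X = begin
          ∑ (λ u → [ X u ] * W u)                                                       ≡⟨ ∑-cong (λ u → sym (∑ᴸ-* (D.allVecs F P n₀) [ X u ] _)) ⟩
          ∑ (λ u → ∑ᴸ (D.allVecs F P n₀) (λ v → [ X u ] * ([ u == tabulate v ] * weight v)))  ≡⟨ ∑-swapᴸ (D.allVecs F P n₀) _ ⟩
          ∑ᴸ (D.allVecs F P n₀) (λ v → ∑ (λ u → [ X u ] * ([ u == tabulate v ] * weight v)))  ≡⟨ ∑ᴸ-cong (D.allVecs F P n₀) (λ v →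
              trans (∑-cong (λ u → QS.solve 3 (λ a b c → a QS.:* (b QS.:* c) QS.:= b QS.:* (a QS.:* c)) refl [ X u ] [ u == tabulate v ] (weight v))) (∑-δ (λ u → [ X u ] * weight v) (tabulate v))) ⟩
          ∑ᴸ (D.allVecs F P n₀) (λ v → [ X (tabulate v) ] * weight v)                   ∎
          where open ≡-Reasoning

        point-sum : ∀ {π} → IsGen π → wt W (span π) ≡ D.pointSum F P w π
        point-sum {π} g = trans (weigh-point-sum (span π)) (sym (go (D.allVecs F P n₀)))
          where
          term : ∀ v → (if D.normalised F P v ∧ D.inSpan? F P v π then w v else 0ℚ) ≡ [ span π (tabulate v) ] * weight v
          term v rewrite in-span v π with D.normalised F P v | span π (tabulate v) in e
          ... | false | b     = sym (trans (cong ([ b ] *_) (*-zeroˡ (w v))) (Data.Rational.Properties.*-zeroʳ [ b ]))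
          ... | true  | false = sym (*-zeroˡ ([ Singᵥ (tabulate v) ] * w v))
          ... | true  | true  = sym (trans (*-identityˡ _) (trans (cong (λ b → [ b ] * w v) (sing (ts (gen-of g)) (tabulate v) e)) (*-identityˡ (w v))))
          go : ∀ vs → D.sumℚ F P (map (λ v → if D.normalised F P v ∧ D.inSpan? F P v π then w v else 0ℚ) vs) ≡ ∑ᴸ vs (λ v → [ span π (tabulate v) ] * weight v)
          go []       = refl
          go (v ∷ vs) = cong₂ _+_ (term v) (go vs)

        not-normalised : ∀ {n} {v : Fun n} → (∀ i → v i ≡ FL.0ᶠ) → D.normalised F P v ≡ false
        not-normalised {zero}  h = refl
        not-normalised {suc n} {v} h with FiniteField._≟_ F (v zero) FL.0ᶠ
        ... | yes _ = not-normalised {n} (λ i → h (suc i))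
        ... | no ne = ⊥-elim (ne (h zero))

        𝓛 : CLSet
        𝓛 = record
          { W = W
          ; W-0 = trans (∑ᴸ-cong (D.allVecs F P n₀) (λ v → trans ([]-guard (0ᵛ == tabulate v) (λ h → trans (cong (λ b → [ b ∧ Singᵥ (tabulate v) ] * w v)
              (not-normalised (λ i → trans (sym (lookup∘tabulate v i)) (trans (cong (λ t → lookup t i) (sym (==-true {0ᵛ} {tabulate v} h))) (lookup-0 i))))) (*-zeroˡ (w v)))) (Data.Rational.Properties.*-zeroʳ [ 0ᵛ == tabulate v ]))) (∑ᴸ-0 (D.allVecs F P n₀))
          ; W-sing = λ u n → trans (∑ᴸ-cong (D.allVecs F P n₀) (λ v → trans ([]-guard (u == tabulate v) (λ h → trans (cong (λ b → [ b ] * w v)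
              (¬true (λ k → n (subst (_∈ Singᵥ) (sym (==-true {u} {tabulate v} h)) (∧-trueʳ {D.normalised F P v} k))))) (*-zeroˡ (w v)))) (Data.Rational.Properties.*-zeroʳ [ u == tabulate v ]))) (∑ᴸ-0 (D.allVecs F P n₀))
          ; χ = χ
          ; χ-mono = λ {K} {M} a b h → χ-intro (Any.map (λ s v k → s v (b v k)) (χ-elim h))
          ; wt-gen = λ {K} g → value g (of-gen g)
          }
          where
          value : ∀ {K} → Gen K → (∃ λ M → IsGen M × (∀ v → span M v ≡ K v)) → wt W K ≡ [ χ K ]
          value {K} g (M , gM , e) = trans (∑-cong (λ v → cong (λ b → [ b ] * W v) (sym (e v)))) (trans (point-sum gM) (decide (split (χ K))))
            where
            decide : χ K ≡ true ⊎ ¬ χ K ≡ true → D.pointSum F P w M ≡ [ χ K ]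
            decide (inj₁ h) = trans (proj₁ (proj₂ CL M gM) (listed⁻¹ gM (χ-intro (Any.map (λ s v k → s v (trans (sym (e v)) k)) (χ-elim h))))) (cong [_] (sym h))
            decide (inj₂ n) = trans (proj₂ (proj₂ CL M gM) (λ l → n (χ-intro (Any.map (λ s v k → s v (trans (e v) k)) (χ-elim (listed gM l)))))) (cong [_] (sym (¬true n)))

        covers : Covers 𝓛 Ls
        covers = record
          { members = All.tabulate (λ {K} m → All.lookup generators m , χ-intro (∈L.lose m (λ v k → k)))
          ; covers = λ g h → χ-elim h }

        x : ℚ
        x = CLSet.x 𝓛

        bb-prod : ∀ m → bb m ≡ ι (D.prodFactors F P m)
        bb-prod zero    = refl
        bb-prod (suc m) = trans (cong₂ _*_ (bb-prod m) (cong (1ℚ +_) power)) (sym (ι-* (D.prodFactors F P m) (suc (D.qPowE+ F P m))))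
          where
          pow-pow : ∀ m → ι (D.base F P) ^^ (D.unit F P ℕ.* m) ≡ q ^^ m
          pow-pow zero    = cong (ι (D.base F P) ^^_) (ℕP.*-zeroʳ (D.unit F P))
          pow-pow (suc m) = trans (cong (ι (D.base F P) ^^_) (ℕP.*-suc (D.unit F P) m)) (trans (^^-+ (ι (D.base F P)) (D.unit F P) _) (cong₂ _*_ (sym q-base) (pow-pow m)))
          power : Qe * q ^^ m ≡ ι (D.qPowE+ F P m)
          power = trans (cong (Qe *_) (sym (pow-pow m))) (trans (sym (^^-+ (ι (D.base F P)) (D.eB F P) (D.unit F P ℕ.* m))) (sym (ι-^ (D.base F P) (D.eB F P ℕ.+ D.unit F P ℕ.* m))))

        distinct : AllPairs (λ K M → ¬ K ⊆ M) Ls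
        distinct = go L (proj₁ LG) (proj₂ LG)
          where
          go : ∀ Ms → (∀ M → M ∈L.∈ Ms → IsGen M) → AllPairs (λ M M′ → ¬ D.SameSpan F M M′) Ms → AllPairs (λ K M → ¬ K ⊆ M) (map span Ms)
          go []       g []       = []
          go (M ∷ Ms) g (p ∷ ps) = AllP.map⁺ (All.tabulate (λ {M′} m s → All.lookup p m
            (⊆⇒same {M = M} {M′} s (gen-⊆ (gen-of (g M (here refl))) (gen-of (g M′ (there m))) s)))) ∷ go Ms (λ M m → g M (there m)) ps

        parameter-x : ∀ {m} → suc m ≡ d₀ → D.parameter F P L ≡ x
        parameter-x {m} e = cancel≡ (ι (D.genDenominator F P)) (ι-nz>0 (D.genDenominator F P) {{D.prodFactors-nonZero F P (d₀ ℕ.∸ 1)}}) (begin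
          ι (D.genDenominator F P) * D.parameter F P L    ≡⟨ *-comm _ (D.parameter F P L) ⟩
          D.parameter F P L * ι (D.genDenominator F P)    ≡⟨ /-* (length L) (D.genDenominator F P) {{D.prodFactors-nonZero F P (d₀ ℕ.∸ 1)}} ⟩
          ι (length L)                                    ≡⟨ cong ι (sym (LP.length-map span L)) ⟩
          ι (length Ls)                                   ≡⟨ Counting.length-total 𝓛 Ls generators distinct (λ _ → χ-elim) (λ _ → χ-intro) e ⟩
          bb m * x                                        ≡⟨ cong (_* x) (trans (bb-prod m) (cong (λ n → ι (D.prodFactors F P (n ℕ.∸ 1))) e)) ⟩
          ι (D.genDenominator F P) * x                    ∎)
          where open ≡-Reasoning

        q*qPowE-1 : q * D.qPowE-1 F P ≡ Qe
        q*qPowE-1 = trans (*-comm q _) (trans (cong (D.qPowE-1 F P *_) (trans q-base (sym (ι-^ (D.base F P) (D.unit F P)))))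
          (trans (/-* (D.base F P ℕ.^ D.eB F P) (D.base F P ℕ.^ D.unit F P) {{ℕP.m^n≢0 (D.base F P) (D.unit F P) {{D.base-nonZero F P}}}}) (ι-^ (D.base F P) (D.eB F P))))

        bound-scaled : q * (D.qPowE-1 F P + 1ℚ) ≡ Qe + q
        bound-scaled = trans (*-distribˡ-+ q _ 1ℚ) (cong₂ _+_ q*qPowE-1 (*-identityʳ q))

        pencil-union : (∀ {u v : V} → D.Collinear F P (lookup u) (lookup v) → Bᵥ u v ≡ FL.0ᶠ) → ∀ {m} → suc m ≡ d₀ → Pencils 𝓛 →
                       ∃ λ k → D.parameter F P L ≡ ℤ.+ k / 1 × D.UnionOfPencils F P L k
        pencil-union coll e ps = k , trans (parameter-x e) (trans (sym k≡x) (sym (/1 k))) , (λ i → lookup (vertex i)) ,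
          (λ i → (λ z → nonzero i (ext (λ j → trans (z j) (sym (lookup-0 j))))) , singular-eq (vertex i) (Sing-elim {vertex i} (singular i))) ,
          (λ i j n c → apart i j n (coll {vertex i} {vertex j} c)) ,
          λ π g → mk⇔ (λ h → let i , m = pencil (gen-of g) (listed g h) in i , span-elim π m)
                      (λ (i , m) → listed⁻¹ g (pencil⁻¹ (gen-of g) i (point-∈ {M = π} {v = vertex i} m)))
          where
          open Pencils ps
          singular-eq : ∀ v → Sg (lookup v) → D.Singular F (D.formKind kind) form (lookup v)
          singular-eq v h = h

        Conclusion : Set
        Conclusion = (Σ ℕ λ k → (D.parameter F P L ≡ (ℤ.+ k) / 1) × D.UnionOfPencils F P L k)
          ⊎ ((D.parameter F P L ≡ D.qPowE-1 F P + 1ℚ)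
             × Σ (D.EmbeddedPolarSpace F P) λ Em →
                 (D.twoE (D.ClassicalPolarSpace.kind (D.EmbeddedPolarSpace.E Em)) ℕ.+ 2 ≡ D.twoE kind) × D.GeneratorsOf F P Em L)

        Embedded : Set
        Embedded = Σ (D.EmbeddedPolarSpace F P) λ Em →
          (D.twoE (D.ClassicalPolarSpace.kind (D.EmbeddedPolarSpace.E Em)) ℕ.+ 2 ≡ D.twoE kind) × D.GeneratorsOf F P Em L

        collinear-⊥ : ∀ {u v : V} → D.Collinear F P (lookup u) (lookup v) → B u v ≡ 0ᶠ
        collinear-⊥ {u} {v} t = trans (bil-cong (λ j → sym (first j)) (λ j → sym (second j))) (ts-bil t (1ᶠ VF.∷ 0ᶠ VF.∷ VF.[]) (0ᶠ VF.∷ 1ᶠ VF.∷ VF.[]))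
          where
          first : ∀ j → 1ᶠ *ᶠ lookup u j +ᶠ (0ᶠ *ᶠ lookup v j +ᶠ 0ᶠ) ≡ lookup u j
          first j = FS.solve 2 (λ a b → FS.:1 FS.:* a FS.:+ (FS.:0 FS.:* b FS.:+ FS.:0) FS.:= a) refl (lookup u j) (lookup v j)
          second : ∀ j → 0ᶠ *ᶠ lookup u j +ᶠ (1ᶠ *ᶠ lookup v j +ᶠ 0ᶠ) ≡ lookup v j
          second j = FS.solve 2 (λ a b → FS.:0 FS.:* a FS.:+ (FS.:1 FS.:* b FS.:+ FS.:0) FS.:= b) refl (lookup u j) (lookup v j)

        conclude : 1 ℕ.≤ d₀ → D.parameter F P L ≤ D.qPowE-1 F P + 1ℚ →
                   (∀ {k} (d-suc : suc (suc k) ≡ d₀) → Extremal-data 𝓛 Ls covers d-suc → Embedded) → Conclusion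
        conclude h bound extremal = by-rank d₀ refl h
          where
          pencils : ∀ {m} → suc m ≡ d₀ → Pencils 𝓛 → Conclusion
          pencils e ps = inj₁ (pencil-union (λ {u} {v} → collinear-⊥ {u} {v}) e ps)
          scaled : ∀ {m} → suc m ≡ d₀ → q * x ≤ Qe + q
          scaled e = subst₂ _≤_ (cong (q *_) (parameter-x e)) bound-scaled (mul≤ q (<⇒≤ 0<q) bound)
          by-rank : ∀ n → n ≡ d₀ → 1 ℕ.≤ n → Conclusion
          by-rank zero e ()
          by-rank (suc zero) e _ = pencils e (rank-one 𝓛 Ls covers e)
          by-rank (suc (suc k)) e _ = either (higher-rank 𝓛 Ls covers (scaled e) e)
            where
            either : Pencils 𝓛 ⊎ Extremal-data 𝓛 Ls covers e → Conclusion
            either (inj₁ ps) = pencils e ps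
            either (inj₂ ex) = inj₂ (cancel≡ q 0<q (trans (cong (q *_) (parameter-x e)) (trans (Extremal-data.x-eq ex) (sym bound-scaled))) , extremal e ex)

        -- The embedded space is coordinatised by a basis of a subspace containing T.
        module Coordinatised (fr : Frame 𝓛) (kE : D.Kind) (fE : D.Form F (D.formKind kE) (D.dim kE d₀)) (ι₀ : Family (D.dim kE d₀)) (ι-ind : Independent ι₀)
                             (T⊆ : ∀ {v} → Frame.T fr v → v ∈ span ι₀)
                             (nondegE : D.NonDegenerate F (D.formKind kE) fE)
                             (ts⇒T : ∀ {l} {G : Fin l → Fun (D.dim kE d₀)} → D.TotallySingular F (D.formKind kE) fE G → ∀ x → Frame.T fr (tabulate (comb ι₀ (D.comb F G x))))
                             (ts⇒⊥ : ∀ {l} {G : Fin l → Fun (D.dim kE d₀)} → D.TotallySingular F (D.formKind kE) fE G → ∀ x y → bil (comb ι₀ (D.comb F G x)) (comb ι₀ (D.comb F G y)) ≡ 0ᶠ)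
                             (ts-from : ∀ {l} {G : Fin l → Fun (D.dim kE d₀)} → (∀ x → Frame.T fr (tabulate (comb ι₀ (D.comb F G x)))) → (∀ x y → bil (comb ι₀ (D.comb F G x)) (comb ι₀ (D.comb F G y)) ≡ 0ᶠ) →
                                        D.TotallySingular F (D.formKind kE) fE G)
                             (Sg⇒T : ∀ {v} → D.Singular F (D.formKind kE) fE v → Frame.T fr (tabulate (comb ι₀ v))) where

          open Frame fr

          nE : ℕ
          nE = D.dim kE d₀

          image : ∀ {l} → (Fin l → Fun nE) → Family l
          image G i = comb ι₀ (G i)

          image-∈ : ∀ {l} (G : Fin l → Fun nE) {v} → v ∈ span (image G) → ∃ λ x → v ≡ tabulate (comb ι₀ (D.comb F G x))
          image-∈ G {v} h = let c , e = span-elim (image G) h in c , trans (sym (tabulate∘lookup v)) (tabulate-cong (λ j → trans (e j) (sym (comb-comb ι₀ G c j))))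

          image-T : ∀ {l} {G : Fin l → Fun nE} → D.TotallySingular F (D.formKind kE) fE G → ∀ {v} → v ∈ span (image G) → T v
          image-T {G = G} t h = let x , e = image-∈ G h in subst T (sym e) (ts⇒T t x)

          image-ts : ∀ {l} {G : Fin l → Fun nE} → D.TotallySingular F (D.formKind kE) fE G → D.TotallySingular F (D.formKind kind) form (image G)
          image-ts {G = G} t = ts⇐ (λ v h → T-sing (image-T t h))
            (λ h k → let x , e = image-∈ G h ; y , e′ = image-∈ G k in subst₂ (λ a b → B a b ≡ 0ᶠ) (sym e) (sym e′)
              (trans (bil-cong (lookup∘tabulate _) (lookup∘tabulate _)) (ts⇒⊥ t x y)))

          image-ind : ∀ {l} {G : Fin l → Fun nE} → D.Independent F G → Independent (image G)
          image-ind {G = G} ind c h = ind c (ι-ind (D.comb F G c) (λ j → trans (comb-comb ι₀ G c j) (h j)))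

          comb-0 : ∀ {l} (M : Family l) {c : Fun l} → (∀ i → c i ≡ 0ᶠ) → ∀ j → comb M c j ≡ 0ᶠ
          comb-0 {l} M h j = trans (FFm.ΣF-cong {l} (λ i → trans (cong (_*ᶠ M i j) (h i)) (*ᶠ-zeroˡ (M i j)))) (FFm.ΣF-0 {l})

          pull-back : ∀ {M : Family d₀} → IsGen M → (∀ {v} → v ∈ span M → T v) →
                      ∃ λ (G : Fin d₀ → Fun nE) → (∀ i j → image G i j ≡ M i j) × D.Independent F G × D.TotallySingular F (D.formKind kE) fE G
          pull-back {M} (ind , t) h = G , rows , (λ c e → ind c (λ j → trans (sym (on-M c j)) (comb-0 ι₀ e j))) ,
            ts-from (λ x → subst T (tabulate-cong (λ j → sym (on-M x j))) (h (comb-∈ M x))) (λ x y → trans (bil-cong (on-M x) (on-M y)) (ts-bil t x y))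
            where
            coords : ∀ i → ∃ λ c → ∀ j → lookup (tabulate (M i)) j ≡ comb ι₀ c j
            coords i = span-elim ι₀ (T⊆ (h (span-self M i)))
            G : Fin d₀ → Fun nE
            G i = proj₁ (coords i)
            rows : ∀ i j → image G i j ≡ M i j
            rows i j = trans (sym (proj₂ (coords i) j)) (lookup∘tabulate (M i) j)
            on-M : ∀ x j → comb ι₀ (D.comb F G x) j ≡ comb M x j
            on-M x j = trans (comb-comb ι₀ G x j) (comb-cong {M = image G} {M′ = M} rows (λ _ → refl) j)

          E : D.ClassicalPolarSpace F d₀
          E = record
            { kind = kE ; form = fE ; nondeg = nondegE
            -- The Witt index is d: the member K, pulled back to coordinates, gives a totally
            -- singular subspace of dimension d, and the image of a larger one would contradict
            -- `witt₂` of P.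
            ; witt₁ = from-gen (of-gen gen-K)
            ; witt₂ = λ G ind t → witt₂ (image G) (image-ind {G = G} ind) (image-ts {G = G} t)
            }
            where
            from-gen : (∃ λ M → IsGen M × (∀ v → span M v ≡ K v)) → ∃ λ (M : Fin d₀ → Fun nE) → D.Independent F M × D.TotallySingular F (D.formKind kE) fE M
            from-gen (M , g , e) = let G , rows , ind , t = pull-back g (λ {v} h → T-K (trans (sym (e v)) h)) in G , ind , t

          Em : D.EmbeddedPolarSpace F P
          Em = record
            { E = E ; ι = ι₀ ; ι-inj = ι-ind
            ; points = λ v (nz , h) → (λ e → nz (ι-ind v e)) , Sg-cong (lookup∘tabulate (comb ι₀ v)) (Sing-elim {tabulate (comb ι₀ v)} (T-sing (Sg⇒T h)))
            ; gens = λ G (ind , t) → image-ind {G = G} ind , image-ts {G = G} t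
            }

          generators-of : D.GeneratorsOf F P Em L
          generators-of π g = mk⇔
            (λ h → let G , rows , ind , t = pull-back {π} g (T-in (gen-of g) (listed g h)) in
              G , (ind , t) , λ v → mk⇔ (λ (c , e) → c , λ j → trans (e j) (comb-cong {M = image G} {M′ = π} rows (λ _ → refl) j))
                                        (λ (c , e) → c , λ j → trans (e j) (sym (comb-cong {M = image G} {M′ = π} rows (λ _ → refl) j))))
            (λ (G , (ind , t) , same) → listed⁻¹ g (CLSet.χ-mono 𝓛 {span (image G)} {span π} (same⇒⊆ {M = image G} {π} same) (same⇒⊆ {M = π} {image G} (same-sym {M = image G} {π} same))
              (T-gen (gen-of {image G} (image-ind {G = G} ind , image-ts {G = G} t)) (image-T {G = G} t))))

          embedded : D.twoE kE ℕ.+ 2 ≡ D.twoE kind → Embedded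
          embedded e = Em , e , generators-of

        module Framed (fr : Frame 𝓛) where
          open Frame fr public

          U : V → Bool
          U = K ⊞ K′

          sU : Sub U
          sU = ⊞-sub (sub (ts gen-K)) (sub (ts gen-K′))

          K⊆U : K ⊆ U
          K⊆U = ⊞-⊆ˡ (sub (ts gen-K′))

          K′⊆U : K′ ⊆ U
          K′⊆U = ⊞-⊆ʳ (sub (ts gen-K))

          ∣U∣ : ⌈ U ⌉ ≡ q ^^ (2 ℕ.* d₀)
          ∣U∣ = trans ∣K⊞K′∣ (trans (cong (λ t → t * t) (∣gen∣ gen-K)) (trans (sym (^^-+ q d₀ d₀)) (cong (λ n → q ^^ (d₀ ℕ.+ n)) (sym (ℕP.+-identityʳ d₀)))))

          opaque
            U-basis : ∃ λ (M : Family (2 ℕ.* d₀)) → Independent M × (∀ v → span M v ≡ U v)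
            U-basis = basis (2 ℕ.* d₀) sU ∣U∣

          ιᵁ : Family (2 ℕ.* d₀)
          ιᵁ = proj₁ U-basis

          ιᵁ-ind : Independent ιᵁ
          ιᵁ-ind = proj₁ (proj₂ U-basis)

          ιᵁ-span : ∀ v → span ιᵁ v ≡ U v
          ιᵁ-span = proj₂ (proj₂ U-basis)

          ιᵁ-in : ∀ x → tabulate (comb ιᵁ x) ∈ U
          ιᵁ-in x = trans (sym (ιᵁ-span _)) (comb-∈ ιᵁ x)

        T-coord : ∀ {k} (M : Family k) {x : Fun k} → Sg (comb M x) → tabulate (comb M x) ∈ Sing
        T-coord M {x} h = Sing-intro {tabulate (comb M x)} (Sg-cong (λ j → sym (lookup∘tabulate (comb M x) j)) h)

        coord-Sg : ∀ {k} (M : Family k) {x : Fun k} → tabulate (comb M x) ∈ Sing → Sg (comb M x)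
        coord-Sg M {x} h = Sg-cong (lookup∘tabulate (comb M x)) (Sing-elim {tabulate (comb M x)} h)

        B-comb : ∀ {k} (M : Family k) x y → B (tabulate (comb M x)) (tabulate (comb M y)) ≡ bil (comb M x) (comb M y)
        B-comb M x y = bil-cong (lookup∘tabulate (comb M x)) (lookup∘tabulate (comb M y))

        tabulate-∔ : ∀ {u v : Fun n₀} → tabulate (λ i → u i +ᶠ v i) ≡ tabulate u ⊕ tabulate v
        tabulate-∔ {u} {v} = ext (λ i → trans (lookup∘tabulate _ i) (sym (trans (lookup-⊕ (tabulate u) (tabulate v) i) (cong₂ _+ᶠ_ (lookup∘tabulate u i) (lookup∘tabulate v i)))))

        comb-zero : ∀ {k} {M : Family k} {x} → Independent M → tabulate (comb M x) ≡ 0ᵛ → ∀ i → x i ≡ 0ᶠ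
        comb-zero {M = M} {x} ind e = ind x (λ j → trans (sym (lookup∘tabulate (comb M x) j)) (trans (cong (λ t → lookup t j) e) (lookup-0 j)))

        radical-free : ∀ {k} {M : Family k} {U} → U ⊆ span M → ∀ x → (∀ y → bil (comb M x) (comb M y) ≡ 0ᶠ) → ∀ {u} → u ∈ U → B (tabulate (comb M x)) u ≡ 0ᶠ
        radical-free {M = M} incl x h {u} hu = let c , e = span-elim M (incl u hu) in trans (bil-cong (lookup∘tabulate (comb M x)) e) (h c)

        -- The embedded form is x ↦ B(α x, β x), where α and β are the components in K and K′ of the
        -- vector with coordinates x. Symmetry of B makes its polar form equal to B on U, so
        -- nondegeneracy follows from `radical`.
        hyperbolic : (m : FFm.Matrix n₀) → (∀ u v → bil u v ≡ FFm.form m u v) → (∀ u v → bil v u ≡ bil u v) → D.twoE kind ≡ 2 → HyperbolicFrame 𝓛 → Embedded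
        hyperbolic m bil-m bil-sym e2 hf = embedded (sym e2)
          where
          open HyperbolicFrame hf using (frame; T⇒; ⇒T)
          open Framed frame
          parts : ∀ i → ∃ λ a → ∃ λ b → a ∈ K × b ∈ K′ × tabulate (ιᵁ i) ≡ a ⊕ b
          parts i = ⊞-elim (trans (sym (ιᵁ-span _)) (span-self ιᵁ i))
          αᶠ βᶠ : Family (2 ℕ.* d₀)
          αᶠ i = lookup (proj₁ (parts i))
          βᶠ i = lookup (proj₁ (proj₂ (parts i)))
          α β : Fun (2 ℕ.* d₀) → V
          α x = tabulate (comb αᶠ x)
          β x = tabulate (comb βᶠ x)
          α∈ : ∀ x → α x ∈ K
          α∈ x = span-⊆ αᶠ (sub (ts gen-K)) (λ i → subst (_∈ K) (sym (tabulate∘lookup (proj₁ (parts i)))) (proj₁ (proj₂ (proj₂ (parts i))))) _ (comb-∈ αᶠ x)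
          β∈ : ∀ x → β x ∈ K′
          β∈ x = span-⊆ βᶠ (sub (ts gen-K′)) (λ i → subst (_∈ K′) (sym (tabulate∘lookup (proj₁ (proj₂ (parts i))))) (proj₁ (proj₂ (proj₂ (proj₂ (parts i)))))) _ (comb-∈ βᶠ x)
          rows : ∀ i j → ιᵁ i j ≡ αᶠ i j +ᶠ βᶠ i j
          rows i j = trans (sym (lookup∘tabulate (ιᵁ i) j)) (trans (cong (λ t → lookup t j) (proj₂ (proj₂ (proj₂ (proj₂ (parts i)))))) (lookup-⊕ (proj₁ (parts i)) (proj₁ (proj₂ (parts i))) j))
          decomp : ∀ x → tabulate (comb ιᵁ x) ≡ α x ⊕ β x
          decomp x = trans (tabulate-cong (λ j → trans (FFm.ΣF-cong {2 ℕ.* d₀} (λ i → trans (cong (x i *ᶠ_) (rows i j)) (FS.solve 3 (λ x a b → x FS.:* (a FS.:+ b) FS.:= x FS.:* a FS.:+ x FS.:* b) refl (x i) (αᶠ i j) (βᶠ i j))))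
            (FFm.ΣF-+ {2 ℕ.* d₀} (λ i → x i *ᶠ αᶠ i j) (λ i → x i *ᶠ βᶠ i j)))) (tabulate-∔ {comb αᶠ x} {comb βᶠ x})
          c : FFm.Matrix (2 ℕ.* d₀)
          c i j = FFm.form m (αᶠ i) (βᶠ j)
          form-c : ∀ x y → FFm.form c x y ≡ B (α x) (β y)
          form-c x y = trans (sym (FFm.form-comb m αᶠ βᶠ x y)) (trans (sym (bil-m _ _)) (bil-cong (λ j → sym (lookup∘tabulate (comb αᶠ x) j)) (λ j → sym (lookup∘tabulate (comb βᶠ y) j))))
          quad-c : ∀ x → FFm.quadVal c x ≡ B (α x) (β x)
          quad-c x = trans (FFm.quadVal-form c x) (form-c x x)
          T-c : ∀ {x} → FFm.quadVal c x ≡ 0ᶠ → T (tabulate (comb ιᵁ x))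
          T-c {x} h = subst T (sym (decomp x)) (⇒T (α∈ x) (β∈ x) (trans (sym (quad-c x)) h))
          c-T : ∀ {x} → T (tabulate (comb ιᵁ x)) → FFm.quadVal c x ≡ 0ᶠ
          c-T {x} h = let a , b , ha , hb , o , e = T⇒ h ; ea , eb = split-unique (α∈ x) (β∈ x) ha hb (trans (sym (decomp x)) e) in
            trans (quad-c x) (subst₂ (λ s t → B s t ≡ 0ᶠ) (sym ea) (sym eb) o)
          bil-c : ∀ x y → D.bil F D.quadratic c x y ≡ bil (comb ιᵁ x) (comb ιᵁ y)
          bil-c x y = trans (FFm.bil-quadratic c x y) (trans (FFm.form-+ c (λ i j → c j i) x y) (trans (cong₂ _+ᶠ_ (form-c x y) (trans (sym (FFm.form-conj (λ i j → c j i) c (λ _ _ → refl) x y)) (form-c y x)))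
            (trans (sym (trans (cong₂ B (decomp x) (decomp y)) (trans (B-⊕ (α x) (β x) (α y ⊕ β y)) (cong₂ _+ᶠ_
                (trans (bil-sym (lookup (α y ⊕ β y)) (lookup (α x))) (trans (B-⊕ (α y) (β y) (α x)) (trans (cong (_+ᶠ B (β y) (α x)) (iso (ts gen-K) (α∈ y) (α∈ x))) (trans (+ᶠ-identityˡ _) (bil-sym (lookup (α x)) (lookup (β y)))))))
                (trans (bil-sym (lookup (α y ⊕ β y)) (lookup (β x))) (trans (B-⊕ (α y) (β y) (β x)) (trans (cong (B (α y) (β x) +ᶠ_) (iso (ts gen-K′) (β∈ y) (β∈ x))) (+ᶠ-identityʳ _))))))))
              (B-comb ιᵁ x y))))
          nondegE : D.NonDegenerate F D.quadratic c
          nondegE x _ h = comb-zero {M = ιᵁ} {x} ιᵁ-ind (trans (decomp x) (trans (cong₂ _⊕_ (proj₁ zeros) (proj₂ zeros)) (⊕-identityˡ 0ᵛ)))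
            where
            orth : ∀ {u} → u ∈ U → B (α x ⊕ β x) u ≡ 0ᶠ
            orth {u} hu = subst (λ t → B t u ≡ 0ᶠ) (decomp x) (radical-free {M = ιᵁ} (λ v k → trans (ιᵁ-span v) k) x (λ y → trans (sym (bil-c x y)) (h y)) hu)
            zeros : α x ≡ 0ᵛ × β x ≡ 0ᵛ
            zeros = radical (α∈ x) (β∈ x) (λ k → orth (K⊆U _ k)) (λ k → orth (K′⊆U _ k))
          T⊆U : ∀ {v} → T v → v ∈ span ιᵁ
          T⊆U {v} h = trans (ιᵁ-span v) (let a , b , ha , hb , o , e = T⇒ h in subst (_∈ U) (sym e) (⊞-intro ha hb))
          open Coordinatised frame D.Q⁺ c ιᵁ ιᵁ-ind T⊆U
            nondegE
            (λ {l} {G} t x → T-c {D.comb F G x} (t x))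
            (λ {l} {G} t x y → trans (sym (bil-c (D.comb F G x) (D.comb F G y))) (FormFacts.ts-bil (FFm.quadratic-facts c) {M = G} t x y))
            (λ {l} {G} t _ x → c-T {D.comb F G x} (t x))
            (λ {v} → T-c {v})

        hermitian-case : (H : D.Hermitian F n₀) → (∀ u v → bil u v ≡ D.bil F D.hermitian H u v) → (∀ {v} → bil v v ≡ 0ᶠ → Sg v) →
                         D.twoE kind ≡ 3 → SubspaceFrame 𝓛 → Embedded
        hermitian-case H bil-h Sg-h e3 hf = embedded (sym e3)
          where
          open SubspaceFrame hf using (frame; T⇒; ⇒T)
          open Framed frame
          open D.Hermitian H using (h; herm; r; r²≡q) renaming (inv to I)
          open FFm.Trace I r r²≡q
          module Sq = FFm.Sesquilinear σ
          module Cj = Sq.Conjugate σ-0 σ-+ σ-* σ-σ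
          HE : D.Hermitian F (2 ℕ.* d₀)
          HE = record { inv = I ; h = λ i j → Sq.form h (ιᵁ i) (ιᵁ j) ; herm = λ i j → Cj.form-conj h h herm (ιᵁ i) (ιᵁ j) ; r = r ; r²≡q = r²≡q }
          bil-E : ∀ x y → D.bil F D.hermitian HE x y ≡ bil (comb ιᵁ x) (comb ιᵁ y)
          bil-E x y = trans (sym (Cj.form-comb h ιᵁ ιᵁ x y)) (sym (bil-h _ _))
          to-T : ∀ {x} → D.bil F D.hermitian HE x x ≡ 0ᶠ → T (tabulate (comb ιᵁ x))
          to-T {x} e = ⇒T (T-coord ιᵁ {x} (Sg-h (trans (sym (bil-E x x)) e))) (ιᵁ-in x)
          nondegE : D.NonDegenerate F D.hermitian HE
          nondegE x _ e with ⊞-elim (ιᵁ-in x)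
          ... | a , b , ha , hb , ab = comb-zero {M = ιᵁ} {x} ιᵁ-ind (trans ab (trans (cong₂ _⊕_ (proj₁ zeros) (proj₂ zeros)) (⊕-identityˡ 0ᵛ)))
            where
            orth : ∀ {u} → u ∈ U → B (a ⊕ b) u ≡ 0ᶠ
            orth {u} hu = subst (λ t → B t u ≡ 0ᶠ) ab (radical-free {M = ιᵁ} (λ v k → trans (ιᵁ-span v) k) x (λ y → trans (sym (bil-E x y)) (e y)) hu)
            zeros : a ≡ 0ᵛ × b ≡ 0ᵛ
            zeros = radical ha hb (λ k → orth (K⊆U _ k)) (λ k → orth (K′⊆U _ k))
          open Coordinatised frame D.H-even HE ιᵁ ιᵁ-ind
            (λ {v} k → trans (ιᵁ-span v) (T⇒ k))
            nondegE
            (λ {l} {G} t x → to-T {D.comb F G x} (t x x))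
            (λ {l} {G} t x y → trans (sym (bil-E (D.comb F G x) (D.comb F G y))) (t x y))
            (λ {l} {G} _ o x y → trans (bil-E (D.comb F G x) (D.comb F G y)) (o x y))
            (λ {v} → to-T {v})

        elliptic : (c : FFm.Matrix n₀) → (∀ u v → bil u v ≡ D.bil F D.quadratic c u v) → (∀ {v} → Sg v → FFm.quadVal c v ≡ 0ᶠ) → (∀ {v} → FFm.quadVal c v ≡ 0ᶠ → Sg v) →
                   D.twoE kind ≡ 4 → EllipticFrame 𝓛 (λ v → FFm.quadVal c (lookup v)) → Embedded
        elliptic c bil-c Sg⇒ ⇒Sg e4 ef = embedded (sym e4)
          where
          open EllipticFrame ef using (frame; T⇒; ⇒T; p; p⊥; p∉; Qp≢0)
          open Framed frame
          U⁺ : V → Bool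
          U⁺ = U ⊞ ⟨ p ⟩
          opaque
            U⁺-basis : ∃ λ (M : Family (suc (2 ℕ.* d₀))) → Independent M × (∀ v → span M v ≡ U⁺ v)
            U⁺-basis = basis (suc (2 ℕ.* d₀)) (⊞-sub sU (⟨⟩-sub p)) (trans (adjoin sU p∉) (cong (q *_) ∣U∣))
          M : Family (suc (2 ℕ.* d₀))
          M = proj₁ U⁺-basis
          M-in : ∀ x → tabulate (comb M x) ∈ U⁺
          M-in x = trans (sym (proj₂ (proj₂ U⁺-basis) _)) (comb-∈ M x)
          cE : FFm.Matrix (suc (2 ℕ.* d₀))
          cE i j = FFm.form c (M i) (M j)
          quad-E : ∀ x → FFm.quadVal cE x ≡ FFm.quadVal c (comb M x)
          quad-E x = sym (FFm.quadVal-comb c M x)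
          bil-E : ∀ x y → D.bil F D.quadratic cE x y ≡ bil (comb M x) (comb M y)
          bil-E x y = trans (cong₂ _+ᶠ_ (trans (quad-E (λ i → x i +ᶠ y i)) (FFm.quadVal-cong c (comb-∔ M x y))) (cong₂ (λ s t → -ᶠ s +ᶠ -ᶠ t) (quad-E x) (quad-E y))) (sym (bil-c _ _))
          to-T : ∀ {x} → FFm.quadVal cE x ≡ 0ᶠ → T (tabulate (comb M x))
          to-T {x} e = ⇒T (T-coord M {x} (⇒Sg (trans (sym (quad-E x)) e))) (M-in x)
          from-T : ∀ {x} → T (tabulate (comb M x)) → FFm.quadVal cE x ≡ 0ᶠ
          from-T {x} h = trans (quad-E x) (Sg⇒ (coord-Sg M {x} (T-sing h)))
          nondegE : D.NonDegenerate F D.quadratic cE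
          -- A vector orthogonal to K and K′ is a multiple of p. In characteristic 2 this p is
          -- orthogonal to the whole span, so singularity of x has to be used: Q(p) ≠ 0 leaves only
          -- the multiple 0.
          nondegE x sx e with ⊞⟨⟩-elim (M-in x)
          ... | u , l , hu , eq with ⊞-elim hu
          ...   | a , b , ha , hb , refl = comb-zero {M = M} {x} (proj₁ (proj₂ U⁺-basis)) (trans on-p p-zero)
            where
            orth : ∀ {u} → u ∈ U → B (a ⊕ b) u ≡ 0ᶠ
            orth {u} m = trans (sym (+ᶠ-identityʳ _)) (trans (cong (B (a ⊕ b) u +ᶠ_) (sym (trans (cong (l *ᶠ_) (p⊥ m)) (*ᶠ-zeroʳ l)))) (trans (sym (B-line (a ⊕ b) l p u))
              (subst (λ t → B t u ≡ 0ᶠ) eq (let y , ey = span-elim M (trans (proj₂ (proj₂ U⁺-basis) u) (⊞-⊆ˡ (⟨⟩-sub p) u m)) in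
                trans (bil-cong (lookup∘tabulate (comb M x)) ey) (trans (sym (bil-E x y)) (e y))))))
            zeros : a ≡ 0ᵛ × b ≡ 0ᵛ
            zeros = radical ha hb (λ k → orth (K⊆U _ k)) (λ k → orth (K′⊆U _ k))
            on-p : tabulate (comb M x) ≡ l · p
            on-p = trans eq (trans (cong (_⊕ l · p) (trans (cong₂ _⊕_ (proj₁ zeros) (proj₂ zeros)) (⊕-identityˡ 0ᵛ))) (⊕-identityˡ (l · p)))
            p-zero : l · p ≡ 0ᵛ
            p-zero with l ≟ᶠ 0ᶠ
            ... | yes refl = 0-· p
            ... | no nz = ⊥-elim (prod≢0 (prod≢0 nz nz) Qp≢0 (trans (sym (trans (FFm.quadVal-cong c (lookup-· l p)) (FFm.quadVal-∙ c l (lookup p)))) (trans (cong (λ v → FFm.quadVal c (lookup v)) (sym on-p)) (trans (FFm.quadVal-cong c (lookup∘tabulate (comb M x))) (trans (sym (quad-E x)) sx)))))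
          open Coordinatised frame D.Q₀ cE M (proj₁ (proj₂ U⁺-basis))
            (λ {v} k → trans (proj₂ (proj₂ U⁺-basis) v) (T⇒ k))
            nondegE
            (λ {l} {G} t x → to-T {D.comb F G x} (t x))
            (λ {l} {G} t x y → trans (sym (bil-E (D.comb F G x) (D.comb F G y))) (FormFacts.ts-bil (FFm.quadratic-facts cE) {M = G} t x y))
            (λ {l} {G} t _ x → from-T {D.comb F G x} (t x))
            (λ {v} → to-T {v})

        rank-bound : Set
        rank-bound = 1 ℕ.≤ d₀ → D.parameter F P L ≤ D.qPowE-1 F P + 1ℚ → Conclusion

        -- The case e < 1, of Q⁺(2d-1,q) and H(2d-1,q): the extremal configuration would give q ≤
        -- q^e, so only pencils occur.
        integral-case : Qe < q → rank-bound
        integral-case lt h bound = conclude h bound (λ ds ex → ⊥-elim (≤<-⊥ (Frames.q≤Qe ex) lt))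

        -- For W(2d-1,q) the form is symmetric only in characteristic 2, which is learnt from the
        -- extremal configuration itself. Symmetry is therefore asked for as a function of that
        -- information; for Q(2d,q) it is known at once.
        symmetric-case : (m : FFm.Matrix n₀) → (∀ u v → bil u v ≡ FFm.form m u v) →
                         (((∀ u v → bil v u ≡ -ᶠ bil u v) → 1ᶠ +ᶠ 1ᶠ ≡ 0ᶠ) → ∀ u v → bil v u ≡ bil u v) → Qe ≡ q → D.twoE kind ≡ 2 → rank-bound
        symmetric-case m bil-m bil-sym e e2 h bound = conclude h bound (λ ds ex →
          hyperbolic m bil-m (bil-sym (λ anti → Frames.alternating-char-2 ex e (λ u v → anti (lookup u) (lookup v)))) e2 (Frames.hyperbolic-frame ex e))

        unitary-case : (H : D.Hermitian F n₀) → (∀ u v → bil u v ≡ D.bil F D.hermitian H u v) → (∀ {v} → bil v v ≡ 0ᶠ → Sg v) →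
                       FormFacts.s facts * q ≡ Qe → D.twoE kind ≡ 3 → rank-bound
        unitary-case H bil-h Sg-h e e3 h bound = conclude h bound (λ ds ex →
          hermitian-case H bil-h Sg-h e3 (Frames.hermitian-frame ex Tr.σ Tr.σ-+ Tr.σ-* Tr.σ-σ conj Tr.norm-one e))
          where
          module Tr = FFm.Trace (D.Hermitian.inv H) (D.Hermitian.r H) (D.Hermitian.r²≡q H)
          conj : ∀ u v → B v u ≡ Tr.σ (B u v)
          conj u v = trans (bil-h _ _) (trans (FFm.Sesquilinear.Conjugate.form-conj Tr.σ Tr.σ-0 Tr.σ-+ Tr.σ-* Tr.σ-σ (D.Hermitian.h H) (D.Hermitian.h H) (D.Hermitian.herm H) (lookup u) (lookup v))
            (cong Tr.σ (sym (bil-h _ _))))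

        quadratic-case : (c : FFm.Matrix n₀) → (∀ u v → bil u v ≡ D.bil F D.quadratic c u v) → (∀ {v} → Sg v → FFm.quadVal c v ≡ 0ᶠ) → (∀ {v} → FFm.quadVal c v ≡ 0ᶠ → Sg v) →
                         FormFacts.s facts ≡ 1ℚ → Qe ≡ q * q → D.twoE kind ≡ 4 → rank-bound
        quadratic-case c bil-c Sg⇒ ⇒Sg s1 e e4 h bound = conclude h bound (λ ds ex →
          elliptic c bil-c Sg⇒ ⇒Sg e4 (Frames.elliptic-frame ex (λ v → FFm.quadVal c (lookup v))
            (λ u v → trans (FFm.quadVal-cong c (lookup-⊕ u v)) (trans (FFm.polarisation c (lookup u) (lookup v)) (cong (FFm.quadVal c (lookup u) +ᶠ FFm.quadVal c (lookup v) +ᶠ_) (sym (bil-c _ _)))))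
            (λ t v → trans (FFm.quadVal-cong c (lookup-· t v)) (FFm.quadVal-∙ c t (lookup v)))
            (λ {v} k → Sg⇒ (Sing-elim {v} k)) (λ {v} k → Sing-intro {v} (⇒Sg k))
            (λ u v → trans (bil-c _ _) (trans (cong₂ _+ᶠ_ (FFm.quadVal-cong c (λ i → +ᶠ-comm (lookup v i) (lookup u i))) (+ᶠ-comm _ _)) (sym (bil-c _ _)))) s1 e))

-- The numerical data of the six families.

module Kinds where

  open import Defs using (FiniteField)
  import Defs as D
  open import Data.Nat as ℕ using (ℕ)
  import Data.Nat.Properties as ℕP
  import Data.Integer as ℤ
  open import Data.Rational using (ℚ; 1ℚ; _<_; _≤_; _+_; _*_; _/_)
  open import Data.Rational.Properties using (*-identityʳ; *-identityˡ; *-comm; *-assoc; ≤-reflexive; ≤-trans; <⇒≤)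
  open import Data.Fin using (Fin)
  open import Data.List using (List)
  open import Data.Product using (Σ; _×_; _,_)
  open import Data.Sum using (_⊎_)
  open import Relation.Binary.PropositionalEquality hiding ([_])
  open Numbers
  open LinearAlgebra
  open ClassicalForms
  open Models
  open QS using (solve; _:=_; _:+_; _:*_; _:-_; :-_; :0; :1)

  double : ∀ x n → x ^^ (2 ℕ.* n) ≡ x ^^ n * x ^^ n
  double x n = trans (^^-+ x n (n ℕ.+ 0)) (cong (λ m → x ^^ n * x ^^ m) (ℕP.+-identityʳ n))

  module _ (F : FiniteField) (d : ℕ) (h : 1 ℕ.≤ d) where
    open FormFact F

    private
      b : ℚ
      b = ι (FiniteField.q F)

      q-base₁ : q ≡ b ^^ 1
      q-base₁ = trans q-def (sym (*-identityʳ b))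

    Statement : D.ClassicalPolarSpace F d → Set
    Statement P = (L : List (Fin d → D.Vec F (D.N F P))) → D.IsGeneratorSet F P L → D.DegreeOneCL F P L →
      D.parameter F P L ≤ D.qPowE-1 F P + 1ℚ →
      (Σ ℕ λ k → (D.parameter F P L ≡ (ℤ.+ k) / 1) × D.UnionOfPencils F P L k)
      ⊎ ((D.parameter F P L ≡ D.qPowE-1 F P + 1ℚ)
         × Σ (D.EmbeddedPolarSpace F P) λ Em →
             (D.twoE (D.ClassicalPolarSpace.kind (D.EmbeddedPolarSpace.E Em)) ℕ.+ 2 ≡ D.twoE (D.ClassicalPolarSpace.kind P))
             × D.GeneratorsOf F P Em L)

    bil-comm : ∀ {n} (c : Matrix n) u v → D.bil F D.quadratic c v u ≡ D.bil F D.quadratic c u v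
    bil-comm c u v = cong₂ _+ᶠ_ (quadVal-cong c (λ i → +ᶠ-comm (v i) (u i))) (+ᶠ-comm _ _)

    Q⁺-case : ∀ c nd w₁ w₂ → Statement (record { kind = D.Q⁺ ; form = c ; nondeg = nd ; witt₁ = w₁ ; witt₂ = w₂ })
    Q⁺-case c nd w₁ w₂ L LG CL bound = Model.Geometry.Translate.integral-case F d P (quadratic-facts c) q-base₁ size₀ L LG CL 1<q h bound
      where
      P : D.ClassicalPolarSpace F d
      P = record { kind = D.Q⁺ ; form = c ; nondeg = nd ; witt₁ = w₁ ; witt₂ = w₂ }
      size₀ : q ^^ (2 ℕ.* d) * 1ℚ ≡ 1ℚ * (q ^^ d * q ^^ d)
      size₀ = trans (*-identityʳ _) (trans (double q d) (sym (*-identityˡ _)))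

    Q₀-case : ∀ c nd w₁ w₂ → Statement (record { kind = D.Q₀ ; form = c ; nondeg = nd ; witt₁ = w₁ ; witt₂ = w₂ })
    Q₀-case c nd w₁ w₂ L LG CL bound =
      Model.Geometry.Translate.symmetric-case F d P (quadratic-facts c) q-base₁ size₀ L LG CL (symmetrise c) (bil-quadratic c) (λ _ → bil-comm c) (sym q-base₁) refl h bound
      where
      P : D.ClassicalPolarSpace F d
      P = record { kind = D.Q₀ ; form = c ; nondeg = nd ; witt₁ = w₁ ; witt₂ = w₂ }
      size₀ : q * q ^^ (2 ℕ.* d) * 1ℚ ≡ b ^^ 1 * (q ^^ d * q ^^ d)
      size₀ = trans (*-identityʳ _) (cong₂ _*_ q-base₁ (double q d))

    Q⁻-case : ∀ c nd w₁ w₂ → Statement (record { kind = D.Q⁻ ; form = c ; nondeg = nd ; witt₁ = w₁ ; witt₂ = w₂ })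
    Q⁻-case c nd w₁ w₂ L LG CL bound =
      Model.Geometry.Translate.quadratic-case F d P (quadratic-facts c) q-base₁ size₀ L LG CL c (λ _ _ → refl) (λ e → e) (λ e → e) refl (sym qq) refl h bound
      where
      P : D.ClassicalPolarSpace F d
      P = record { kind = D.Q⁻ ; form = c ; nondeg = nd ; witt₁ = w₁ ; witt₂ = w₂ }
      qq : q * q ≡ b ^^ 2
      qq = trans (cong₂ _*_ q-def q-def) (cong (b *_) (sym (*-identityʳ b)))
      size₀ : q * (q * q ^^ (2 ℕ.* d)) * 1ℚ ≡ b ^^ 2 * (q ^^ d * q ^^ d)
      size₀ = trans (*-identityʳ _) (trans (sym (*-assoc q q _)) (cong₂ _*_ qq (double q d)))

    W-case : ∀ a nd w₁ w₂ → Statement (record { kind = D.W ; form = a ; nondeg = nd ; witt₁ = w₁ ; witt₂ = w₂ })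
    W-case (a , a0 , a-) nd w₁ w₂ L LG CL bound =
      Model.Geometry.Translate.symmetric-case F d P (alternating-facts (a , a0 , a-)) q-base₁ size₀ L LG CL a (λ _ _ → refl) symmetric (sym q-base₁) refl h bound
      where
      P : D.ClassicalPolarSpace F d
      P = record { kind = D.W ; form = a , a0 , a- ; nondeg = nd ; witt₁ = w₁ ; witt₂ = w₂ }
      size₀ : q ^^ (2 ℕ.* d) * q ≡ b ^^ 1 * (q ^^ d * q ^^ d)
      size₀ = trans (*-comm _ q) (cong₂ _*_ q-base₁ (double q d))
      anti : ∀ u v → form a v u ≡ -ᶠ form a u v
      anti u v = trans (form-conj (λ i j → a j i) a (λ i j → refl) u v) (trans (form-cong (λ i j → a- i j) (λ _ → refl) (λ _ → refl)) (form-neg a u v))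
      symmetric : ((∀ u v → form a v u ≡ -ᶠ form a u v) → 1ᶠ +ᶠ 1ᶠ ≡ 0ᶠ) → ∀ u v → form a v u ≡ form a u v
      symmetric char-2 u v = trans (anti u v) (trans (FS.solve 1 (λ t → FS.:- t FS.:= t FS.:- (FS.:1 FS.:+ FS.:1) FS.:* t) refl (form a u v))
        (trans (cong (λ s → form a u v +ᶠ -ᶠ (s *ᶠ form a u v)) (char-2 anti)) (FS.solve 1 (λ t → t FS.:- FS.:0 FS.:* t FS.:= t) refl (form a u v))))

    H-even-case : ∀ H nd w₁ w₂ → Statement (record { kind = D.H-even ; form = H ; nondeg = nd ; witt₁ = w₁ ; witt₂ = w₂ })
    H-even-case H nd w₁ w₂ L LG CL bound = Model.Geometry.Translate.integral-case F d P (hermitian-facts H) q-base₂ size₀ L LG CL r<q h bound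
      where
      open D.Hermitian H using (r; r²≡q) renaming (inv to I)
      open Trace I r r²≡q
      P : D.ClassicalPolarSpace F d
      P = record { kind = D.H-even ; form = H ; nondeg = nd ; witt₁ = w₁ ; witt₂ = w₂ }
      q-base₂ : q ≡ rℚ ^^ 2
      q-base₂ = trans (sym r²ℚ) (cong (rℚ *_) (sym (*-identityʳ rℚ)))
      size₀ : q ^^ (2 ℕ.* d) * rℚ ≡ rℚ ^^ 1 * (q ^^ d * q ^^ d)
      size₀ = trans (*-comm _ rℚ) (cong₂ _*_ (sym (*-identityʳ rℚ)) (double q d))
      -- If q = r² ≤ r, then r ≤ 1, hence q ≤ 1, against q > 1.
      r<q : rℚ ^^ 1 < q
      r<q = Data.Rational.Properties.≰⇒> (λ e → let r≤1 = cancel≤ rℚ rℚ>0 (subst (_≤ rℚ ^^ 1) (sym r²ℚ) e) in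
        ≤<-⊥ (≤-trans (≤-reflexive (sym r²ℚ)) (≤-trans (mul≤ rℚ (<⇒≤ rℚ>0) r≤1) (≤-trans (≤-reflexive (*-identityʳ rℚ)) r≤1))) 1<q)

    H-odd-case : ∀ H nd w₁ w₂ → Statement (record { kind = D.H-odd ; form = H ; nondeg = nd ; witt₁ = w₁ ; witt₂ = w₂ })
    H-odd-case H nd w₁ w₂ L LG CL bound =
      Model.Geometry.Translate.unitary-case F d P (hermitian-facts H) q-base₂ size₀ L LG CL H (λ _ _ → refl) (λ e → e) (cong (rℚ *_) q-base₂) refl h bound
      where
      open D.Hermitian H using (r; r²≡q) renaming (inv to I)
      open Trace I r r²≡q
      P : D.ClassicalPolarSpace F d
      P = record { kind = D.H-odd ; form = H ; nondeg = nd ; witt₁ = w₁ ; witt₂ = w₂ }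
      q-base₂ : q ≡ rℚ ^^ 2
      q-base₂ = trans (sym r²ℚ) (cong (rℚ *_) (sym (*-identityʳ rℚ)))
      size₀ : q * q ^^ (2 ℕ.* d) * rℚ ≡ rℚ ^^ 3 * (q ^^ d * q ^^ d)
      size₀ = trans (solve 3 (λ q n r → q :* n :* r := r :* q :* n) refl q (q ^^ (2 ℕ.* d)) rℚ) (cong₂ _*_ (cong (rℚ *_) q-base₂) (double q d))

    -- Matching on `kind` inside the record lets the type of the form, the base and the exponents
    -- compute before the rest of the data is used.
    every-kind : ∀ P → Statement P
    every-kind record { kind = D.Q⁺ ; form = f ; nondeg = nd ; witt₁ = w₁ ; witt₂ = w₂ } = Q⁺-case f nd w₁ w₂
    every-kind record { kind = D.Q₀ ; form = f ; nondeg = nd ; witt₁ = w₁ ; witt₂ = w₂ } = Q₀-case f nd w₁ w₂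
    every-kind record { kind = D.Q⁻ ; form = f ; nondeg = nd ; witt₁ = w₁ ; witt₂ = w₂ } = Q⁻-case f nd w₁ w₂
    every-kind record { kind = D.W ; form = f ; nondeg = nd ; witt₁ = w₁ ; witt₂ = w₂ } = W-case f nd w₁ w₂
    every-kind record { kind = D.H-even ; form = f ; nondeg = nd ; witt₁ = w₁ ; witt₂ = w₂ } = H-even-case f nd w₁ w₂
    every-kind record { kind = D.H-odd ; form = f ; nondeg = nd ; witt₁ = w₁ ; witt₂ = w₂ } = H-odd-case f nd w₁ w₂

open import Defs
open import Data.Nat using (ℕ; _≤_; _+_)
open import Data.Integer using (+_)
open import Data.Rational using (_/_; 1ℚ) renaming (_≤_ to _≤ℚ_; _+_ to _+ℚ_)
open import Data.Fin using (Fin)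
open import Data.List using (List)
open import Data.Product using (Σ; _×_)
open import Data.Sum using (_⊎_)
open import Relation.Binary.PropositionalEquality using (_≡_)

theorem5p5 : (F : FiniteField) (d : ℕ) → 1 ≤ d →
    (P : ClassicalPolarSpace F d) (L : List (Fin d → Vec F (N F P))) →
    IsGeneratorSet F P L →
    DegreeOneCL F P L →
    parameter F P L ≤ℚ qPowE-1 F P +ℚ 1ℚ →
    (Σ ℕ λ k → (parameter F P L ≡ (+ k) / 1) × UnionOfPencils F P L k)
    ⊎ ((parameter F P L ≡ qPowE-1 F P +ℚ 1ℚ)
    × Σ (EmbeddedPolarSpace F P) λ Em →
    (twoE (ClassicalPolarSpace.kind (EmbeddedPolarSpace.E Em)) + 2
    ≡ twoE (ClassicalPolarSpace.kind P))
    × GeneratorsOf F P Em L)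
theorem5p5 F d h P = Kinds.every-kind F d h P
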